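{- Let $p$ be a prime, $t\ge1$ an integer, and $m=p^t$. Define $d_m(n)$ by \[ \prod_{k=1}^\infty\frac{1-q^{mk}}{1-q^k}=\sum_{n=0}^\infty d_m(n)q^n . \] Then there are infinitely many non-nested arithmetic progressions $\{An+B: n\ge 0\}$ (with $A,B$ integers, $A\ge1$) such that $d_m(An+B)\equiv 0\pmod p$ for all $n\ge 0$.
   Context: $d_m(n)$ is the number of partitions of $n$ into parts not divisible by $m$. A family of arithmetic progressions is non-nested if no progression in the family is contained in another one of the family. -}

module Defs where

open import Data.Nat using (ℕ; zero; suc; _+_; _*_; _∸_; _≤?_)
open import Data.Nat.Divisibility using (_∣_; _∣?_)
open import Data.Product using (∃; _×_; _,_)
open import Relation.Binary.PropositionalEquality using (_≡_)
open import Relation.Nullary using (yes; no)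

-- cnt m k n = number of partitions of n into parts from {1,…,k}
-- that are not divisible by m.  A partition is determined by the
-- multiplicity j of the largest allowed part k; we sum over j.
-- (Equivalently: coefficient of q^n in ∏_{i≤k, m∤i} 1/(1-q^i).)
mutual
  cnt : ℕ → ℕ → ℕ → ℕ
  cnt m zero zero    = 1
  cnt m zero (suc n) = 0
  cnt m (suc k) n with m ∣? suc k
  ... | yes _ = cnt m k n
  ... | no  _ = sumMult m k n n

  sumMult : ℕ → ℕ → ℕ → ℕ → ℕ
  sumMult m k n zero = cnt m k n
  sumMult m k n (suc j) with suc j * suc k ≤? n
  ... | yes _ = cnt m k (n ∸ suc j * suc k) + sumMult m k n j
  ... | no  _ = sumMult m k n j

-- d m n : number of partitions of n into parts not divisible by m
-- (parts of a partition of n are ≤ n), i.e. the coefficient of q^n in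
-- ∏_{k≥1} (1-q^{mk})/(1-q^k).
d : ℕ → ℕ → ℕ
d m n = cnt m n n

_⊆AP_ : ℕ × ℕ → ℕ × ℕ → Set
(A , B) ⊆AP (A' , B') = ∀ n → ∃ λ n' → A * n + B ≡ A' * n' + B'

-- Write E = ∏ (1 − q^k).  Since E(q^m) ≡ E^m (mod p), Σ d_m(n) q^n ≡ E^{m−1}.  A single progression suffices, because its
-- subprogressions of indices ≡ 2^i (mod 2^{i+1}) are pairwise disjoint.
--
-- For p ≠ 5 put η = q E(q^24), so that the coefficients in question are those of η^{m−1}, and raise to the p-th power to get an
-- even exponent 2ρ.  With x = η²/η(q⁵)² and s = 5 η(q⁵)²/η², the six series formed by s and the five conjugates of x(q^{1/5}) are
-- the roots of X⁶ + 10 X³ − γ X + 5 for a Laurent series γ (γ = E₄/η⁸), so the power sums of these roots are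
-- polynomials in γ.  Hence a multiple T of the Hecke operator at 5 maps the span of η^{2ρ} γ^k, 4k ≤ ρ, into itself.  Modulo p
-- this span is finite, and the recurrence t_{k+1} = T t_k − 5^{ρ+1} t_{k−1} with t_{−1} = 0, t_0 = η^{2ρ} is invertible, hence
-- purely periodic, so that t_N = 0 for some N ≥ 0.  This says that the coefficients of η^{2ρ} at 5^N j vanish whenever 5 ∤ j.
-- For p = 5 all coefficients of η⁴ at multiples of 5 vanish.
--
-- The sextic comes from E = e₀(q⁵) − q E(q²⁵) + q² e₂(q⁵) with e₀ e₂ = −E(q⁵)² (the pentagonal number theorem, and the absence of
-- exponents ≡ 2 (mod 5) in Jacobi's series for E³) and from the norm ∏_{j mod 5} E(ζ^j q) = E(q⁵)⁶/E(q²⁵), ζ⁵ = 1.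

module Submission where

open import Defs
open import Algebra using (CommutativeRing)
open import Data.Empty using (⊥; ⊥-elim)
open import Data.Fin using (Fin; fromℕ; fromℕ<; inject₁; toℕ; combine; funToFin; finToFun)
open import Data.Integer using (ℤ; +_; -[1+_])
open import Data.Maybe using (Maybe; just; nothing)
open import Data.Nat using (ℕ; zero; suc; _*_; _+_; _^_; _∸_; _≥_; _≤_; _<_; z≤n; s≤s; NonZero; _≤?_; _<?_)
open import Data.Nat.Divisibility using (_∣_; _∣?_; divides)
open import Data.Nat.GCD using (module Bézout)
open import Data.Nat.Primality using (Prime)
open import Data.Product using (Σ; ∃; _×_; _,_; proj₁; proj₂)
open import Data.Sum using (_⊎_; inj₁; inj₂)
open import Data.Vec using (Vec; []; _∷_; lookup)
open import Level using (0ℓ)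
open import Relation.Binary.PropositionalEquality using (_≡_)
open import Relation.Nullary using (¬_; Dec; yes; no; contradiction)
open import Relation.Nullary.Decidable using (from-no; from-yes)
import Algebra.Properties.AbelianGroup
import Algebra.Properties.CommutativeSemiring.Binomial
import Algebra.Properties.CommutativeSemiring.Exp
import Algebra.Properties.Ring
import Algebra.Properties.Semiring.Mult
import Algebra.Properties.Semiring.Mult.TCOptimised
import Algebra.Properties.Semiring.Sum
import Algebra.Solver.Ring
import Algebra.Solver.Ring.AlmostCommutativeRing as ACR
import Data.Fin.Properties as FinP
import Data.Integer as ℤ
import Data.Integer.DivMod as ℤ÷
import Data.Integer.Properties as ℤP
import Data.Nat as ℕ
import Data.Nat.Combinatorics as Comb
import Data.Nat.Coprimality as Coprimality
import Data.Nat.Divisibility as ∣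
import Data.Nat.DivMod as ÷
import Data.Nat.Primality as Primality
import Data.Nat.Properties as ℕP
import Data.Nat.Solver
import Relation.Binary.PropositionalEquality as ≡
import Relation.Binary.Reasoning.Setoid
open Data.Nat.Solver.+-*-Solver using () renaming (solve to ℕ-solve; _:=_ to _≐_; _:+_ to _∔_; _:*_ to _∙_; con to ν)

-- The prime 5 is convenient because all modular input there reduces to polynomial identities
-- between e₀, e₂ and E(q⁵). Evenness of the exponent makes the weight ρ of η^(2ρ) integral: η^(2ρ)
-- is η(q⁵)^(2ρ) times the integral power x^ρ, so the operator acts through power sums of the roots.
-- The bound 4k ≤ ρ says that η^(2ρ) γ^k = η^(2ρ-8k) E₄^k contains no negative power of η;
-- algebraically it keeps the exponents of the roots in the range where their power sums have degree
-- at most ρ/4 in γ. Negative powers of the roots and the backward recurrence divide by 5, which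
-- sets p = 5 apart. Two tools can fail modulo p: the factor 3 in the expansion of E³ may not
-- cancel, and a primitive fifth root of unity may not exist. Both identities for e₀ and e₂ are
-- therefore proved over ℤ, the second one inside ℤ[ζ], and then mapped to ℤ/p. Finally n is chosen
-- so that 5^N is the exact power of 5 in 24n + p^t - 1.

-- Commutative rings, homomorphisms and a ring solver with integer coefficients.

module RingKit (R : CommutativeRing 0ℓ 0ℓ) where
  open CommutativeRing R public
    using (Carrier; 0#; 1#; setoid; refl; sym; trans; reflexive; semiring; commutativeSemiring)
    renaming
    ( _≈_ to infix 4 _≈_; _+_ to infixl 6 _⊕_; _*_ to infixl 7 _⊗_; -_ to infix 8 ⊖_
    ; _-_ to infixl 6 _⊝_
    ; +-cong to ⊕-cong; +-congˡ to ⊕-congˡ; +-congʳ to ⊕-congʳ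
    ; +-assoc to ⊕-assoc; +-comm to ⊕-comm; +-identityˡ to ⊕-identityˡ; +-identityʳ to ⊕-identityʳ
    ; *-cong to ⊗-cong; *-congˡ to ⊗-congˡ; *-congʳ to ⊗-congʳ
    ; *-assoc to ⊗-assoc; *-comm to ⊗-comm; *-identityˡ to ⊗-identityˡ; *-identityʳ to ⊗-identityʳ
    ; -‿cong to ⊖-cong; -‿inverseˡ to ⊖-inverseˡ; -‿inverseʳ to ⊖-inverseʳ
    ; zeroˡ to ⊗-zeroˡ; zeroʳ to ⊗-zeroʳ; distribˡ to ⊗-distribˡ; distribʳ to ⊗-distribʳ )
  open Algebra.Properties.CommutativeSemiring.Exp commutativeSemiring public
    using () renaming
    ( _^_ to infixr 8 _↑_; ^-congˡ to ↑-congˡ; ^-congʳ to ↑-congʳ; ^-homo-* to ↑-homo-⊗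
    ; ^-assocʳ to ↑-assocʳ; ^-distrib-* to ↑-distrib-⊗ )
  module ≈-Reasoning = Relation.Binary.Reasoning.Setoid setoid
  open Algebra.Properties.Ring (CommutativeRing.ring R)
    using () renaming (-‿distribˡ-* to ⊖-distribˡ-⊗; -‿involutive to ⊖-involutive; -0#≈0# to ⊖0≈0)
  open Algebra.Properties.AbelianGroup (CommutativeRing.+-abelianGroup R)
    using () renaming (⁻¹-∙-comm to ⊖-⊕-comm)
  open Algebra.Properties.Semiring.Mult.TCOptimised semiring
    using () renaming (_×_ to _·_; ×-homo-+ to ·-homo-+; ×1-homo-* to ·1-homo-*)

  -- The canonical map from ℤ. With the optimised multiple, `int (+ 1)` reduces to `1#` itself, so
  -- `con (+ 1)` in a solver equation matches `1#` definitionally.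
  int : ℤ → Carrier
  int (+ n)    = n · 1#
  int -[1+ n ] = ⊖ (suc n · 1#)

  private
    int-⊖ : ∀ m n → int (m ℤ.⊖ n) ≈ m · 1# ⊝ n · 1#
    int-⊖ m zero = sym (trans (⊕-congˡ ⊖0≈0) (⊕-identityʳ _))
    int-⊖ zero (suc n) = sym (⊕-identityˡ _)
    int-⊖ (suc m) (suc n) = begin
      int (suc m ℤ.⊖ suc n)                   ≡⟨ ≡.cong int (ℤP.[1+m]⊖[1+n]≡m⊖n m n) ⟩
      int (m ℤ.⊖ n)                           ≈⟨ int-⊖ m n ⟩
      m · 1# ⊝ n · 1#                         ≈⟨ ⊕-congʳ (sym (⊕-identityʳ _)) ⟩
      (m · 1# ⊕ 0#) ⊝ n · 1#                  ≈⟨ ⊕-congʳ (⊕-congˡ (sym (⊖-inverseʳ 1#))) ⟩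
      (m · 1# ⊕ (1# ⊝ 1#)) ⊝ n · 1#           ≈⟨ ⊕-congʳ (sym (⊕-assoc _ _ _)) ⟩
      ((m · 1# ⊕ 1#) ⊝ 1#) ⊝ n · 1#           ≈⟨ ⊕-assoc _ _ _ ⟩
      (m · 1# ⊕ 1#) ⊕ (⊖ 1# ⊝ n · 1#)         ≈⟨ ⊕-cong (⊕-comm _ _) (⊖-⊕-comm _ _) ⟩
      (1# ⊕ m · 1#) ⊝ (1# ⊕ n · 1#)           ≈⟨ ⊕-cong (·-homo-+ 1# 1 m) (⊖-cong (·-homo-+ 1# 1 n)) ⟨
      suc m · 1# ⊝ suc n · 1#                 ∎
      where open ≈-Reasoning

    int-+ : ∀ i j → int (i ℤ.+ j) ≈ int i ⊕ int j
    int-+ (+ m) (+ n) = ·-homo-+ 1# m n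
    int-+ (+ m) -[1+ n ] = int-⊖ m (suc n)
    int-+ -[1+ m ] (+ n) = trans (int-⊖ n (suc m)) (⊕-comm _ _)
    int-+ -[1+ m ] -[1+ n ] = begin
      ⊖ (suc (suc (m + n)) · 1#)        ≡⟨ ≡.cong (λ k → ⊖ (k · 1#)) (≡.cong suc (≡.sym (ℕP.+-suc m n))) ⟩
      ⊖ ((suc m + suc n) · 1#)          ≈⟨ ⊖-cong (·-homo-+ 1# (suc m) (suc n)) ⟩
      ⊖ (suc m · 1# ⊕ suc n · 1#)       ≈⟨ ⊖-⊕-comm _ _ ⟨
      ⊖ (suc m · 1#) ⊕ ⊖ (suc n · 1#)   ∎
      where open ≈-Reasoning

    int-neg : ∀ i → int (ℤ.- i) ≈ ⊖ int i
    int-neg (+ zero)  = sym ⊖0≈0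
    int-neg (+ suc n) = refl
    int-neg -[1+ n ]  = sym (⊖-involutive _)

    int-*⁺ : ∀ m j → int (+ m ℤ.* j) ≈ m · 1# ⊗ int j
    int-*⁺ m (+ n) = trans (reflexive (≡.cong int (≡.sym (ℤP.pos-* m n)))) (·1-homo-* m n)
    int-*⁺ m -[1+ n ] = begin
      int (+ m ℤ.* -[1+ n ])          ≡⟨ ≡.cong int (ℤP.neg-distribʳ-* (+ m) (+ suc n)) ⟨
      int (ℤ.- (+ m ℤ.* + suc n))     ≈⟨ int-neg (+ m ℤ.* + suc n) ⟩
      ⊖ int (+ m ℤ.* + suc n)         ≈⟨ ⊖-cong (int-*⁺ m (+ suc n)) ⟩
      ⊖ (m · 1# ⊗ (suc n · 1#))       ≈⟨ ⊖-cong (⊗-comm _ _) ⟩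
      ⊖ ((suc n · 1#) ⊗ m · 1#)       ≈⟨ ⊖-distribˡ-⊗ _ _ ⟩
      ⊖ (suc n · 1#) ⊗ m · 1#         ≈⟨ ⊗-comm _ _ ⟩
      m · 1# ⊗ int -[1+ n ]           ∎
      where open ≈-Reasoning

    int-* : ∀ i j → int (i ℤ.* j) ≈ int i ⊗ int j
    int-* (+ m) j = int-*⁺ m j
    int-* -[1+ m ] j = begin
      int (-[1+ m ] ℤ.* j)            ≡⟨ ≡.cong int (ℤP.neg-distribˡ-* (+ suc m) j) ⟨
      int (ℤ.- (+ suc m ℤ.* j))       ≈⟨ int-neg (+ suc m ℤ.* j) ⟩
      ⊖ int (+ suc m ℤ.* j)           ≈⟨ ⊖-cong (int-*⁺ (suc m) j) ⟩
      ⊖ ((suc m · 1#) ⊗ int j)        ≈⟨ ⊖-distribˡ-⊗ _ _ ⟩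
      int -[1+ m ] ⊗ int j            ∎
      where open ≈-Reasoning

    int-morphism : CommutativeRing.rawRing ℤP.+-*-commutativeRing ACR.-Raw-AlmostCommutative⟶ ACR.fromCommutativeRing R
    int-morphism = record
      { ⟦_⟧ = int ; +-homo = int-+ ; *-homo = int-* ; -‿homo = int-neg ; 0-homo = refl ; 1-homo = refl }

    -- Coefficients are compared in ℤ only, so an identity accepted by the solver holds in every
    -- commutative ring, whatever its characteristic.
    int-≟ : ∀ i j → Maybe (int i ≈ int j)
    int-≟ i j with i ℤ.≟ j
    ... | yes i≡j = just (reflexive (≡.cong int i≡j))
    ... | no _ = nothing

  open Algebra.Solver.Ring _ (ACR.fromCommutativeRing R) int-morphism int-≟ public
    using (solve; _:=_; con; _:+_; _:*_; _:-_; :-_; _:^_)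

  int-homo-+ : ∀ i j → int (i ℤ.+ j) ≈ int i ⊕ int j
  int-homo-+ = int-+

  int-homo-* : ∀ i j → int (i ℤ.* j) ≈ int i ⊗ int j
  int-homo-* = int-*

  1↑ : ∀ n → 1# ↑ n ≈ 1#
  1↑ zero = refl
  1↑ (suc n) = trans (⊗-identityˡ _) (1↑ n)

  unit-↑ : ∀ {a b} n → a ⊗ b ≈ 1# → a ↑ n ⊗ b ↑ n ≈ 1#
  unit-↑ {a} {b} n e = trans (sym (↑-distrib-⊗ a b n)) (trans (↑-congˡ n e) (1↑ n))

  unit-cancel : ∀ {a b x y} → a ⊗ b ≈ 1# → a ⊗ x ≈ a ⊗ y → x ≈ y
  unit-cancel {a} {b} e e′ = trans (sym (strip _)) (trans (⊗-congˡ e′) (strip _))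
    where
    strip : ∀ h → b ⊗ (a ⊗ h) ≈ h
    strip h = trans (sym (⊗-assoc _ _ _)) (trans (⊗-congʳ (trans (⊗-comm _ _) e)) (⊗-identityˡ h))

record Hom (R S : CommutativeRing 0ℓ 0ℓ) : Set where
  private
    module R = RingKit R
    module S = RingKit S
  open S
  field
    ⟪_⟫   : R.Carrier → S.Carrier
    ⟪⟫-cong : ∀ {x y} → x R.≈ y → ⟪ x ⟫ ≈ ⟪ y ⟫
    ⟪⟫-⊕  : ∀ x y → ⟪ x R.⊕ y ⟫ ≈ ⟪ x ⟫ ⊕ ⟪ y ⟫
    ⟪⟫-⊗  : ∀ x y → ⟪ x R.⊗ y ⟫ ≈ ⟪ x ⟫ ⊗ ⟪ y ⟫
    ⟪⟫-1  : ⟪ R.1# ⟫ ≈ 1#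

  ⟪⟫-0 : ⟪ R.0# ⟫ ≈ 0#
  ⟪⟫-0 = begin
    ⟪ R.0# ⟫                              ≈⟨ solve 2 (λ x y → x := x :+ y :- y) refl ⟪ R.0# ⟫ ⟪ R.0# ⟫ ⟩
    ⟪ R.0# ⟫ ⊕ ⟪ R.0# ⟫ ⊝ ⟪ R.0# ⟫         ≈⟨ ⊕-congʳ (⟪⟫-⊕ _ _) ⟨
    ⟪ R.0# R.⊕ R.0# ⟫ ⊝ ⟪ R.0# ⟫           ≈⟨ ⊕-congʳ (⟪⟫-cong (R.⊕-identityˡ _)) ⟩
    ⟪ R.0# ⟫ ⊝ ⟪ R.0# ⟫                    ≈⟨ ⊖-inverseʳ _ ⟩
    0#                                    ∎
    where open ≈-Reasoning

  ⟪⟫-⊖ : ∀ x → ⟪ R.⊖ x ⟫ ≈ ⊖ ⟪ x ⟫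
  ⟪⟫-⊖ x = begin
    ⟪ R.⊖ x ⟫                             ≈⟨ solve 2 (λ x y → x := x :+ y :- y) refl ⟪ R.⊖ x ⟫ ⟪ x ⟫ ⟩
    ⟪ R.⊖ x ⟫ ⊕ ⟪ x ⟫ ⊝ ⟪ x ⟫              ≈⟨ ⊕-congʳ (⟪⟫-⊕ _ _) ⟨
    ⟪ R.⊖ x R.⊕ x ⟫ ⊝ ⟪ x ⟫                ≈⟨ ⊕-congʳ (trans (⟪⟫-cong (R.⊖-inverseˡ _)) ⟪⟫-0) ⟩
    0# ⊝ ⟪ x ⟫                            ≈⟨ ⊕-identityˡ _ ⟩
    ⊖ ⟪ x ⟫                               ∎
    where open ≈-Reasoning

  ⟪⟫-⊝ : ∀ x y → ⟪ x R.⊝ y ⟫ ≈ ⟪ x ⟫ ⊝ ⟪ y ⟫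
  ⟪⟫-⊝ x y = trans (⟪⟫-⊕ x _) (⊕-congˡ (⟪⟫-⊖ y))

  ⟪⟫-↑ : ∀ x n → ⟪ x R.↑ n ⟫ ≈ ⟪ x ⟫ ↑ n
  ⟪⟫-↑ x zero = ⟪⟫-1
  ⟪⟫-↑ x (suc n) = trans (⟪⟫-⊗ _ _) (⊗-congˡ (⟪⟫-↑ x n))

  ⟪⟫-int : ∀ i → ⟪ R.int i ⟫ ≈ int i
  ⟪⟫-int (+ zero) = ⟪⟫-0
  ⟪⟫-int (+ suc n) = go n
    where
    go : ∀ n → ⟪ R.int (+ suc n) ⟫ ≈ int (+ suc n)
    go zero = ⟪⟫-1
    go (suc n) = begin
      ⟪ R.int (+ suc (suc n)) ⟫              ≈⟨ ⟪⟫-cong (R.int-homo-+ (+ 1) (+ suc n)) ⟩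
      ⟪ R.1# R.⊕ R.int (+ suc n) ⟫           ≈⟨ ⟪⟫-⊕ _ _ ⟩
      ⟪ R.1# ⟫ ⊕ ⟪ R.int (+ suc n) ⟫         ≈⟨ ⊕-cong ⟪⟫-1 (go n) ⟩
      1# ⊕ int (+ suc n)                    ≈⟨ int-homo-+ (+ 1) (+ suc n) ⟨
      int (+ suc (suc n))                   ∎
      where open ≈-Reasoning
  ⟪⟫-int -[1+ n ] = trans (⟪⟫-⊖ _) (⊖-cong (⟪⟫-int (+ suc n)))

open Hom public using () renaming (⟪_⟫ to _⟪_⟫)

-- Formal power series and agreement up to a given order.

module PowerSeries (K : CommutativeRing 0ℓ 0ℓ) where
  open RingKit K

  Series : Set
  Series = ℕ → Carrier

  infix 4 _≋_
  _≋_ : Series → Series → Set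
  f ≋ g = ∀ n → f n ≈ g n

  tail : Series → Series
  tail f n = f (suc n)

  constant : Carrier → Series
  constant c zero = c
  constant c (suc n) = 0#

  add mul : Series → Series → Series
  add f g n = f n ⊕ g n
  mul f g zero = f 0 ⊗ g 0
  mul f g (suc n) = f 0 ⊗ g (suc n) ⊕ mul (tail f) g n

  -- The coefficient of q^n in a product involves only the coefficients of the factors up to n; this
  -- makes agreement below q^N a congruence.
  mul-cong≤ : ∀ n {f f′ g g′} → (∀ i → i ≤ n → f i ≈ f′ i) → (∀ i → i ≤ n → g i ≈ g′ i) → mul f g n ≈ mul f′ g′ n
  mul-cong≤ zero ff gg = ⊗-cong (ff 0 z≤n) (gg 0 z≤n)
  mul-cong≤ (suc n) ff gg = ⊕-cong (⊗-cong (ff 0 z≤n) (gg (suc n) ℕP.≤-refl))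
    (mul-cong≤ n (λ i i≤n → ff (suc i) (s≤s i≤n)) (λ i i≤n → gg i (ℕP.m≤n⇒m≤1+n i≤n)))

  mul-cong : ∀ {f f′ g g′} → f ≋ f′ → g ≋ g′ → mul f g ≋ mul f′ g′
  mul-cong ff gg n = mul-cong≤ n (λ i _ → ff i) (λ i _ → gg i)

  mul-sucʳ : ∀ f g n → mul f g (suc n) ≈ f (suc n) ⊗ g 0 ⊕ mul f (tail g) n
  mul-sucʳ f g zero = ⊕-comm _ _
  mul-sucʳ f g (suc n) = begin
    f 0 ⊗ g (suc (suc n)) ⊕ mul (tail f) g (suc n)
      ≈⟨ ⊕-congˡ (mul-sucʳ (tail f) g n) ⟩
    f 0 ⊗ g (suc (suc n)) ⊕ (f (suc (suc n)) ⊗ g 0 ⊕ mul (tail f) (tail g) n)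
      ≈⟨ solve 3 (λ a b c → a :+ (b :+ c) := b :+ (a :+ c)) refl _ _ _ ⟩
    f (suc (suc n)) ⊗ g 0 ⊕ (f 0 ⊗ g (suc (suc n)) ⊕ mul (tail f) (tail g) n) ∎
    where open ≈-Reasoning

  mul-comm : ∀ f g → mul f g ≋ mul g f
  mul-comm f g zero = ⊗-comm _ _
  mul-comm f g (suc n) = trans (⊕-cong (⊗-comm _ _) (mul-comm (tail f) g n)) (sym (mul-sucʳ g f n))

  mul-distribʳ : ∀ h f g → mul (add f g) h ≋ add (mul f h) (mul g h)
  mul-distribʳ h f g zero = ⊗-distribʳ _ _ _
  mul-distribʳ h f g (suc n) = trans (⊕-cong (⊗-distribʳ _ _ _) (mul-distribʳ h (tail f) (tail g) n))
    (solve 4 (λ a b c d → (a :+ b) :+ (c :+ d) := (a :+ c) :+ (b :+ d)) refl _ _ _ _)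

  mul-scaleˡ : ∀ c f g → mul (λ n → c ⊗ f n) g ≋ (λ n → c ⊗ mul f g n)
  mul-scaleˡ c f g zero = ⊗-assoc _ _ _
  mul-scaleˡ c f g (suc n) = trans (⊕-cong (⊗-assoc _ _ _) (mul-scaleˡ c (tail f) g n)) (sym (⊗-distribˡ _ _ _))

  mul-assoc : ∀ f g h → mul (mul f g) h ≋ mul f (mul g h)
  mul-assoc f g h zero = ⊗-assoc _ _ _
  mul-assoc f g h (suc n) = begin
    (f 0 ⊗ g 0) ⊗ h (suc n) ⊕ mul (add (λ n → f 0 ⊗ tail g n) (mul (tail f) g)) h n
      ≈⟨ ⊕-cong (⊗-assoc _ _ _) (mul-distribʳ h _ _ n) ⟩
    f 0 ⊗ (g 0 ⊗ h (suc n)) ⊕ (mul (λ n → f 0 ⊗ tail g n) h n ⊕ mul (mul (tail f) g) h n)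
      ≈⟨ ⊕-congˡ (⊕-cong (mul-scaleˡ _ _ _ n) (mul-assoc (tail f) g h n)) ⟩
    f 0 ⊗ (g 0 ⊗ h (suc n)) ⊕ (f 0 ⊗ mul (tail g) h n ⊕ mul (tail f) (mul g h) n)
      ≈⟨ solve 4 (λ a b c d → a :* b :+ (a :* c :+ d) := a :* (b :+ c) :+ d) refl _ _ _ _ ⟩
    f 0 ⊗ (g 0 ⊗ h (suc n) ⊕ mul (tail g) h n) ⊕ mul (tail f) (mul g h) n ∎
    where open ≈-Reasoning

  mul-zeroˡ : ∀ f → mul (λ _ → 0#) f ≋ (λ _ → 0#)
  mul-zeroˡ f zero = ⊗-zeroˡ _
  mul-zeroˡ f (suc n) = trans (⊕-cong (⊗-zeroˡ _) (mul-zeroˡ f n)) (⊕-identityˡ _)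

  mul-constantˡ : ∀ c f → mul (constant c) f ≋ (λ n → c ⊗ f n)
  mul-constantˡ c f zero = refl
  mul-constantˡ c f (suc n) = trans (⊕-congˡ (mul-zeroˡ f n)) (⊕-identityʳ _)

  mul-identityˡ : ∀ f → mul (constant 1#) f ≋ f
  mul-identityˡ f n = trans (mul-constantˡ 1# f n) (⊗-identityˡ _)

  seriesRing : CommutativeRing 0ℓ 0ℓ
  seriesRing = record
    { Carrier = Series ; _≈_ = _≋_ ; _+_ = add ; _*_ = mul ; -_ = λ f n → ⊖ f n
    ; 0# = λ _ → 0# ; 1# = constant 1#
    ; isCommutativeRing = record
      { isRing = record
        { +-isAbelianGroup = record
          { isGroup = record
            { isMonoid = record
              { isSemigroup = record
                { isMagma = record
                  { isEquivalence = record
                    { refl = λ _ → refl ; sym = λ e n → sym (e n) ; trans = λ e e′ n → trans (e n) (e′ n) }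
                  ; ∙-cong = λ e e′ n → ⊕-cong (e n) (e′ n) }
                ; assoc = λ _ _ _ _ → ⊕-assoc _ _ _ }
              ; identity = (λ _ _ → ⊕-identityˡ _) , (λ _ _ → ⊕-identityʳ _) }
            ; inverse = (λ _ _ → ⊖-inverseˡ _) , (λ _ _ → ⊖-inverseʳ _)
            ; ⁻¹-cong = λ e n → ⊖-cong (e n) }
          ; comm = λ _ _ _ → ⊕-comm _ _ }
        ; *-cong = mul-cong
        ; *-assoc = mul-assoc
        ; *-identity = mul-identityˡ , λ f n → trans (mul-comm f _ n) (mul-identityˡ f n)
        ; distrib = (λ h f g n → trans (mul-comm h _ n) (trans (mul-distribʳ h f g n) (⊕-cong (mul-comm f h n) (mul-comm g h n))))
                  , mul-distribʳ }
      ; *-comm = mul-comm } }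

  module 𝕊 = RingKit seriesRing

  q : Series
  q zero = 0#
  q (suc n) = 𝕊.1# n

  q⊗-zero : ∀ f → (q 𝕊.⊗ f) 0 ≈ 0#
  q⊗-zero f = ⊗-zeroˡ _

  q⊗-suc : ∀ f n → (q 𝕊.⊗ f) (suc n) ≈ f n
  q⊗-suc f n = trans (⊕-cong (⊗-zeroˡ _) (mul-identityˡ f n)) (⊕-identityˡ _)

  q-cancel : ∀ {f g} → q 𝕊.⊗ f ≋ q 𝕊.⊗ g → f ≋ g
  q-cancel {f} {g} e n = trans (sym (q⊗-suc f n)) (trans (e (suc n)) (q⊗-suc g n))

  q↑⊗-+ : ∀ k f n → (q 𝕊.↑ k 𝕊.⊗ f) (k + n) ≈ f n
  q↑⊗-+ zero f n = mul-identityˡ f n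
  q↑⊗-+ (suc k) f n = trans (𝕊.⊗-assoc q (q 𝕊.↑ k) f (suc k + n)) (trans (q⊗-suc (q 𝕊.↑ k 𝕊.⊗ f) (k + n)) (q↑⊗-+ k f n))

  q↑⊗-< : ∀ k f n → n < k → (q 𝕊.↑ k 𝕊.⊗ f) n ≈ 0#
  q↑⊗-< (suc k) f zero _ = trans (𝕊.⊗-assoc q (q 𝕊.↑ k) f 0) (q⊗-zero (q 𝕊.↑ k 𝕊.⊗ f))
  q↑⊗-< (suc k) f (suc n) (s≤s n<k) = trans (𝕊.⊗-assoc q (q 𝕊.↑ k) f (suc n)) (trans (q⊗-suc (q 𝕊.↑ k 𝕊.⊗ f) n) (q↑⊗-< k f n n<k))

  head+tail : ∀ f → f ≋ constant (f 0) 𝕊.⊕ q 𝕊.⊗ tail f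
  head+tail f zero = sym (trans (⊕-congˡ (q⊗-zero (tail f))) (⊕-identityʳ _))
  head+tail f (suc n) = sym (trans (⊕-identityˡ _) (q⊗-suc (tail f) n))

  infix 4 _≋[_]_
  -- Equality modulo q^N. Infinite products are handled through finite ones that agree with them to
  -- every order.
  _≋[_]_ : Series → ℕ → Series → Set
  f ≋[ N ] g = ∀ n → n < N → f n ≈ g n

  ≋⇒≋[] : ∀ {f g N} → f ≋ g → f ≋[ N ] g
  ≋⇒≋[] e n _ = e n

  ≋[]-sym : ∀ {f g N} → f ≋[ N ] g → g ≋[ N ] f
  ≋[]-sym e n n<N = sym (e n n<N)

  ≋[]-trans : ∀ {f g h N} → f ≋[ N ] g → g ≋[ N ] h → f ≋[ N ] h
  ≋[]-trans e e′ n n<N = trans (e n n<N) (e′ n n<N)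

  ≋[]-weaken : ∀ {f g M N} → M ≤ N → f ≋[ N ] g → f ≋[ M ] g
  ≋[]-weaken M≤N e n n<M = e n (ℕP.<-≤-trans n<M M≤N)

  ≋[]-⊕ : ∀ {f f′ g g′ N} → f ≋[ N ] f′ → g ≋[ N ] g′ → f 𝕊.⊕ g ≋[ N ] f′ 𝕊.⊕ g′
  ≋[]-⊕ e e′ n n<N = ⊕-cong (e n n<N) (e′ n n<N)

  ≋[]-⊗ : ∀ {f f′ g g′ N} → f ≋[ N ] f′ → g ≋[ N ] g′ → f 𝕊.⊗ g ≋[ N ] f′ 𝕊.⊗ g′
  ≋[]-⊗ e e′ n n<N = mul-cong≤ n (λ i i≤n → e i (ℕP.≤-<-trans i≤n n<N)) (λ i i≤n → e′ i (ℕP.≤-<-trans i≤n n<N))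

  ≋[]-↑ : ∀ {f f′ N} k → f ≋[ N ] f′ → f 𝕊.↑ k ≋[ N ] f′ 𝕊.↑ k
  ≋[]-↑ zero e = ≋⇒≋[] {𝕊.1#} 𝕊.refl
  ≋[]-↑ (suc k) e = ≋[]-⊗ e (≋[]-↑ k e)

  q↑⊗≋[]0 : ∀ {N} k f → N ≤ k → q 𝕊.↑ k 𝕊.⊗ f ≋[ N ] 𝕊.0#
  q↑⊗≋[]0 k f N≤k n n<N = q↑⊗-< k f n (ℕP.<-≤-trans n<N N≤k)

  q⊗≋[] : ∀ {f g N} → f ≋[ N ] g → q 𝕊.⊗ f ≋[ suc N ] q 𝕊.⊗ g
  q⊗≋[] {f} {g} e zero _ = trans (q⊗-zero f) (sym (q⊗-zero g))
  q⊗≋[] {f} {g} e (suc n) (s≤s n<N) = trans (q⊗-suc f n) (trans (e n n<N) (sym (q⊗-suc g n)))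

  q↑⊗≋[] : ∀ k {f g N} → f ≋[ N ] g → q 𝕊.↑ k 𝕊.⊗ f ≋[ k + N ] q 𝕊.↑ k 𝕊.⊗ g
  q↑⊗≋[] zero {f} {g} e = ≋[]-trans (≋⇒≋[] (mul-identityˡ f)) (≋[]-trans e (≋⇒≋[] {g} (𝕊.sym (mul-identityˡ g))))
  q↑⊗≋[] (suc k) {f} {g} e = ≋[]-trans (≋⇒≋[] (𝕊.⊗-assoc q _ f))
    (≋[]-trans (q⊗≋[] (q↑⊗≋[] k e)) (≋⇒≋[] {q 𝕊.⊗ (q 𝕊.↑ k 𝕊.⊗ g)} (𝕊.sym (𝕊.⊗-assoc q _ g))))

  ≋[]⇒≋ : ∀ {f g} → (∀ N → f ≋[ N ] g) → f ≋ g
  ≋[]⇒≋ e n = e (suc n) n ℕP.≤-refl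

infixr 9 _∘ʰ_
_∘ʰ_ : ∀ {R S T : CommutativeRing 0ℓ 0ℓ} → Hom S T → Hom R S → Hom R T
_∘ʰ_ {T = T} ψ φ = record
  { ⟪_⟫ = λ x → ψ ⟪ φ ⟪ x ⟫ ⟫
  ; ⟪⟫-cong = λ e → Hom.⟪⟫-cong ψ (Hom.⟪⟫-cong φ e)
  ; ⟪⟫-⊕ = λ x y → trans (Hom.⟪⟫-cong ψ (Hom.⟪⟫-⊕ φ x y)) (Hom.⟪⟫-⊕ ψ _ _)
  ; ⟪⟫-⊗ = λ x y → trans (Hom.⟪⟫-cong ψ (Hom.⟪⟫-⊗ φ x y)) (Hom.⟪⟫-⊗ ψ _ _)
  ; ⟪⟫-1 = trans (Hom.⟪⟫-cong ψ (Hom.⟪⟫-1 φ)) (Hom.⟪⟫-1 ψ) }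
  where open RingKit T

-- Substitution q ↦ q^k, extraction of a residue class of exponents, and twisting.

module SeriesMaps (K : CommutativeRing 0ℓ 0ℓ) where
  open RingKit K
  open PowerSeries K

  q↑-≡ : ∀ k → (q 𝕊.↑ k) k ≈ 1#
  q↑-≡ zero = refl
  q↑-≡ (suc k) = trans (q⊗-suc (q 𝕊.↑ k) k) (q↑-≡ k)

  q↑-≢ : ∀ k n → ¬ (n ≡ k) → (q 𝕊.↑ k) n ≈ 0#
  q↑-≢ zero zero n≢k = ⊥-elim (n≢k ≡.refl)
  q↑-≢ zero (suc n) n≢k = refl
  q↑-≢ (suc k) zero n≢k = q⊗-zero (q 𝕊.↑ k)
  q↑-≢ (suc k) (suc n) n≢k = trans (q⊗-suc (q 𝕊.↑ k) n) (q↑-≢ k n (λ e → n≢k (≡.cong suc e)))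

  -- spread k c f is q^c f(q^{k+1}).
  spread : ℕ → ℕ → Series → Series
  spread k zero f zero = f 0
  spread k zero f (suc n) = spread k k (tail f) n
  spread k (suc c) f zero = 0#
  spread k (suc c) f (suc n) = spread k c f n

  -- dil k f is f(q^k) for k > 0; dil 0 f = f is a junk value.
  dil : ℕ → Series → Series
  dil zero f = f
  dil (suc k) f = spread k 0 f

  spread-cong : ∀ k c {f g} → f ≋ g → spread k c f ≋ spread k c g
  spread-cong k zero e zero = e 0
  spread-cong k zero e (suc n) = spread-cong k k (λ i → e (suc i)) n
  spread-cong k (suc c) e zero = refl
  spread-cong k (suc c) e (suc n) = spread-cong k c e n

  spread-⊕ : ∀ k c f g → spread k c (f 𝕊.⊕ g) ≋ spread k c f 𝕊.⊕ spread k c g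
  spread-⊕ k zero f g zero = refl
  spread-⊕ k zero f g (suc n) = spread-⊕ k k (tail f) (tail g) n
  spread-⊕ k (suc c) f g zero = sym (⊕-identityˡ 0#)
  spread-⊕ k (suc c) f g (suc n) = spread-⊕ k c f g n

  spread-scale : ∀ k c a f → spread k c (λ n → a ⊗ f n) ≋ (λ n → a ⊗ spread k c f n)
  spread-scale k zero a f zero = refl
  spread-scale k zero a f (suc n) = spread-scale k k a (tail f) n
  spread-scale k (suc c) a f zero = sym (⊗-zeroʳ a)
  spread-scale k (suc c) a f (suc n) = spread-scale k c a f n

  spread-shift : ∀ k c f → spread k c f ≋ q 𝕊.↑ c 𝕊.⊗ spread k 0 f
  spread-shift k zero f n = sym (mul-identityˡ (spread k 0 f) n)
  spread-shift k (suc c) f zero = sym (trans (𝕊.⊗-assoc q (q 𝕊.↑ c) (spread k 0 f) 0) (q⊗-zero (q 𝕊.↑ c 𝕊.⊗ spread k 0 f)))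
  spread-shift k (suc c) f (suc n) = trans (spread-shift k c f n)
    (sym (trans (𝕊.⊗-assoc q (q 𝕊.↑ c) (spread k 0 f) (suc n)) (q⊗-suc (q 𝕊.↑ c 𝕊.⊗ spread k 0 f) n)))

  dil-cong : ∀ k {f g} → f ≋ g → dil k f ≋ dil k g
  dil-cong zero e = e
  dil-cong (suc k) e = spread-cong k 0 e

  dil-⊕ : ∀ k f g → dil k (f 𝕊.⊕ g) ≋ dil k f 𝕊.⊕ dil k g
  dil-⊕ zero f g _ = refl
  dil-⊕ (suc k) f g = spread-⊕ k 0 f g

  dil-scale : ∀ k a f → dil k (λ n → a ⊗ f n) ≋ constant a 𝕊.⊗ dil k f
  dil-scale zero a f n = sym (mul-constantˡ a f n)
  dil-scale (suc k) a f n = trans (spread-scale k 0 a f n) (sym (mul-constantˡ a (spread k 0 f) n))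

  -- Each use gains a factor q^(k+1), so identities about `dil` follow by induction on the order of
  -- agreement.
  dil-step : ∀ k f → dil (suc k) f ≋ constant (f 0) 𝕊.⊕ q 𝕊.↑ suc k 𝕊.⊗ dil (suc k) (tail f)
  dil-step k f zero = sym (trans (⊕-congˡ (q↑⊗-< (suc k) (dil (suc k) (tail f)) 0 (s≤s z≤n))) (⊕-identityʳ _))
  dil-step k f (suc n) = trans (spread-shift k k (tail f) n)
    (sym (trans (⊕-identityˡ _) (trans (𝕊.⊗-assoc q (q 𝕊.↑ k) (spread k 0 (tail f)) (suc n))
      (q⊗-suc (q 𝕊.↑ k 𝕊.⊗ spread k 0 (tail f)) n))))

  dil-1 : ∀ k → dil k 𝕊.1# ≋ 𝕊.1#
  dil-1 zero n = refl
  dil-1 (suc k) zero = refl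
  dil-1 (suc k) (suc n) = spread-0 k k n
    where
    spread-0 : ∀ k c → spread k c (λ _ → 0#) ≋ (λ _ → 0#)
    spread-0 k zero zero = refl
    spread-0 k zero (suc n) = spread-0 k k n
    spread-0 k (suc c) zero = refl
    spread-0 k (suc c) (suc n) = spread-0 k c n

  dil-⊗-tail : ∀ k f g → dil (suc k) (f 𝕊.⊗ g) ≋ constant (f 0) 𝕊.⊗ dil (suc k) g 𝕊.⊕ q 𝕊.↑ suc k 𝕊.⊗ dil (suc k) (tail f 𝕊.⊗ g)
  dil-⊗-tail k f g = begin
    dil (suc k) (f 𝕊.⊗ g)
      ≈⟨ dil-step k (f 𝕊.⊗ g) ⟩
    constant (f 0 ⊗ g 0) 𝕊.⊕ Q 𝕊.⊗ dil (suc k) ((λ n → f 0 ⊗ tail g n) 𝕊.⊕ tail f 𝕊.⊗ g)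
      ≈⟨ 𝕊.⊕-cong constant-⊗ (𝕊.⊗-congˡ (𝕊.trans (dil-⊕ (suc k) _ _) (𝕊.⊕-congʳ (dil-scale (suc k) (f 0) (tail g))))) ⟩
    constant (f 0) 𝕊.⊗ constant (g 0) 𝕊.⊕ Q 𝕊.⊗ (constant (f 0) 𝕊.⊗ dil (suc k) (tail g) 𝕊.⊕ dil (suc k) (tail f 𝕊.⊗ g))
      ≈⟨ 𝕊.solve 5 (λ a b c d e → a 𝕊.:* b 𝕊.:+ c 𝕊.:* (a 𝕊.:* d 𝕊.:+ e) 𝕊.:= a 𝕊.:* (b 𝕊.:+ c 𝕊.:* d) 𝕊.:+ c 𝕊.:* e) 𝕊.refl
          (constant (f 0)) (constant (g 0)) Q (dil (suc k) (tail g)) (dil (suc k) (tail f 𝕊.⊗ g)) ⟩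
    constant (f 0) 𝕊.⊗ (constant (g 0) 𝕊.⊕ Q 𝕊.⊗ dil (suc k) (tail g)) 𝕊.⊕ Q 𝕊.⊗ dil (suc k) (tail f 𝕊.⊗ g)
      ≈⟨ 𝕊.⊕-congʳ (𝕊.⊗-congˡ (dil-step k g)) ⟨
    constant (f 0) 𝕊.⊗ dil (suc k) g 𝕊.⊕ Q 𝕊.⊗ dil (suc k) (tail f 𝕊.⊗ g) ∎
    where
    open 𝕊.≈-Reasoning
    Q = q 𝕊.↑ suc k
    constant-⊗ : constant (f 0 ⊗ g 0) ≋ constant (f 0) 𝕊.⊗ constant (g 0)
    constant-⊗ zero = refl
    constant-⊗ (suc n) = sym (trans (mul-constantˡ (f 0) (constant (g 0)) (suc n)) (⊗-zeroʳ _))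

  dil-⊗ : ∀ k f g → dil k (f 𝕊.⊗ g) ≋ dil k f 𝕊.⊗ dil k g
  dil-⊗ zero f g _ = refl
  dil-⊗ (suc k) f g = ≋[]⇒≋ (λ N → go N f g)
    where
    go : ∀ N f g → dil (suc k) (f 𝕊.⊗ g) ≋[ N ] dil (suc k) f 𝕊.⊗ dil (suc k) g
    go zero f g n ()
    go (suc N) f g = ≋[]-trans (≋⇒≋[] (dil-⊗-tail k f g)) (≋[]-trans
      (≋[]-⊕ (≋⇒≋[] {constant (f 0) 𝕊.⊗ dil (suc k) g} 𝕊.refl)
             (≋[]-weaken (s≤s (ℕP.m≤n+m N k)) (q↑⊗≋[] (suc k) (go N (tail f) g))))
      (≋⇒≋[] {constant (f 0) 𝕊.⊗ dil (suc k) g 𝕊.⊕ q 𝕊.↑ suc k 𝕊.⊗ (dil (suc k) (tail f) 𝕊.⊗ dil (suc k) g)}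
        (𝕊.trans
        (𝕊.solve 4 (λ a b c d → a 𝕊.:* b 𝕊.:+ c 𝕊.:* (d 𝕊.:* b) 𝕊.:= (a 𝕊.:+ c 𝕊.:* d) 𝕊.:* b) 𝕊.refl
          (constant (f 0)) (dil (suc k) g) (q 𝕊.↑ suc k) (dil (suc k) (tail f)))
        (𝕊.⊗-congʳ (𝕊.sym (dil-step k f))))))

  dilHom : ℕ → Hom seriesRing seriesRing
  dilHom k = record { ⟪_⟫ = dil k ; ⟪⟫-cong = dil-cong k ; ⟪⟫-⊕ = dil-⊕ k ; ⟪⟫-⊗ = dil-⊗ k ; ⟪⟫-1 = dil-1 k }

  dil-constant : ∀ k c → dil k (constant c) ≋ constant c
  dil-constant k c = 𝕊.trans (dil-cong k (λ { zero → sym (⊗-identityʳ c) ; (suc n) → sym (⊗-zeroʳ c) }))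
    (𝕊.trans (dil-scale k c 𝕊.1#) (𝕊.trans (𝕊.⊗-congˡ (dil-1 k)) (𝕊.⊗-identityʳ _)))

  dil-q : ∀ k → dil (suc k) q ≋ q 𝕊.↑ suc k
  dil-q k = 𝕊.trans (dil-step k q) (𝕊.trans (𝕊.⊕-cong (λ { zero → refl ; (suc n) → refl }) (𝕊.⊗-congˡ (dil-1 (suc k))))
    (𝕊.trans (𝕊.⊕-identityˡ _) (𝕊.⊗-identityʳ _)))

  dil-≋[] : ∀ k {f g N} → f ≋[ N ] g → dil (suc k) f ≋[ N ] dil (suc k) g
  dil-≋[] k {N = N} = go N
    where
    go : ∀ N {f g} → f ≋[ N ] g → dil (suc k) f ≋[ N ] dil (suc k) g
    go zero e n ()
    go (suc N) {f} {g} e = ≋[]-trans (≋⇒≋[] (dil-step k f)) (≋[]-trans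
      (≋[]-⊕ {constant (f 0)} {constant (g 0)} (λ { zero _ → e 0 (s≤s z≤n) ; (suc n) _ → refl })
        (≋[]-weaken (s≤s (ℕP.m≤n+m N k)) (q↑⊗≋[] (suc k) (go N (λ i i<N → e (suc i) (s≤s i<N))))))
      (≋⇒≋[] {constant (g 0) 𝕊.⊕ q 𝕊.↑ suc k 𝕊.⊗ dil (suc k) (tail g)} (𝕊.sym (dil-step k g))))

  dil-dil : ∀ a b f → dil (suc a) (dil (suc b) f) ≋ dil (suc a * suc b) f
  dil-dil a b f = ≋[]⇒≋ (λ N → go N f)
    where
    go : ∀ N f → dil (suc a) (dil (suc b) f) ≋[ N ] dil (suc a * suc b) f
    go zero f n ()
    go (suc N) f = ≋[]-trans (≋⇒≋[] (begin
        dil (suc a) (dil (suc b) f)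
          ≈⟨ dil-cong (suc a) (dil-step b f) ⟩
        dil (suc a) (constant (f 0) 𝕊.⊕ q 𝕊.↑ suc b 𝕊.⊗ dil (suc b) (tail f))
          ≈⟨ 𝕊.trans (dil-⊕ (suc a) _ _) (𝕊.⊕-cong (dil-constant (suc a) (f 0)) (dil-⊗ (suc a) _ _)) ⟩
        constant (f 0) 𝕊.⊕ dil (suc a) (q 𝕊.↑ suc b) 𝕊.⊗ dil (suc a) (dil (suc b) (tail f))
          ≈⟨ 𝕊.⊕-congˡ (𝕊.⊗-congʳ (𝕊.trans (Hom.⟪⟫-↑ (dilHom (suc a)) q (suc b))
              (𝕊.trans (𝕊.↑-congˡ (suc b) (dil-q a)) (𝕊.↑-assocʳ q (suc a) (suc b))))) ⟩
        constant (f 0) 𝕊.⊕ q 𝕊.↑ (suc a * suc b) 𝕊.⊗ dil (suc a) (dil (suc b) (tail f)) ∎))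
      (≋[]-trans (≋[]-⊕ (≋⇒≋[] {constant (f 0)} 𝕊.refl)
          (≋[]-weaken (s≤s (ℕP.m≤n+m N (b + a * suc b))) (q↑⊗≋[] (suc a * suc b) (go N (tail f)))))
        (≋⇒≋[] {constant (f 0) 𝕊.⊕ q 𝕊.↑ (suc a * suc b) 𝕊.⊗ dil (suc a * suc b) (tail f)} (𝕊.sym (dil-step (b + a * suc b) f))))
      where open 𝕊.≈-Reasoning

  private
    spread-skip : ∀ k c f n → spread k c f (c + n) ≈ spread k 0 f n
    spread-skip k zero f n = refl
    spread-skip k (suc c) f n = spread-skip k c f n

    spread-small : ∀ k c f n → n < c → spread k c f n ≈ 0#
    spread-small k (suc c) f zero _ = refl
    spread-small k (suc c) f (suc n) (s≤s n<c) = spread-small k c f n n<c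

  dil-+ : ∀ k f n → dil (suc k) f (suc k + n) ≈ dil (suc k) (tail f) n
  dil-+ k f n = spread-skip k k (tail f) n

  dil-multiple : ∀ k f n → dil (suc k) f (n * suc k) ≈ f n
  dil-multiple k f zero = refl
  dil-multiple k f (suc n) = trans (dil-+ k f (n * suc k)) (dil-multiple k (tail f) n)

  dil-residue : ∀ k f n r → 0 < r → r < suc k → dil (suc k) f (n * suc k + r) ≈ 0#
  dil-residue k f zero (suc r) _ (s≤s r<k) = spread-small k k (tail f) r r<k
  dil-residue k f (suc n) r 0<r r<k = trans
    (reflexive (≡.cong (dil (suc k) f) (ℕP.+-assoc (suc k) (n * suc k) r)))
    (trans (dil-+ k f (n * suc k + r)) (dil-residue k (tail f) n r 0<r r<k))

  dil-injective : ∀ k {f g} → dil (suc k) f ≋ dil (suc k) g → f ≋ g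
  dil-injective k {f} {g} e n = trans (sym (dil-multiple k f n)) (trans (e (n * suc k)) (dil-multiple k g n))

  section : ℕ → Series → Series
  section k f n = f (n * k)

  section-q↑⊗ : ∀ k f → section (suc k) (q 𝕊.↑ suc k 𝕊.⊗ f) ≋ q 𝕊.⊗ section (suc k) f
  section-q↑⊗ k f zero = trans (q↑⊗-< (suc k) f 0 (s≤s z≤n)) (sym (q⊗-zero (section (suc k) f)))
  section-q↑⊗ k f (suc n) = trans (q↑⊗-+ (suc k) f (n * suc k)) (sym (q⊗-suc (section (suc k) f) n))

  -- The projection formula: extracting the exponents divisible by k+1 is linear over series in
  -- q^(k+1). It becomes `U-⊗` for Laurent series.
  section-dil-⊗ : ∀ k g h → section (suc k) (dil (suc k) g 𝕊.⊗ h) ≋ g 𝕊.⊗ section (suc k) h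
  section-dil-⊗ k g h = ≋[]⇒≋ (λ N → go N g)
    where
    open 𝕊.≈-Reasoning
    go : ∀ N g → section (suc k) (dil (suc k) g 𝕊.⊗ h) ≋[ N ] g 𝕊.⊗ section (suc k) h
    go zero g n ()
    go (suc N) g = ≋[]-trans (≋⇒≋[] (begin
      section (suc k) (dil (suc k) g 𝕊.⊗ h)
        ≈⟨ (λ n → 𝕊.trans (𝕊.⊗-congʳ (dil-step k g)) (𝕊.trans (𝕊.⊗-distribʳ h _ _) (𝕊.⊕-congˡ (𝕊.⊗-assoc _ _ h))) (n * suc k)) ⟩
      section (suc k) (constant (g 0) 𝕊.⊗ h) 𝕊.⊕ section (suc k) (q 𝕊.↑ suc k 𝕊.⊗ (dil (suc k) (tail g) 𝕊.⊗ h))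
        ≈⟨ 𝕊.⊕-cong (λ n → trans (mul-constantˡ (g 0) h (n * suc k)) (sym (mul-constantˡ (g 0) (section (suc k) h) n)))
                    (section-q↑⊗ k _) ⟩
      constant (g 0) 𝕊.⊗ section (suc k) h 𝕊.⊕ q 𝕊.⊗ section (suc k) (dil (suc k) (tail g) 𝕊.⊗ h) ∎))
      (≋[]-trans (≋[]-⊕ (≋⇒≋[] {constant (g 0) 𝕊.⊗ section (suc k) h} 𝕊.refl) (q⊗≋[] (go N (tail g))))
        (≋⇒≋[] {constant (g 0) 𝕊.⊗ section (suc k) h 𝕊.⊕ q 𝕊.⊗ (tail g 𝕊.⊗ section (suc k) h)}
          (𝕊.trans (𝕊.solve 4 (λ a b c d → a 𝕊.:* b 𝕊.:+ c 𝕊.:* (d 𝕊.:* b) 𝕊.:= (a 𝕊.:+ c 𝕊.:* d) 𝕊.:* b) 𝕊.refl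
              (constant (g 0)) (section (suc k) h) q (tail g))
            (𝕊.⊗-congʳ (𝕊.sym (head+tail g))))))

  section-dil : ∀ k g → section (suc k) (dil (suc k) g) ≋ g
  section-dil k g n = dil-multiple k g n

  section-q↑ : ∀ k j → ¬ (k ∣ j) → section k (q 𝕊.↑ j) ≋ 𝕊.0#
  section-q↑ k j k∤j n = q↑-≢ j (n * k) (λ e → k∤j (divides n (≡.sym e)))

  section-q↑⊗dil : ∀ k j g → ¬ (suc k ∣ j) → section (suc k) (q 𝕊.↑ j 𝕊.⊗ dil (suc k) g) ≋ 𝕊.0#
  section-q↑⊗dil k j g k∤j = begin
    section (suc k) (q 𝕊.↑ j 𝕊.⊗ dil (suc k) g)    ≈⟨ (λ n → 𝕊.⊗-comm (q 𝕊.↑ j) (dil (suc k) g) (n * suc k)) ⟩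
    section (suc k) (dil (suc k) g 𝕊.⊗ q 𝕊.↑ j)    ≈⟨ section-dil-⊗ k g (q 𝕊.↑ j) ⟩
    g 𝕊.⊗ section (suc k) (q 𝕊.↑ j)                ≈⟨ 𝕊.⊗-congˡ {g} (section-q↑ (suc k) j k∤j) ⟩
    g 𝕊.⊗ 𝕊.0#                                     ≈⟨ 𝕊.⊗-zeroʳ g ⟩
    𝕊.0# ∎
    where open 𝕊.≈-Reasoning

  -- The substitution q ↦ aq; for a fifth root of unity a it is one of the conjugations in the norm.
  twist : Carrier → Series → Series
  twist a f n = a ↑ n ⊗ f n

  twist-⊗ : ∀ a f g → twist a (f 𝕊.⊗ g) ≋ twist a f 𝕊.⊗ twist a g
  twist-⊗ a f g zero = solve 2 (λ x y → con (+ 1) :* (x :* y) := (con (+ 1) :* x) :* (con (+ 1) :* y)) refl (f 0) (g 0)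
  twist-⊗ a f g (suc n) = begin
    a ⊗ a ↑ n ⊗ (f 0 ⊗ g (suc n) ⊕ (tail f 𝕊.⊗ g) n)
      ≈⟨ solve 5 (λ a b x y z → a :* b :* (x :* y :+ z) := (con (+ 1) :* x) :* (a :* b :* y) :+ a :* (b :* z)) refl
           a (a ↑ n) (f 0) (g (suc n)) ((tail f 𝕊.⊗ g) n) ⟩
    (1# ⊗ f 0) ⊗ (a ⊗ a ↑ n ⊗ g (suc n)) ⊕ a ⊗ (a ↑ n ⊗ (tail f 𝕊.⊗ g) n)
      ≈⟨ ⊕-congˡ (⊗-congˡ (twist-⊗ a (tail f) g n)) ⟩
    (1# ⊗ f 0) ⊗ (a ⊗ a ↑ n ⊗ g (suc n)) ⊕ a ⊗ (twist a (tail f) 𝕊.⊗ twist a g) n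
      ≈⟨ ⊕-congˡ (mul-scaleˡ a (twist a (tail f)) (twist a g) n) ⟨
    (1# ⊗ f 0) ⊗ (a ⊗ a ↑ n ⊗ g (suc n)) ⊕ mul (λ i → a ⊗ twist a (tail f) i) (twist a g) n
      ≈⟨ ⊕-congˡ (mul-cong (λ i → sym (⊗-assoc a (a ↑ i) (f (suc i)))) (λ _ → refl) n) ⟩
    (1# ⊗ f 0) ⊗ (a ⊗ a ↑ n ⊗ g (suc n)) ⊕ (tail (twist a f) 𝕊.⊗ twist a g) n ∎
    where open ≈-Reasoning

  twistHom : Carrier → Hom seriesRing seriesRing
  twistHom a = record
    { ⟪_⟫ = twist a
    ; ⟪⟫-cong = λ e n → ⊗-congˡ (e n)
    ; ⟪⟫-⊕ = λ f g n → ⊗-distribˡ (a ↑ n) (f n) (g n)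
    ; ⟪⟫-⊗ = twist-⊗ a
    ; ⟪⟫-1 = λ { zero → ⊗-identityˡ 1# ; (suc n) → ⊗-zeroʳ _ } }

  twist-q : ∀ a → twist a q ≋ constant a 𝕊.⊗ q
  twist-q a n = sym (trans (mul-constantˡ a q n) (go n))
    where
    go : ∀ n → a ⊗ q n ≈ a ↑ n ⊗ q n
    go zero = trans (⊗-zeroʳ a) (sym (⊗-zeroʳ 1#))
    go (suc zero) = ⊗-congʳ (sym (⊗-identityʳ a))
    go (suc (suc n)) = trans (⊗-zeroʳ a) (sym (⊗-zeroʳ _))

module SeriesHom {K K′ : CommutativeRing 0ℓ 0ℓ} (φ : Hom K K′) where
  private
    module P = PowerSeries K
    module P′ = PowerSeries K′
  open RingKit K′
  open Hom φ

  mapSeries : P.Series → P′.Series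
  mapSeries f n = ⟪ f n ⟫

  mapSeries-⊗ : ∀ f g → mapSeries (f P.𝕊.⊗ g) P′.≋ mapSeries f P′.𝕊.⊗ mapSeries g
  mapSeries-⊗ f g zero = ⟪⟫-⊗ _ _
  mapSeries-⊗ f g (suc n) = trans (⟪⟫-⊕ _ _) (⊕-cong (⟪⟫-⊗ _ _) (mapSeries-⊗ (P.tail f) g n))

  mapHom : Hom P.seriesRing P′.seriesRing
  mapHom = record
    { ⟪_⟫ = mapSeries
    ; ⟪⟫-cong = λ e n → ⟪⟫-cong (e n)
    ; ⟪⟫-⊕ = λ f g n → ⟪⟫-⊕ (f n) (g n)
    ; ⟪⟫-⊗ = mapSeries-⊗
    ; ⟪⟫-1 = λ { zero → ⟪⟫-1 ; (suc n) → ⟪⟫-0 } }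

  map-q : mapSeries P.q P′.≋ P′.q
  map-q zero = ⟪⟫-0
  map-q (suc n) = Hom.⟪⟫-1 mapHom n

  map-dil : ∀ k f → mapSeries (SeriesMaps.dil K k f) P′.≋ SeriesMaps.dil K′ k (mapSeries f)
  map-dil zero f _ = refl
  map-dil (suc k) f = go 0 f
    where
    go : ∀ c f → mapSeries (SeriesMaps.spread K k c f) P′.≋ SeriesMaps.spread K′ k c (mapSeries f)
    go zero f zero = refl
    go zero f (suc n) = go k (P.tail f) n
    go (suc c) f zero = ⟪⟫-0
    go (suc c) f (suc n) = go c f n

-- Recurrences for the partition count `cnt`.

private
  sumMult-zero : ∀ m k n j → n < suc k → sumMult m k n j ≡ cnt m k n
  sumMult-zero m k n zero n<k = ≡.refl
  sumMult-zero m k n (suc j) n<k with suc j * suc k ≤? n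
  ... | yes le = contradiction (ℕP.≤-trans (ℕP.m≤m+n (suc k) (j * suc k)) le) (ℕP.<⇒≱ n<k)
  ... | no _   = sumMult-zero m k n j n<k

  -- Removing one copy of the part k+1 matches multiplicity j+1 in size k+1+n with multiplicity j in
  -- size n; multiplicity zero is the separate summand.
  sumMult-suc : ∀ m k n j → sumMult m k (suc k + n) (suc j) ≡ cnt m k (suc k + n) + sumMult m k n j
  sumMult-suc m k n zero with 1 * suc k ≤? suc k + n
  ... | yes _ rewrite ℕP.+-identityʳ k | ℕP.m+n∸m≡n k n = ℕP.+-comm (cnt m k n) _
  ... | no ¬le = contradiction (ℕP.≤-trans (ℕP.≤-reflexive (ℕP.*-identityˡ (suc k))) (ℕP.m≤m+n (suc k) n)) ¬le
  sumMult-suc m k n (suc j) with suc (suc j) * suc k ≤? suc k + n | suc j * suc k ≤? n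
  ... | yes a | yes b rewrite ℕP.[m+n]∸[m+o]≡n∸o k n (suc j * suc k) | sumMult-suc m k n j =
    ≡.trans (≡.sym (ℕP.+-assoc (cnt m k (n ∸ suc j * suc k)) _ _))
      (≡.trans (≡.cong (_+ sumMult m k n j) (ℕP.+-comm (cnt m k (n ∸ suc j * suc k)) _)) (ℕP.+-assoc (cnt m k (suc k + n)) _ _))
  ... | yes a | no ¬b = contradiction (ℕP.+-cancelˡ-≤ (suc k) _ _ a) ¬b
  ... | no ¬a | yes b = contradiction (ℕP.+-monoʳ-≤ (suc k) b) ¬a
  ... | no ¬a | no ¬b = sumMult-suc m k n j

  -- Multiplicities above n cannot occur in size n. After one part is removed the summation bound is
  -- k + n instead of n, and this restores it.
  sumMult-stable : ∀ m k n i → sumMult m k n (i + n) ≡ sumMult m k n n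
  sumMult-stable m k n zero = ≡.refl
  sumMult-stable m k n (suc i) with suc (i + n) * suc k ≤? n
  ... | yes le = contradiction (ℕP.≤-trans (ℕP.m≤m*n (suc (i + n)) (suc k)) le) (ℕP.<⇒≱ (s≤s (ℕP.m≤n+m n i)))
  ... | no _   = sumMult-stable m k n i

cnt-suc-∣ : ∀ m k n → m ∣ suc k → cnt m (suc k) n ≡ cnt m k n
cnt-suc-∣ m k n m∣k with m ∣? suc k
... | yes _ = ≡.refl
... | no ¬m∣k = contradiction m∣k ¬m∣k

cnt-suc-< : ∀ m k n → n < suc k → cnt m (suc k) n ≡ cnt m k n
cnt-suc-< m k n n<k with m ∣? suc k
... | yes _ = ≡.refl
... | no _  = sumMult-zero m k n n n<k

cnt-suc-+ : ∀ m k n → ¬ (m ∣ suc k) → cnt m (suc k) (suc k + n) ≡ cnt m k (suc k + n) + cnt m (suc k) n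
cnt-suc-+ m k n ¬m∣k with m ∣? suc k
... | yes m∣k = contradiction m∣k ¬m∣k
... | no _ = ≡.trans (sumMult-suc m k n (k + n)) (≡.cong (λ s → cnt m k (suc k + n) + s) (sumMult-stable m k n k))

-- Euler products and the generating function of `d`.

module EulerProduct (K : CommutativeRing 0ℓ 0ℓ) where
  private module K = RingKit K
  open PowerSeries K hiding (module 𝕊)
  open SeriesMaps K
  open RingKit seriesRing

  factor : ℕ → Series
  factor k = 1# ⊝ q ↑ k

  factor≋[]1 : ∀ k N → N ≤ k → factor k ≋[ N ] 1#
  factor≋[]1 k N N≤k = ≋[]-trans
    (≋⇒≋[] {factor k} {1# ⊝ q ↑ k ⊗ 1#} (⊕-congˡ (⊖-cong (sym (⊗-identityʳ (q ↑ k))))))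
    (≋[]-trans (λ n n<N → K.⊕-congˡ (K.⊖-cong (q↑⊗≋[]0 k 1# N≤k n n<N)))
      (≋⇒≋[] {1# ⊝ 0#} (solve 1 (λ x → x :- con (+ 0) := x) refl 1#)))

  Q : ℕ → Series
  Q zero = 1#
  Q (suc n) = Q n ⊗ factor (suc n)

  Q-stable : ∀ i n → Q (i + n) ≋[ suc n ] Q n
  Q-stable zero n = ≋⇒≋[] {Q n} refl
  Q-stable (suc i) n = ≋[]-trans (≋[]-⊗ (Q-stable i n) (factor≋[]1 (suc (i + n)) (suc n) (s≤s (ℕP.m≤n+m n i))))
    (≋⇒≋[] (⊗-identityʳ (Q n)))

  Q-stable≤ : ∀ {m n} → n ≤ m → Q m ≋[ suc n ] Q n
  Q-stable≤ {m} {n} n≤m = ≡.subst (λ m → Q m ≋[ suc n ] Q n) (ℕP.m∸n+n≡m n≤m) (Q-stable (m ∸ n) n)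

  -- The diagonal is the infinite product: the coefficient of q^n in `Q m` is the same for all m ≥
  -- n.
  E : Series
  E n = Q n n

  Q≋[]E : ∀ N → Q N ≋[ suc N ] E
  Q≋[]E N n n<N = Q-stable≤ (ℕP.≤-pred n<N) n ℕP.≤-refl

  Qd : ℕ → ℕ → Series
  Qd m zero = 1#
  Qd m (suc n) with m ∣? suc n
  ... | yes _ = Qd m n
  ... | no _  = Qd m n ⊗ factor (suc n)

  Qd-∣ : ∀ m n → m ∣ suc n → Qd m (suc n) ≋ Qd m n
  Qd-∣ m n m∣n with m ∣? suc n
  ... | yes _ = refl {Qd m n}
  ... | no ¬m∣n = contradiction m∣n ¬m∣n

  Qd-∤ : ∀ m n → ¬ (m ∣ suc n) → Qd m (suc n) ≋ Qd m n ⊗ factor (suc n)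
  Qd-∤ m n ¬m∣n with m ∣? suc n
  ... | yes m∣n = contradiction m∣n ¬m∣n
  ... | no _ = refl {Qd m n ⊗ factor (suc n)}

  partitions : ℕ → ℕ → Series
  partitions m k n = K.int (+ cnt m k n)

  D : ℕ → Series
  D m n = K.int (+ d m n)

  partitions-step : ∀ m k → ¬ (m ∣ suc k) → partitions m (suc k) ≋ partitions m k ⊕ q ↑ suc k ⊗ partitions m (suc k)
  partitions-step m k ¬m∣k n with n <? suc k
  ... | yes n<k = K.trans (K.reflexive (≡.cong (λ c → K.int (+ c)) (cnt-suc-< m k n n<k)))
    (K.sym (K.trans (K.⊕-congˡ (q↑⊗-< (suc k) (partitions m (suc k)) n n<k)) (K.⊕-identityʳ _)))
  ... | no n≮k = ≡.subst (λ n → partitions m (suc k) n K.≈ (partitions m k ⊕ q ↑ suc k ⊗ partitions m (suc k)) n)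
    (ℕP.m+[n∸m]≡n (ℕP.≮⇒≥ n≮k))
    (K.trans (K.reflexive (≡.cong (λ c → K.int (+ c)) (cnt-suc-+ m k (n ∸ suc k) ¬m∣k)))
      (K.trans (K.int-homo-+ (+ cnt m k (suc k + (n ∸ suc k))) (+ cnt m (suc k) (n ∸ suc k)))
        (K.⊕-congˡ (K.sym (q↑⊗-+ (suc k) (partitions m (suc k)) (n ∸ suc k))))))

  partitions-Qd : ∀ m k → partitions m k ⊗ Qd m k ≋ 1#
  partitions-Qd m zero = trans (⊗-identityʳ (partitions m 0)) (λ { zero → K.refl ; (suc n) → K.refl })
  partitions-Qd m (suc k) = go (m ∣? suc k)
    where
    open ≈-Reasoning
    P = partitions m (suc k)
    go : Dec (m ∣ suc k) → P ⊗ Qd m (suc k) ≋ 1#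
    go (yes m∣k) = trans (⊗-cong {P} {partitions m k} {Qd m (suc k)} {Qd m k}
      (λ n → K.reflexive (≡.cong (λ c → K.int (+ c)) (cnt-suc-∣ m k n m∣k))) (Qd-∣ m k m∣k)) (partitions-Qd m k)
    go (no ¬m∣k) = begin
      P ⊗ Qd m (suc k)
        ≈⟨ ⊗-congˡ {P} (Qd-∤ m k ¬m∣k) ⟩
      P ⊗ (Qd m k ⊗ (1# ⊝ q ↑ suc k))
        ≈⟨ solve 4 (λ p r s o → p :* (r :* (o :- s)) := (p :* o :- s :* p) :* r) refl P (Qd m k) (q ↑ suc k) 1# ⟩
      (P ⊗ 1# ⊝ q ↑ suc k ⊗ P) ⊗ Qd m k
        ≈⟨ ⊗-congʳ {Qd m k} (⊕-congʳ {⊖ (q ↑ suc k ⊗ P)} (trans (⊗-identityʳ P) (partitions-step m k ¬m∣k))) ⟩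
      (partitions m k ⊕ q ↑ suc k ⊗ P ⊝ q ↑ suc k ⊗ P) ⊗ Qd m k
        ≈⟨ solve 3 (λ p r s → (p :+ s :- s) :* r := p :* r) refl (partitions m k) (Qd m k) (q ↑ suc k ⊗ P) ⟩
      partitions m k ⊗ Qd m k
        ≈⟨ partitions-Qd m k ⟩
      1# ∎

  partitions-stable : ∀ m i n → cnt m (i + n) n ≡ cnt m n n
  partitions-stable m zero n = ≡.refl
  partitions-stable m (suc i) n = ≡.trans (cnt-suc-< m (i + n) n (s≤s (ℕP.m≤n+m n i))) (partitions-stable m i n)

  partitions≋[]D : ∀ m k N → N ≤ k → partitions m k ≋[ N ] D m
  partitions≋[]D m k N N≤k n n<N = K.reflexive (≡.cong (λ c → K.int (+ c))
    (≡.trans (≡.cong (λ k → cnt m k n) (≡.sym (ℕP.m∸n+n≡m (ℕP.≤-trans (ℕP.<⇒≤ n<N) N≤k)))) (partitions-stable m (k ∸ n) n)))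

  Qd-0 : ∀ k → Qd 0 k ≋ Q k
  Qd-0 zero = refl {1#}
  Qd-0 (suc k) = trans (Qd-∤ 0 k (λ 0∣k → contradiction (∣.0∣⇒≡0 0∣k) λ ())) (⊗-congʳ {factor (suc k)} (Qd-0 k))

  -- As 0 divides no positive integer, m = 0 excludes no part: `D 0` counts all partitions, and it
  -- serves from here on as the inverse of `E`.
  D0⊗E : D 0 ⊗ E ≋ 1#
  D0⊗E = ≋[]⇒≋ λ N → ≋[]-trans
    (≋[]-⊗ (≋[]-sym (partitions≋[]D 0 N N ℕP.≤-refl)) (≋[]-weaken (ℕP.n≤1+n N) (≋[]-sym (Q≋[]E N))))
    (≋⇒≋[] (trans (⊗-congˡ {partitions 0 N} (sym (Qd-0 N))) (partitions-Qd 0 N)))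

  -- `Qd` omits the factors at multiples of m+1, and the dilated `Q M` supplies exactly these. The
  -- induction runs through a block of m non-multiples, and `Qd-block-end` crosses the multiple that
  -- closes it.
  Qd-block : ∀ m M i → i < suc m → Qd (suc m) (i + suc m * M) ⊗ dil (suc m) (Q M) ≋ Q (i + suc m * M)
  Qd-block-end : ∀ m M → Qd (suc m) (suc m * M) ⊗ dil (suc m) (Q M) ≋ Q (suc m * M)
  Qd-block m M zero _ = Qd-block-end m M
  Qd-block m M (suc i) i<m = begin
    Qd (suc m) (suc (i + suc m * M)) ⊗ dil (suc m) (Q M)
      ≈⟨ ⊗-congʳ {dil (suc m) (Q M)} (Qd-∤ (suc m) (i + suc m * M) λ m∣ →
           ℕP.<⇒≱ i<m (∣.∣⇒≤ (∣.∣m+n∣m⇒∣n (≡.subst (suc m ∣_) (ℕP.+-comm (suc i) (suc m * M)) m∣) (∣.m∣m*n M)))) ⟩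
    Qd (suc m) (i + suc m * M) ⊗ factor (suc (i + suc m * M)) ⊗ dil (suc m) (Q M)
      ≈⟨ solve 3 (λ a b c → a :* b :* c := (a :* c) :* b) refl
           (Qd (suc m) (i + suc m * M)) (factor (suc (i + suc m * M))) (dil (suc m) (Q M)) ⟩
    Qd (suc m) (i + suc m * M) ⊗ dil (suc m) (Q M) ⊗ factor (suc (i + suc m * M))
      ≈⟨ ⊗-congʳ {factor (suc (i + suc m * M))} (Qd-block m M i (ℕP.<-trans (ℕP.n<1+n i) i<m)) ⟩
    Q (suc (i + suc m * M)) ∎
    where open ≈-Reasoning
  Qd-block-end m zero = ≡.subst (λ n → Qd (suc m) n ⊗ dil (suc m) 1# ≋ Q n) (≡.sym (ℕP.*-zeroʳ (suc m)))
    (trans (⊗-identityˡ (dil (suc m) 1#)) (dil-1 (suc m)))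
  Qd-block-end m (suc M) = ≡.subst (λ n → Qd (suc m) n ⊗ dil (suc m) (Q (suc M)) ≋ Q n) (≡.sym (ℕP.*-suc (suc m) M)) (begin
    Qd (suc m) (suc n) ⊗ dil (suc m) (Q M ⊗ factor (suc M))
      ≈⟨ ⊗-cong (Qd-∣ (suc m) n (≡.subst (suc m ∣_) (ℕP.*-suc (suc m) M) (∣.m∣m*n (suc M)))) (dil-⊗ (suc m) (Q M) (factor (suc M))) ⟩
    Qd (suc m) n ⊗ (dil (suc m) (Q M) ⊗ dil (suc m) (factor (suc M)))
      ≈⟨ ⊗-assoc (Qd (suc m) n) (dil (suc m) (Q M)) (dil (suc m) (factor (suc M))) ⟨
    Qd (suc m) n ⊗ dil (suc m) (Q M) ⊗ dil (suc m) (factor (suc M))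
      ≈⟨ ⊗-cong (Qd-block m M m ℕP.≤-refl) (dil-factor (suc M)) ⟩
    Q n ⊗ factor (suc m * suc M)
      ≡⟨ ≡.cong (λ k → Q n ⊗ factor k) (ℕP.*-suc (suc m) M) ⟩
    Q (suc n) ∎)
    where
    open ≈-Reasoning
    n = m + suc m * M
    dil-factor : ∀ k → dil (suc m) (factor k) ≋ factor (suc m * k)
    dil-factor k = trans (Hom.⟪⟫-⊝ (dilHom (suc m)) 1# (q ↑ k)) (⊕-cong (dil-1 (suc m)) (⊖-cong
      (trans (Hom.⟪⟫-↑ (dilHom (suc m)) q k) (trans (↑-congˡ k (dil-q m)) (↑-assocʳ q (suc m) k)))))

  D⊗E : ∀ m → D (suc m) ⊗ E ≋ dil (suc m) E
  D⊗E m = ≋[]⇒≋ λ N → ≋[]-trans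
    (≋[]-⊗ (≋[]-sym (partitions≋[]D (suc m) (suc m * N) N (ℕP.m≤n*m N (suc m))))
           (≋[]-weaken (ℕP.≤-trans (ℕP.m≤n*m N (suc m)) (ℕP.n≤1+n _)) (≋[]-sym (Q≋[]E (suc m * N)))))
    (≋[]-trans (≋⇒≋[] (begin
      partitions (suc m) (suc m * N) ⊗ Q (suc m * N)
        ≈⟨ ⊗-congˡ {partitions (suc m) (suc m * N)} (Qd-block-end m N) ⟨
      partitions (suc m) (suc m * N) ⊗ (Qd (suc m) (suc m * N) ⊗ dil (suc m) (Q N))
        ≈⟨ ⊗-assoc (partitions (suc m) (suc m * N)) (Qd (suc m) (suc m * N)) (dil (suc m) (Q N)) ⟨
      partitions (suc m) (suc m * N) ⊗ Qd (suc m) (suc m * N) ⊗ dil (suc m) (Q N)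
        ≈⟨ ⊗-congʳ {dil (suc m) (Q N)} (partitions-Qd (suc m) (suc m * N)) ⟩
      1# ⊗ dil (suc m) (Q N)
        ≈⟨ ⊗-identityˡ (dil (suc m) (Q N)) ⟩
      dil (suc m) (Q N) ∎))
    (dil-≋[] m (≋[]-weaken (ℕP.n≤1+n N) (Q≋[]E N))))
    where open ≈-Reasoning

-- The pentagonal number theorem and the dissection of E modulo 5.

T : ℕ → ℕ
T zero = zero
T (suc n) = suc n + T n

-- The generalised pentagonal numbers n(3n - 1)/2 and n(3n + 1)/2, written through triangular
-- numbers to avoid division and subtraction.
ω⁻ ω⁺ : ℕ → ℕ
ω⁻ zero = 0
ω⁻ (suc n) = T n + suc n * suc n
ω⁺ n = n * n + T n

module Pentagonal (K : CommutativeRing 0ℓ 0ℓ) where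
  open PowerSeries K hiding (module 𝕊)
  open SeriesMaps K
  open EulerProduct K
  open RingKit seriesRing

  sgn : ℕ → Series
  sgn n = (⊖ 1#) ↑ n

  pent : ℕ → Series
  pent zero = 1#
  pent (suc n) = pent n ⊕ sgn (suc n) ⊗ (q ↑ ω⁻ (suc n) ⊕ q ↑ ω⁺ (suc n))

  -- ratio n s = Q n / Q s for s ≤ n
  ratio : ℕ → ℕ → Series
  ratio zero s = 1#
  ratio (suc n) s with s ≤? n
  ... | yes _ = ratio n s ⊗ factor (suc n)
  ... | no _  = 1#

  ratio-suc : ∀ n s → s ≤ n → ratio (suc n) s ≋ ratio n s ⊗ factor (suc n)
  ratio-suc n s s≤n with s ≤? n
  ... | yes _ = refl {ratio n s ⊗ factor (suc n)}
  ... | no s≰n = contradiction s≤n s≰n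

  ratio-diag : ∀ n → ratio n n ≋ 1#
  ratio-diag zero = refl {1#}
  ratio-diag (suc n) with suc n ≤? n
  ... | yes n<n = contradiction n<n ℕP.1+n≰n
  ... | no _ = refl {1#}

  ratio-down : ∀ n s → suc s ≤ n → ratio n (suc s) ⊗ factor (suc s) ≋ ratio n s
  ratio-down (suc n) s (s≤s s≤n) with ℕP.m≤n⇒m<n∨m≡n s≤n
  ... | inj₁ s<n = begin
    ratio (suc n) (suc s) ⊗ factor (suc s)                ≈⟨ ⊗-congʳ {factor (suc s)} (ratio-suc n (suc s) s<n) ⟩
    ratio n (suc s) ⊗ factor (suc n) ⊗ factor (suc s)     ≈⟨ solve 3 (λ a b c → a :* b :* c := a :* c :* b) refl
                                                               (ratio n (suc s)) (factor (suc n)) (factor (suc s)) ⟩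
    ratio n (suc s) ⊗ factor (suc s) ⊗ factor (suc n)     ≈⟨ ⊗-congʳ {factor (suc n)} (ratio-down n s s<n) ⟩
    ratio n s ⊗ factor (suc n)                            ≈⟨ ratio-suc n s s≤n ⟨
    ratio (suc n) s ∎
    where open ≈-Reasoning
  ... | inj₂ ≡.refl = trans (⊗-congʳ {factor (suc n)} (trans (ratio-diag (suc n)) (sym (ratio-diag n)))) (sym (ratio-suc n n ℕP.≤-refl))

  ratio-0 : ∀ n → ratio n 0 ≋ Q n
  ratio-0 zero = refl {1#}
  ratio-0 (suc n) = trans (ratio-suc n 0 z≤n) (⊗-congʳ {factor (suc n)} (ratio-0 n))

  -- Summands of Shanks' finite form of the pentagonal number theorem: their sum over s ≤ n is
  -- exactly the n-th pentagonal partial sum, and it is `Q n` modulo q^(n+1).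
  term : ℕ → ℕ → Series
  term n s = sgn s ⊗ ratio n s ⊗ q ↑ (s * n + T s)

  termSum : ℕ → ℕ → Series
  termSum n zero = term n 0
  termSum n (suc k) = termSum n k ⊕ term n (suc k)

  rest : ℕ → ℕ → Series
  rest n s = sgn s ⊗ ratio n s ⊗ q ↑ (s * n + T s) ⊗ q ↑ s ⊗ q ↑ suc n

  term-step : ∀ n s → s ≤ n → term (suc n) s ≋ term n s ⊗ q ↑ s ⊝ rest n s
  term-step n s s≤n = begin
    sgn s ⊗ ratio (suc n) s ⊗ q ↑ (s * suc n + T s)
      ≈⟨ ⊗-cong (⊗-congˡ {sgn s} (ratio-suc n s s≤n)) (trans (reflexive (≡.cong (q ↑_)
           (ℕ-solve 3 (λ s n t → s ∙ (ν 1 ∔ n) ∔ t ≐ (s ∙ n ∔ t) ∔ s) ≡.refl s n (T s)))) (↑-homo-⊗ q (s * n + T s) s)) ⟩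
    sgn s ⊗ (ratio n s ⊗ (1# ⊝ q ↑ suc n)) ⊗ (q ↑ (s * n + T s) ⊗ q ↑ s)
      ≈⟨ solve 5 (λ g r x a b → g :* (r :* (con (+ 1) :- x)) :* (a :* b) := g :* r :* a :* b :- g :* r :* a :* b :* x) refl
           (sgn s) (ratio n s) (q ↑ suc n) (q ↑ (s * n + T s)) (q ↑ s) ⟩
    term n s ⊗ q ↑ s ⊝ rest n s ∎
    where open ≈-Reasoning

  -- Shanks' telescoping: passing from n to n+1 changes the s-th term by rest n (s − 1) − rest n s.
  term-telescope : ∀ n s → suc s ≤ n → term (suc n) (suc s) ≋ term n (suc s) ⊕ rest n s ⊝ rest n (suc s)
  term-telescope n s s<n = trans (term-step n (suc s) s<n) (⊕-congʳ {⊖ rest n (suc s)} (begin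
    term n (suc s) ⊗ q ↑ suc s
      ≈⟨ solve 4 (λ g r a b → g :* r :* a :* b := g :* r :* a :- g :* (r :* (con (+ 1) :- b)) :* a) refl
           (sgn (suc s)) (ratio n (suc s)) (q ↑ (suc s * n + T (suc s))) (q ↑ suc s) ⟩
    term n (suc s) ⊝ sgn (suc s) ⊗ (ratio n (suc s) ⊗ factor (suc s)) ⊗ q ↑ (suc s * n + T (suc s))
      ≈⟨ ⊕-congˡ {term n (suc s)} (⊖-cong (⊗-cong (⊗-congˡ {sgn (suc s)} (ratio-down n s s<n)) (trans (reflexive (≡.cong (q ↑_)
           (ℕ-solve 3 (λ s n t → (ν 1 ∔ s) ∙ n ∔ (ν 1 ∔ s ∔ t) ≐ (s ∙ n ∔ t) ∔ (s ∔ (ν 1 ∔ n))) ≡.refl s n (T s))))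
           (trans (↑-homo-⊗ q (s * n + T s) (s + suc n)) (⊗-congˡ {q ↑ (s * n + T s)} (↑-homo-⊗ q s (suc n))))))) ⟩
    term n (suc s) ⊝ sgn (suc s) ⊗ ratio n s ⊗ (q ↑ (s * n + T s) ⊗ (q ↑ s ⊗ q ↑ suc n))
      ≈⟨ solve 6 (λ t g r a b c → t :- (:- con (+ 1) :* g) :* r :* (a :* (b :* c)) := t :+ g :* r :* a :* b :* c) refl
           (term n (suc s)) (sgn s) (ratio n s) (q ↑ (s * n + T s)) (q ↑ s) (q ↑ suc n) ⟩
    term n (suc s) ⊕ rest n s ∎))
    where open ≈-Reasoning

  termSum-step : ∀ n k → k ≤ n → termSum (suc n) k ≋ termSum n k ⊝ rest n k
  termSum-step n zero _ = trans (term-step n 0 z≤n) (⊕-congʳ {⊖ rest n 0} (⊗-identityʳ (term n 0)))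
  termSum-step n (suc k) k<n = trans (⊕-cong (termSum-step n k (ℕP.<⇒≤ k<n)) (term-telescope n k k<n))
    (solve 4 (λ a b c d → a :- b :+ (c :+ b :- d) := a :+ c :- d) refl (termSum n k) (rest n k) (term n (suc k)) (rest n (suc k)))

  -- After telescoping, the step from n to n+1 leaves -`rest n n`, the monomial with exponent
  -- ω⁻(n+1), and the new last summand, the one with exponent ω⁺(n+1).
  termSum≋pent : ∀ n → termSum n n ≋ pent n
  termSum≋pent zero = solve 1 (λ x → con (+ 1) :* con (+ 1) :* con (+ 1) := con (+ 1)) refl 1#
  termSum≋pent (suc n) = begin
    termSum (suc n) n ⊕ sgn (suc n) ⊗ ratio (suc n) (suc n) ⊗ q ↑ (suc n * suc n + T (suc n))
      ≈⟨ ⊕-cong (termSum-step n n ℕP.≤-refl) (⊗-congʳ {q ↑ ω⁺ (suc n)} (trans (⊗-congˡ {sgn (suc n)} (ratio-diag (suc n))) (⊗-identityʳ (sgn (suc n))))) ⟩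
    termSum n n ⊝ rest n n ⊕ sgn (suc n) ⊗ q ↑ ω⁺ (suc n)
      ≈⟨ ⊕-congʳ {sgn (suc n) ⊗ q ↑ ω⁺ (suc n)} (⊕-cong (termSum≋pent n) (⊖-cong rest-diag)) ⟩
    pent n ⊝ sgn n ⊗ q ↑ ω⁻ (suc n) ⊕ sgn (suc n) ⊗ q ↑ ω⁺ (suc n)
      ≈⟨ solve 4 (λ p g a b → p :- g :* a :+ (:- con (+ 1) :* g) :* b := p :+ (:- con (+ 1) :* g) :* (a :+ b)) refl
           (pent n) (sgn n) (q ↑ ω⁻ (suc n)) (q ↑ ω⁺ (suc n)) ⟩
    pent (suc n) ∎
    where
    open ≈-Reasoning
    rest-diag : rest n n ≋ sgn n ⊗ q ↑ ω⁻ (suc n)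
    rest-diag = begin
      sgn n ⊗ ratio n n ⊗ q ↑ (n * n + T n) ⊗ q ↑ n ⊗ q ↑ suc n
        ≈⟨ ⊗-congʳ {q ↑ suc n} (⊗-congʳ {q ↑ n} (⊗-congʳ {q ↑ (n * n + T n)} (trans (⊗-congˡ {sgn n} (ratio-diag n)) (⊗-identityʳ (sgn n))))) ⟩
      sgn n ⊗ q ↑ (n * n + T n) ⊗ q ↑ n ⊗ q ↑ suc n
        ≈⟨ solve 4 (λ g a b c → g :* a :* b :* c := g :* (a :* (b :* c))) refl (sgn n) (q ↑ (n * n + T n)) (q ↑ n) (q ↑ suc n) ⟩
      sgn n ⊗ (q ↑ (n * n + T n) ⊗ (q ↑ n ⊗ q ↑ suc n))
        ≈⟨ ⊗-congˡ {sgn n} (trans (⊗-congˡ {q ↑ (n * n + T n)} (sym (↑-homo-⊗ q n (suc n)))) (trans (sym (↑-homo-⊗ q (n * n + T n) (n + suc n)))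
             (reflexive (≡.cong (q ↑_) (ℕ-solve 2 (λ n t → (n ∙ n ∔ t) ∔ (n ∔ (ν 1 ∔ n)) ≐ t ∔ (ν 1 ∔ n) ∙ (ν 1 ∔ n)) ≡.refl n (T n)))))) ⟩
      sgn n ⊗ q ↑ ω⁻ (suc n) ∎

  -- For s ≥ 1 the exponent sn + T s is at least n+1, so modulo q^(n+1) only the summand s = 0,
  -- which is `Q n`, survives.
  termSum≋[]Q : ∀ n k → termSum n k ≋[ suc n ] Q n
  termSum≋[]Q n zero = ≋⇒≋[] (trans (⊗-identityʳ (1# ⊗ ratio n 0)) (trans (⊗-identityˡ (ratio n 0)) (ratio-0 n)))
  termSum≋[]Q n (suc k) = ≋[]-trans (≋[]-⊕ (termSum≋[]Q n k) (≋[]-trans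
    (≋⇒≋[] (⊗-comm (sgn (suc k) ⊗ ratio n (suc k)) (q ↑ (suc k * n + T (suc k)))))
    (q↑⊗≋[]0 (suc k * n + T (suc k)) (sgn (suc k) ⊗ ratio n (suc k))
      (ℕP.≤-trans (ℕP.≤-trans (s≤s (ℕP.m≤m+n n (k * n + (k + T k)))) (ℕP.≤-reflexive
        (ℕ-solve 3 (λ n k t → ν 1 ∔ (n ∔ (k ∙ n ∔ (k ∔ t))) ≐ n ∔ k ∙ n ∔ (ν 1 ∔ k ∔ t)) ≡.refl n k (T k)))) ℕP.≤-refl))))
    (≋⇒≋[] {Q n ⊕ 0#} {Q n} (solve 1 (λ x → x :+ con (+ 0) := x) refl (Q n)))

  pent≋[]E : ∀ n → pent n ≋[ suc n ] E
  pent≋[]E n = ≋[]-trans (≋⇒≋[] (sym (termSum≋pent n))) (≋[]-trans (termSum≋[]Q n n) (Q≋[]E n))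

  T5 : ∀ n → T (n * 5) + 10 * n ≡ 25 * T n
  T5 zero = ≡.refl
  T5 (suc n) = ≡.trans (ℕ-solve 2 (λ n t → (ν 5 ∔ n ∙ ν 5) ∔ ((ν 4 ∔ n ∙ ν 5) ∔ ((ν 3 ∔ n ∙ ν 5) ∔ ((ν 2 ∔ n ∙ ν 5) ∔ ((ν 1 ∔ n ∙ ν 5) ∔ t)))) ∔ ν 10 ∙ (ν 1 ∔ n)
      ≐ (t ∔ ν 10 ∙ n) ∔ (ν 25 ∔ ν 25 ∙ n)) ≡.refl n (T (n * 5)))
    (≡.trans (≡.cong (_+ (25 + 25 * n)) (T5 n)) (ℕ-solve 2 (λ n t → ν 25 ∙ t ∔ (ν 25 ∔ ν 25 ∙ n) ≐ ν 25 ∙ (ν 1 ∔ n ∔ t)) ≡.refl n (T n)))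

  -- Since 24ω + 1 = (6n ± 1)² is a square modulo 5, pentagonal exponents fall into the classes 0,
  -- 1, 2. The middle class is tracked because it is again a pentagonal sum; the outer two are left
  -- existential.
  Dissected : Series → Series → Set
  Dissected f h = ∃ λ a → ∃ λ b → f ≋ dil 5 a ⊕ q ⊗ dil 5 h ⊕ q ↑ 2 ⊗ dil 5 b

  dil5-monomial : ∀ s k → dil 5 (sgn s ⊗ q ↑ k) ≋ sgn s ⊗ q ↑ (5 * k)
  dil5-monomial s k = trans (dil-⊗ 5 (sgn s) (q ↑ k)) (⊗-cong
    (trans (Hom.⟪⟫-↑ (dilHom 5) (⊖ 1#) s) (↑-congˡ s (trans (Hom.⟪⟫-⊖ (dilHom 5) 1#) (⊖-cong (dil-1 5)))))
    (trans (Hom.⟪⟫-↑ (dilHom 5) q k) (trans (↑-congˡ k (dil-q 4)) (↑-assocʳ q 5 k))))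

  dissected-0 : ∀ {f h} s k e → e ≡ 5 * k → Dissected f h → Dissected (f ⊕ sgn s ⊗ q ↑ e) h
  dissected-0 {f} {h} s k _ ≡.refl (a , b , eq) = a ⊕ sgn s ⊗ q ↑ k , b , trans (⊕-cong eq (sym (dil5-monomial s k)))
    (trans (solve 4 (λ a h b m → a :+ h :+ b :+ m := (a :+ m) :+ h :+ b) refl (dil 5 a) (q ⊗ dil 5 h) (q ↑ 2 ⊗ dil 5 b) (dil 5 (sgn s ⊗ q ↑ k)))
      (⊕-congʳ {q ↑ 2 ⊗ dil 5 b} (⊕-congʳ {q ⊗ dil 5 h} (sym (dil-⊕ 5 a (sgn s ⊗ q ↑ k))))))

  dissected-1 : ∀ {f h} s k e → e ≡ 1 + 5 * k → Dissected f h → Dissected (f ⊕ sgn s ⊗ q ↑ e) (h ⊕ sgn s ⊗ q ↑ k)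
  dissected-1 {f} {h} s k _ ≡.refl (a , b , eq) = a , b , trans (⊕-cong eq
      (trans (solve 3 (λ g x y → g :* (x :* y) := x :* (g :* y)) refl (sgn s) q (q ↑ (5 * k))) (⊗-congˡ {q} (sym (dil5-monomial s k)))))
    (trans (solve 5 (λ a q h b m → a :+ q :* h :+ b :+ q :* m := a :+ q :* (h :+ m) :+ b) refl (dil 5 a) q (dil 5 h) (q ↑ 2 ⊗ dil 5 b) (dil 5 (sgn s ⊗ q ↑ k)))
      (⊕-congʳ {q ↑ 2 ⊗ dil 5 b} (⊕-congˡ {dil 5 a} (⊗-congˡ {q} (sym (dil-⊕ 5 h (sgn s ⊗ q ↑ k)))))))

  dissected-2 : ∀ {f h} s k e → e ≡ 2 + 5 * k → Dissected f h → Dissected (f ⊕ sgn s ⊗ q ↑ e) h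
  dissected-2 {f} {h} s k _ ≡.refl (a , b , eq) = a , b ⊕ sgn s ⊗ q ↑ k , trans (⊕-cong eq
      (trans (solve 3 (λ g x y → g :* (x :* (x :* y)) := (x :^ 2) :* (g :* y)) refl (sgn s) q (q ↑ (5 * k))) (⊗-congˡ {q ↑ 2} (sym (dil5-monomial s k)))))
    (trans (solve 5 (λ a h q b m → a :+ h :+ q :* b :+ q :* m := a :+ h :+ q :* (b :+ m)) refl (dil 5 a) (q ⊗ dil 5 h) (q ↑ 2) (dil 5 b) (dil 5 (sgn s ⊗ q ↑ k)))
      (⊕-congˡ {dil 5 a ⊕ q ⊗ dil 5 h} (⊗-congˡ {q ↑ 2} (sym (dil-⊕ 5 b (sgn s ⊗ q ↑ k))))))

  dissected-cong : ∀ {f f′ h h′} → f ≋ f′ → h ≋ h′ → Dissected f h → Dissected f′ h′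
  dissected-cong {h = h} {h′} e e′ (a , b , eq) = a , b , trans (sym e) (trans eq (⊕-congʳ {q ↑ 2 ⊗ dil 5 b} (⊕-congˡ {dil 5 a} (⊗-congˡ {q} (dil-cong 5 e′)))))

  private
    expo : ∀ n {e k} r → e ≡ (T (n * 5) + 10 * n) + r → 25 * T n + r ≡ k → e ≡ k
    expo n r e≡ k≡ = ≡.trans e≡ (≡.trans (≡.cong (_+ r) (T5 n)) k≡)

    dissected-split : ∀ {f h x y} s → Dissected (f ⊕ sgn s ⊗ x ⊕ sgn s ⊗ y) h → Dissected (f ⊕ sgn s ⊗ (x ⊕ y)) h
    dissected-split {f} {h} {x} {y} s = dissected-cong
      (solve 4 (λ f g x y → f :+ g :* x :+ g :* y := f :+ g :* (x :+ y)) refl f (sgn s) x y) (refl {h})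

    sgn-*5 : ∀ n → sgn (n * 5) ≋ sgn n
    sgn-*5 zero = refl {1#}
    sgn-*5 (suc n) = trans
      (solve 1 (λ s → :- con (+ 1) :* (:- con (+ 1) :* (:- con (+ 1) :* (:- con (+ 1) :* (:- con (+ 1) :* s)))) := :- con (+ 1) :* s) refl (sgn (n * 5)))
      (⊗-congˡ {⊖ 1#} (sgn-*5 n))

  -- The class of 1 comes from ω⁺(5n+4) = 1 + 25 ω⁻(n+1) and ω⁻(5n+6) = 1 + 25 ω⁺(n+1). Stopping at
  -- the index 1 + 5n puts both exponents belonging to n+1 into one block of five indices; their
  -- signs are opposite to that of n+1, hence the minus.
  pent-dissected : ∀ n → Dissected (pent (1 + n * 5)) (⊖ dil 5 (pent n))
  pent-dissected zero = 1# , ⊖ 1# , trans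
    (solve 1 (λ q → con (+ 1) :+ (:- con (+ 1) :* con (+ 1)) :* (q :* con (+ 1) :+ q :* (q :* con (+ 1)))
        := con (+ 1) :+ q :* (:- con (+ 1)) :+ (q :* (q :* con (+ 1))) :* (:- con (+ 1))) refl q)
    (⊕-cong (⊕-cong (sym (dil-1 5)) (⊗-congˡ {q} (sym (dil5-⊖ (dil-1 5))))) (⊗-congˡ {q ↑ 2} (sym (dil5-⊖ (refl {1#})))))
    where
    dil5-⊖ : ∀ {f} → f ≋ 1# → dil 5 (⊖ f) ≋ ⊖ 1#
    dil5-⊖ {f} e = trans (Hom.⟪⟫-⊖ (dilHom 5) f) (⊖-cong (trans (dil-cong 5 e) (dil-1 5)))
  pent-dissected (suc n) = dissected-cong (refl {pent (1 + suc n * 5)}) h-step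
    (dissected-split (6 + n * 5) (dissected-2 (6 + n * 5) ((5 * (T n + n * n) + (16 * n + 11))) _
      (expo n (25 * (n * n) + (80 * n + 57))
      (ℕ-solve 2 (λ n t → (ν 6 ∔ n ∙ ν 5) ∙ (ν 6 ∔ n ∙ ν 5) ∔ ((ν 6 ∔ n ∙ ν 5) ∔ ((ν 5 ∔ n ∙ ν 5) ∔ ((ν 4 ∔ n ∙ ν 5) ∔ ((ν 3 ∔ n ∙ ν 5) ∔ ((ν 2 ∔ n ∙ ν 5) ∔ ((ν 1 ∔ n ∙ ν 5) ∔ t)))))) ≐ (t ∔ ν 10 ∙ n) ∔ (ν 25 ∙ (n ∙ n) ∔ (ν 80 ∙ n ∔ ν 57))) ≡.refl n (T (n * 5)))
      (ℕ-solve 2 (λ n t → ν 25 ∙ t ∔ (ν 25 ∙ (n ∙ n) ∔ (ν 80 ∙ n ∔ ν 57)) ≐ ν 2 ∔ ν 5 ∙ ((ν 5 ∙ (t ∔ n ∙ n) ∔ (ν 16 ∙ n ∔ ν 11)))) ≡.refl n (T n)))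
    (dissected-1 (6 + n * 5) (5 * ω⁺ (suc n)) _
      (expo n (25 * (n * n) + (75 * n + 51))
      (ℕ-solve 2 (λ n t → ((ν 5 ∔ n ∙ ν 5) ∔ ((ν 4 ∔ n ∙ ν 5) ∔ ((ν 3 ∔ n ∙ ν 5) ∔ ((ν 2 ∔ n ∙ ν 5) ∔ ((ν 1 ∔ n ∙ ν 5) ∔ t))))) ∔ (ν 6 ∔ n ∙ ν 5) ∙ (ν 6 ∔ n ∙ ν 5) ≐ (t ∔ ν 10 ∙ n) ∔ (ν 25 ∙ (n ∙ n) ∔ (ν 75 ∙ n ∔ ν 51))) ≡.refl n (T (n * 5)))
      (ℕ-solve 2 (λ n t → ν 25 ∙ t ∔ (ν 25 ∙ (n ∙ n) ∔ (ν 75 ∙ n ∔ ν 51)) ≐ ν 1 ∔ ν 5 ∙ (ν 5 ∙ ((ν 1 ∔ n) ∙ (ν 1 ∔ n) ∔ (ν 1 ∔ n ∔ t)))) ≡.refl n (T n)))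
    (dissected-split (5 + n * 5) (dissected-0 (5 + n * 5) ((5 * (T n + n * n) + (13 * n + 8))) _
      (expo n (25 * (n * n) + (65 * n + 40))
      (ℕ-solve 2 (λ n t → (ν 5 ∔ n ∙ ν 5) ∙ (ν 5 ∔ n ∙ ν 5) ∔ ((ν 5 ∔ n ∙ ν 5) ∔ ((ν 4 ∔ n ∙ ν 5) ∔ ((ν 3 ∔ n ∙ ν 5) ∔ ((ν 2 ∔ n ∙ ν 5) ∔ ((ν 1 ∔ n ∙ ν 5) ∔ t))))) ≐ (t ∔ ν 10 ∙ n) ∔ (ν 25 ∙ (n ∙ n) ∔ (ν 65 ∙ n ∔ ν 40))) ≡.refl n (T (n * 5)))
      (ℕ-solve 2 (λ n t → ν 25 ∙ t ∔ (ν 25 ∙ (n ∙ n) ∔ (ν 65 ∙ n ∔ ν 40)) ≐ ν 5 ∙ ((ν 5 ∙ (t ∔ n ∙ n) ∔ (ν 13 ∙ n ∔ ν 8)))) ≡.refl n (T n)))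
    (dissected-0 (5 + n * 5) ((5 * (T n + n * n) + (12 * n + 7))) _
      (expo n (25 * (n * n) + (60 * n + 35))
      (ℕ-solve 2 (λ n t → ((ν 4 ∔ n ∙ ν 5) ∔ ((ν 3 ∔ n ∙ ν 5) ∔ ((ν 2 ∔ n ∙ ν 5) ∔ ((ν 1 ∔ n ∙ ν 5) ∔ t)))) ∔ (ν 5 ∔ n ∙ ν 5) ∙ (ν 5 ∔ n ∙ ν 5) ≐ (t ∔ ν 10 ∙ n) ∔ (ν 25 ∙ (n ∙ n) ∔ (ν 60 ∙ n ∔ ν 35))) ≡.refl n (T (n * 5)))
      (ℕ-solve 2 (λ n t → ν 25 ∙ t ∔ (ν 25 ∙ (n ∙ n) ∔ (ν 60 ∙ n ∔ ν 35)) ≐ ν 5 ∙ ((ν 5 ∙ (t ∔ n ∙ n) ∔ (ν 12 ∙ n ∔ ν 7)))) ≡.refl n (T n)))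
    (dissected-split (4 + n * 5) (dissected-1 (4 + n * 5) (5 * ω⁻ (suc n)) _
      (expo n (25 * (n * n) + (50 * n + 26))
      (ℕ-solve 2 (λ n t → (ν 4 ∔ n ∙ ν 5) ∙ (ν 4 ∔ n ∙ ν 5) ∔ ((ν 4 ∔ n ∙ ν 5) ∔ ((ν 3 ∔ n ∙ ν 5) ∔ ((ν 2 ∔ n ∙ ν 5) ∔ ((ν 1 ∔ n ∙ ν 5) ∔ t)))) ≐ (t ∔ ν 10 ∙ n) ∔ (ν 25 ∙ (n ∙ n) ∔ (ν 50 ∙ n ∔ ν 26))) ≡.refl n (T (n * 5)))
      (ℕ-solve 2 (λ n t → ν 25 ∙ t ∔ (ν 25 ∙ (n ∙ n) ∔ (ν 50 ∙ n ∔ ν 26)) ≐ ν 1 ∔ ν 5 ∙ (ν 5 ∙ (t ∔ (ν 1 ∔ n) ∙ (ν 1 ∔ n)))) ≡.refl n (T n)))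
    (dissected-2 (4 + n * 5) ((5 * (T n + n * n) + (9 * n + 4))) _
      (expo n (25 * (n * n) + (45 * n + 22))
      (ℕ-solve 2 (λ n t → ((ν 3 ∔ n ∙ ν 5) ∔ ((ν 2 ∔ n ∙ ν 5) ∔ ((ν 1 ∔ n ∙ ν 5) ∔ t))) ∔ (ν 4 ∔ n ∙ ν 5) ∙ (ν 4 ∔ n ∙ ν 5) ≐ (t ∔ ν 10 ∙ n) ∔ (ν 25 ∙ (n ∙ n) ∔ (ν 45 ∙ n ∔ ν 22))) ≡.refl n (T (n * 5)))
      (ℕ-solve 2 (λ n t → ν 25 ∙ t ∔ (ν 25 ∙ (n ∙ n) ∔ (ν 45 ∙ n ∔ ν 22)) ≐ ν 2 ∔ ν 5 ∙ ((ν 5 ∙ (t ∔ n ∙ n) ∔ (ν 9 ∙ n ∔ ν 4)))) ≡.refl n (T n)))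
    (dissected-split (3 + n * 5) (dissected-0 (3 + n * 5) ((5 * (T n + n * n) + (7 * n + 3))) _
      (expo n (25 * (n * n) + (35 * n + 15))
      (ℕ-solve 2 (λ n t → (ν 3 ∔ n ∙ ν 5) ∙ (ν 3 ∔ n ∙ ν 5) ∔ ((ν 3 ∔ n ∙ ν 5) ∔ ((ν 2 ∔ n ∙ ν 5) ∔ ((ν 1 ∔ n ∙ ν 5) ∔ t))) ≐ (t ∔ ν 10 ∙ n) ∔ (ν 25 ∙ (n ∙ n) ∔ (ν 35 ∙ n ∔ ν 15))) ≡.refl n (T (n * 5)))
      (ℕ-solve 2 (λ n t → ν 25 ∙ t ∔ (ν 25 ∙ (n ∙ n) ∔ (ν 35 ∙ n ∔ ν 15)) ≐ ν 5 ∙ ((ν 5 ∙ (t ∔ n ∙ n) ∔ (ν 7 ∙ n ∔ ν 3)))) ≡.refl n (T n)))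
    (dissected-2 (3 + n * 5) ((5 * (T n + n * n) + (6 * n + 2))) _
      (expo n (25 * (n * n) + (30 * n + 12))
      (ℕ-solve 2 (λ n t → ((ν 2 ∔ n ∙ ν 5) ∔ ((ν 1 ∔ n ∙ ν 5) ∔ t)) ∔ (ν 3 ∔ n ∙ ν 5) ∙ (ν 3 ∔ n ∙ ν 5) ≐ (t ∔ ν 10 ∙ n) ∔ (ν 25 ∙ (n ∙ n) ∔ (ν 30 ∙ n ∔ ν 12))) ≡.refl n (T (n * 5)))
      (ℕ-solve 2 (λ n t → ν 25 ∙ t ∔ (ν 25 ∙ (n ∙ n) ∔ (ν 30 ∙ n ∔ ν 12)) ≐ ν 2 ∔ ν 5 ∙ ((ν 5 ∙ (t ∔ n ∙ n) ∔ (ν 6 ∙ n ∔ ν 2)))) ≡.refl n (T n)))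
    (dissected-split (2 + n * 5) (dissected-2 (2 + n * 5) ((5 * (T n + n * n) + (4 * n + 1))) _
      (expo n (25 * (n * n) + (20 * n + 7))
      (ℕ-solve 2 (λ n t → (ν 2 ∔ n ∙ ν 5) ∙ (ν 2 ∔ n ∙ ν 5) ∔ ((ν 2 ∔ n ∙ ν 5) ∔ ((ν 1 ∔ n ∙ ν 5) ∔ t)) ≐ (t ∔ ν 10 ∙ n) ∔ (ν 25 ∙ (n ∙ n) ∔ (ν 20 ∙ n ∔ ν 7))) ≡.refl n (T (n * 5)))
      (ℕ-solve 2 (λ n t → ν 25 ∙ t ∔ (ν 25 ∙ (n ∙ n) ∔ (ν 20 ∙ n ∔ ν 7)) ≐ ν 2 ∔ ν 5 ∙ ((ν 5 ∙ (t ∔ n ∙ n) ∔ (ν 4 ∙ n ∔ ν 1)))) ≡.refl n (T n)))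
    (dissected-0 (2 + n * 5) ((5 * (T n + n * n) + (3 * n + 1))) _
      (expo n (25 * (n * n) + (15 * n + 5))
      (ℕ-solve 2 (λ n t → ((ν 1 ∔ n ∙ ν 5) ∔ t) ∔ (ν 2 ∔ n ∙ ν 5) ∙ (ν 2 ∔ n ∙ ν 5) ≐ (t ∔ ν 10 ∙ n) ∔ (ν 25 ∙ (n ∙ n) ∔ (ν 15 ∙ n ∔ ν 5))) ≡.refl n (T (n * 5)))
      (ℕ-solve 2 (λ n t → ν 25 ∙ t ∔ (ν 25 ∙ (n ∙ n) ∔ (ν 15 ∙ n ∔ ν 5)) ≐ ν 5 ∙ ((ν 5 ∙ (t ∔ n ∙ n) ∔ (ν 3 ∙ n ∔ ν 1)))) ≡.refl n (T n)))
    ((pent-dissected n)))))))))))))))))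
    where
    h-step : ⊖ dil 5 (pent n) ⊕ sgn (4 + n * 5) ⊗ q ↑ (5 * ω⁻ (suc n)) ⊕ sgn (6 + n * 5) ⊗ q ↑ (5 * ω⁺ (suc n)) ≋ ⊖ dil 5 (pent (suc n))
    h-step = begin
      ⊖ dil 5 (pent n) ⊕ sgn (4 + n * 5) ⊗ x ⊕ sgn (6 + n * 5) ⊗ y
        ≈⟨ solve 4 (λ p s x y → :- p :+ (:- con (+ 1) :* (:- con (+ 1) :* (:- con (+ 1) :* (:- con (+ 1) :* s)))) :* x
               :+ (:- con (+ 1) :* (:- con (+ 1) :* (:- con (+ 1) :* (:- con (+ 1) :* (:- con (+ 1) :* (:- con (+ 1) :* s)))))) :* y
             := :- (p :+ ((:- con (+ 1) :* s) :* x :+ (:- con (+ 1) :* s) :* y))) refl (dil 5 (pent n)) (sgn (n * 5)) x y ⟩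
      ⊖ (dil 5 (pent n) ⊕ (sgn (1 + n * 5) ⊗ x ⊕ sgn (1 + n * 5) ⊗ y))
        ≈⟨ ⊖-cong (⊕-congˡ {dil 5 (pent n)} (⊕-cong
             (trans (⊗-congʳ {x} (⊗-congˡ {⊖ 1#} (sgn-*5 n))) (sym (dil5-monomial (suc n) (ω⁻ (suc n)))))
             (trans (⊗-congʳ {y} (⊗-congˡ {⊖ 1#} (sgn-*5 n))) (sym (dil5-monomial (suc n) (ω⁺ (suc n))))))) ⟩
      ⊖ (dil 5 (pent n) ⊕ (dil 5 (sgn (suc n) ⊗ q ↑ ω⁻ (suc n)) ⊕ dil 5 (sgn (suc n) ⊗ q ↑ ω⁺ (suc n))))
        ≈⟨ ⊖-cong (⊕-congˡ {dil 5 (pent n)} (trans (sym (dil-⊕ 5 (sgn (suc n) ⊗ q ↑ ω⁻ (suc n)) (sgn (suc n) ⊗ q ↑ ω⁺ (suc n))))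
             (dil-cong 5 (sym (⊗-distribˡ (sgn (suc n)) (q ↑ ω⁻ (suc n)) (q ↑ ω⁺ (suc n))))))) ⟩
      ⊖ (dil 5 (pent n) ⊕ dil 5 (sgn (suc n) ⊗ (q ↑ ω⁻ (suc n) ⊕ q ↑ ω⁺ (suc n))))
        ≈⟨ ⊖-cong (dil-⊕ 5 (pent n) (sgn (suc n) ⊗ (q ↑ ω⁻ (suc n) ⊕ q ↑ ω⁺ (suc n)))) ⟨
      ⊖ dil 5 (pent (suc n)) ∎
      where
      open ≈-Reasoning
      x = q ↑ (5 * ω⁻ (suc n))
      y = q ↑ (5 * ω⁺ (suc n))

  -- The coefficients of E at 5n and at 5n + 2. The factor q³ moves the second class onto multiples
  -- of 5, and `tail` drops the zero coefficient this creates.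
  e₀ e₂ : Series
  e₀ = section 5 E
  e₂ = tail (section 5 (q ↑ 3 ⊗ E))

  ProductRelation : Set
  ProductRelation = e₀ ⊗ e₂ ≋ ⊖ (dil 5 E ⊗ dil 5 E)

  E-dissected : E ≋ dil 5 e₀ ⊝ q ⊗ dil 5 (dil 5 E) ⊕ q ↑ 2 ⊗ dil 5 e₂
  -- The index is 1 + N because `b` is recovered from q ⊗ `b`, and dividing by q costs one
  -- coefficient.
  E-dissected = ≋[]⇒≋ λ N → approx N (pent-dissected (1 + N))
    where
    section-≋[] : ∀ N {f g} → f ≋[ N * 5 ] g → section 5 f ≋[ N ] section 5 g
    section-≋[] N e n n<N = e (n * 5) (ℕP.*-monoˡ-< 5 n<N)
    approx : ∀ N → Dissected (pent (1 + (1 + N) * 5)) (⊖ dil 5 (pent (1 + N))) →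
      E ≋[ N ] dil 5 e₀ ⊝ q ⊗ dil 5 (dil 5 E) ⊕ q ↑ 2 ⊗ dil 5 e₂
    approx N (a , b , eq) = ≋[]-trans (≋[]-weaken N≤ (≋[]-sym p≋E)) (≋[]-trans (≋⇒≋[] {p} eq)
      (≋[]-⊕ (≋[]-⊕ (dil-≋[] 4 a≋) (≋[]-trans (≋[]-⊗ (≋⇒≋[] {q} (refl {q})) (dil-≋[] 4 h≋))
          (≋⇒≋[] {q ⊗ dil 5 (⊖ dil 5 E)} {⊖ (q ⊗ dil 5 (dil 5 E))} (trans (⊗-congˡ {q} (Hom.⟪⟫-⊖ (dilHom 5) (dil 5 E)))
            (solve 2 (λ q x → q :* (:- x) := :- (q :* x)) refl q (dil 5 (dil 5 E)))))))
        (≋[]-⊗ (≋⇒≋[] {q ↑ 2} (refl {q ↑ 2})) (dil-≋[] 4 b≋))))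
      where
      p = pent (1 + (1 + N) * 5)
      N≤ : N ≤ (1 + N) * 5
      N≤ = ℕP.≤-trans (ℕP.n≤1+n N) (ℕP.m≤m*n (1 + N) 5)
      p≋E : p ≋[ (1 + N) * 5 ] E
      p≋E = ≋[]-weaken (ℕP.≤-trans (ℕP.n≤1+n _) (ℕP.n≤1+n _)) (pent≋[]E (1 + (1 + N) * 5))
      h≋ : ⊖ dil 5 (pent (1 + N)) ≋[ N ] ⊖ dil 5 E
      h≋ n n<N = 𝕂⊖ (dil-≋[] 4 (≋[]-weaken (ℕP.≤-trans (ℕP.n≤1+n N) (ℕP.n≤1+n _)) (pent≋[]E (1 + N))) n n<N)
        where 𝕂⊖ = RingKit.⊖-cong K
      eq′ : p ≋ dil 5 a ⊕ q ↑ 1 ⊗ dil 5 (⊖ dil 5 (pent (1 + N))) ⊕ q ↑ 2 ⊗ dil 5 b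
      eq′ = trans eq (⊕-congʳ {q ↑ 2 ⊗ dil 5 b} (⊕-congˡ {dil 5 a} (⊗-congʳ (sym (⊗-identityʳ q)))))
      a≋ : a ≋[ N ] e₀
      a≋ = ≋[]-trans (≋⇒≋[] {a} {section 5 p} (sym (begin
          section 5 p
            ≈⟨ (λ n → eq′ (n * 5)) ⟩
          section 5 (dil 5 a) ⊕ section 5 (q ↑ 1 ⊗ dil 5 (⊖ dil 5 (pent (1 + N)))) ⊕ section 5 (q ↑ 2 ⊗ dil 5 b)
            ≈⟨ ⊕-cong (⊕-cong (section-dil 4 a) (section-q↑⊗dil 4 1 _ (from-no (5 ∣? 1))))
                 (section-q↑⊗dil 4 2 b (from-no (5 ∣? 2))) ⟩
          a ⊕ 0# ⊕ 0#
            ≈⟨ solve 1 (λ a → a :+ con (+ 0) :+ con (+ 0) := a) refl a ⟩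
          a ∎)))
        (≋[]-weaken (ℕP.n≤1+n N) (section-≋[] (1 + N) p≋E))
        where open ≈-Reasoning
      qb≋ : q ⊗ b ≋[ suc N ] section 5 (q ↑ 3 ⊗ E)
      qb≋ = ≋[]-trans (≋⇒≋[] {q ⊗ b} {section 5 (q ↑ 3 ⊗ p)} (sym (begin
          section 5 (q ↑ 3 ⊗ p)
            ≈⟨ (λ n → trans (⊗-congˡ {q ↑ 3} eq′) (solve 4 (λ q a h b → q :^ 3 :* (a :+ q :^ 1 :* h :+ q :^ 2 :* b) := q :^ 3 :* a :+ q :^ 4 :* h :+ q :^ 5 :* b)
                refl q (dil 5 a) (dil 5 (⊖ dil 5 (pent (1 + N)))) (dil 5 b)) (n * 5)) ⟩
          section 5 (q ↑ 3 ⊗ dil 5 a) ⊕ section 5 (q ↑ 4 ⊗ dil 5 (⊖ dil 5 (pent (1 + N)))) ⊕ section 5 (q ↑ 5 ⊗ dil 5 b)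
            ≈⟨ ⊕-cong (⊕-cong (section-q↑⊗dil 4 3 a (from-no (5 ∣? 3)))
                 (section-q↑⊗dil 4 4 _ (from-no (5 ∣? 4))))
                 (trans (section-q↑⊗ 4 (dil 5 b)) (⊗-congˡ {q} (section-dil 4 b))) ⟩
          0# ⊕ 0# ⊕ q ⊗ b
            ≈⟨ solve 1 (λ x → con (+ 0) :+ con (+ 0) :+ x := x) refl (q ⊗ b) ⟩
          q ⊗ b ∎)))
        (section-≋[] (1 + N) (≋[]-⊗ (≋⇒≋[] {q ↑ 3} (refl {q ↑ 3})) p≋E))
        where open ≈-Reasoning
      b≋ : b ≋[ N ] e₂
      b≋ n n<N = RingKit.trans K (RingKit.sym K (q⊗-suc b n)) (qb≋ (suc n) (s≤s n<N))

-- Jacobi's series for E³ and the product e₀ e₂.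

-- T(k+5) = T k + 5(k+3), so five cases suffice. Conceptually, 8T + 1 is a square, and T ≡ 2 would
-- make it ≡ 2, a non-square modulo 5.
T-mod-5 : ∀ k → ∃ λ i → (T k ≡ 5 * i) ⊎ (T k ≡ 1 + 5 * i) ⊎ (T k ≡ 3 + 5 * i)
T-mod-5 0 = 0 , inj₁ ≡.refl
T-mod-5 1 = 0 , inj₂ (inj₁ ≡.refl)
T-mod-5 2 = 0 , inj₂ (inj₂ ≡.refl)
T-mod-5 3 = 1 , inj₂ (inj₁ ≡.refl)
T-mod-5 4 = 2 , inj₁ ≡.refl
T-mod-5 (suc (suc (suc (suc (suc k))))) with T-mod-5 k
... | i , inj₁ e = i + (k + 3) , inj₁ (≡.trans (≡.cong (λ t → 5 + k + (4 + k + (3 + k + (2 + k + (1 + k + t))))) e)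
  (ℕ-solve 2 (λ k i → (ν 5 ∔ k) ∔ ((ν 4 ∔ k) ∔ ((ν 3 ∔ k) ∔ ((ν 2 ∔ k) ∔ ((ν 1 ∔ k) ∔ ν 5 ∙ i)))) ≐ ν 5 ∙ (i ∔ (k ∔ ν 3))) ≡.refl k i))
... | i , inj₂ (inj₁ e) = i + (k + 3) , inj₂ (inj₁ (≡.trans (≡.cong (λ t → 5 + k + (4 + k + (3 + k + (2 + k + (1 + k + t))))) e)
  (ℕ-solve 2 (λ k i → (ν 5 ∔ k) ∔ ((ν 4 ∔ k) ∔ ((ν 3 ∔ k) ∔ ((ν 2 ∔ k) ∔ ((ν 1 ∔ k) ∔ (ν 1 ∔ ν 5 ∙ i))))) ≐ ν 1 ∔ ν 5 ∙ (i ∔ (k ∔ ν 3))) ≡.refl k i)))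
... | i , inj₂ (inj₂ e) = i + (k + 3) , inj₂ (inj₂ (≡.trans (≡.cong (λ t → 5 + k + (4 + k + (3 + k + (2 + k + (1 + k + t))))) e)
  (ℕ-solve 2 (λ k i → (ν 5 ∔ k) ∔ ((ν 4 ∔ k) ∔ ((ν 3 ∔ k) ∔ ((ν 2 ∔ k) ∔ ((ν 1 ∔ k) ∔ (ν 3 ∔ ν 5 ∙ i))))) ≐ ν 3 ∔ ν 5 ∙ (i ∔ (k ∔ ν 3))) ≡.refl k i)))

T≢2mod5 : ∀ k n → ¬ (T k ≡ 2 + n * 5)
T≢2mod5 k n e = cases (T-mod-5 k)
  where
  residue : ∀ c i → T k ≡ c + 5 * i → c ÷.% 5 ≡ 2
  residue c i e′ = ≡.trans (≡.sym (÷.[m+kn]%n≡m%n c i 5)) (≡.trans (≡.cong (÷._% 5)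
    (≡.trans (≡.cong (λ m → c + m) (ℕP.*-comm i 5)) (≡.trans (≡.sym e′) e))) (÷.[m+kn]%n≡m%n 2 n 5))
  cases : (∃ λ i → (T k ≡ 5 * i) ⊎ (T k ≡ 1 + 5 * i) ⊎ (T k ≡ 3 + 5 * i)) → ⊥
  cases (i , inj₁ e′)        = contradiction (residue 0 i e′) λ ()
  cases (i , inj₂ (inj₁ e′)) = contradiction (residue 1 i e′) λ ()
  cases (i , inj₂ (inj₂ e′)) = contradiction (residue 3 i e′) λ ()

k≤T : ∀ k → k ≤ T k
k≤T zero = z≤n
k≤T (suc k) = ℕP.m≤m+n (suc k) (T k)

module JacobiCube (K : CommutativeRing 0ℓ 0ℓ) where
  private module K = RingKit K
  open PowerSeries K hiding (module 𝕊)
  open SeriesMaps K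
  open EulerProduct K
  open Pentagonal K
  open RingKit seriesRing

  -- φ n k is the coefficient of z^k in (1 − z) ∏_{1 ≤ i ≤ n} (1 − z q^i)(1 − z⁻¹ q^i); the coefficient of z^{-1} is − φ n 0.
  φ : ℕ → ℕ → Series
  φ zero zero = 1#
  φ zero (suc k) = 0#
  φ (suc n) zero = (1# ⊕ q ↑ suc n ⊗ q ↑ suc n) ⊗ φ n 0 ⊝ q ↑ suc n ⊗ (φ n 1 ⊝ φ n 0)
  φ (suc n) (suc k) = (1# ⊕ q ↑ suc n ⊗ q ↑ suc n) ⊗ φ n (suc k) ⊝ q ↑ suc n ⊗ (φ n k ⊕ φ n (suc (suc k)))

  φ-> : ∀ n k → n < k → φ n k ≋ 0#
  φ-> zero (suc k) _ = refl {0#}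
  φ-> (suc n) (suc k) (s≤s n<k) = trans
    (⊕-cong (⊗-congˡ {1# ⊕ q ↑ suc n ⊗ q ↑ suc n} (φ-> n (suc k) (ℕP.m≤n⇒m≤1+n n<k)))
      (⊖-cong (⊗-congˡ {q ↑ suc n} (⊕-cong (φ-> n k n<k) (φ-> n (suc (suc k)) (ℕP.m≤n⇒m≤1+n (ℕP.m≤n⇒m≤1+n n<k)))))))
    (solve 1 (λ q → (con (+ 1) :+ q :* q) :* con (+ 0) :- q :* (con (+ 0) :+ con (+ 0)) := con (+ 0)) refl (q ↑ suc n))

  odd : ℕ → Series
  odd zero = 1#
  odd (suc k) = odd k ⊕ 1# ⊕ 1#

  oddSum : ℕ → ℕ → Series
  oddSum n zero = φ n 0
  oddSum n (suc k) = oddSum n k ⊕ odd (suc k) ⊗ φ n (suc k)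

  -- Multiplication by (1 - zx)(1 - z⁻¹x) with x = q^(n+1) scales the weighted sum by its value (1 -
  -- x)² at z = 1. The other two summands are boundary terms from cutting the sum at k.
  oddSum-step : ∀ n k → oddSum (suc n) k ≋
    factor (suc n) ⊗ factor (suc n) ⊗ oddSum n k ⊝ q ↑ suc n ⊗ odd k ⊗ φ n (suc k) ⊕ q ↑ suc n ⊗ odd (suc k) ⊗ φ n k
  oddSum-step n zero = solve 3 (λ q a b → (con (+ 1) :+ q :* q) :* a :- q :* (b :- a)
      := (con (+ 1) :- q) :* (con (+ 1) :- q) :* a :- q :* con (+ 1) :* b :+ q :* (con (+ 1) :+ con (+ 1) :+ con (+ 1)) :* a) refl
    (q ↑ suc n) (φ n 0) (φ n 1)
  oddSum-step n (suc k) = trans (⊕-congʳ {odd (suc k) ⊗ φ (suc n) (suc k)} (oddSum-step n k))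
    (solve 6 (λ q S o a b c → (con (+ 1) :- q) :* (con (+ 1) :- q) :* S :- q :* o :* b :+ q :* (o :+ con (+ 1) :+ con (+ 1)) :* a
        :+ (o :+ con (+ 1) :+ con (+ 1)) :* ((con (+ 1) :+ q :* q) :* b :- q :* (a :+ c))
      := (con (+ 1) :- q) :* (con (+ 1) :- q) :* (S :+ (o :+ con (+ 1) :+ con (+ 1)) :* b) :- q :* (o :+ con (+ 1) :+ con (+ 1)) :* c
        :+ q :* (o :+ con (+ 1) :+ con (+ 1) :+ con (+ 1) :+ con (+ 1)) :* b) refl
    (q ↑ suc n) (oddSum n k) (odd k) (φ n k) (φ n (suc k)) (φ n (suc (suc k))))

  -- For symmetric g, the coefficients of (1 - z⁻¹) g(z) at z^k and z^(-k-1) are opposite, and its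
  -- derivative at z = 1 is g(1). Pairing these terms yields the weights 2k + 1 and the value g(1) =
  -- (Q n)².
  oddSum≋Q² : ∀ n → oddSum n n ≋ Q n ⊗ Q n
  oddSum≋Q² zero = sym (⊗-identityˡ 1#)
  oddSum≋Q² (suc n) = begin
    oddSum (suc n) (suc n)
      ≈⟨ oddSum-step n (suc n) ⟩
    F ⊗ F ⊗ (oddSum n n ⊕ odd (suc n) ⊗ φ n (suc n)) ⊝ q ↑ suc n ⊗ odd (suc n) ⊗ φ n (suc (suc n)) ⊕ q ↑ suc n ⊗ odd (suc (suc n)) ⊗ φ n (suc n)
      ≈⟨ ⊕-cong (⊕-cong (⊗-congˡ {F ⊗ F} (⊕-cong (oddSum≋Q² n) (⊗-congˡ {odd (suc n)} φ₁))) (⊖-cong (⊗-congˡ {q ↑ suc n ⊗ odd (suc n)} φ₂)))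
           (⊗-congˡ {q ↑ suc n ⊗ odd (suc (suc n))} φ₁) ⟩
    F ⊗ F ⊗ (Q n ⊗ Q n ⊕ odd (suc n) ⊗ 0#) ⊝ q ↑ suc n ⊗ odd (suc n) ⊗ 0# ⊕ q ↑ suc n ⊗ odd (suc (suc n)) ⊗ 0#
      ≈⟨ solve 5 (λ f p o q o′ → f :* f :* (p :* p :+ o :* con (+ 0)) :- q :* o :* con (+ 0) :+ q :* o′ :* con (+ 0) := (p :* f) :* (p :* f)) refl
           F (Q n) (odd (suc n)) (q ↑ suc n) (odd (suc (suc n))) ⟩
    Q (suc n) ⊗ Q (suc n) ∎
    where
    open ≈-Reasoning
    F = factor (suc n)
    φ₁ = φ-> n (suc n) ℕP.≤-refl
    φ₂ = φ-> n (suc (suc n)) (ℕP.n≤1+n (suc n))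

  monomial : ℕ → Series
  monomial k = sgn k ⊗ q ↑ T k

  monomial-suc : ∀ k → monomial (suc k) ≋ ⊖ (monomial k ⊗ q ↑ suc k)
  monomial-suc k = trans (⊗-congˡ {sgn (suc k)} (↑-homo-⊗ q (suc k) (T k)))
    (solve 3 (λ s a b → (:- con (+ 1) :* s) :* (a :* b) := :- (s :* b :* a)) refl (sgn k) (q ↑ suc k) (q ↑ T k))

  φ-diag : ∀ n → φ n n ≋ monomial n
  φ-diag zero = sym (⊗-identityˡ 1#)
  φ-diag (suc n) = trans (⊕-cong (⊗-congˡ {1# ⊕ q ↑ suc n ⊗ q ↑ suc n} (φ-> n (suc n) ℕP.≤-refl))
      (⊖-cong (⊗-congˡ {q ↑ suc n} (⊕-cong (φ-diag n) (φ-> n (suc (suc n)) (ℕP.n≤1+n (suc n)))))))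
    (trans (solve 2 (λ q m → (con (+ 1) :+ q :* q) :* con (+ 0) :- q :* (m :+ con (+ 0)) := :- (m :* q)) refl (q ↑ suc n) (monomial n))
      (sym (monomial-suc n)))

  private
    q↑-≡-⊗ : ∀ a b c d → a + b ≡ c + d → q ↑ a ⊗ q ↑ b ≋ q ↑ c ⊗ q ↑ d
    q↑-≡-⊗ a b c d e = trans (sym (↑-homo-⊗ q a b)) (trans (reflexive (≡.cong (q ↑_) e)) (↑-homo-⊗ q c d))

  -- The finite Jacobi triple product reads Closed n j k, with j = n − k: φ n k = (−1)^k q^{T k} Q (2n+1) / (Q (n−k) Q (n+k+1)).
  Closed : ℕ → ℕ → ℕ → Set
  Closed n j k = φ n k ⊗ Q j ⊗ Q (suc (n + k)) ≋ monomial k ⊗ Q (suc (n + n))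

  φ-closed-step : ∀ n j k → j + k ≡ n → (∀ j k → j + k ≡ n → Closed n j k) → Closed (suc n) (suc j) k
  φ-closed-step n j k ≡.refl φ-closed = begin
    φ (suc n) k ⊗ Q (suc j) ⊗ Q (suc (suc (n + k)))
      ≈⟨ split k ≡.refl ⟩
    (1# ⊕ x ⊗ x) ⊗ (φ n k ⊗ Y) ⊝ (x ⊗ left k ⊕ x ⊗ (φ n (suc k) ⊗ Y))
      ≈⟨ ⊕-cong (⊗-congˡ {1# ⊕ x ⊗ x} middle-eq) (⊖-cong (⊕-cong (left-eq k ≡.refl) (right-eq j ≡.refl))) ⟩
    (1# ⊕ x ⊗ x) ⊗ (M ⊗ P ⊗ ((1# ⊝ a) ⊗ (1# ⊝ b))) ⊝ (⊖ (M ⊗ P ⊗ ((a ⊝ x ⊗ x) ⊗ (1# ⊝ b))) ⊕ ⊖ (M ⊗ P ⊗ ((b ⊝ x ⊗ x) ⊗ (1# ⊝ a))))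
      -- Everything reduces to (1 + x²)(1 - a)(1 - b) + (a - x²)(1 - b) + (b - x²)(1 - a) = (1 -
      -- x²)(1 - ab); here x² = q^(2n+2) and ab = q^(2n+3) give the two new factors of Q(2n+3).
      ≈⟨ solve 4 (λ x m a b → (con (+ 1) :+ x :* x) :* (m :* ((con (+ 1) :- a) :* (con (+ 1) :- b)))
             :- (:- (m :* ((a :- x :* x) :* (con (+ 1) :- b))) :+ :- (m :* ((b :- x :* x) :* (con (+ 1) :- a))))
             := m :* ((con (+ 1) :- x :* x) :* (con (+ 1) :- a :* b))) refl x (M ⊗ P) a b ⟩
    M ⊗ P ⊗ ((1# ⊝ x ⊗ x) ⊗ (1# ⊝ a ⊗ b))
      ≈⟨ ⊗-congˡ {M ⊗ P} (⊗-cong (⊕-congˡ {1#} (⊖-cong (trans (sym (↑-homo-⊗ q (suc n) (suc n))) (reflexive (≡.cong (q ↑_) (≡.cong suc (ℕP.+-suc n n)))))))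
           (⊕-congˡ {1#} (⊖-cong (trans (sym (↑-homo-⊗ q (suc j) (suc (suc (n + k))))) (reflexive (≡.cong (q ↑_)
             (ℕ-solve 2 (λ j k → (ν 1 ∔ j) ∔ (ν 2 ∔ ((j ∔ k) ∔ k)) ≐ ν 3 ∔ ((j ∔ k) ∔ (j ∔ k))) ≡.refl j k))))))) ⟩
    M ⊗ P ⊗ (factor (suc (suc (n + n))) ⊗ factor (suc (suc (suc (n + n)))))
      ≈⟨ solve 4 (λ m p x y → m :* p :* (x :* y) := m :* (p :* x :* y)) refl M P (factor (suc (suc (n + n)))) (factor (suc (suc (suc (n + n))))) ⟩
    M ⊗ Q (suc (suc (suc (n + n))))
      ≡⟨ ≡.cong (λ i → M ⊗ Q (suc (suc i))) (ℕP.+-suc n n) ⟨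
    M ⊗ Q (suc (suc n + suc n)) ∎
    where
    open ≈-Reasoning
    x = q ↑ suc n
    Y = Q (suc j) ⊗ Q (suc (suc (n + k)))
    M = monomial k
    P = Q (suc (n + n))
    a = q ↑ suc j
    b = q ↑ suc (suc (n + k))
    left : ℕ → Series
    left zero = ⊖ (φ n 0 ⊗ Y)
    left (suc k′) = φ n k′ ⊗ Y
    split : ∀ k′ → k ≡ k′ → φ (suc n) k′ ⊗ Q (suc j) ⊗ Q (suc (suc (n + k))) ≋ (1# ⊕ x ⊗ x) ⊗ (φ n k′ ⊗ Y) ⊝ (x ⊗ left k′ ⊕ x ⊗ (φ n (suc k′) ⊗ Y))
    split zero _ = solve 5 (λ x u v y z → ((con (+ 1) :+ x :* x) :* u :- x :* (v :- u)) :* y :* z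
      := (con (+ 1) :+ x :* x) :* (u :* (y :* z)) :- (x :* (:- (u :* (y :* z))) :+ x :* (v :* (y :* z)))) refl x (φ n 0) (φ n 1) (Q (suc j)) (Q (suc (suc (n + k))))
    split (suc k′) _ = solve 6 (λ x u v w y z → ((con (+ 1) :+ x :* x) :* u :- x :* (w :+ v)) :* y :* z
      := (con (+ 1) :+ x :* x) :* (u :* (y :* z)) :- (x :* (w :* (y :* z)) :+ x :* (v :* (y :* z)))) refl x (φ n (suc k′)) (φ n (suc (suc k′))) (φ n k′) (Q (suc j)) (Q (suc (suc (n + k))))
    middle-eq : φ n k ⊗ Y ≋ M ⊗ P ⊗ ((1# ⊝ a) ⊗ (1# ⊝ b))
    middle-eq = trans
      (solve 5 (λ f x y a b → f :* ((x :* a) :* (y :* b)) := f :* x :* y :* (a :* b)) refl (φ n k) (Q j) (Q (suc (n + k))) (1# ⊝ a) (1# ⊝ b))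
      (⊗-congʳ {(1# ⊝ a) ⊗ (1# ⊝ b)} (φ-closed j k ≡.refl))
    left-eq : ∀ k′ → k ≡ k′ → x ⊗ left k′ ≋ ⊖ (M ⊗ P ⊗ ((a ⊝ x ⊗ x) ⊗ (1# ⊝ b)))
    left-eq zero ≡.refl = begin
      x ⊗ (⊖ (φ n 0 ⊗ Y))
        ≈⟨ ⊗-congˡ {x} (⊖-cong middle-eq) ⟩
      x ⊗ (⊖ (M ⊗ P ⊗ ((1# ⊝ a) ⊗ (1# ⊝ b))))
        ≈⟨ ⊗-congʳ x≋a ⟩
      a ⊗ (⊖ (M ⊗ P ⊗ ((1# ⊝ a) ⊗ (1# ⊝ b))))
        ≈⟨ solve 4 (λ m p a b → a :* (:- (m :* p :* ((con (+ 1) :- a) :* (con (+ 1) :- b)))) := :- (m :* p :* ((a :- a :* a) :* (con (+ 1) :- b)))) refl M P a b ⟩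
      ⊖ (M ⊗ P ⊗ ((a ⊝ a ⊗ a) ⊗ (1# ⊝ b)))
        ≈⟨ ⊖-cong (⊗-congˡ {M ⊗ P} (⊗-congʳ {1# ⊝ b} (⊕-congˡ {a} (⊖-cong (⊗-cong x≋a x≋a))))) ⟨
      ⊖ (M ⊗ P ⊗ ((a ⊝ x ⊗ x) ⊗ (1# ⊝ b))) ∎
      where
      x≋a : x ≋ a
      x≋a = reflexive (≡.cong (λ i → q ↑ suc i) (ℕP.+-identityʳ j))
    left-eq (suc k′) ≡.refl = begin
      x ⊗ (φ n k′ ⊗ (Q (suc j) ⊗ (Q (suc (n + suc k′)) ⊗ (1# ⊝ b))))
        ≡⟨ ≡.cong (λ i → x ⊗ (φ n k′ ⊗ (Q (suc j) ⊗ (Q (suc i) ⊗ (1# ⊝ b))))) (ℕP.+-suc n k′) ⟩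
      x ⊗ (φ n k′ ⊗ (Q (suc j) ⊗ (Q (suc (n + k′)) ⊗ (1# ⊝ c) ⊗ (1# ⊝ b))))
        ≈⟨ solve 6 (λ x f u v c b → x :* (f :* (u :* (v :* (con (+ 1) :- c) :* (con (+ 1) :- b)))) := x :* (f :* u :* v) :* ((con (+ 1) :- c) :* (con (+ 1) :- b))) refl
             x (φ n k′) (Q (suc j)) (Q (suc (n + k′))) c b ⟩
      x ⊗ (φ n k′ ⊗ Q (suc j) ⊗ Q (suc (n + k′))) ⊗ ((1# ⊝ c) ⊗ (1# ⊝ b))
        ≈⟨ ⊗-congʳ {(1# ⊝ c) ⊗ (1# ⊝ b)} (⊗-congˡ {x} (φ-closed (suc j) k′ (≡.sym (ℕP.+-suc j k′)))) ⟩
      x ⊗ (monomial k′ ⊗ P) ⊗ ((1# ⊝ c) ⊗ (1# ⊝ b))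
        ≈⟨ ⊗-congʳ {(1# ⊝ c) ⊗ (1# ⊝ b)} (⊗-congʳ {monomial k′ ⊗ P} (↑-homo-⊗ q (suc j) (suc k′))) ⟩
      a ⊗ q ↑ suc k′ ⊗ (monomial k′ ⊗ P) ⊗ ((1# ⊝ c) ⊗ (1# ⊝ b))
        ≈⟨ solve 6 (λ a r m p c b → a :* r :* (m :* p) :* ((con (+ 1) :- c) :* (con (+ 1) :- b)) := :- (:- (m :* r) :* p :* ((a :- a :* c) :* (con (+ 1) :- b)))) refl
             a (q ↑ suc k′) (monomial k′) P c b ⟩
      ⊖ (⊖ (monomial k′ ⊗ q ↑ suc k′) ⊗ P ⊗ ((a ⊝ a ⊗ c) ⊗ (1# ⊝ b)))
        ≈⟨ ⊖-cong (⊗-cong (⊗-congʳ {P} (sym (monomial-suc k′))) (⊗-congʳ {1# ⊝ b} (⊕-congˡ {a} (⊖-cong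
             (q↑-≡-⊗ (suc j) (suc (suc (n + k′))) (suc n) (suc n)
               (ℕ-solve 2 (λ j k → (ν 1 ∔ j) ∔ (ν 2 ∔ ((j ∔ (ν 1 ∔ k)) ∔ k)) ≐ (ν 1 ∔ (j ∔ (ν 1 ∔ k))) ∔ (ν 1 ∔ (j ∔ (ν 1 ∔ k)))) ≡.refl j k′)))))) ⟩
      ⊖ (M ⊗ P ⊗ ((a ⊝ x ⊗ x) ⊗ (1# ⊝ b))) ∎
      where c = q ↑ suc (suc (n + k′))
    right-eq : ∀ j′ → j ≡ j′ → x ⊗ (φ n (suc k) ⊗ Y) ≋ ⊖ (M ⊗ P ⊗ ((b ⊝ x ⊗ x) ⊗ (1# ⊝ a)))
    -- At the top index k = n the neighbour φ n (n+1) vanishes and b = x², so both sides are zero.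
    right-eq zero ≡.refl = begin
      x ⊗ (φ n (suc k) ⊗ Y)
        ≈⟨ ⊗-congˡ {x} (⊗-congʳ {Y} (φ-> n (suc k) ℕP.≤-refl)) ⟩
      x ⊗ (0# ⊗ Y)
        ≈⟨ solve 5 (λ x y m p a → x :* (con (+ 0) :* y) := :- (m :* p :* ((x :* x :- x :* x) :* (con (+ 1) :- a)))) refl x Y M P a ⟩
      ⊖ (M ⊗ P ⊗ ((x ⊗ x ⊝ x ⊗ x) ⊗ (1# ⊝ a)))
        ≈⟨ ⊖-cong (⊗-congˡ {M ⊗ P} (⊗-congʳ {1# ⊝ a} (⊕-congʳ {⊖ (x ⊗ x)} (trans (sym (↑-homo-⊗ q (suc n) (suc n)))
             (reflexive (≡.cong (λ i → q ↑ suc i) (ℕP.+-suc n n))))))) ⟩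
      ⊖ (M ⊗ P ⊗ ((b ⊝ x ⊗ x) ⊗ (1# ⊝ a))) ∎
    right-eq (suc j′) ≡.refl = begin
      x ⊗ (φ n (suc k) ⊗ (Q j ⊗ (1# ⊝ a) ⊗ Q (suc (suc (n + k)))))
        ≡⟨ ≡.cong (λ i → x ⊗ (φ n (suc k) ⊗ (Q j ⊗ (1# ⊝ a) ⊗ Q (suc i)))) (ℕP.+-suc n k) ⟨
      x ⊗ (φ n (suc k) ⊗ (Q (suc j′) ⊗ (1# ⊝ a) ⊗ Q (suc (n + suc k))))
        ≈⟨ solve 6 (λ x f u e a v → x :* (f :* (u :* (con (+ 1) :- e) :* (con (+ 1) :- a) :* v)) := x :* (f :* u :* v) :* ((con (+ 1) :- e) :* (con (+ 1) :- a))) refl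
             x (φ n (suc k)) (Q j′) e a (Q (suc (n + suc k))) ⟩
      x ⊗ (φ n (suc k) ⊗ Q j′ ⊗ Q (suc (n + suc k))) ⊗ ((1# ⊝ e) ⊗ (1# ⊝ a))
        ≈⟨ ⊗-congʳ {(1# ⊝ e) ⊗ (1# ⊝ a)} (⊗-congˡ {x} (φ-closed j′ (suc k) (ℕP.+-suc j′ k))) ⟩
      x ⊗ (monomial (suc k) ⊗ P) ⊗ ((1# ⊝ e) ⊗ (1# ⊝ a))
        ≈⟨ ⊗-congʳ {(1# ⊝ e) ⊗ (1# ⊝ a)} (⊗-congˡ {x} (⊗-congʳ {P} (monomial-suc k))) ⟩
      x ⊗ (⊖ (M ⊗ q ↑ suc k) ⊗ P) ⊗ ((1# ⊝ e) ⊗ (1# ⊝ a))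
        ≈⟨ solve 6 (λ x m r p e a → x :* (:- (m :* r) :* p) :* ((con (+ 1) :- e) :* (con (+ 1) :- a)) := :- (m :* p :* ((x :* r :- (x :* r) :* e) :* (con (+ 1) :- a)))) refl
             x M (q ↑ suc k) P e a ⟩
      ⊖ (M ⊗ P ⊗ ((x ⊗ q ↑ suc k ⊝ (x ⊗ q ↑ suc k) ⊗ e) ⊗ (1# ⊝ a)))
        ≈⟨ ⊖-cong (⊗-congˡ {M ⊗ P} (⊗-congʳ {1# ⊝ a} (⊕-cong xr≋b (⊖-cong (trans (⊗-congʳ {e} xr≋b)
             (q↑-≡-⊗ (suc (suc (n + k))) j (suc n) (suc n)
               (ℕ-solve 2 (λ j k → (ν 2 ∔ ((j ∔ k) ∔ k)) ∔ j ≐ (ν 1 ∔ (j ∔ k)) ∔ (ν 1 ∔ (j ∔ k))) ≡.refl j k))))))) ⟩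
      ⊖ (M ⊗ P ⊗ ((b ⊝ x ⊗ x) ⊗ (1# ⊝ a))) ∎
      where
      e = q ↑ j
      xr≋b : x ⊗ q ↑ suc k ≋ b
      xr≋b = trans (sym (↑-homo-⊗ q (suc n) (suc k))) (reflexive (≡.cong (λ i → q ↑ suc i) (ℕP.+-suc n k)))

  φ-closed : ∀ n j k → j + k ≡ n → Closed n j k
  φ-closed n zero k ≡.refl = ⊗-congʳ {Q (suc (n + n))} (trans (⊗-identityʳ (φ n n)) (φ-diag n))
  φ-closed (suc n) (suc j) k e = φ-closed-step n j k (ℕP.suc-injective e) (φ-closed n)

  Q⁻¹ : ℕ → Series
  Q⁻¹ n = partitions 0 n

  Q⁻¹⊗Q : ∀ n → Q⁻¹ n ⊗ Q n ≋ 1#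
  Q⁻¹⊗Q n = trans (⊗-congˡ {Q⁻¹ n} (sym (Qd-0 n))) (partitions-Qd 0 n)

  Q⁻¹≋[] : ∀ n N → N ≤ n → Q⁻¹ n ≋[ N ] D 0
  Q⁻¹≋[] n N N≤n = partitions≋[]D 0 n N N≤n

  sgn-⊗ : ∀ k f n → f n K.≈ K.0# → (sgn k ⊗ f) n K.≈ K.0#
  sgn-⊗ zero f n e = K.trans (⊗-identityˡ f n) e
  sgn-⊗ (suc k) f n e = K.trans (solve 2 (λ s f → (:- con (+ 1) :* s) :* f := :- (s :* f)) refl (sgn k) f n)
    (K.trans (K.⊖-cong (sgn-⊗ k f n e)) (K.trans (K.sym (K.⊕-identityˡ _)) (K.⊖-inverseʳ K.0#)))

  φ⊗E : ℕ → ℕ → Series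
  φ⊗E j k = Q (suc (j + k + (j + k))) ⊗ Q⁻¹ j ⊗ Q⁻¹ (suc (j + k + k)) ⊗ E

  φ⊗E-closed : ∀ j k → φ (j + k) k ⊗ E ≋ monomial k ⊗ φ⊗E j k
  φ⊗E-closed j k = begin
    f ⊗ E
      ≈⟨ solve 2 (λ f e → f :* e := f :* con (+ 1) :* con (+ 1) :* e) refl f E ⟩
    f ⊗ 1# ⊗ 1# ⊗ E
      ≈⟨ ⊗-congʳ {E} (⊗-cong (⊗-congˡ {f} (sym (Q⁻¹⊗Q j))) (sym (Q⁻¹⊗Q (suc (j + k + k))))) ⟩
    f ⊗ (i ⊗ Q j) ⊗ (i′ ⊗ Q (suc (j + k + k))) ⊗ E
      ≈⟨ solve 6 (λ f i q i′ q′ e → f :* (i :* q) :* (i′ :* q′) :* e := (f :* q :* q′) :* (i :* i′ :* e)) refl f i (Q j) i′ (Q (suc (j + k + k))) E ⟩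
    (f ⊗ Q j ⊗ Q (suc (j + k + k))) ⊗ (i ⊗ i′ ⊗ E)
      ≈⟨ ⊗-congʳ {i ⊗ i′ ⊗ E} (φ-closed (j + k) j k ≡.refl) ⟩
    (monomial k ⊗ Q (suc (j + k + (j + k)))) ⊗ (i ⊗ i′ ⊗ E)
      ≈⟨ solve 5 (λ m q i i′ e → (m :* q) :* (i :* i′ :* e) := m :* (q :* i :* i′ :* e)) refl (monomial k) (Q (suc (j + k + (j + k)))) i i′ E ⟩
    monomial k ⊗ φ⊗E j k ∎
    where
    open ≈-Reasoning
    f = φ (j + k) k
    i = Q⁻¹ j
    i′ = Q⁻¹ (suc (j + k + k))

  -- Modulo q^j the factor `Q` becomes E and both factors `Q⁻¹` become 1/E, which leaves E · E⁻¹ ·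
  -- E⁻¹ · E.
  φ⊗E≋[]1 : ∀ j k → φ⊗E j k ≋[ j ] 1#
  φ⊗E≋[]1 j k = ≋[]-trans
    (≋[]-⊗ (≋[]-⊗ (≋[]-⊗ (≋[]-weaken j≤₁ (Q≋[]E (suc (j + k + (j + k))))) (Q⁻¹≋[] j j ℕP.≤-refl)) (Q⁻¹≋[] (suc (j + k + k)) j j≤₂)) (≋⇒≋[] {E} (refl {E})))
    (≋⇒≋[] (trans (solve 2 (λ e d → e :* d :* d :* e := (d :* e) :* (d :* e)) refl E (D 0)) (trans (⊗-cong D0⊗E D0⊗E) (⊗-identityˡ 1#))))
    where
    j≤₁ : j ≤ suc (suc (j + k + (j + k)))
    j≤₁ = ℕP.≤-trans (ℕP.m≤m+n j k) (ℕP.≤-trans (ℕP.m≤m+n (j + k) (j + k)) (ℕP.≤-trans (ℕP.n≤1+n _) (ℕP.n≤1+n _)))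
    j≤₂ : j ≤ suc (j + k + k)
    j≤₂ = ℕP.≤-trans (ℕP.m≤m+n j k) (ℕP.≤-trans (ℕP.m≤m+n (j + k) k) (ℕP.n≤1+n _))

  -- Either M < j, and through order M the product is just the monomial with exponent T k; or j ≤ M,
  -- which forces k > M and hence T k > M.
  φ⊗E-vanish : ∀ M j k → M + suc M ≤ j + k → ¬ (T k ≡ M) → (φ (j + k) k ⊗ E) M K.≈ K.0#
  φ⊗E-vanish M j k 2M≤ T≢M = K.trans (φ⊗E-closed j k M) (K.trans (⊗-assoc (sgn k) (q ↑ T k) (φ⊗E j k) M) (sgn-⊗ k (q ↑ T k ⊗ φ⊗E j k) M (go (M <? j))))
    where
    go : Dec (M < j) → (q ↑ T k ⊗ φ⊗E j k) M K.≈ K.0#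
    go (yes M<j) = K.trans (≋[]-⊗ (≋⇒≋[] {q ↑ T k} (refl {q ↑ T k})) (φ⊗E≋[]1 j k) M M<j)
      (K.trans (⊗-identityʳ (q ↑ T k) M) (q↑-≢ (T k) M (λ e → T≢M (≡.sym e))))
    go (no M≮j) = q↑⊗-< (T k) (φ⊗E j k) M (ℕP.<-≤-trans (ℕP.+-cancelˡ-≤ M _ _ (ℕP.≤-trans 2M≤ (ℕP.+-monoˡ-≤ k (ℕP.≮⇒≥ M≮j)))) (k≤T k))

  -- The part of E³ = Σ (-1)^k (2k + 1) q^(T k) that concerns absent exponents. `Q n` with n = 2M +
  -- 1 replaces E in two of the three factors, and this n is large enough for `φ⊗E-vanish`.
  E³-vanish : ∀ M → (∀ k → ¬ (T k ≡ M)) → (E ⊗ E ⊗ E) M K.≈ K.0#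
  E³-vanish M T≢M = K.trans
    (≋[]-⊗ (≋[]-⊗ E≋Q E≋Q) (≋⇒≋[] {E} (refl {E})) M (s≤s (ℕP.m≤m+n M (suc M))))
    (K.trans (⊗-congʳ {E} (sym (oddSum≋Q² n)) M) (go n ℕP.≤-refl))
    where
    n = M + suc M
    E≋Q : E ≋[ suc n ] Q n
    E≋Q = ≋[]-sym (Q≋[]E n)
    summand : ∀ k → k ≤ n → (φ n k ⊗ E) M K.≈ K.0#
    summand k k≤n = ≡.subst (λ i → (φ i k ⊗ E) M K.≈ K.0#) (ℕP.m∸n+n≡m k≤n)
      (φ⊗E-vanish M (n ∸ k) k (ℕP.≤-reflexive (≡.sym (ℕP.m∸n+n≡m k≤n))) (T≢M k))
    odd-⊗ : ∀ k f → f M K.≈ K.0# → (odd k ⊗ f) M K.≈ K.0#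
    odd-⊗ zero f e = K.trans (⊗-identityˡ f M) e
    odd-⊗ (suc k) f e = K.trans (solve 2 (λ o f → (o :+ con (+ 1) :+ con (+ 1)) :* f := o :* f :+ f :+ f) refl (odd k) f M)
      (K.trans (K.⊕-cong (K.⊕-cong (odd-⊗ k f e) e) e) (K.trans (K.⊕-identityʳ _) (K.⊕-identityʳ _)))
    go : ∀ k → k ≤ n → (oddSum n k ⊗ E) M K.≈ K.0#
    go zero _ = summand 0 z≤n
    go (suc k) k<n = K.trans (trans (⊗-distribʳ E (oddSum n k) (odd (suc k) ⊗ φ n (suc k)))
        (⊕-congˡ {oddSum n k ⊗ E} (⊗-assoc (odd (suc k)) (φ n (suc k)) E)) M)
      (K.trans (K.⊕-cong (go k (ℕP.<⇒≤ k<n)) (odd-⊗ (suc k) (φ n (suc k) ⊗ E) (summand (suc k) k<n))) (K.⊕-identityʳ _))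

module Dissection (K : CommutativeRing 0ℓ 0ℓ)
  (3-cancel : ∀ x → RingKit._≈_ K (RingKit._⊗_ K (RingKit.int K (+ 3)) x) (RingKit.0# K) → RingKit._≈_ K x (RingKit.0# K)) where
  private module K = RingKit K
  open PowerSeries K hiding (module 𝕊)
  open SeriesMaps K
  open EulerProduct K
  open Pentagonal K
  open JacobiCube K
  open RingKit seriesRing

  -- Over any ring a series with constant coefficient 1 is no zero divisor: the coefficients of g
  -- vanish one after another.
  monic-cancel : ∀ f g → f 0 K.≈ K.1# → f ⊗ g ≋ 0# → g ≋ 0#
  monic-cancel f g f₀≈1 fg≈0 = ≋[]⇒≋ go
    where
    at-0 : ∀ x → f 0 K.⊗ x K.≈ K.0# → x K.≈ K.0#
    at-0 x e = K.trans (K.trans (K.sym (K.⊗-identityˡ x)) (K.⊗-congʳ (K.sym f₀≈1))) e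
    go : ∀ N → g ≋[ N ] 0#
    go zero n ()
    go (suc N) n n<N with ℕP.m≤n⇒m<n∨m≡n (ℕP.≤-pred n<N)
    ... | inj₁ n<N′ = go N n n<N′
    go (suc zero) _ _ | inj₂ ≡.refl = at-0 _ (fg≈0 0)
    go (suc (suc N)) _ _ | inj₂ ≡.refl = at-0 _ (K.trans (K.sym (K.⊕-identityʳ _)) (K.trans
      (K.⊕-congˡ (K.sym (K.trans (mul-cong≤ N {tail f} {tail f} (λ _ _ → K.refl) (λ i i≤N → go (suc N) i (s≤s i≤N)))
        (⊗-zeroʳ (tail f) N)))) (fg≈0 (suc N))))

  E-0 : E 0 K.≈ K.1#
  E-0 = K.refl

  -- The class of 2 modulo 5 in E³ is 3 e₀ (e₀ e₂ + E(q⁵)²) up to the variable, and it vanishes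
  -- since no triangular number is ≡ 2. The factor e₀ cancels over any ring; the factor 3 cancels by
  -- hypothesis.
  e₀⊗e₂ : e₀ ⊗ e₂ ≋ ⊖ (dil 5 E ⊗ dil 5 E)
  e₀⊗e₂ = begin
    e₀ ⊗ e₂                       ≈⟨ solve 2 (λ x y → x := x :+ y :- y) refl (e₀ ⊗ e₂) (G ⊗ G) ⟩
    e₀ ⊗ e₂ ⊕ G ⊗ G ⊝ G ⊗ G       ≈⟨ ⊕-congʳ {⊖ (G ⊗ G)} (monic-cancel e₀ (e₀ ⊗ e₂ ⊕ G ⊗ G) E-0 class-2) ⟩
    0# ⊝ G ⊗ G                    ≈⟨ ⊕-identityˡ (⊖ (G ⊗ G)) ⟩
    ⊖ (G ⊗ G) ∎
    where
    open ≈-Reasoning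
    G = dil 5 E
    A = dil 5 e₀
    B = dil 5 G
    C = dil 5 e₂
    -- As in the definition of `e₂`, the factor q³ moves the class of 2 onto multiples of 5.
    E³-class : section 5 (q ↑ 3 ⊗ (E ⊗ E ⊗ E)) ≋ 0#
    E³-class zero = q↑⊗-< 3 (E ⊗ E ⊗ E) 0 (s≤s z≤n)
    E³-class (suc n) = K.trans (q↑⊗-+ 3 (E ⊗ E ⊗ E) (2 + n * 5)) (E³-vanish (2 + n * 5) (λ k → T≢2mod5 k n))
    dil3 : ∀ a b c → dil 5 (a ⊗ b ⊗ c) ≋ dil 5 a ⊗ dil 5 b ⊗ dil 5 c
    dil3 a b c = trans (dil-⊗ 5 (a ⊗ b) c) (⊗-congʳ {dil 5 c} (dil-⊗ 5 a b))
    part : ∀ j a b c → ¬ (5 ∣ j) → section 5 (q ↑ j ⊗ (dil 5 a ⊗ dil 5 b ⊗ dil 5 c)) ≋ 0#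
    part j a b c 5∤j = trans (λ n → ⊗-congˡ {q ↑ j} (sym (dil3 a b c)) (n * 5)) (section-q↑⊗dil 4 j (a ⊗ b ⊗ c) 5∤j)
    part5 : ∀ a b c → section 5 (q ↑ 5 ⊗ (dil 5 a ⊗ dil 5 b ⊗ dil 5 c)) ≋ q ⊗ (a ⊗ b ⊗ c)
    part5 a b c = trans (λ n → ⊗-congˡ {q ↑ 5} (sym (dil3 a b c)) (n * 5)) (trans (section-q↑⊗ 4 (dil 5 (a ⊗ b ⊗ c))) (⊗-congˡ {q} (section-dil 4 (a ⊗ b ⊗ c))))
    w : ℕ → Series → Series → Series → Series
    w j x y z = q ↑ j ⊗ (x ⊗ y ⊗ z)
    t6 = w 6 A B C ⊕ w 6 A B C ⊕ w 6 A B C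
    expansion : q ↑ 3 ⊗ (E ⊗ E ⊗ E) ≋
      w 3 A A A ⊝ (w 4 A A B ⊕ w 4 A A B ⊕ w 4 A A B)
      ⊕ (w 5 A B B ⊕ w 5 A B B ⊕ w 5 A B B ⊕ (w 5 A A C ⊕ w 5 A A C ⊕ w 5 A A C))
      ⊝ (w 6 B B B ⊕ (w 6 A B C ⊕ w 6 A B C ⊕ w 6 A B C) ⊕ (w 6 A B C ⊕ w 6 A B C ⊕ w 6 A B C))
      ⊕ (w 7 B B C ⊕ w 7 B B C ⊕ w 7 B B C ⊕ (w 7 A C C ⊕ w 7 A C C ⊕ w 7 A C C))
      ⊝ (w 8 B C C ⊕ w 8 B C C ⊕ w 8 B C C) ⊕ w 9 C C C
    expansion = trans (⊗-congˡ {q ↑ 3} (⊗-cong (⊗-cong E-dissected E-dissected) E-dissected))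
      (solve 4 (λ q A B C → let e = A :- q :* B :+ q :^ 2 :* C ; w = λ j x y z → q :^ j :* (x :* y :* z) in
        q :^ 3 :* (e :* e :* e) :=
        w 3 A A A :- (w 4 A A B :+ w 4 A A B :+ w 4 A A B)
        :+ (w 5 A B B :+ w 5 A B B :+ w 5 A B B :+ (w 5 A A C :+ w 5 A A C :+ w 5 A A C))
        :- (w 6 B B B :+ (w 6 A B C :+ w 6 A B C :+ w 6 A B C) :+ (w 6 A B C :+ w 6 A B C :+ w 6 A B C))
        :+ (w 7 B B C :+ w 7 B B C :+ w 7 B B C :+ (w 7 A C C :+ w 7 A C C :+ w 7 A C C))
        :- (w 8 B C C :+ w 8 B C C :+ w 8 B C C) :+ w 9 C C C) refl q A B C)
    triple : ∀ f → section 5 f ≋ 0# → section 5 (f ⊕ f ⊕ f) ≋ 0#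
    triple f e = trans (⊕-cong (⊕-cong e e) e) (solve 0 (con (+ 0) :+ con (+ 0) :+ con (+ 0) := con (+ 0)) refl)
    zero₂ : ∀ f g → section 5 f ≋ 0# → section 5 g ≋ 0# → section 5 (f ⊕ g) ≋ 0#
    zero₂ f g e e′ = trans (⊕-cong e e′) (⊕-identityˡ 0#)
    class-sum : section 5 (q ↑ 3 ⊗ (E ⊗ E ⊗ E)) ≋
      0# ⊝ 0# ⊕ (q ⊗ (e₀ ⊗ G ⊗ G) ⊕ q ⊗ (e₀ ⊗ G ⊗ G) ⊕ q ⊗ (e₀ ⊗ G ⊗ G) ⊕ (q ⊗ (e₀ ⊗ e₀ ⊗ e₂) ⊕ q ⊗ (e₀ ⊗ e₀ ⊗ e₂) ⊕ q ⊗ (e₀ ⊗ e₀ ⊗ e₂)))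
      ⊝ 0# ⊕ 0# ⊝ 0# ⊕ 0#
    class-sum = trans (λ n → expansion (n * 5))
      (⊕-cong (⊕-cong (⊕-cong (⊕-cong (⊕-cong (⊕-cong
        (part 3 e₀ e₀ e₀ (from-no (5 ∣? 3)))
        (⊖-cong (triple (w 4 A A B) (part 4 e₀ e₀ G (from-no (5 ∣? 4))))))
        (⊕-cong (⊕-cong (⊕-cong (part5 e₀ G G) (part5 e₀ G G)) (part5 e₀ G G)) (⊕-cong (⊕-cong (part5 e₀ e₀ e₂) (part5 e₀ e₀ e₂)) (part5 e₀ e₀ e₂))))
        (⊖-cong (zero₂ (w 6 B B B ⊕ t6) t6 (zero₂ (w 6 B B B) t6 (part 6 G G G (from-no (5 ∣? 6))) (triple (w 6 A B C) (part 6 e₀ G e₂ (from-no (5 ∣? 6))))) (triple (w 6 A B C) (part 6 e₀ G e₂ (from-no (5 ∣? 6)))))))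
        (zero₂ (w 7 B B C ⊕ w 7 B B C ⊕ w 7 B B C) (w 7 A C C ⊕ w 7 A C C ⊕ w 7 A C C) (triple (w 7 B B C) (part 7 G G e₂ (from-no (5 ∣? 7)))) (triple (w 7 A C C) (part 7 e₀ e₂ e₂ (from-no (5 ∣? 7))))))
        (⊖-cong (triple (w 8 B C C) (part 8 G e₂ e₂ (from-no (5 ∣? 8))))))
        (part 9 e₂ e₂ e₂ (from-no (5 ∣? 9))))
    q3-zero : q ⊗ ((1# ⊕ 1# ⊕ 1#) ⊗ (e₀ ⊗ (e₀ ⊗ e₂ ⊕ G ⊗ G))) ≋ q ⊗ 0#
    q3-zero = trans (solve 4 (λ q a b c → q :* ((con (+ 1) :+ con (+ 1) :+ con (+ 1)) :* (a :* (a :* c :+ b :* b))) :=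
        con (+ 0) :- con (+ 0) :+ (q :* (a :* b :* b) :+ q :* (a :* b :* b) :+ q :* (a :* b :* b) :+ (q :* (a :* a :* c) :+ q :* (a :* a :* c) :+ q :* (a :* a :* c)))
        :- con (+ 0) :+ con (+ 0) :- con (+ 0) :+ con (+ 0)) refl q e₀ G e₂)
      (trans (sym class-sum) (trans E³-class (sym (⊗-zeroʳ q))))
    class-2 : e₀ ⊗ (e₀ ⊗ e₂ ⊕ G ⊗ G) ≋ 0#
    class-2 n = 3-cancel _ (K.trans
      (K.solve 1 (λ x → K.con (+ 3) K.:* x K.:= x K.:+ x K.:+ x) K.refl ((e₀ ⊗ (e₀ ⊗ e₂ ⊕ G ⊗ G)) n))
      (K.trans (solve 1 (λ x → x :+ x :+ x := (con (+ 1) :+ con (+ 1) :+ con (+ 1)) :* x) refl (e₀ ⊗ (e₀ ⊗ e₂ ⊕ G ⊗ G)) n) (q-cancel q3-zero n)))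

-- Fifth roots of unity, the norm of E and the quintic relation.

-- R[θ] with θ² = a θ + b; the pair (x , y) is x + y θ.
module QuadraticExtension (R : CommutativeRing 0ℓ 0ℓ) where
  open RingKit R

  module Adjoin (a b : Carrier) where
    private
      _≈²_ : Carrier × Carrier → Carrier × Carrier → Set
      (x , y) ≈² (u , v) = (x ≈ u) × (y ≈ v)

      _⊕²_ _⊗²_ : Carrier × Carrier → Carrier × Carrier → Carrier × Carrier
      (x , y) ⊕² (u , v) = x ⊕ u , y ⊕ v
      (x , y) ⊗² (u , v) = x ⊗ u ⊕ b ⊗ (y ⊗ v) , x ⊗ v ⊕ y ⊗ u ⊕ a ⊗ (y ⊗ v)

      ⊗²-comm : ∀ s t → (s ⊗² t) ≈² (t ⊗² s)
      ⊗²-comm (x , y) (u , v) =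
        solve 5 (λ x y u v b → x :* u :+ b :* (y :* v) := u :* x :+ b :* (v :* y)) refl x y u v b ,
        solve 5 (λ x y u v a → x :* v :+ y :* u :+ a :* (y :* v) := u :* y :+ v :* x :+ a :* (v :* y)) refl x y u v a

      ⊗²-assoc : ∀ r s t → ((r ⊗² s) ⊗² t) ≈² (r ⊗² (s ⊗² t))
      ⊗²-assoc (x , y) (u , v) (z , w) =
        solve 8 (λ x y u v z w a b → (x :* u :+ b :* (y :* v)) :* z :+ b :* ((x :* v :+ y :* u :+ a :* (y :* v)) :* w)
          := x :* (u :* z :+ b :* (v :* w)) :+ b :* (y :* (u :* w :+ v :* z :+ a :* (v :* w)))) refl x y u v z w a b ,
        solve 8 (λ x y u v z w a b → (x :* u :+ b :* (y :* v)) :* w :+ (x :* v :+ y :* u :+ a :* (y :* v)) :* z :+ a :* ((x :* v :+ y :* u :+ a :* (y :* v)) :* w)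
          := x :* (u :* w :+ v :* z :+ a :* (v :* w)) :+ y :* (u :* z :+ b :* (v :* w)) :+ a :* (y :* (u :* w :+ v :* z :+ a :* (v :* w)))) refl x y u v z w a b

      ⊗²-cong : ∀ {r s t w} → r ≈² s → t ≈² w → (r ⊗² t) ≈² (s ⊗² w)
      ⊗²-cong (e₁ , e₂) (e₃ , e₄) =
        ⊕-cong (⊗-cong e₁ e₃) (⊗-congˡ (⊗-cong e₂ e₄)) ,
        ⊕-cong (⊕-cong (⊗-cong e₁ e₄) (⊗-cong e₂ e₃)) (⊗-congˡ (⊗-cong e₂ e₄))

      ⊗²-identityˡ : ∀ t → ((1# , 0#) ⊗² t) ≈² t
      ⊗²-identityˡ (x , y) =
        solve 3 (λ x y b → con (+ 1) :* x :+ b :* (con (+ 0) :* y) := x) refl x y b ,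
        solve 3 (λ x y a → con (+ 1) :* y :+ con (+ 0) :* x :+ a :* (con (+ 0) :* y) := y) refl x y a

      ⊗²-distribˡ : ∀ r s t → (r ⊗² (s ⊕² t)) ≈² ((r ⊗² s) ⊕² (r ⊗² t))
      ⊗²-distribˡ (x , y) (u , v) (z , w) =
        solve 7 (λ x y u v z w b → x :* (u :+ z) :+ b :* (y :* (v :+ w)) := (x :* u :+ b :* (y :* v)) :+ (x :* z :+ b :* (y :* w))) refl x y u v z w b ,
        solve 7 (λ x y u v z w a → x :* (v :+ w) :+ y :* (u :+ z) :+ a :* (y :* (v :+ w))
          := (x :* v :+ y :* u :+ a :* (y :* v)) :+ (x :* w :+ y :* z :+ a :* (y :* w))) refl x y u v z w a

      trans² : ∀ {r s t} → r ≈² s → s ≈² t → r ≈² t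
      trans² (e₁ , e₂) (e₃ , e₄) = trans e₁ e₃ , trans e₂ e₄

    extension : CommutativeRing 0ℓ 0ℓ
    extension = record
      { Carrier = Carrier × Carrier ; _≈_ = _≈²_ ; _+_ = _⊕²_ ; _*_ = _⊗²_ ; -_ = λ (x , y) → ⊖ x , ⊖ y
      ; 0# = 0# , 0# ; 1# = 1# , 0#
      ; isCommutativeRing = record
        { isRing = record
          { +-isAbelianGroup = record
            { isGroup = record
              { isMonoid = record
                { isSemigroup = record
                  { isMagma = record
                    { isEquivalence = record
                      { refl = refl , refl ; sym = λ (e , e′) → sym e , sym e′ ; trans = trans² }
                    ; ∙-cong = λ (e₁ , e₂) (e₃ , e₄) → ⊕-cong e₁ e₃ , ⊕-cong e₂ e₄ }
                  ; assoc = λ _ _ _ → ⊕-assoc _ _ _ , ⊕-assoc _ _ _ }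
                ; identity = (λ _ → ⊕-identityˡ _ , ⊕-identityˡ _) , (λ _ → ⊕-identityʳ _ , ⊕-identityʳ _) }
              ; inverse = (λ _ → ⊖-inverseˡ _ , ⊖-inverseˡ _) , (λ _ → ⊖-inverseʳ _ , ⊖-inverseʳ _)
              ; ⁻¹-cong = λ (e , e′) → ⊖-cong e , ⊖-cong e′ }
            ; comm = λ _ _ → ⊕-comm _ _ , ⊕-comm _ _ }
          ; *-cong = ⊗²-cong
          ; *-assoc = ⊗²-assoc
          ; *-identity = ⊗²-identityˡ , λ t → trans² (⊗²-comm t _) (⊗²-identityˡ t)
          ; distrib = ⊗²-distribˡ , λ r s t → trans² (⊗²-comm (s ⊕² t) r) (trans² (⊗²-distribˡ r s t)
              (⊕-cong (proj₁ (⊗²-comm r s)) (proj₁ (⊗²-comm r t)) , ⊕-cong (proj₂ (⊗²-comm r s)) (proj₂ (⊗²-comm r t)))) }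
        ; *-comm = ⊗²-comm } }

    embed : Hom R extension
    embed = record
      { ⟪_⟫ = λ x → x , 0#
      ; ⟪⟫-cong = λ e → e , refl
      ; ⟪⟫-⊕ = λ _ _ → refl , sym (⊕-identityˡ 0#)
      ; ⟪⟫-⊗ = λ x y → solve 3 (λ x y b → x :* y := x :* y :+ b :* (con (+ 0) :* con (+ 0))) refl x y b
                     , solve 3 (λ x y a → con (+ 0) := x :* con (+ 0) :+ con (+ 0) :* y :+ a :* (con (+ 0) :* con (+ 0))) refl x y a
      ; ⟪⟫-1 = refl , refl }

    θ : Carrier × Carrier
    θ = 0# , 1#

module CyclotomicNorm (K : CommutativeRing 0ℓ 0ℓ) where
  private module K = RingKit K
  open K using () renaming (Carrier to C; _≈_ to _≈ᴷ_; _⊕_ to _⊕ᴷ_; _↑_ to _↑ᴷ_; 0# to 0ᴷ; 1# to 1ᴷ)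

  -- A zero of the fifth cyclotomic polynomial Φ₅; the equation ζ⁵ = 1 would also admit ζ = 1.
  IsRoot : C → Set
  IsRoot ζ = (1ᴷ ⊕ᴷ ζ ⊕ᴷ ζ ↑ᴷ 2 ⊕ᴷ ζ ↑ᴷ 3 ⊕ᴷ ζ ↑ᴷ 4) ≈ᴷ 0ᴷ

  module At (ζ : C) (Φ-root : IsRoot ζ) where
    open PowerSeries K hiding (module 𝕊)
    open SeriesMaps K
    open EulerProduct K
    open RingKit seriesRing

    constantHom : Hom K seriesRing
    constantHom = record
      { ⟪_⟫ = constant
      ; ⟪⟫-cong = λ { e zero → e ; e (suc n) → K.refl }
      ; ⟪⟫-⊕ = λ { x y zero → K.refl ; x y (suc n) → K.sym (K.⊕-identityˡ K.0#) }
      ; ⟪⟫-⊗ = λ { x y zero → K.refl ; x y (suc n) → K.sym (K.trans (mul-constantˡ x (constant y) (suc n)) (K.⊗-zeroʳ x)) }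
      ; ⟪⟫-1 = refl {1#} }

    Root : Series → Set
    Root m = 1# ⊕ m ⊕ m ↑ 2 ⊕ m ↑ 3 ⊕ m ↑ 4 ≋ 0#

    c : Series
    c = constant ζ

    c-root : Root c
    c-root = begin
      1# ⊕ c ⊕ c ↑ 2 ⊕ c ↑ 3 ⊕ c ↑ 4
        ≈⟨ ⊕-cong (⊕-cong (⊕-congˡ {1# ⊕ c} (pow 2)) (pow 3)) (pow 4) ⟨
      1# ⊕ c ⊕ constant (ζ ↑ᴷ 2) ⊕ constant (ζ ↑ᴷ 3) ⊕ constant (ζ ↑ᴷ 4)
        ≈⟨ trans (H.⟪⟫-⊕ _ _) (⊕-congʳ (trans (H.⟪⟫-⊕ _ _) (⊕-congʳ (trans (H.⟪⟫-⊕ _ _) (⊕-congʳ (H.⟪⟫-⊕ _ _)))))) ⟨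
      constant (1ᴷ ⊕ᴷ ζ ⊕ᴷ ζ ↑ᴷ 2 ⊕ᴷ ζ ↑ᴷ 3 ⊕ᴷ ζ ↑ᴷ 4)
        ≈⟨ H.⟪⟫-cong Φ-root ⟩
      constant 0ᴷ
        ≈⟨ H.⟪⟫-0 ⟩
      0# ∎
      where
      open ≈-Reasoning
      module H = Hom constantHom
      pow : ∀ n → constant (ζ ↑ᴷ n) ≋ c ↑ n
      pow n = H.⟪⟫-↑ ζ n

    root-5 : ∀ {m} → Root m → m ↑ 5 ≋ 1#
    root-5 {m} r = trans
      (solve 1 (λ m → m :^ 5 := con (+ 1) :+ (m :- con (+ 1)) :* (con (+ 1) :+ m :+ m :^ 2 :+ m :^ 3 :+ m :^ 4)) refl m)
      (trans (⊕-congˡ {1#} (⊗-congˡ {m ⊝ 1#} r)) (solve 1 (λ m → con (+ 1) :+ m :* con (+ 0) := con (+ 1)) refl (m ⊝ 1#)))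

    -- Φ₅(m) divides Φ₅(m²), the quotient being the tenth cyclotomic polynomial; for m³ it is the
    -- fifteenth.
    root-2 : ∀ {m} → Root m → Root (m ↑ 2)
    root-2 {m} r = trans
      (solve 1 (λ m → con (+ 1) :+ m :^ 2 :+ (m :^ 2) :^ 2 :+ (m :^ 2) :^ 3 :+ (m :^ 2) :^ 4
        := (con (+ 1) :- m :+ m :^ 2 :- m :^ 3 :+ m :^ 4) :* (con (+ 1) :+ m :+ m :^ 2 :+ m :^ 3 :+ m :^ 4)) refl m)
      (trans (⊗-congˡ {1# ⊝ m ⊕ m ↑ 2 ⊝ m ↑ 3 ⊕ m ↑ 4} r) (⊗-zeroʳ _))

    root-3 : ∀ {m} → Root m → Root (m ↑ 3)
    root-3 {m} r = trans
      (solve 1 (λ m → con (+ 1) :+ m :^ 3 :+ (m :^ 3) :^ 2 :+ (m :^ 3) :^ 3 :+ (m :^ 3) :^ 4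
        := (con (+ 1) :- m :+ m :^ 3 :- m :^ 4 :+ m :^ 5 :- m :^ 7 :+ m :^ 8) :* (con (+ 1) :+ m :+ m :^ 2 :+ m :^ 3 :+ m :^ 4)) refl m)
      (trans (⊗-congˡ {1# ⊝ m ⊕ m ↑ 3 ⊝ m ↑ 4 ⊕ m ↑ 5 ⊝ m ↑ 7 ⊕ m ↑ 8} r) (⊗-zeroʳ _))

    root-4 : ∀ {m} → Root m → Root (m ↑ 4)
    root-4 {m} r = trans (⊕-cong (⊕-cong (⊕-cong (⊕-congˡ {1#} sq) (↑-congˡ 2 sq)) (↑-congˡ 3 sq)) (↑-congˡ 4 sq)) (root-2 (root-2 r))
      where
      sq : m ↑ 4 ≋ (m ↑ 2) ↑ 2
      sq = sym (↑-assocʳ m 2 2)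

    root-pairs : ∀ {m} → Root m → m ⊗ m ↑ 4 ≋ 1# × m ↑ 2 ⊗ m ↑ 3 ≋ 1#
    root-pairs {m} r = root-5 r , trans (sym (↑-homo-⊗ m 2 3)) (root-5 r)

    private
      -- Both sides involve m only through u = m + m⁴ and v = m² + m³, with u + v = u v = −1.
      root-sum : ∀ {m} → Root m → (m ⊕ m ↑ 4) ⊕ (m ↑ 2 ⊕ m ↑ 3) ≋ ⊖ 1#
      root-sum {m} r = trans (solve 1 (λ m → (m :+ m :^ 4) :+ (m :^ 2 :+ m :^ 3) := (con (+ 1) :+ m :+ m :^ 2 :+ m :^ 3 :+ m :^ 4) :- con (+ 1)) refl m)
        (trans (⊕-congʳ {⊖ 1#} r) (⊕-identityˡ (⊖ 1#)))

      root-product : ∀ {m} → Root m → (m ⊕ m ↑ 4) ⊗ (m ↑ 2 ⊕ m ↑ 3) ≋ ⊖ 1#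
      root-product {m} r = begin
        (m ⊕ m ↑ 4) ⊗ (m ↑ 2 ⊕ m ↑ 3)
          ≈⟨ solve 1 (λ m → (m :+ m :^ 4) :* (m :^ 2 :+ m :^ 3) := m :^ 3 :+ m :^ 4 :+ (m :+ m :^ 2) :* m :^ 5) refl m ⟩
        m ↑ 3 ⊕ m ↑ 4 ⊕ (m ⊕ m ↑ 2) ⊗ m ↑ 5
          ≈⟨ ⊕-congˡ {m ↑ 3 ⊕ m ↑ 4} (⊗-congˡ {m ⊕ m ↑ 2} (root-5 r)) ⟩
        m ↑ 3 ⊕ m ↑ 4 ⊕ (m ⊕ m ↑ 2) ⊗ 1#
          ≈⟨ solve 1 (λ m → m :^ 3 :+ m :^ 4 :+ (m :+ m :^ 2) :* con (+ 1) := (m :+ m :^ 4) :+ (m :^ 2 :+ m :^ 3)) refl m ⟩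
        (m ⊕ m ↑ 4) ⊕ (m ↑ 2 ⊕ m ↑ 3)
          ≈⟨ root-sum r ⟩
        ⊖ 1# ∎
        where open ≈-Reasoning

    cyclotomic : ∀ m x → Root m → (1# ⊝ x) ⊗ (1# ⊝ m ⊗ x) ⊗ (1# ⊝ m ↑ 2 ⊗ x) ⊗ (1# ⊝ m ↑ 3 ⊗ x) ⊗ (1# ⊝ m ↑ 4 ⊗ x) ≋ 1# ⊝ x ↑ 5
    cyclotomic m x r = begin
      (1# ⊝ x) ⊗ (1# ⊝ m ⊗ x) ⊗ (1# ⊝ m ↑ 2 ⊗ x) ⊗ (1# ⊝ m ↑ 3 ⊗ x) ⊗ (1# ⊝ m ↑ 4 ⊗ x)
        ≈⟨ solve 5 (λ x m m² m³ m⁴ → (con (+ 1) :- x) :* (con (+ 1) :- m :* x) :* (con (+ 1) :- m² :* x) :* (con (+ 1) :- m³ :* x) :* (con (+ 1) :- m⁴ :* x)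
             := (con (+ 1) :- x) :* ((con (+ 1) :- (m :+ m⁴) :* x :+ m :* m⁴ :* (x :* x)) :* (con (+ 1) :- (m² :+ m³) :* x :+ m² :* m³ :* (x :* x)))) refl
             x m (m ↑ 2) (m ↑ 3) (m ↑ 4) ⟩
      (1# ⊝ x) ⊗ ((1# ⊝ u ⊗ x ⊕ m ⊗ m ↑ 4 ⊗ (x ⊗ x)) ⊗ (1# ⊝ v ⊗ x ⊕ m ↑ 2 ⊗ m ↑ 3 ⊗ (x ⊗ x)))
        ≈⟨ ⊗-congˡ {1# ⊝ x} (⊗-cong (⊕-congˡ {1# ⊝ u ⊗ x} (⊗-congʳ {x ⊗ x} (proj₁ (root-pairs r)))) (⊕-congˡ {1# ⊝ v ⊗ x} (⊗-congʳ {x ⊗ x} (proj₂ (root-pairs r))))) ⟩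
      (1# ⊝ x) ⊗ ((1# ⊝ u ⊗ x ⊕ 1# ⊗ (x ⊗ x)) ⊗ (1# ⊝ v ⊗ x ⊕ 1# ⊗ (x ⊗ x)))
        ≈⟨ solve 3 (λ x u v → (con (+ 1) :- x) :* ((con (+ 1) :- u :* x :+ con (+ 1) :* (x :* x)) :* (con (+ 1) :- v :* x :+ con (+ 1) :* (x :* x)))
             := (con (+ 1) :- x) :* (con (+ 1) :+ con (+ 2) :* (x :* x) :+ (x :* x) :* (x :* x) :- (u :+ v) :* (x :+ x :* x :* x) :+ u :* v :* (x :* x))) refl x u v ⟩
      (1# ⊝ x) ⊗ (1# ⊕ int (+ 2) ⊗ (x ⊗ x) ⊕ (x ⊗ x) ⊗ (x ⊗ x) ⊝ (u ⊕ v) ⊗ (x ⊕ x ⊗ x ⊗ x) ⊕ u ⊗ v ⊗ (x ⊗ x))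
        ≈⟨ ⊗-congˡ {1# ⊝ x} (⊕-cong (⊕-congˡ {1# ⊕ int (+ 2) ⊗ (x ⊗ x) ⊕ (x ⊗ x) ⊗ (x ⊗ x)} (⊖-cong (⊗-congʳ {x ⊕ x ⊗ x ⊗ x} (root-sum r)))) (⊗-congʳ {x ⊗ x} (root-product r))) ⟩
      (1# ⊝ x) ⊗ (1# ⊕ int (+ 2) ⊗ (x ⊗ x) ⊕ (x ⊗ x) ⊗ (x ⊗ x) ⊝ (⊖ 1#) ⊗ (x ⊕ x ⊗ x ⊗ x) ⊕ (⊖ 1#) ⊗ (x ⊗ x))
        ≈⟨ solve 1 (λ x → (con (+ 1) :- x) :* (con (+ 1) :+ con (+ 2) :* (x :* x) :+ (x :* x) :* (x :* x) :- (:- con (+ 1)) :* (x :+ x :* x :* x) :+ (:- con (+ 1)) :* (x :* x))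
             := con (+ 1) :- x :^ 5) refl x ⟩
      1# ⊝ x ↑ 5 ∎
      where
      open ≈-Reasoning
      u = m ⊕ m ↑ 4
      v = m ↑ 2 ⊕ m ↑ 3

    -- Give x, y, z the weights 0, 1, 2: in the norm only monomials of weight divisible by 5
    -- survive, and before xz is replaced these can be written x⁵, y⁵, z⁵, -5(xz)y³ and 5(xz)²y.
    -- With xz = -y² the last two become 5y⁵ each, so 11 = 1 + 5 + 5.
    cyclotomic-trinomial : ∀ m x y z → Root m → x ⊗ z ≋ ⊖ (y ⊗ y) →
      (x ⊕ y ⊕ z) ⊗ (x ⊕ m ⊗ y ⊕ m ↑ 2 ⊗ z) ⊗ (x ⊕ m ↑ 2 ⊗ y ⊕ m ↑ 4 ⊗ z) ⊗ (x ⊕ m ↑ 3 ⊗ y ⊕ m ↑ 6 ⊗ z) ⊗ (x ⊕ m ↑ 4 ⊗ y ⊕ m ↑ 8 ⊗ z)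
        ≋ x ↑ 5 ⊕ int (+ 11) ⊗ y ↑ 5 ⊕ z ↑ 5
    cyclotomic-trinomial m x y z r xz = begin
      (x ⊕ y ⊕ z) ⊗ (x ⊕ m ⊗ y ⊕ m ↑ 2 ⊗ z) ⊗ (x ⊕ m ↑ 2 ⊗ y ⊕ m ↑ 4 ⊗ z) ⊗ (x ⊕ m ↑ 3 ⊗ y ⊕ m ↑ 6 ⊗ z) ⊗ (x ⊕ m ↑ 4 ⊗ y ⊕ m ↑ 8 ⊗ z)
        ≈⟨ ⊗-cong (⊗-congˡ {(x ⊕ y ⊕ z) ⊗ (x ⊕ m ⊗ y ⊕ m ↑ 2 ⊗ z) ⊗ (x ⊕ m ↑ 2 ⊗ y ⊕ m ↑ 4 ⊗ z)} (⊕-congˡ {x ⊕ m ↑ 3 ⊗ y} (⊗-congʳ {z} (red 1))))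
             (⊕-congˡ {x ⊕ m ↑ 4 ⊗ y} (⊗-congʳ {z} (red 3))) ⟩
      (x ⊕ y ⊕ z) ⊗ (x ⊕ m ⊗ y ⊕ m ↑ 2 ⊗ z) ⊗ (x ⊕ m ↑ 2 ⊗ y ⊕ m ↑ 4 ⊗ z) ⊗ (x ⊕ m ↑ 3 ⊗ y ⊕ m ↑ 1 ⊗ z) ⊗ (x ⊕ m ↑ 4 ⊗ y ⊕ m ↑ 3 ⊗ z)
        ≈⟨ solve 7 (λ x y z m m² m³ m⁴ → (x :+ y :+ z) :* (x :+ m :* y :+ m² :* z) :* (x :+ m² :* y :+ m⁴ :* z) :* (x :+ m³ :* y :+ (m :* con (+ 1)) :* z) :* (x :+ m⁴ :* y :+ m³ :* z)
             := (x :+ y :+ z) :* (((x :+ m :* y :+ m² :* z) :* (x :+ m⁴ :* y :+ m³ :* z)) :* ((x :+ m² :* y :+ m⁴ :* z) :* (x :+ m³ :* y :+ m :* z)))) refl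
             x y z m (m ↑ 2) (m ↑ 3) (m ↑ 4) ⟩
      (x ⊕ y ⊕ z) ⊗ (((x ⊕ m ⊗ y ⊕ m ↑ 2 ⊗ z) ⊗ (x ⊕ m ↑ 4 ⊗ y ⊕ m ↑ 3 ⊗ z)) ⊗ ((x ⊕ m ↑ 2 ⊗ y ⊕ m ↑ 4 ⊗ z) ⊗ (x ⊕ m ↑ 3 ⊗ y ⊕ m ⊗ z)))
        ≈⟨ ⊗-congˡ {x ⊕ y ⊕ z} (⊗-cong pair₁ pair₂) ⟩
      (x ⊕ y ⊕ z) ⊗ ((S ⊕ u ⊗ P ⊕ v ⊗ W) ⊗ (S ⊕ v ⊗ P ⊕ u ⊗ W))
        ≈⟨ solve 6 (λ L S P W u v → L :* ((S :+ u :* P :+ v :* W) :* (S :+ v :* P :+ u :* W))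
             := L :* (S :* S :+ (u :+ v) :* (S :* (P :+ W)) :+ u :* v :* (P :* P :+ W :* W) :+ ((u :+ v) :* (u :+ v) :- con (+ 2) :* (u :* v)) :* (P :* W))) refl
             (x ⊕ y ⊕ z) S P W u v ⟩
      (x ⊕ y ⊕ z) ⊗ (S ⊗ S ⊕ (u ⊕ v) ⊗ (S ⊗ (P ⊕ W)) ⊕ u ⊗ v ⊗ (P ⊗ P ⊕ W ⊗ W) ⊕ ((u ⊕ v) ⊗ (u ⊕ v) ⊝ int (+ 2) ⊗ (u ⊗ v)) ⊗ (P ⊗ W))
        ≈⟨ ⊗-congˡ {x ⊕ y ⊕ z} (⊕-cong (⊕-cong (⊕-congˡ {S ⊗ S} (⊗-congʳ {S ⊗ (P ⊕ W)} s)) (⊗-congʳ {P ⊗ P ⊕ W ⊗ W} p))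
             (⊗-congʳ {P ⊗ W} (⊕-cong (⊗-cong s s) (⊖-cong (⊗-congˡ {int (+ 2)} p))))) ⟩
      (x ⊕ y ⊕ z) ⊗ (S ⊗ S ⊕ (⊖ 1#) ⊗ (S ⊗ (P ⊕ W)) ⊕ (⊖ 1#) ⊗ (P ⊗ P ⊕ W ⊗ W) ⊕ ((⊖ 1#) ⊗ (⊖ 1#) ⊝ int (+ 2) ⊗ (⊖ 1#)) ⊗ (P ⊗ W))
        ≈⟨ solve 3 (λ x y z → let S = x :* x :+ y :* y :+ z :* z ; P = x :* y :+ y :* z ; W = x :* z ; -1# = :- con (+ 1) in
             (x :+ y :+ z) :* (S :* S :+ -1# :* (S :* (P :+ W)) :+ -1# :* (P :* P :+ W :* W) :+ (-1# :* -1# :- con (+ 2) :* -1#) :* (P :* W))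
             := x :^ 5 :+ y :^ 5 :+ z :^ 5 :- con (+ 5) :* ((x :* z) :* (y :* y :* y)) :+ con (+ 5) :* ((x :* z) :* (x :* z) :* y)) refl x y z ⟩
      x ↑ 5 ⊕ y ↑ 5 ⊕ z ↑ 5 ⊝ int (+ 5) ⊗ ((x ⊗ z) ⊗ (y ⊗ y ⊗ y)) ⊕ int (+ 5) ⊗ ((x ⊗ z) ⊗ (x ⊗ z) ⊗ y)
        ≈⟨ ⊕-cong (⊕-congˡ {x ↑ 5 ⊕ y ↑ 5 ⊕ z ↑ 5} (⊖-cong (⊗-congˡ {int (+ 5)} (⊗-congʳ {y ⊗ y ⊗ y} xz)))) (⊗-congˡ {int (+ 5)} (⊗-congʳ {y} (⊗-cong xz xz))) ⟩
      x ↑ 5 ⊕ y ↑ 5 ⊕ z ↑ 5 ⊝ int (+ 5) ⊗ ((⊖ (y ⊗ y)) ⊗ (y ⊗ y ⊗ y)) ⊕ int (+ 5) ⊗ ((⊖ (y ⊗ y)) ⊗ (⊖ (y ⊗ y)) ⊗ y)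
        ≈⟨ solve 3 (λ x y z → x :^ 5 :+ y :^ 5 :+ z :^ 5 :- con (+ 5) :* ((:- (y :* y)) :* (y :* y :* y)) :+ con (+ 5) :* ((:- (y :* y)) :* (:- (y :* y)) :* y)
             := x :^ 5 :+ con (+ 11) :* y :^ 5 :+ z :^ 5) refl x y z ⟩
      x ↑ 5 ⊕ int (+ 11) ⊗ y ↑ 5 ⊕ z ↑ 5 ∎
      where
      open ≈-Reasoning
      u = m ⊕ m ↑ 4
      v = m ↑ 2 ⊕ m ↑ 3
      S = x ⊗ x ⊕ y ⊗ y ⊕ z ⊗ z
      P = x ⊗ y ⊕ y ⊗ z
      W = x ⊗ z
      s = root-sum r
      p = root-product r
      red : ∀ i → m ↑ (5 + i) ≋ m ↑ i
      red i = trans (↑-homo-⊗ m 5 i) (trans (⊗-congʳ {m ↑ i} (root-5 r)) (⊗-identityˡ (m ↑ i)))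
      pair₁ : (x ⊕ m ⊗ y ⊕ m ↑ 2 ⊗ z) ⊗ (x ⊕ m ↑ 4 ⊗ y ⊕ m ↑ 3 ⊗ z) ≋ S ⊕ u ⊗ P ⊕ v ⊗ W
      pair₁ = begin
        (x ⊕ m ⊗ y ⊕ m ↑ 2 ⊗ z) ⊗ (x ⊕ m ↑ 4 ⊗ y ⊕ m ↑ 3 ⊗ z)
          ≈⟨ solve 4 (λ x y z m → (x :+ m :* y :+ m :^ 2 :* z) :* (x :+ m :^ 4 :* y :+ m :^ 3 :* z)
               := x :* x :+ (m :+ m :^ 4) :* (x :* y) :+ (m :^ 2 :+ m :^ 3) :* (x :* z) :+ m :^ 4 :* (y :* z) :+ m :^ 5 :* (y :* y :+ z :* z :+ m :* (y :* z))) refl x y z m ⟩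
        x ⊗ x ⊕ u ⊗ (x ⊗ y) ⊕ v ⊗ (x ⊗ z) ⊕ m ↑ 4 ⊗ (y ⊗ z) ⊕ m ↑ 5 ⊗ (y ⊗ y ⊕ z ⊗ z ⊕ m ⊗ (y ⊗ z))
          ≈⟨ ⊕-congˡ {x ⊗ x ⊕ u ⊗ (x ⊗ y) ⊕ v ⊗ (x ⊗ z) ⊕ m ↑ 4 ⊗ (y ⊗ z)} (⊗-congʳ {y ⊗ y ⊕ z ⊗ z ⊕ m ⊗ (y ⊗ z)} (root-5 r)) ⟩
        x ⊗ x ⊕ u ⊗ (x ⊗ y) ⊕ v ⊗ (x ⊗ z) ⊕ m ↑ 4 ⊗ (y ⊗ z) ⊕ 1# ⊗ (y ⊗ y ⊕ z ⊗ z ⊕ m ⊗ (y ⊗ z))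
          ≈⟨ solve 4 (λ x y z m → x :* x :+ (m :+ m :^ 4) :* (x :* y) :+ (m :^ 2 :+ m :^ 3) :* (x :* z) :+ m :^ 4 :* (y :* z) :+ con (+ 1) :* (y :* y :+ z :* z :+ m :* (y :* z))
               := (x :* x :+ y :* y :+ z :* z) :+ (m :+ m :^ 4) :* (x :* y :+ y :* z) :+ (m :^ 2 :+ m :^ 3) :* (x :* z)) refl x y z m ⟩
        S ⊕ u ⊗ P ⊕ v ⊗ W ∎
      pair₂ : (x ⊕ m ↑ 2 ⊗ y ⊕ m ↑ 4 ⊗ z) ⊗ (x ⊕ m ↑ 3 ⊗ y ⊕ m ⊗ z) ≋ S ⊕ v ⊗ P ⊕ u ⊗ W
      pair₂ = begin
        (x ⊕ m ↑ 2 ⊗ y ⊕ m ↑ 4 ⊗ z) ⊗ (x ⊕ m ↑ 3 ⊗ y ⊕ m ⊗ z)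
          ≈⟨ solve 4 (λ x y z m → (x :+ m :^ 2 :* y :+ m :^ 4 :* z) :* (x :+ m :^ 3 :* y :+ m :* z)
               := x :* x :+ (m :^ 2 :+ m :^ 3) :* (x :* y) :+ (m :+ m :^ 4) :* (x :* z) :+ m :^ 3 :* (y :* z) :+ m :^ 5 :* (y :* y :+ z :* z :+ m :^ 2 :* (y :* z))) refl x y z m ⟩
        x ⊗ x ⊕ v ⊗ (x ⊗ y) ⊕ u ⊗ (x ⊗ z) ⊕ m ↑ 3 ⊗ (y ⊗ z) ⊕ m ↑ 5 ⊗ (y ⊗ y ⊕ z ⊗ z ⊕ m ↑ 2 ⊗ (y ⊗ z))
          ≈⟨ ⊕-congˡ {x ⊗ x ⊕ v ⊗ (x ⊗ y) ⊕ u ⊗ (x ⊗ z) ⊕ m ↑ 3 ⊗ (y ⊗ z)} (⊗-congʳ {y ⊗ y ⊕ z ⊗ z ⊕ m ↑ 2 ⊗ (y ⊗ z)} (root-5 r)) ⟩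
        x ⊗ x ⊕ v ⊗ (x ⊗ y) ⊕ u ⊗ (x ⊗ z) ⊕ m ↑ 3 ⊗ (y ⊗ z) ⊕ 1# ⊗ (y ⊗ y ⊕ z ⊗ z ⊕ m ↑ 2 ⊗ (y ⊗ z))
          ≈⟨ solve 4 (λ x y z m → x :* x :+ (m :^ 2 :+ m :^ 3) :* (x :* y) :+ (m :+ m :^ 4) :* (x :* z) :+ m :^ 3 :* (y :* z) :+ con (+ 1) :* (y :* y :+ z :* z :+ m :^ 2 :* (y :* z))
               := (x :* x :+ y :* y :+ z :* z) :+ (m :^ 2 :+ m :^ 3) :* (x :* y :+ y :* z) :+ (m :+ m :^ 4) :* (x :* z)) refl x y z m ⟩
        S ⊕ v ⊗ P ⊕ u ⊗ W ∎

    σ : ℕ → Hom seriesRing seriesRing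
    σ j = twistHom (ζ ↑ᴷ j)

    norm : Series → Series
    norm f = f ⊗ σ 1 ⟪ f ⟫ ⊗ σ 2 ⟪ f ⟫ ⊗ σ 3 ⟪ f ⟫ ⊗ σ 4 ⟪ f ⟫

    norm-⊗ : ∀ f g → norm (f ⊗ g) ≋ norm f ⊗ norm g
    norm-⊗ f g = trans
      (⊗-cong (⊗-cong (⊗-cong (⊗-congˡ {f ⊗ g} (Hom.⟪⟫-⊗ (σ 1) f g)) (Hom.⟪⟫-⊗ (σ 2) f g)) (Hom.⟪⟫-⊗ (σ 3) f g)) (Hom.⟪⟫-⊗ (σ 4) f g))
      (solve 10 (λ a b c d e a′ b′ c′ d′ e′ → (a :* a′) :* (b :* b′) :* (c :* c′) :* (d :* d′) :* (e :* e′) := (a :* b :* c :* d :* e) :* (a′ :* b′ :* c′ :* d′ :* e′)) refl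
        f (σ 1 ⟪ f ⟫) (σ 2 ⟪ f ⟫) (σ 3 ⟪ f ⟫) (σ 4 ⟪ f ⟫) g (σ 1 ⟪ g ⟫) (σ 2 ⟪ g ⟫) (σ 3 ⟪ g ⟫) (σ 4 ⟪ g ⟫))

    norm-≋[] : ∀ {f g N} → f ≋[ N ] g → norm f ≋[ N ] norm g
    norm-≋[] {f} {g} {N} e = ≋[]-⊗ (≋[]-⊗ (≋[]-⊗ (≋[]-⊗ e (tw 1)) (tw 2)) (tw 3)) (tw 4)
      where
      tw : ∀ j → σ j ⟪ f ⟫ ≋[ N ] σ j ⟪ g ⟫
      tw j n n<N = K.⊗-congˡ (e n n<N)

    norm-cong : ∀ {f g} → f ≋ g → norm f ≋ norm g
    norm-cong e = ≋[]⇒≋ λ N → norm-≋[] (≋⇒≋[] e)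

    σ-q↑ : ∀ j k → σ j ⟪ q ↑ k ⟫ ≋ (c ↑ k) ↑ j ⊗ q ↑ k
    σ-q↑ j k = begin
      σ j ⟪ q ↑ k ⟫                            ≈⟨ Hom.⟪⟫-↑ (σ j) q k ⟩
      σ j ⟪ q ⟫ ↑ k                            ≈⟨ ↑-congˡ k (twist-q (ζ ↑ᴷ j)) ⟩
      (constant (ζ ↑ᴷ j) ⊗ q) ↑ k              ≈⟨ ↑-distrib-⊗ (constant (ζ ↑ᴷ j)) q k ⟩
      constant (ζ ↑ᴷ j) ↑ k ⊗ q ↑ k            ≈⟨ ⊗-congʳ {q ↑ k} (↑-congˡ k (Hom.⟪⟫-↑ constantHom ζ j)) ⟩
      (c ↑ j) ↑ k ⊗ q ↑ k                      ≈⟨ ⊗-congʳ {q ↑ k} (trans (↑-assocʳ c j k) (trans (reflexive (≡.cong (c ↑_) (ℕP.*-comm j k))) (sym (↑-assocʳ c k j)))) ⟩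
      (c ↑ k) ↑ j ⊗ q ↑ k ∎
      where open ≈-Reasoning

    σ-factor : ∀ j k → σ j ⟪ factor k ⟫ ≋ 1# ⊝ (c ↑ k) ↑ j ⊗ q ↑ k
    σ-factor j k = trans (Hom.⟪⟫-⊝ (σ j) 1# (q ↑ k)) (⊕-cong (Hom.⟪⟫-1 (σ j)) (⊖-cong (σ-q↑ j k)))

    norm-factor : ∀ k m → c ↑ k ≋ m → norm (factor k) ≋ (1# ⊝ q ↑ k) ⊗ (1# ⊝ m ⊗ q ↑ k) ⊗ (1# ⊝ m ↑ 2 ⊗ q ↑ k) ⊗ (1# ⊝ m ↑ 3 ⊗ q ↑ k) ⊗ (1# ⊝ m ↑ 4 ⊗ q ↑ k)
    norm-factor k m c↑k≋m = ⊗-cong (⊗-cong (⊗-cong (⊗-congˡ {factor k} (trans (eq 1) (⊕-congˡ {1#} (⊖-cong (⊗-congʳ {q ↑ k} (⊗-identityʳ m)))))) (eq 2)) (eq 3)) (eq 4)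
      where
      eq : ∀ j → σ j ⟪ factor k ⟫ ≋ 1# ⊝ m ↑ j ⊗ q ↑ k
      eq j = trans (σ-factor j k) (⊕-congˡ {1#} (⊖-cong (⊗-congʳ {q ↑ k} (↑-congˡ j c↑k≋m))))

    norm-factor-unramified : ∀ k → Root (c ↑ k) → norm (factor k) ≋ dil 5 (factor k)
    norm-factor-unramified k r = trans (norm-factor k (c ↑ k) refl′) (trans (cyclotomic (c ↑ k) (q ↑ k) r) (sym (dil-factor k)))
      where
      refl′ = refl {c ↑ k}
      dil-factor : ∀ k → dil 5 (factor k) ≋ 1# ⊝ (q ↑ k) ↑ 5
      dil-factor k = trans (Hom.⟪⟫-⊝ (dilHom 5) 1# (q ↑ k)) (⊕-cong (dil-1 5) (⊖-cong (trans (Hom.⟪⟫-↑ (dilHom 5) q k)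
        (trans (↑-congˡ k (dil-q 4)) (trans (↑-assocʳ q 5 k) (trans (reflexive (≡.cong (q ↑_) (ℕP.*-comm 5 k))) (sym (↑-assocʳ q k 5))))))))

    c↑5* : ∀ i M → c ↑ (i + 5 * M) ≋ c ↑ i
    c↑5* i M = trans (↑-homo-⊗ c i (5 * M)) (trans (⊗-congˡ {c ↑ i} (trans (sym (↑-assocʳ c 5 M)) (trans (↑-congˡ M (root-5 c-root)) (1↑ M)))) (⊗-identityʳ (c ↑ i)))

    root-cong : ∀ {m m′} → m ≋ m′ → Root m → Root m′
    root-cong e r = trans (sym (⊕-cong (⊕-cong (⊕-cong (⊕-congˡ {1#} e) (↑-congˡ 2 e)) (↑-congˡ 3 e)) (↑-congˡ 4 e))) r

    norm-factor-ramified : ∀ M → norm (factor (5 * M)) ≋ dil 5 (factor M) ↑ 5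
    norm-factor-ramified M = trans (norm-factor (5 * M) 1# (c↑5* 0 M))
      (trans (solve 1 (λ x → (con (+ 1) :- x) :* (con (+ 1) :- con (+ 1) :* x) :* (con (+ 1) :- con (+ 1) :^ 2 :* x) :* (con (+ 1) :- con (+ 1) :^ 3 :* x) :* (con (+ 1) :- con (+ 1) :^ 4 :* x)
          := (con (+ 1) :- x) :^ 5) refl (q ↑ (5 * M)))
        (↑-congˡ 5 (sym (trans (Hom.⟪⟫-⊝ (dilHom 5) 1# (q ↑ M)) (⊕-cong (dil-1 5) (⊖-cong (trans (Hom.⟪⟫-↑ (dilHom 5) q M)
          (trans (↑-congˡ M (dil-q 4)) (↑-assocʳ q 5 M)))))))))

    -- For 5 ∤ k the conjugates of 1 - q^k multiply to 1 - q^(5k). For k = 5i they coincide and give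
    -- (1 - q^(5i))⁵ in place of 1 - q^(25i); the two products over i ≤ M record this exchange.
    norm-Q : ∀ M → norm (Q (5 * M)) ⊗ dil 5 (dil 5 (Q M)) ≋ dil 5 (Q (5 * M)) ⊗ dil 5 (Q M) ↑ 5
    norm-Q zero = trans (⊗-cong (trans (⊗-cong (⊗-cong (⊗-cong (⊗-congˡ {1#} (Hom.⟪⟫-1 (σ 1))) (Hom.⟪⟫-1 (σ 2))) (Hom.⟪⟫-1 (σ 3))) (Hom.⟪⟫-1 (σ 4)))
        (solve 0 (con (+ 1) :* con (+ 1) :* con (+ 1) :* con (+ 1) :* con (+ 1) := con (+ 1)) refl)) (trans (dil-cong 5 (dil-1 5)) (dil-1 5)))
      (trans (solve 0 (con (+ 1) :* con (+ 1) := con (+ 1) :* con (+ 1) :^ 5) refl) (sym (⊗-cong (dil-1 5) (↑-congˡ 5 (dil-1 5)))))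
    norm-Q (suc M) = ≡.subst (λ n → norm (Q n) ⊗ dil 5 (dil 5 (Q (suc M))) ≋ dil 5 (Q n) ⊗ dil 5 (Q (suc M)) ↑ 5) (≡.sym (ℕP.*-suc 5 M)) (begin
      norm (Q n ⊗ F 1 ⊗ F 2 ⊗ F 3 ⊗ F 4 ⊗ F 5) ⊗ dil 5 (dil 5 (Q M ⊗ factor (suc M)))
        ≈⟨ ⊗-cong (trans (norm-⊗ (Q n ⊗ F 1 ⊗ F 2 ⊗ F 3 ⊗ F 4) (F 5)) (⊗-cong (trans (norm-⊗ (Q n ⊗ F 1 ⊗ F 2 ⊗ F 3) (F 4)) (⊗-cong (trans (norm-⊗ (Q n ⊗ F 1 ⊗ F 2) (F 3))
             (⊗-cong (trans (norm-⊗ (Q n ⊗ F 1) (F 2)) (⊗-cong (trans (norm-⊗ (Q n) (F 1)) (⊗-congˡ {norm (Q n)} (unramified 1 c-root′)))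
               (unramified 2 (root-2 c-root)))) (unramified 3 (root-3 c-root)))) (unramified 4 (root-4 c-root)))) ramified))
             (trans (dil-cong 5 (dil-⊗ 5 (Q M) (factor (suc M)))) (dil-⊗ 5 (dil 5 (Q M)) (dil 5 (factor (suc M))))) ⟩
      norm (Q n) ⊗ dil 5 (F 1) ⊗ dil 5 (F 2) ⊗ dil 5 (F 3) ⊗ dil 5 (F 4) ⊗ g ↑ 5 ⊗ (dil 5 (dil 5 (Q M)) ⊗ dil 5 g)
        ≈⟨ solve 8 (λ n a b c d e x y → n :* a :* b :* c :* d :* e :* (x :* y) := (n :* x) :* (a :* b :* c :* d :* y) :* e) refl
             (norm (Q n)) (dil 5 (F 1)) (dil 5 (F 2)) (dil 5 (F 3)) (dil 5 (F 4)) (g ↑ 5) (dil 5 (dil 5 (Q M))) (dil 5 g) ⟩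
      (norm (Q n) ⊗ dil 5 (dil 5 (Q M))) ⊗ (dil 5 (F 1) ⊗ dil 5 (F 2) ⊗ dil 5 (F 3) ⊗ dil 5 (F 4) ⊗ dil 5 g) ⊗ g ↑ 5
        ≈⟨ ⊗-congʳ {g ↑ 5} (⊗-cong (norm-Q M) (⊗-congˡ {dil 5 (F 1) ⊗ dil 5 (F 2) ⊗ dil 5 (F 3) ⊗ dil 5 (F 4)} (dil-cong 5 g≋F5))) ⟩
      (dil 5 (Q n) ⊗ dil 5 (Q M) ↑ 5) ⊗ (dil 5 (F 1) ⊗ dil 5 (F 2) ⊗ dil 5 (F 3) ⊗ dil 5 (F 4) ⊗ dil 5 (F 5)) ⊗ g ↑ 5
        ≈⟨ solve 8 (λ n x a b c d e g → (n :* x :^ 5) :* (a :* b :* c :* d :* e) :* g :^ 5 := (n :* a :* b :* c :* d :* e) :* (x :* g) :^ 5) refl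
             (dil 5 (Q n)) (dil 5 (Q M)) (dil 5 (F 1)) (dil 5 (F 2)) (dil 5 (F 3)) (dil 5 (F 4)) (dil 5 (F 5)) g ⟩
      (dil 5 (Q n) ⊗ dil 5 (F 1) ⊗ dil 5 (F 2) ⊗ dil 5 (F 3) ⊗ dil 5 (F 4) ⊗ dil 5 (F 5)) ⊗ (dil 5 (Q M) ⊗ g) ↑ 5
        ≈⟨ ⊗-cong (trans (dil-⊗ 5 (Q n ⊗ F 1 ⊗ F 2 ⊗ F 3 ⊗ F 4) (F 5)) (⊗-congʳ {dil 5 (F 5)} (trans (dil-⊗ 5 (Q n ⊗ F 1 ⊗ F 2 ⊗ F 3) (F 4)) (⊗-congʳ {dil 5 (F 4)}
             (trans (dil-⊗ 5 (Q n ⊗ F 1 ⊗ F 2) (F 3)) (⊗-congʳ {dil 5 (F 3)} (trans (dil-⊗ 5 (Q n ⊗ F 1) (F 2)) (⊗-congʳ {dil 5 (F 2)} (dil-⊗ 5 (Q n) (F 1))))))))))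
             (↑-congˡ 5 (dil-⊗ 5 (Q M) (factor (suc M)))) ⟨
      dil 5 (Q n ⊗ F 1 ⊗ F 2 ⊗ F 3 ⊗ F 4 ⊗ F 5) ⊗ dil 5 (Q (suc M)) ↑ 5 ∎)
      where
      open ≈-Reasoning
      n = 5 * M
      F : ℕ → Series
      F i = factor (i + n)
      g = dil 5 (factor (suc M))
      c-root′ : Root (c ↑ 1)
      c-root′ = root-cong (sym (⊗-identityʳ c)) c-root
      unramified : ∀ i → Root (c ↑ i) → norm (F i) ≋ dil 5 (F i)
      unramified i r = norm-factor-unramified (i + n) (root-cong (sym (c↑5* i M)) r)
      ramified : norm (F 5) ≋ g ↑ 5
      ramified = ≡.subst (λ k → norm (factor k) ≋ g ↑ 5) (ℕP.*-suc 5 M) (norm-factor-ramified (suc M))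
      g≋F5 : g ≋ F 5
      g≋F5 = trans (Hom.⟪⟫-⊝ (dilHom 5) 1# (q ↑ suc M)) (⊕-cong (dil-1 5) (⊖-cong (trans (Hom.⟪⟫-↑ (dilHom 5) q (suc M))
        (trans (↑-congˡ (suc M) (dil-q 4)) (trans (↑-assocʳ q 5 (suc M)) (reflexive (≡.cong (q ↑_) (ℕP.*-suc 5 M))))))))

    norm-E : norm E ⊗ dil 5 (dil 5 E) ≋ dil 5 E ↑ 6
    norm-E = ≋[]⇒≋ λ N → ≋[]-trans
      (≋[]-⊗ (norm-≋[] (Q5 N)) (dil-≋[] 4 (dil-≋[] 4 (Q1 N))))
      (≋[]-trans (≋⇒≋[] (norm-Q N)) (≋[]-⊗ (≋[]-sym (dil-≋[] 4 (Q5 N))) (≋[]-↑ 5 (≋[]-sym (dil-≋[] 4 (Q1 N))))))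
      where
      Q1 : ∀ N → E ≋[ N ] Q N
      Q1 N = ≋[]-weaken (ℕP.n≤1+n N) (≋[]-sym (Q≋[]E N))
      Q5 : ∀ N → E ≋[ N ] Q (5 * N)
      Q5 N = ≋[]-weaken (ℕP.≤-trans (ℕP.m≤n*m N 5) (ℕP.n≤1+n _)) (≋[]-sym (Q≋[]E (5 * N)))

    -- The twist multiplies q by ζ^j, and (ζ^j)⁵ = 1.
    σ-dil : ∀ j a → σ j ⟪ dil 5 a ⟫ ≋ dil 5 a
    σ-dil j a = ≋[]⇒≋ λ N → go N a
      where
      ζʲ↑5 : constant (ζ ↑ᴷ j) ↑ 5 ≋ 1#
      ζʲ↑5 = trans (↑-congˡ 5 (Hom.⟪⟫-↑ constantHom ζ j)) (trans (↑-assocʳ c j 5) (trans (reflexive (≡.cong (c ↑_) (ℕP.*-comm j 5))) (c↑5* 0 j)))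
      σ-constant : ∀ x → σ j ⟪ constant x ⟫ ≋ constant x
      σ-constant x zero = K.⊗-identityˡ x
      σ-constant x (suc n) = K.⊗-zeroʳ _
      go : ∀ N a → σ j ⟪ dil 5 a ⟫ ≋[ N ] dil 5 a
      go zero a n ()
      go (suc N) a = ≋[]-trans (≋⇒≋[] (begin
          σ j ⟪ dil 5 a ⟫
            ≈⟨ Hom.⟪⟫-cong (σ j) (dil-step 4 a) ⟩
          σ j ⟪ constant (a 0) ⊕ q ↑ 5 ⊗ dil 5 (tail a) ⟫
            ≈⟨ trans (Hom.⟪⟫-⊕ (σ j) (constant (a 0)) (q ↑ 5 ⊗ dil 5 (tail a))) (⊕-cong (σ-constant (a 0)) (Hom.⟪⟫-⊗ (σ j) (q ↑ 5) (dil 5 (tail a)))) ⟩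
          constant (a 0) ⊕ σ j ⟪ q ↑ 5 ⟫ ⊗ σ j ⟪ dil 5 (tail a) ⟫
            ≈⟨ ⊕-congˡ {constant (a 0)} (⊗-congʳ {σ j ⟪ dil 5 (tail a) ⟫} (trans (Hom.⟪⟫-↑ (σ j) q 5) (trans (↑-congˡ 5 (twist-q (ζ ↑ᴷ j)))
                 (trans (↑-distrib-⊗ (constant (ζ ↑ᴷ j)) q 5) (trans (⊗-congʳ {q ↑ 5} ζʲ↑5) (⊗-identityˡ (q ↑ 5))))))) ⟩
          constant (a 0) ⊕ q ↑ 5 ⊗ σ j ⟪ dil 5 (tail a) ⟫ ∎))
        (≋[]-trans (≋[]-⊕ (≋⇒≋[] {constant (a 0)} (refl {constant (a 0)})) (≋[]-weaken (s≤s (ℕP.m≤n+m N 4)) (q↑⊗≋[] 5 (go N (tail a)))))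
          (≋⇒≋[] {constant (a 0) ⊕ q ↑ 5 ⊗ dil 5 (tail a)} (sym (dil-step 4 a))))
        where open ≈-Reasoning

    norm-trinomial : ∀ a b d → a ⊗ d ≋ ⊖ (b ⊗ b) →
      norm (dil 5 a ⊕ q ⊗ dil 5 b ⊕ q ↑ 2 ⊗ dil 5 d) ≋ dil 5 a ↑ 5 ⊕ int (+ 11) ⊗ (q ⊗ dil 5 b) ↑ 5 ⊕ (q ↑ 2 ⊗ dil 5 d) ↑ 5
    norm-trinomial a b d ad = trans
      (⊗-cong (⊗-cong (⊗-cong (⊗-congˡ {x ⊕ y ⊕ z} (trans (eq 1) (⊕-cong (⊕-congˡ {x} (⊗-congʳ {y} (⊗-identityʳ c))) (refl {c ↑ 2 ⊗ z})))) (eq 2)) (eq 3)) (eq 4))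
      (cyclotomic-trinomial c x y z c-root (begin
        dil 5 a ⊗ (q ↑ 2 ⊗ dil 5 d)         ≈⟨ solve 3 (λ a d q → a :* (q :* d) := q :* (a :* d)) refl (dil 5 a) (dil 5 d) (q ↑ 2) ⟩
        q ↑ 2 ⊗ (dil 5 a ⊗ dil 5 d)         ≈⟨ ⊗-congˡ {q ↑ 2} (trans (sym (dil-⊗ 5 a d)) (trans (dil-cong 5 ad) (trans (Hom.⟪⟫-⊖ (dilHom 5) (b ⊗ b)) (⊖-cong (dil-⊗ 5 b b))))) ⟩
        q ↑ 2 ⊗ (⊖ (dil 5 b ⊗ dil 5 b))     ≈⟨ solve 2 (λ q b → q :^ 2 :* (:- (b :* b)) := :- ((q :* b) :* (q :* b))) refl q (dil 5 b) ⟩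
        ⊖ (y ⊗ y) ∎))
      where
      open ≈-Reasoning
      x = dil 5 a
      y = q ⊗ dil 5 b
      z = q ↑ 2 ⊗ dil 5 d
      σ-class : ∀ j k g → σ j ⟪ q ↑ k ⊗ dil 5 g ⟫ ≋ c ↑ (k * j) ⊗ (q ↑ k ⊗ dil 5 g)
      σ-class j k g = trans (Hom.⟪⟫-⊗ (σ j) (q ↑ k) (dil 5 g)) (trans (⊗-cong (trans (σ-q↑ j k) (⊗-congʳ {q ↑ k} (↑-assocʳ c k j))) (σ-dil j g))
        (⊗-assoc (c ↑ (k * j)) (q ↑ k) (dil 5 g)))
      y′ : q ↑ 1 ⊗ dil 5 b ≋ y
      y′ = ⊗-congʳ {dil 5 b} (⊗-identityʳ q)
      eq : ∀ j → σ j ⟪ x ⊕ y ⊕ z ⟫ ≋ x ⊕ c ↑ j ⊗ y ⊕ c ↑ (2 * j) ⊗ z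
      eq j = trans (Hom.⟪⟫-⊕ (σ j) (x ⊕ y) z) (⊕-cong (trans (Hom.⟪⟫-⊕ (σ j) x y) (⊕-cong (σ-dil j a)
        (trans (Hom.⟪⟫-cong (σ j) (sym y′)) (trans (σ-class j 1 b) (⊗-cong (reflexive (≡.cong (c ↑_) (ℕP.*-identityˡ j))) y′))))) (σ-class j 2 d))

intHom : (K : CommutativeRing 0ℓ 0ℓ) → Hom ℤP.+-*-commutativeRing K
intHom K = record
  { ⟪_⟫ = int ; ⟪⟫-cong = λ e → reflexive (≡.cong int e) ; ⟪⟫-⊕ = int-homo-+ ; ⟪⟫-⊗ = int-homo-* ; ⟪⟫-1 = refl }
  where open RingKit K

module MapE {K K′ : CommutativeRing 0ℓ 0ℓ} (φ : Hom K K′) where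
  private
    module P = EulerProduct K
    module P′ = EulerProduct K′
  open SeriesHom φ public
  open PowerSeries K′ hiding (module 𝕊)
  open RingKit seriesRing
  private module H = Hom mapHom

  map-Q : ∀ n → mapSeries (P.Q n) ≋ P′.Q n
  map-Q zero = H.⟪⟫-1
  map-Q (suc n) = trans (H.⟪⟫-⊗ (P.Q n) (P.factor (suc n))) (⊗-cong (map-Q n)
    (trans (H.⟪⟫-⊝ _ _) (⊕-cong H.⟪⟫-1 (⊖-cong (trans (H.⟪⟫-↑ _ (suc n)) (↑-congˡ (suc n) map-q))))))

  map-E : mapSeries P.E ≋ P′.E
  map-E n = map-Q n n

  map-e₀ : mapSeries (Pentagonal.e₀ K) ≋ Pentagonal.e₀ K′
  map-e₀ n = map-E (n * 5)

  map-e₂ : mapSeries (Pentagonal.e₂ K) ≋ Pentagonal.e₂ K′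
  map-e₂ n = trans (H.⟪⟫-⊗ _ _) (⊗-cong (trans (H.⟪⟫-↑ _ 3) (↑-congˡ 3 map-q)) map-E) (suc n * 5)

module QuinticRelation {K Kζ : CommutativeRing 0ℓ 0ℓ} (φ : Hom K Kζ)
  (φ-injective : ∀ {x y} → RingKit._≈_ Kζ (φ ⟪ x ⟫) (φ ⟪ y ⟫) → RingKit._≈_ K x y)
  (ζ : RingKit.Carrier Kζ)
  (Φ-root : CyclotomicNorm.IsRoot Kζ ζ)
  (e₀⊗e₂ : Pentagonal.ProductRelation K) where
  open PowerSeries K hiding (module 𝕊)
  open SeriesMaps K
  open EulerProduct K
  open Pentagonal K

  private
    module N = CyclotomicNorm.At Kζ ζ Φ-root
    module M = MapE φ
    module 𝕊 = RingKit seriesRing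
    module 𝕊′ = RingKit (PowerSeries.seriesRing Kζ)
    module H = Hom M.mapHom
    module E′ = EulerProduct Kζ
    module S′ = SeriesMaps Kζ
    module P′ = PowerSeries Kζ

    G : Series
    G = dil 5 E

    dilated : Series
    dilated = dil 5 e₀ 𝕊.↑ 5 𝕊.⊕ 𝕊.int (+ 11) 𝕊.⊗ (q 𝕊.⊗ dil 5 (𝕊.⊖ G)) 𝕊.↑ 5 𝕊.⊕ (q 𝕊.↑ 2 𝕊.⊗ dil 5 e₂) 𝕊.↑ 5

    map-E-dissected : E′.E P′.≋ S′.dil 5 (M.mapSeries e₀) 𝕊′.⊕ P′.q 𝕊′.⊗ S′.dil 5 (M.mapSeries (𝕊.⊖ G)) 𝕊′.⊕ P′.q 𝕊′.↑ 2 𝕊′.⊗ S′.dil 5 (M.mapSeries e₂)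
    map-E-dissected = begin
      E′.E
        ≈⟨ M.map-E ⟨
      M.mapSeries E
        ≈⟨ H.⟪⟫-cong (𝕊.trans E-dissected (𝕊.⊕-congʳ {q 𝕊.↑ 2 𝕊.⊗ dil 5 e₂} (𝕊.⊕-congˡ {dil 5 e₀} (𝕊.trans
             (𝕊.solve 2 (λ q x → 𝕊.:- (q 𝕊.:* x) 𝕊.:= q 𝕊.:* (𝕊.:- x)) 𝕊.refl q (dil 5 G)) (𝕊.⊗-congˡ {q} (𝕊.sym (Hom.⟪⟫-⊖ (dilHom 5) G))))))) ⟩
      M.mapSeries (dil 5 e₀ 𝕊.⊕ q 𝕊.⊗ dil 5 (𝕊.⊖ G) 𝕊.⊕ q 𝕊.↑ 2 𝕊.⊗ dil 5 e₂)
        ≈⟨ 𝕊′.trans (H.⟪⟫-⊕ (dil 5 e₀ 𝕊.⊕ q 𝕊.⊗ dil 5 (𝕊.⊖ G)) (q 𝕊.↑ 2 𝕊.⊗ dil 5 e₂)) (𝕊′.⊕-cong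
             (𝕊′.trans (H.⟪⟫-⊕ (dil 5 e₀) (q 𝕊.⊗ dil 5 (𝕊.⊖ G))) (𝕊′.⊕-cong (M.map-dil 5 e₀)
               (𝕊′.trans (H.⟪⟫-⊗ q (dil 5 (𝕊.⊖ G))) (𝕊′.⊗-cong M.map-q (M.map-dil 5 (𝕊.⊖ G))))))
             (𝕊′.trans (H.⟪⟫-⊗ (q 𝕊.↑ 2) (dil 5 e₂)) (𝕊′.⊗-cong (𝕊′.trans (H.⟪⟫-↑ q 2) (𝕊′.↑-congˡ 2 M.map-q)) (M.map-dil 5 e₂)))) ⟩
      S′.dil 5 (M.mapSeries e₀) 𝕊′.⊕ P′.q 𝕊′.⊗ S′.dil 5 (M.mapSeries (𝕊.⊖ G)) 𝕊′.⊕ P′.q 𝕊′.↑ 2 𝕊′.⊗ S′.dil 5 (M.mapSeries e₂) ∎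
      where open 𝕊′.≈-Reasoning

    e₀⊗e₂-map : M.mapSeries e₀ 𝕊′.⊗ M.mapSeries e₂ P′.≋ 𝕊′.⊖ (M.mapSeries (𝕊.⊖ G) 𝕊′.⊗ M.mapSeries (𝕊.⊖ G))
    e₀⊗e₂-map = 𝕊′.trans (𝕊′.sym (H.⟪⟫-⊗ e₀ e₂)) (𝕊′.trans (H.⟪⟫-cong (𝕊.trans e₀⊗e₂
        (𝕊.solve 1 (λ g → 𝕊.:- (g 𝕊.:* g) 𝕊.:= 𝕊.:- ((𝕊.:- g) 𝕊.:* (𝕊.:- g))) 𝕊.refl G)))
      (𝕊′.trans (H.⟪⟫-⊖ _) (𝕊′.⊖-cong (H.⟪⟫-⊗ (𝕊.⊖ G) (𝕊.⊖ G)))))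

    norm-dilated : N.norm E′.E P′.≋ M.mapSeries dilated
    norm-dilated = 𝕊′.trans (N.norm-cong map-E-dissected) (𝕊′.trans
      (N.norm-trinomial (M.mapSeries e₀) (M.mapSeries (𝕊.⊖ G)) (M.mapSeries e₂) e₀⊗e₂-map)
      (𝕊′.sym (𝕊′.trans (H.⟪⟫-⊕ (dil 5 e₀ 𝕊.↑ 5 𝕊.⊕ 𝕊.int (+ 11) 𝕊.⊗ (q 𝕊.⊗ dil 5 (𝕊.⊖ G)) 𝕊.↑ 5) ((q 𝕊.↑ 2 𝕊.⊗ dil 5 e₂) 𝕊.↑ 5)) (𝕊′.⊕-cong
        (𝕊′.trans (H.⟪⟫-⊕ (dil 5 e₀ 𝕊.↑ 5) (𝕊.int (+ 11) 𝕊.⊗ (q 𝕊.⊗ dil 5 (𝕊.⊖ G)) 𝕊.↑ 5)) (𝕊′.⊕-cong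
          (𝕊′.trans (H.⟪⟫-↑ (dil 5 e₀) 5) (𝕊′.↑-congˡ 5 (M.map-dil 5 e₀)))
          (𝕊′.trans (H.⟪⟫-⊗ (𝕊.int (+ 11)) ((q 𝕊.⊗ dil 5 (𝕊.⊖ G)) 𝕊.↑ 5)) (𝕊′.⊗-cong (H.⟪⟫-int (+ 11))
            (𝕊′.trans (H.⟪⟫-↑ (q 𝕊.⊗ dil 5 (𝕊.⊖ G)) 5) (𝕊′.↑-congˡ 5 (𝕊′.trans (H.⟪⟫-⊗ q (dil 5 (𝕊.⊖ G))) (𝕊′.⊗-cong M.map-q (M.map-dil 5 (𝕊.⊖ G))))))))))
        (𝕊′.trans (H.⟪⟫-↑ (q 𝕊.↑ 2 𝕊.⊗ dil 5 e₂) 5) (𝕊′.↑-congˡ 5 (𝕊′.trans (H.⟪⟫-⊗ (q 𝕊.↑ 2) (dil 5 e₂))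
          (𝕊′.⊗-cong (𝕊′.trans (H.⟪⟫-↑ q 2) (𝕊′.↑-congˡ 2 M.map-q)) (M.map-dil 5 e₂)))))))))

    dilated⊗ : dilated 𝕊.⊗ dil 5 G ≋ dil 5 (E 𝕊.↑ 6)
    dilated⊗ n = φ-injective (image n)
      where
      open 𝕊′.≈-Reasoning
      map-G : M.mapSeries (dil 5 G) P′.≋ S′.dil 5 (S′.dil 5 E′.E)
      map-G = 𝕊′.trans (M.map-dil 5 G) (S′.dil-cong 5 (𝕊′.trans (M.map-dil 5 E) (S′.dil-cong 5 M.map-E)))
      image : M.mapSeries (dilated 𝕊.⊗ dil 5 G) P′.≋ M.mapSeries (dil 5 (E 𝕊.↑ 6))
      image = begin
        M.mapSeries (dilated 𝕊.⊗ dil 5 G)                   ≈⟨ H.⟪⟫-⊗ dilated (dil 5 G) ⟩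
        M.mapSeries dilated 𝕊′.⊗ M.mapSeries (dil 5 G)      ≈⟨ 𝕊′.⊗-cong (𝕊′.sym norm-dilated) map-G ⟩
        N.norm E′.E 𝕊′.⊗ S′.dil 5 (S′.dil 5 E′.E)           ≈⟨ N.norm-E ⟩
        S′.dil 5 E′.E 𝕊′.↑ 6                                ≈⟨ Hom.⟪⟫-↑ (S′.dilHom 5) E′.E 6 ⟨
        S′.dil 5 (E′.E 𝕊′.↑ 6)                              ≈⟨ S′.dil-cong 5 (𝕊′.trans (H.⟪⟫-↑ E 6) (𝕊′.↑-congˡ 6 M.map-E)) ⟨
        S′.dil 5 (M.mapSeries (E 𝕊.↑ 6))                    ≈⟨ M.map-dil 5 (E 𝕊.↑ 6) ⟨
        M.mapSeries (dil 5 (E 𝕊.↑ 6)) ∎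

  -- The norm of E is computed twice, from the product and from the dissection; the results agree
  -- after q ↦ q⁵, and injectivity of `dil` removes that substitution. Divided by q E(q⁵)⁶ this is
  -- the classical formula for R⁻⁵ - 11 - R⁵, with R the Rogers-Ramanujan continued fraction.
  quintic : (e₀ 𝕊.↑ 5 𝕊.⊝ 𝕊.int (+ 11) 𝕊.⊗ (q 𝕊.⊗ dil 5 E 𝕊.↑ 5) 𝕊.⊕ q 𝕊.↑ 2 𝕊.⊗ e₂ 𝕊.↑ 5) 𝕊.⊗ dil 5 E ≋ E 𝕊.↑ 6
  quintic = dil-injective 4 (𝕊.trans (𝕊.sym undilate) dilated⊗)
    where
    module D = Hom (dilHom 5)
    open 𝕊.≈-Reasoning
    11s = 𝕊.int (+ 11)
    eleven : dil 5 11s ≋ 11s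
    eleven = D.⟪⟫-int (+ 11)
    undilate : dilated 𝕊.⊗ dil 5 G ≋ dil 5 ((e₀ 𝕊.↑ 5 𝕊.⊝ 11s 𝕊.⊗ (q 𝕊.⊗ G 𝕊.↑ 5) 𝕊.⊕ q 𝕊.↑ 2 𝕊.⊗ e₂ 𝕊.↑ 5) 𝕊.⊗ G)
    undilate = begin
      (dil 5 e₀ 𝕊.↑ 5 𝕊.⊕ 11s 𝕊.⊗ (q 𝕊.⊗ dil 5 (𝕊.⊖ G)) 𝕊.↑ 5 𝕊.⊕ (q 𝕊.↑ 2 𝕊.⊗ dil 5 e₂) 𝕊.↑ 5) 𝕊.⊗ dil 5 G
        ≈⟨ 𝕊.⊗-congʳ {dil 5 G} (𝕊.⊕-congʳ {(q 𝕊.↑ 2 𝕊.⊗ dil 5 e₂) 𝕊.↑ 5} (𝕊.⊕-congˡ {dil 5 e₀ 𝕊.↑ 5} (𝕊.⊗-congˡ {11s} (𝕊.↑-congˡ 5 (𝕊.⊗-congˡ {q} (D.⟪⟫-⊖ G)))))) ⟩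
      (dil 5 e₀ 𝕊.↑ 5 𝕊.⊕ 11s 𝕊.⊗ (q 𝕊.⊗ (𝕊.⊖ dil 5 G)) 𝕊.↑ 5 𝕊.⊕ (q 𝕊.↑ 2 𝕊.⊗ dil 5 e₂) 𝕊.↑ 5) 𝕊.⊗ dil 5 G
        ≈⟨ 𝕊.solve 5 (λ a q g b l → (a 𝕊.:^ 5 𝕊.:+ l 𝕊.:* (q 𝕊.:* (𝕊.:- g)) 𝕊.:^ 5 𝕊.:+ (q 𝕊.:^ 2 𝕊.:* b) 𝕊.:^ 5) 𝕊.:* g
             𝕊.:= (a 𝕊.:^ 5 𝕊.:- l 𝕊.:* (q 𝕊.:^ 5 𝕊.:* g 𝕊.:^ 5) 𝕊.:+ (q 𝕊.:^ 5) 𝕊.:^ 2 𝕊.:* b 𝕊.:^ 5) 𝕊.:* g) 𝕊.refl (dil 5 e₀) q (dil 5 G) (dil 5 e₂) 11s ⟩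
      (dil 5 e₀ 𝕊.↑ 5 𝕊.⊝ 11s 𝕊.⊗ (q 𝕊.↑ 5 𝕊.⊗ dil 5 G 𝕊.↑ 5) 𝕊.⊕ (q 𝕊.↑ 5) 𝕊.↑ 2 𝕊.⊗ dil 5 e₂ 𝕊.↑ 5) 𝕊.⊗ dil 5 G
        ≈⟨ 𝕊.⊗-congʳ {dil 5 G} (𝕊.⊕-cong (𝕊.⊕-cong (D.⟪⟫-↑ e₀ 5) (𝕊.⊖-cong (𝕊.trans (D.⟪⟫-⊗ 11s (q 𝕊.⊗ G 𝕊.↑ 5)) (𝕊.⊗-cong eleven
             (𝕊.trans (D.⟪⟫-⊗ q (G 𝕊.↑ 5)) (𝕊.⊗-cong (dil-q 4) (D.⟪⟫-↑ G 5)))))))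
             (𝕊.trans (D.⟪⟫-⊗ (q 𝕊.↑ 2) (e₂ 𝕊.↑ 5)) (𝕊.⊗-cong (𝕊.trans (D.⟪⟫-↑ q 2) (𝕊.↑-congˡ 2 (dil-q 4))) (D.⟪⟫-↑ e₂ 5)))) ⟨
      (dil 5 (e₀ 𝕊.↑ 5) 𝕊.⊝ dil 5 (11s 𝕊.⊗ (q 𝕊.⊗ G 𝕊.↑ 5)) 𝕊.⊕ dil 5 (q 𝕊.↑ 2 𝕊.⊗ e₂ 𝕊.↑ 5)) 𝕊.⊗ dil 5 G
        ≈⟨ 𝕊.trans (D.⟪⟫-⊗ (e₀ 𝕊.↑ 5 𝕊.⊝ 11s 𝕊.⊗ (q 𝕊.⊗ G 𝕊.↑ 5) 𝕊.⊕ q 𝕊.↑ 2 𝕊.⊗ e₂ 𝕊.↑ 5) G) (𝕊.⊗-congʳ {dil 5 G} (𝕊.trans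
             (D.⟪⟫-⊕ (e₀ 𝕊.↑ 5 𝕊.⊝ 11s 𝕊.⊗ (q 𝕊.⊗ G 𝕊.↑ 5)) (q 𝕊.↑ 2 𝕊.⊗ e₂ 𝕊.↑ 5))
             (𝕊.⊕-congʳ {dil 5 (q 𝕊.↑ 2 𝕊.⊗ e₂ 𝕊.↑ 5)} (D.⟪⟫-⊝ (e₀ 𝕊.↑ 5) (11s 𝕊.⊗ (q 𝕊.⊗ G 𝕊.↑ 5)))))) ⟨
      dil 5 ((e₀ 𝕊.↑ 5 𝕊.⊝ 11s 𝕊.⊗ (q 𝕊.⊗ G 𝕊.↑ 5) 𝕊.⊕ q 𝕊.↑ 2 𝕊.⊗ e₂ 𝕊.↑ 5) 𝕊.⊗ G) ∎

-- The two identities over ℤ and their transfer to every commutative ring.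

module IntegralFacts where
  private
    ℤring = ℤP.+-*-commutativeRing

    3-cancel : ∀ x → + 3 ℤ.* x ≡ + 0 → x ≡ + 0
    3-cancel x e with ℤP.i*j≡0⇒i≡0∨j≡0 (+ 3) e
    ... | inj₂ x≡0 = x≡0

    -- τ = ζ + ζ⁻¹ satisfies τ² = -τ + 1, and then ζ² = τζ - 1. Two quadratic steps exhibit ℤ[ζ]
    -- with a basis containing 1, so that ℤ embeds injectively.
    module ℤ[τ] = QuadraticExtension.Adjoin ℤring (ℤ.- + 1) (+ 1)
    module ℤ[ζ] = QuadraticExtension.Adjoin ℤ[τ].extension (+ 0 , + 1) (ℤ.- + 1 , + 0)

  open Dissection ℤring 3-cancel public using (e₀⊗e₂)
  open QuinticRelation (ℤ[ζ].embed ∘ʰ ℤ[τ].embed) (λ e → proj₁ (proj₁ e)) ℤ[ζ].θ ((≡.refl , ≡.refl) , (≡.refl , ≡.refl)) e₀⊗e₂ public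
    using (quintic)

module Transfer {K₀ K : CommutativeRing 0ℓ 0ℓ} (φ : Hom K₀ K) where
  open PowerSeries K
  open SeriesMaps K
  open EulerProduct K
  open Pentagonal K
  open MapE φ
  private
    module H = Hom mapHom
    module P = PowerSeries K₀
    module S = SeriesMaps K₀
    module Z = Pentagonal K₀
    module E = EulerProduct K₀
    G = S.dil 5 E.E

    map-G : mapSeries G ≋ dil 5 E
    map-G = 𝕊.trans (map-dil 5 E.E) (dil-cong 5 map-E)

    pow : ∀ {g} f → mapSeries f ≋ g → ∀ n → mapSeries (f P.𝕊.↑ n) ≋ g 𝕊.↑ n
    pow f e n = 𝕊.trans (H.⟪⟫-↑ f n) (𝕊.↑-congˡ n e)

    times : ∀ {f′ g′} f g → mapSeries f ≋ f′ → mapSeries g ≋ g′ → mapSeries (f P.𝕊.⊗ g) ≋ f′ 𝕊.⊗ g′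
    times f g e e′ = 𝕊.trans (H.⟪⟫-⊗ f g) (𝕊.⊗-cong e e′)

  e₀⊗e₂-transfer : Z.e₀ P.𝕊.⊗ Z.e₂ P.≋ P.𝕊.⊖ (G P.𝕊.⊗ G) → e₀ 𝕊.⊗ e₂ ≋ 𝕊.⊖ (dil 5 E 𝕊.⊗ dil 5 E)
  e₀⊗e₂-transfer e = 𝕊.trans (𝕊.sym (times Z.e₀ Z.e₂ map-e₀ map-e₂)) (𝕊.trans (H.⟪⟫-cong e)
    (𝕊.trans (H.⟪⟫-⊖ (G P.𝕊.⊗ G)) (𝕊.⊖-cong (times G G map-G map-G))))

  quintic-transfer :
    (Z.e₀ P.𝕊.↑ 5 P.𝕊.⊝ P.𝕊.int (+ 11) P.𝕊.⊗ (P.q P.𝕊.⊗ G P.𝕊.↑ 5) P.𝕊.⊕ P.q P.𝕊.↑ 2 P.𝕊.⊗ Z.e₂ P.𝕊.↑ 5) P.𝕊.⊗ G P.≋ E.E P.𝕊.↑ 6 →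
    (e₀ 𝕊.↑ 5 𝕊.⊝ 𝕊.int (+ 11) 𝕊.⊗ (q 𝕊.⊗ dil 5 E 𝕊.↑ 5) 𝕊.⊕ q 𝕊.↑ 2 𝕊.⊗ e₂ 𝕊.↑ 5) 𝕊.⊗ dil 5 E ≋ E 𝕊.↑ 6
  quintic-transfer e = 𝕊.trans (𝕊.sym (times (a P.𝕊.⊝ b P.𝕊.⊕ c) G
      (𝕊.trans (H.⟪⟫-⊕ (a P.𝕊.⊝ b) c) (𝕊.⊕-cong (𝕊.trans (H.⟪⟫-⊝ a b) (𝕊.⊕-cong (pow Z.e₀ map-e₀ 5) (𝕊.⊖-cong
        (times (P.𝕊.int (+ 11)) (P.q P.𝕊.⊗ G P.𝕊.↑ 5) (H.⟪⟫-int (+ 11)) (times P.q (G P.𝕊.↑ 5) map-q (pow G map-G 5))))))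
        (times (P.q P.𝕊.↑ 2) (Z.e₂ P.𝕊.↑ 5) (pow P.q map-q 2) (pow Z.e₂ map-e₂ 5)))) map-G))
    (𝕊.trans (H.⟪⟫-cong e) (pow E.E map-E 6))
    where
    a = Z.e₀ P.𝕊.↑ 5
    b = P.𝕊.int (+ 11) P.𝕊.⊗ (P.q P.𝕊.⊗ G P.𝕊.↑ 5)
    c = P.q P.𝕊.↑ 2 P.𝕊.⊗ Z.e₂ P.𝕊.↑ 5

module EulerFacts (K : CommutativeRing 0ℓ 0ℓ) where
  open PowerSeries K
  open SeriesMaps K
  open EulerProduct K
  open Pentagonal K

  e₀⊗e₂ : e₀ 𝕊.⊗ e₂ ≋ 𝕊.⊖ (dil 5 E 𝕊.⊗ dil 5 E)
  e₀⊗e₂ = Transfer.e₀⊗e₂-transfer (intHom K) IntegralFacts.e₀⊗e₂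

  quintic : (e₀ 𝕊.↑ 5 𝕊.⊝ 𝕊.int (+ 11) 𝕊.⊗ (q 𝕊.⊗ dil 5 E 𝕊.↑ 5) 𝕊.⊕ q 𝕊.↑ 2 𝕊.⊗ e₂ 𝕊.↑ 5) 𝕊.⊗ dil 5 E ≋ E 𝕊.↑ 6
  quintic = Transfer.quintic-transfer (intHom K) IntegralFacts.quintic

-- Laurent series and the operators V and U on them.

module Localisation (R : CommutativeRing 0ℓ 0ℓ) where
  open RingKit R

  module Away (t : Carrier) (t-cancel : ∀ {x y} → t ⊗ x ≈ t ⊗ y → x ≈ y) where

    -- The denominator is stored beside its exponent: identities between sums and products stay
    -- polynomial in `num` and `den`, while `U` needs the exponent to shift the numerator.
    record Fraction : Set where
      no-eta-equality
      constructor frac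
      field
        num den : Carrier
        exponent : ℕ
        den≈ : den ≈ t ↑ exponent

    open Fraction public

    t↑-cancel : ∀ k {x y} → t ↑ k ⊗ x ≈ t ↑ k ⊗ y → x ≈ y
    t↑-cancel zero e = trans (sym (⊗-identityˡ _)) (trans e (⊗-identityˡ _))
    t↑-cancel (suc k) e = t↑-cancel k (t-cancel (trans (sym (⊗-assoc _ _ _)) (trans e (⊗-assoc _ _ _))))

    den-cancel : ∀ (s : Fraction) {x y} → den s ⊗ x ≈ den s ⊗ y → x ≈ y
    den-cancel s e = t↑-cancel (exponent s) (trans (sym (⊗-congʳ (den≈ s))) (trans e (⊗-congʳ (den≈ s))))

    infix 4 _≈ᶠ_
    -- Plain cross-multiplication is transitive here because t, and hence every denominator, is
    -- cancellable.
    record _≈ᶠ_ (r s : Fraction) : Set where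
      constructor cross
      field uncross : num r ⊗ den s ≈ num s ⊗ den r

    open _≈ᶠ_ public

    private
      den-⊗ : ∀ r s → den r ⊗ den s ≈ t ↑ (exponent r + exponent s)
      den-⊗ r s = trans (⊗-cong (den≈ r) (den≈ s)) (sym (↑-homo-⊗ t (exponent r) (exponent s)))

    _⊕ᶠ_ _⊗ᶠ_ : Fraction → Fraction → Fraction
    r ⊕ᶠ s = frac (num r ⊗ den s ⊕ num s ⊗ den r) (den r ⊗ den s) (exponent r + exponent s) (den-⊗ r s)
    r ⊗ᶠ s = frac (num r ⊗ num s) (den r ⊗ den s) (exponent r + exponent s) (den-⊗ r s)

    ⊖ᶠ_ : Fraction → Fraction
    ⊖ᶠ s = frac (⊖ num s) (den s) (exponent s) (den≈ s)

    ι : Carrier → Fraction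
    ι x = frac x 1# 0 refl

    private
      transᶠ : ∀ {r s u} → r ≈ᶠ s → s ≈ᶠ u → r ≈ᶠ u
      transᶠ {r} {s} {u} (cross e) (cross e′) = cross (den-cancel s (begin
        den s ⊗ (num r ⊗ den u)    ≈⟨ solve 3 (λ a b c → a :* (b :* c) := (b :* a) :* c) refl (den s) (num r) (den u) ⟩
        (num r ⊗ den s) ⊗ den u    ≈⟨ ⊗-congʳ e ⟩
        (num s ⊗ den r) ⊗ den u    ≈⟨ solve 3 (λ a b c → (a :* b) :* c := (a :* c) :* b) refl (num s) (den r) (den u) ⟩
        (num s ⊗ den u) ⊗ den r    ≈⟨ ⊗-congʳ e′ ⟩
        (num u ⊗ den s) ⊗ den r    ≈⟨ solve 3 (λ a b c → (a :* b) :* c := b :* (a :* c)) refl (num u) (den s) (den r) ⟩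
        den s ⊗ (num u ⊗ den r) ∎))
        where open ≈-Reasoning

      ⊕ᶠ-cong : ∀ {r s u v} → r ≈ᶠ s → u ≈ᶠ v → (r ⊕ᶠ u) ≈ᶠ (s ⊕ᶠ v)
      ⊕ᶠ-cong {r} {s} {u} {v} (cross e) (cross e′) = cross (begin
        (num r ⊗ den u ⊕ num u ⊗ den r) ⊗ (den s ⊗ den v)
          ≈⟨ solve 6 (λ a a′ c c′ b′ d′ → (a :* c′ :+ c :* a′) :* (b′ :* d′) := (a :* b′) :* (c′ :* d′) :+ (c :* d′) :* (a′ :* b′)) refl
               (num r) (den r) (num u) (den u) (den s) (den v) ⟩
        (num r ⊗ den s) ⊗ (den u ⊗ den v) ⊕ (num u ⊗ den v) ⊗ (den r ⊗ den s)
          ≈⟨ ⊕-cong (⊗-congʳ e) (⊗-congʳ e′) ⟩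
        (num s ⊗ den r) ⊗ (den u ⊗ den v) ⊕ (num v ⊗ den u) ⊗ (den r ⊗ den s)
          ≈⟨ solve 6 (λ b a′ c′ b′ d d′ → (b :* a′) :* (c′ :* d′) :+ (d :* c′) :* (a′ :* b′) := (b :* d′ :+ d :* b′) :* (a′ :* c′)) refl
               (num s) (den r) (den u) (den s) (num v) (den v) ⟩
        (num s ⊗ den v ⊕ num v ⊗ den s) ⊗ (den r ⊗ den u) ∎)
        where open ≈-Reasoning

      ⊗ᶠ-cong : ∀ {r s u v} → r ≈ᶠ s → u ≈ᶠ v → (r ⊗ᶠ u) ≈ᶠ (s ⊗ᶠ v)
      ⊗ᶠ-cong {r} {s} {u} {v} (cross e) (cross e′) = cross (trans
        (solve 4 (λ a b c d → (a :* b) :* (c :* d) := (a :* c) :* (b :* d)) refl (num r) (num u) (den s) (den v))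
        (trans (⊗-cong e e′) (solve 4 (λ a b c d → (a :* b) :* (c :* d) := (a :* c) :* (b :* d)) refl (num s) (den r) (num v) (den u))))

      ⊕ᶠ-comm : ∀ r s → (r ⊕ᶠ s) ≈ᶠ (s ⊕ᶠ r)
      ⊕ᶠ-comm r s = cross (solve 4 (λ a a′ b b′ → (a :* b′ :+ b :* a′) :* (b′ :* a′) := (b :* a′ :+ a :* b′) :* (a′ :* b′)) refl (num r) (den r) (num s) (den s))

      ⊕ᶠ-assoc : ∀ r s u → ((r ⊕ᶠ s) ⊕ᶠ u) ≈ᶠ (r ⊕ᶠ (s ⊕ᶠ u))
      ⊕ᶠ-assoc r s u = cross (solve 6 (λ a a′ b b′ c c′ → ((a :* b′ :+ b :* a′) :* c′ :+ c :* (a′ :* b′)) :* (a′ :* (b′ :* c′))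
        := (a :* (b′ :* c′) :+ (b :* c′ :+ c :* b′) :* a′) :* ((a′ :* b′) :* c′)) refl (num r) (den r) (num s) (den s) (num u) (den u))

      ⊕ᶠ-identityˡ : ∀ s → (ι 0# ⊕ᶠ s) ≈ᶠ s
      ⊕ᶠ-identityˡ s = cross (solve 2 (λ a b → (con (+ 0) :* b :+ a :* con (+ 1)) :* b := a :* (con (+ 1) :* b)) refl (num s) (den s))

      ⊖ᶠ-inverseˡ : ∀ s → ((⊖ᶠ s) ⊕ᶠ s) ≈ᶠ ι 0#
      ⊖ᶠ-inverseˡ s = cross (solve 2 (λ a b → (:- a :* b :+ a :* b) :* con (+ 1) := con (+ 0) :* (b :* b)) refl (num s) (den s))

      ⊗ᶠ-comm : ∀ r s → (r ⊗ᶠ s) ≈ᶠ (s ⊗ᶠ r)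
      ⊗ᶠ-comm r s = cross (⊗-cong (⊗-comm _ _) (⊗-comm _ _))

      ⊗ᶠ-assoc : ∀ r s u → ((r ⊗ᶠ s) ⊗ᶠ u) ≈ᶠ (r ⊗ᶠ (s ⊗ᶠ u))
      ⊗ᶠ-assoc r s u = cross (⊗-cong (⊗-assoc _ _ _) (sym (⊗-assoc _ _ _)))

      ⊗ᶠ-identityˡ : ∀ s → (ι 1# ⊗ᶠ s) ≈ᶠ s
      ⊗ᶠ-identityˡ s = cross (⊗-cong (⊗-identityˡ _) (sym (⊗-identityˡ _)))

      ⊗ᶠ-distribˡ : ∀ r s u → (r ⊗ᶠ (s ⊕ᶠ u)) ≈ᶠ ((r ⊗ᶠ s) ⊕ᶠ (r ⊗ᶠ u))
      ⊗ᶠ-distribˡ r s u = cross (solve 6 (λ a a′ b b′ c c′ → (a :* (b :* c′ :+ c :* b′)) :* ((a′ :* b′) :* (a′ :* c′))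
        := ((a :* b) :* (a′ :* c′) :+ (a :* c) :* (a′ :* b′)) :* (a′ :* (b′ :* c′))) refl (num r) (den r) (num s) (den s) (num u) (den u))

    localisation : CommutativeRing 0ℓ 0ℓ
    localisation = record
      { Carrier = Fraction ; _≈_ = _≈ᶠ_ ; _+_ = _⊕ᶠ_ ; _*_ = _⊗ᶠ_ ; -_ = ⊖ᶠ_ ; 0# = ι 0# ; 1# = ι 1#
      ; isCommutativeRing = record
        { isRing = record
          { +-isAbelianGroup = record
            { isGroup = record
              { isMonoid = record
                { isSemigroup = record
                  { isMagma = record
                    { isEquivalence = record { refl = cross refl ; sym = λ (cross e) → cross (sym e) ; trans = transᶠ }
                    ; ∙-cong = ⊕ᶠ-cong }
                  ; assoc = ⊕ᶠ-assoc }
                ; identity = ⊕ᶠ-identityˡ , λ s → transᶠ (⊕ᶠ-comm s (ι 0#)) (⊕ᶠ-identityˡ s) }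
              ; inverse = ⊖ᶠ-inverseˡ , λ s → transᶠ (⊕ᶠ-comm s (⊖ᶠ s)) (⊖ᶠ-inverseˡ s)
              ; ⁻¹-cong = λ (cross e) → cross (trans (solve 2 (λ a b → :- a :* b := :- (a :* b)) refl _ _)
                  (trans (⊖-cong e) (solve 2 (λ a b → :- (a :* b) := :- a :* b) refl _ _))) }
            ; comm = ⊕ᶠ-comm }
          ; *-cong = ⊗ᶠ-cong
          ; *-assoc = ⊗ᶠ-assoc
          ; *-identity = ⊗ᶠ-identityˡ , λ s → transᶠ (⊗ᶠ-comm s (ι 1#)) (⊗ᶠ-identityˡ s)
          ; distrib = ⊗ᶠ-distribˡ , λ r s u → transᶠ (⊗ᶠ-comm (s ⊕ᶠ u) r) (transᶠ (⊗ᶠ-distribˡ r s u) (⊕ᶠ-cong (⊗ᶠ-comm r s) (⊗ᶠ-comm r u))) }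
        ; *-comm = ⊗ᶠ-comm } }

    ιHom : Hom R localisation
    ιHom = record
      { ⟪_⟫ = ι
      ; ⟪⟫-cong = λ e → cross (⊗-congʳ e)
      ; ⟪⟫-⊕ = λ x y → cross (solve 2 (λ x y → (x :+ y) :* (con (+ 1) :* con (+ 1)) := (x :* con (+ 1) :+ y :* con (+ 1)) :* con (+ 1)) refl x y)
      ; ⟪⟫-⊗ = λ x y → cross (⊗-congˡ (⊗-identityˡ 1#))
      ; ⟪⟫-1 = cross refl }

    t⁻¹ : Fraction
    t⁻¹ = frac 1# t 1 (sym (⊗-identityʳ t))

    t⊗t⁻¹ : (ι t ⊗ᶠ t⁻¹) ≈ᶠ ι 1#
    t⊗t⁻¹ = cross (solve 1 (λ t → (t :* con (+ 1)) :* con (+ 1) := con (+ 1) :* (con (+ 1) :* t)) refl t)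

module LaurentSeries (K : CommutativeRing 0ℓ 0ℓ) where
  open PowerSeries K using (Series; seriesRing; q; q-cancel)
  open SeriesMaps K
  open Localisation.Away seriesRing q q-cancel public
  open RingKit seriesRing

  dilᶠ-exponent : ∀ k s → dil (suc k) (den s) ≈ q ↑ (suc k * exponent s)
  dilᶠ-exponent k s = trans (dil-cong (suc k) (den≈ s)) (trans (Hom.⟪⟫-↑ (dilHom (suc k)) q (exponent s))
    (trans (↑-congˡ (exponent s) (dil-q k)) (↑-assocʳ q (suc k) (exponent s))))

  dilᶠ : ℕ → Fraction → Fraction
  dilᶠ k s = frac (dil (suc k) (num s)) (dil (suc k) (den s)) (suc k * exponent s) (dilᶠ-exponent k s)

  dilᶠHom : ℕ → Hom localisation localisation
  dilᶠHom k = record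
    { ⟪_⟫ = dilᶠ k
    ; ⟪⟫-cong = λ {r} {s} (cross e) → cross (trans (sym (D.⟪⟫-⊗ (num r) (den s))) (trans (D.⟪⟫-cong e) (D.⟪⟫-⊗ (num s) (den r))))
    ; ⟪⟫-⊕ = λ r s → cross (⊗-cong
        (trans (D.⟪⟫-⊕ (num r ⊗ den s) (num s ⊗ den r)) (⊕-cong (D.⟪⟫-⊗ (num r) (den s)) (D.⟪⟫-⊗ (num s) (den r))))
        (sym (D.⟪⟫-⊗ (den r) (den s))))
    ; ⟪⟫-⊗ = λ r s → cross (⊗-cong (D.⟪⟫-⊗ (num r) (num s)) (sym (D.⟪⟫-⊗ (den r) (den s))))
    ; ⟪⟫-1 = cross (⊗-comm (dil (suc k) 1#) 1#) }
    where module D = Hom (dilHom (suc k))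

  -- f / q^k = q^{4k} f / q^{5k}
  U : Fraction → Fraction
  U s = frac (section 5 (q ↑ (4 * exponent s) ⊗ num s)) (q ↑ exponent s) (exponent s) (refl {q ↑ exponent s})

  private
    section-q↑5 : ∀ k f → section 5 (q ↑ (5 * k) ⊗ f) ≈ q ↑ k ⊗ section 5 f
    section-q↑5 k f = trans (λ n → ⊗-congʳ {f} (sym (trans (Hom.⟪⟫-↑ (dilHom 5) q k) (trans (↑-congˡ k (dil-q 4)) (↑-assocʳ q 5 k)))) (n * 5))
      (section-dil-⊗ 4 (q ↑ k) f)

    q↑-sum : ∀ a b f → q ↑ (a + b) ⊗ f ≈ q ↑ a ⊗ (q ↑ b ⊗ f)
    q↑-sum a b f = trans (⊗-congʳ {f} (↑-homo-⊗ q a b)) (⊗-assoc (q ↑ a) (q ↑ b) f)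

  -- `U` reads the exponent of the representative, so independence of the representative has
  -- content: both sides are compared after multiplication by powers q^(5k), which pass through the
  -- section as q^k.
  U-cong : ∀ {r s} → r ≈ᶠ s → U r ≈ᶠ U s
  U-cong {r} {s} (cross e) = cross (begin
    section 5 (q ↑ (4 * k) ⊗ num r) ⊗ q ↑ l
      ≈⟨ ⊗-comm (section 5 (q ↑ (4 * k) ⊗ num r)) (q ↑ l) ⟩
    q ↑ l ⊗ section 5 (q ↑ (4 * k) ⊗ num r)
      ≈⟨ section-q↑5 l (q ↑ (4 * k) ⊗ num r) ⟨
    section 5 (q ↑ (5 * l) ⊗ (q ↑ (4 * k) ⊗ num r))
      ≈⟨ (λ n → middle (n * 5)) ⟩
    section 5 (q ↑ (5 * k) ⊗ (q ↑ (4 * l) ⊗ num s))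
      ≈⟨ section-q↑5 k (q ↑ (4 * l) ⊗ num s) ⟩
    q ↑ k ⊗ section 5 (q ↑ (4 * l) ⊗ num s)
      ≈⟨ ⊗-comm (q ↑ k) (section 5 (q ↑ (4 * l) ⊗ num s)) ⟩
    section 5 (q ↑ (4 * l) ⊗ num s) ⊗ q ↑ k ∎)
    where
    open ≈-Reasoning
    k = exponent r
    l = exponent s
    side : ∀ k l f → q ↑ (5 * l) ⊗ (q ↑ (4 * k) ⊗ f) ≈ q ↑ (4 * k + 4 * l) ⊗ (f ⊗ q ↑ l)
    side k l f = trans (sym (q↑-sum (5 * l) (4 * k) f)) (trans
      (⊗-congʳ {f} (reflexive (≡.cong (q ↑_) (ℕ-solve 2 (λ k l → ν 5 ∙ l ∔ ν 4 ∙ k ≐ (ν 4 ∙ k ∔ ν 4 ∙ l) ∔ l) ≡.refl k l))))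
      (trans (q↑-sum (4 * k + 4 * l) l f) (⊗-congˡ {q ↑ (4 * k + 4 * l)} (⊗-comm (q ↑ l) f))))
    middle : q ↑ (5 * l) ⊗ (q ↑ (4 * k) ⊗ num r) ≈ q ↑ (5 * k) ⊗ (q ↑ (4 * l) ⊗ num s)
    middle = trans (side k l (num r)) (trans (⊗-cong (reflexive (≡.cong (q ↑_) (ℕP.+-comm (4 * k) (4 * l))))
      (trans (⊗-congˡ {num r} (sym (den≈ s))) (trans e (⊗-congˡ {num s} (den≈ r))))) (sym (side l k (num s))))

  U-⊗ : ∀ r s → U (dilᶠ 4 r ⊗ᶠ s) ≈ᶠ (r ⊗ᶠ U s)
  U-⊗ r s = cross (begin
    section 5 (q ↑ (4 * (5 * k + l)) ⊗ (dil 5 (num r) ⊗ num s)) ⊗ (den r ⊗ q ↑ l)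
      ≈⟨ ⊗-cong (λ n → inner (n * 5)) (⊗-congʳ {q ↑ l} (den≈ r)) ⟩
    section 5 (dil 5 (q ↑ (4 * k) ⊗ num r) ⊗ (q ↑ (4 * l) ⊗ num s)) ⊗ (q ↑ k ⊗ q ↑ l)
      ≈⟨ ⊗-congʳ {q ↑ k ⊗ q ↑ l} (section-dil-⊗ 4 (q ↑ (4 * k) ⊗ num r) (q ↑ (4 * l) ⊗ num s)) ⟩
    (q ↑ (4 * k) ⊗ num r) ⊗ u ⊗ (q ↑ k ⊗ q ↑ l)
      ≈⟨ solve 5 (λ a n u x y → (a :* n) :* u :* (x :* y) := (n :* u) :* (a :* (x :* y))) refl (q ↑ (4 * k)) (num r) u (q ↑ k) (q ↑ l) ⟩
    (num r ⊗ u) ⊗ (q ↑ (4 * k) ⊗ (q ↑ k ⊗ q ↑ l))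
      ≈⟨ ⊗-congˡ {num r ⊗ u} (trans (⊗-congˡ {q ↑ (4 * k)} (sym (↑-homo-⊗ q k l))) (trans (sym (↑-homo-⊗ q (4 * k) (k + l)))
           (reflexive (≡.cong (q ↑_) (ℕ-solve 2 (λ k l → ν 4 ∙ k ∔ (k ∔ l) ≐ ν 5 ∙ k ∔ l) ≡.refl k l))))) ⟩
    (num r ⊗ u) ⊗ q ↑ (5 * k + l) ∎)
    where
    open ≈-Reasoning
    k = exponent r
    l = exponent s
    u = section 5 (q ↑ (4 * l) ⊗ num s)
    inner : q ↑ (4 * (5 * k + l)) ⊗ (dil 5 (num r) ⊗ num s) ≈ dil 5 (q ↑ (4 * k) ⊗ num r) ⊗ (q ↑ (4 * l) ⊗ num s)
    inner = trans (⊗-congʳ {dil 5 (num r) ⊗ num s} (trans (reflexive (≡.cong (q ↑_)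
        (ℕ-solve 2 (λ k l → ν 4 ∙ (ν 5 ∙ k ∔ l) ≐ ν 5 ∙ (ν 4 ∙ k) ∔ ν 4 ∙ l) ≡.refl k l))) (↑-homo-⊗ q (5 * (4 * k)) (4 * l))))
      (trans (solve 4 (λ a b c d → (a :* b) :* (c :* d) := (a :* c) :* (b :* d)) refl (q ↑ (5 * (4 * k))) (q ↑ (4 * l)) (dil 5 (num r)) (num s))
        (⊗-congʳ {q ↑ (4 * l) ⊗ num s} (sym (trans (dil-⊗ 5 (q ↑ (4 * k)) (num r)) (⊗-congʳ {dil 5 (num r)}
          (trans (Hom.⟪⟫-↑ (dilHom 5) q (4 * k)) (trans (↑-congˡ (4 * k) (dil-q 4)) (↑-assocʳ q 5 (4 * k)))))))))

  U-⊕ : ∀ r s → U (r ⊕ᶠ s) ≈ᶠ (U r ⊕ᶠ U s)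
  U-⊕ r s = cross (⊗-cong {section 5 (q ↑ (4 * (k + l)) ⊗ (num r ⊗ den s ⊕ num s ⊗ den r))} (begin
    section 5 (q ↑ (4 * (k + l)) ⊗ (num r ⊗ den s ⊕ num s ⊗ den r))
      ≈⟨ (λ n → trans (⊗-distribˡ (q ↑ (4 * (k + l))) (num r ⊗ den s) (num s ⊗ den r)) (⊕-cong (side k l (num r) (den s) (den≈ s) ≡.refl)
           (side l k (num s) (den r) (den≈ r) (≡.cong (λ i → 4 * i) (ℕP.+-comm k l)))) (n * 5)) ⟩
    section 5 (q ↑ (5 * l) ⊗ (q ↑ (4 * k) ⊗ num r)) ⊕ section 5 (q ↑ (5 * k) ⊗ (q ↑ (4 * l) ⊗ num s))
      ≈⟨ ⊕-cong (trans (section-q↑5 l (q ↑ (4 * k) ⊗ num r)) (⊗-comm (q ↑ l) (section 5 (q ↑ (4 * k) ⊗ num r))))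
           (trans (section-q↑5 k (q ↑ (4 * l) ⊗ num s)) (⊗-comm (q ↑ k) (section 5 (q ↑ (4 * l) ⊗ num s)))) ⟩
    section 5 (q ↑ (4 * k) ⊗ num r) ⊗ q ↑ l ⊕ section 5 (q ↑ (4 * l) ⊗ num s) ⊗ q ↑ k ∎) (sym (↑-homo-⊗ q k l)))
    where
    open ≈-Reasoning
    k = exponent r
    l = exponent s
    side : ∀ k l f e {m} → e ≈ q ↑ l → m ≡ 4 * (k + l) → q ↑ m ⊗ (f ⊗ e) ≈ q ↑ (5 * l) ⊗ (q ↑ (4 * k) ⊗ f)
    side k l f e e≈ ≡.refl = trans (⊗-congˡ {q ↑ (4 * (k + l))} (trans (⊗-congˡ {f} e≈) (⊗-comm f (q ↑ l))))
      (trans (sym (q↑-sum (4 * (k + l)) l f)) (trans (⊗-congʳ {f} (reflexive (≡.cong (q ↑_)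
        (ℕ-solve 2 (λ k l → ν 4 ∙ (k ∔ l) ∔ l ≐ ν 5 ∙ l ∔ ν 4 ∙ k) ≡.refl k l)))) (q↑-sum (5 * l) (4 * k) f)))

  U-ι : ∀ f → U (ι f) ≈ᶠ ι (section 5 f)
  U-ι f = cross (⊗-congʳ {1#} {section 5 (1# ⊗ f)} (λ n → ⊗-identityˡ f (n * 5)))

-- The modular relations at 5, power sums of the roots and the Hecke operator.

-- U and V stand for the operators on Laurent series Σ f(n) q^n ↦ Σ f(5n) q^n and f(q) ↦ f(q⁵), and H for η(24z).
module TraceOperator (L : CommutativeRing 0ℓ 0ℓ) (V : Hom L L) where
  open RingKit L

  module At
    (U : Carrier → Carrier)
    (U-cong : ∀ {f g} → f ≈ g → U f ≈ U g)
    (U-⊕ : ∀ f g → U (f ⊕ g) ≈ U f ⊕ U g)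
    (U-⊗ : ∀ f g → U (V ⟪ f ⟫ ⊗ g) ≈ f ⊗ U g)
    (U-1 : U 1# ≈ 1#)
    (H H⁻¹ y z : Carrier) (H⊗H⁻¹ : H ⊗ H⁻¹ ≈ 1#) (y⊗z : y ⊗ z ≈ ⊖ 1#)
    (H-dissected : H ≈ (y ⊝ 1# ⊕ z) ⊗ V ⟪ V ⟪ H ⟫ ⟫)
    (U-y : ∀ i → 1 ≤ i → i ≤ 4 → U (y ↑ i) ≈ 0#)
    (U-z : ∀ i → 1 ≤ i → i ≤ 4 → U (z ↑ i) ≈ 0#) where

    module V = Hom V

    U-int : ∀ c f → U (int c ⊗ f) ≈ int c ⊗ U f
    U-int c f = trans (U-cong (⊗-congʳ (sym (V.⟪⟫-int c)))) (U-⊗ (int c) f)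

    U-const : ∀ c → U (int c) ≈ int c
    U-const c = trans (U-cong (sym (⊗-identityʳ _))) (trans (U-int c 1#) (trans (⊗-congˡ U-1) (⊗-identityʳ _)))

    X : Carrier
    X = y ⊝ 1# ⊕ z

    private
      u : Carrier
      u = y ⊕ z

      -- As z = -y⁻¹, a polynomial in y + z is a Laurent polynomial in y, and in degrees below 5 the
      -- operator U keeps only its constant term. The values below are such constant terms.
      U-sum : ∀ i → 1 ≤ i → i ≤ 4 → U (y ↑ i ⊕ z ↑ i) ≈ 0#
      U-sum i 1≤i i≤4 = trans (U-⊕ _ _) (trans (⊕-cong (U-y i 1≤i i≤4) (U-z i 1≤i i≤4)) (⊕-identityˡ 0#))

      u² : u ↑ 2 ≈ (y ↑ 2 ⊕ z ↑ 2) ⊕ int (ℤ.- + 2)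
      u² = trans (solve 2 (λ y z → (y :+ z) :^ 2 := (y :^ 2 :+ z :^ 2) :+ con (+ 2) :* (y :* z)) refl y z)
        (trans (⊕-congˡ (⊗-congˡ y⊗z)) (solve 2 (λ y z → (y :^ 2 :+ z :^ 2) :+ con (+ 2) :* (:- con (+ 1)) := (y :^ 2 :+ z :^ 2) :+ con (ℤ.- + 2)) refl y z))

      u³ : u ↑ 3 ≈ (y ↑ 3 ⊕ z ↑ 3) ⊕ int (ℤ.- + 3) ⊗ (y ↑ 1 ⊕ z ↑ 1)
      u³ = trans (solve 2 (λ y z → (y :+ z) :^ 3 := (y :^ 3 :+ z :^ 3) :+ con (+ 3) :* (y :* z) :* (y :+ z)) refl y z)
        (trans (⊕-congˡ (⊗-congʳ (⊗-congˡ y⊗z))) (solve 2 (λ y z → (y :^ 3 :+ z :^ 3) :+ con (+ 3) :* (:- con (+ 1)) :* (y :+ z)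
          := (y :^ 3 :+ z :^ 3) :+ con (ℤ.- + 3) :* (y :^ 1 :+ z :^ 1)) refl y z))

      u⁴ : u ↑ 4 ≈ (y ↑ 4 ⊕ z ↑ 4) ⊕ int (ℤ.- + 4) ⊗ (y ↑ 2 ⊕ z ↑ 2) ⊕ int (+ 6)
      u⁴ = trans (solve 2 (λ y z → (y :+ z) :^ 4 := (y :^ 4 :+ z :^ 4) :+ con (+ 4) :* (y :* z) :* (y :^ 2 :+ z :^ 2) :+ con (+ 6) :* ((y :* z) :* (y :* z))) refl y z)
        (trans (⊕-cong (⊕-congˡ (⊗-congʳ (⊗-congˡ y⊗z))) (⊗-congˡ (⊗-cong y⊗z y⊗z)))
          (solve 2 (λ y z → (y :^ 4 :+ z :^ 4) :+ con (+ 4) :* (:- con (+ 1)) :* (y :^ 2 :+ z :^ 2) :+ con (+ 6) :* ((:- con (+ 1)) :* (:- con (+ 1)))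
            := (y :^ 4 :+ z :^ 4) :+ con (ℤ.- + 4) :* (y :^ 2 :+ z :^ 2) :+ con (+ 6)) refl y z))

      U-u : U (y ⊕ z) ≈ 0#
      U-u = trans (U-cong (sym (⊕-cong (⊗-identityʳ y) (⊗-identityʳ z)))) (U-sum 1 (s≤s z≤n) (s≤s z≤n))

      U-u² : U (u ↑ 2) ≈ int (ℤ.- + 2)
      U-u² = trans (U-cong u²) (trans (U-⊕ _ _) (trans (⊕-cong (U-sum 2 (s≤s z≤n) (s≤s (s≤s z≤n))) (U-const (ℤ.- + 2))) (⊕-identityˡ _)))

      U-u³ : U (u ↑ 3) ≈ 0#
      U-u³ = trans (U-cong u³) (trans (U-⊕ _ _) (trans (⊕-cong (U-sum 3 (s≤s z≤n) (s≤s (s≤s (s≤s z≤n))))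
        (trans (U-int (ℤ.- + 3) _) (⊗-congˡ (U-sum 1 (s≤s z≤n) (s≤s z≤n))))) (solve 0 (con (+ 0) :+ con (ℤ.- + 3) :* con (+ 0) := con (+ 0)) refl)))

      U-u⁴ : U (u ↑ 4) ≈ int (+ 6)
      U-u⁴ = trans (U-cong u⁴) (trans (U-⊕ _ _) (trans (⊕-cong (trans (U-⊕ _ _) (⊕-cong (U-sum 4 (s≤s z≤n) ℕP.≤-refl)
        (trans (U-int (ℤ.- + 4) _) (⊗-congˡ (U-sum 2 (s≤s z≤n) (s≤s (s≤s z≤n))))))) (U-const (+ 6))) (solve 0 (con (+ 0) :+ con (ℤ.- + 4) :* con (+ 0) :+ con (+ 6) := con (+ 6)) refl)))

      U₂ : ∀ {a b a′ b′} c → U a ≈ a′ → U b ≈ b′ → U (a ⊕ int c ⊗ b) ≈ a′ ⊕ int c ⊗ b′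
      U₂ c e e′ = trans (U-⊕ _ _) (⊕-cong e (trans (U-int c _) (⊗-congˡ e′)))

    U-X¹ : U X ≈ int (ℤ.- + 1)
    U-X¹ = trans (U-cong (solve 2 (λ y z → y :- con (+ 1) :+ z := (y :+ z) :+ con (ℤ.- + 1) :* con (+ 1)) refl y z))
      (trans (U₂ (ℤ.- + 1) U-u U-1) (solve 0 (con (+ 0) :+ con (ℤ.- + 1) :* con (+ 1) := con (ℤ.- + 1)) refl))

    U-X² : U (X ↑ 2) ≈ int (ℤ.- + 1)
    U-X² = trans (U-cong (solve 2 (λ y z → (y :- con (+ 1) :+ z) :^ 2 := (y :+ z) :^ 2 :+ con (ℤ.- + 2) :* (y :+ z) :+ con (+ 1) :* con (+ 1)) refl y z))
      (trans (U₂ (+ 1) (U₂ (ℤ.- + 2) U-u² U-u) U-1)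
        (solve 0 (con (ℤ.- + 2) :+ con (ℤ.- + 2) :* con (+ 0) :+ con (+ 1) :* con (+ 1) := con (ℤ.- + 1)) refl))

    U-X³ : U (X ↑ 3) ≈ int (+ 5)
    U-X³ = trans (U-cong (solve 2 (λ y z → (y :- con (+ 1) :+ z) :^ 3 := (y :+ z) :^ 3 :+ con (ℤ.- + 3) :* (y :+ z) :^ 2 :+ con (+ 3) :* (y :+ z) :+ con (ℤ.- + 1) :* con (+ 1)) refl y z))
      (trans (U₂ (ℤ.- + 1) (U₂ (+ 3) (U₂ (ℤ.- + 3) U-u³ U-u²) U-u) U-1)
        (solve 0 (con (+ 0) :+ con (ℤ.- + 3) :* con (ℤ.- + 2) :+ con (+ 3) :* con (+ 0) :+ con (ℤ.- + 1) :* con (+ 1) := con (+ 5)) refl))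

    -- The value is 6 + 6 · (-2) + 1, the constant term of (y - 1 - y⁻¹)⁴; its divisibility by 5
    -- settles the case p = 5.
    U-X⁴ : U (X ↑ 4) ≈ int (ℤ.- + 5)
    U-X⁴ = trans (U-cong (solve 2 (λ y z → (y :- con (+ 1) :+ z) :^ 4
        := (y :+ z) :^ 4 :+ con (ℤ.- + 4) :* (y :+ z) :^ 3 :+ con (+ 6) :* (y :+ z) :^ 2 :+ con (ℤ.- + 4) :* (y :+ z) :+ con (+ 1) :* con (+ 1)) refl y z))
      (trans (U₂ (+ 1) (U₂ (ℤ.- + 4) (U₂ (+ 6) (U₂ (ℤ.- + 4) U-u⁴ U-u³) U-u²) U-u) U-1)
        (solve 0 (con (+ 6) :+ con (ℤ.- + 4) :* con (+ 0) :+ con (+ 6) :* con (ℤ.- + 2) :+ con (ℤ.- + 4) :* con (+ 0) :+ con (+ 1) :* con (+ 1) := con (ℤ.- + 5)) refl))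

    -- For p = 5 this alone gives a progression.
    U-H⁴ : ∀ g → U (H ↑ 4 ⊗ V ⟪ g ⟫) ≈ int (ℤ.- + 5) ⊗ (V ⟪ H ⟫ ↑ 4 ⊗ g)
    U-H⁴ g = begin
      U (H ↑ 4 ⊗ V ⟪ g ⟫)                              ≈⟨ U-cong (⊗-congʳ (trans (↑-congˡ 4 H-dissected) (↑-distrib-⊗ X _ 4))) ⟩
      U (X ↑ 4 ⊗ V ⟪ V ⟪ H ⟫ ⟫ ↑ 4 ⊗ V ⟪ g ⟫)          ≈⟨ U-cong (solve 3 (λ x a b → x :* a :* b := (a :* b) :* x) refl _ _ _) ⟩
      U (V ⟪ V ⟪ H ⟫ ⟫ ↑ 4 ⊗ V ⟪ g ⟫ ⊗ X ↑ 4)          ≈⟨ U-cong (⊗-congʳ (trans (V.⟪⟫-⊗ _ _) (⊗-congʳ (V.⟪⟫-↑ _ 4)))) ⟨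
      U (V ⟪ V ⟪ H ⟫ ↑ 4 ⊗ g ⟫ ⊗ X ↑ 4)                ≈⟨ U-⊗ _ _ ⟩
      V ⟪ H ⟫ ↑ 4 ⊗ g ⊗ U (X ↑ 4)                      ≈⟨ ⊗-congˡ U-X⁴ ⟩
      V ⟪ H ⟫ ↑ 4 ⊗ g ⊗ int (ℤ.- + 5)                  ≈⟨ ⊗-comm _ _ ⟩
      int (ℤ.- + 5) ⊗ (V ⟪ H ⟫ ↑ 4 ⊗ g) ∎
      where open ≈-Reasoning

    G G⁻¹ x σ : Carrier
    G = V ⟪ H ⟫
    G⁻¹ = V ⟪ H⁻¹ ⟫
    x = H ↑ 2 ⊗ G⁻¹ ↑ 2
    σ = G ↑ 2 ⊗ H⁻¹ ↑ 2

    G⊗G⁻¹ : G ⊗ G⁻¹ ≈ 1#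
    G⊗G⁻¹ = trans (sym (V.⟪⟫-⊗ H H⁻¹)) (trans (V.⟪⟫-cong H⊗H⁻¹) V.⟪⟫-1)

    x⊗σ : x ⊗ σ ≈ 1#
    x⊗σ = trans (solve 4 (λ h h′ g g′ → (h :^ 2 :* g′ :^ 2) :* (g :^ 2 :* h′ :^ 2) := (h :* h′) :^ 2 :* (g :* g′) :^ 2) refl H H⁻¹ G G⁻¹)
      (trans (⊗-cong (↑-congˡ 2 H⊗H⁻¹) (↑-congˡ 2 G⊗G⁻¹)) (solve 0 (con (+ 1) :^ 2 :* con (+ 1) :^ 2 := con (+ 1)) refl))

    module Quintic (quintic : y ↑ 5 ⊝ int (+ 11) ⊕ z ↑ 5 ≈ V ⟪ x ↑ 3 ⟫) where

      -- With yz = -1 and u = y + z one has y⁵ + z⁵ = u⁵ + 5u³ + 5u. Expanding at u = X + 1 produces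
      -- the constant 11, which the quintic relation cancels.
      poly-X : X ↑ 5 ⊕ int (+ 5) ⊗ X ↑ 4 ⊕ int (+ 15) ⊗ X ↑ 3 ⊕ int (+ 25) ⊗ X ↑ 2 ⊕ int (+ 25) ⊗ X ≈ V ⟪ x ↑ 3 ⟫
      poly-X = begin
        X ↑ 5 ⊕ int (+ 5) ⊗ X ↑ 4 ⊕ int (+ 15) ⊗ X ↑ 3 ⊕ int (+ 25) ⊗ X ↑ 2 ⊕ int (+ 25) ⊗ X
          ≈⟨ in-u X≈ ⟩
        u ↑ 5 ⊕ int (+ 5) ⊗ u ↑ 3 ⊕ int (+ 5) ⊗ u ⊝ int (+ 11)
          ≈⟨ solve 2 (λ y z → let u = y :+ z ; w = y :* z in u :^ 5 :+ con (+ 5) :* u :^ 3 :+ con (+ 5) :* u :- con (+ 11)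
               := y :^ 5 :- con (+ 11) :+ z :^ 5 :+ (w :+ con (+ 1)) :* (con (+ 5) :* (u :^ 3) :- con (+ 5) :* (w :- con (+ 1)) :* u)) refl y z ⟩
        y ↑ 5 ⊝ int (+ 11) ⊕ z ↑ 5 ⊕ (y ⊗ z ⊕ 1#) ⊗ (int (+ 5) ⊗ u ↑ 3 ⊝ int (+ 5) ⊗ (y ⊗ z ⊝ 1#) ⊗ u)
          ≈⟨ ⊕-congˡ (⊗-congʳ (trans (⊕-congʳ y⊗z) (⊖-inverseˡ 1#))) ⟩
        y ↑ 5 ⊝ int (+ 11) ⊕ z ↑ 5 ⊕ 0# ⊗ (int (+ 5) ⊗ u ↑ 3 ⊝ int (+ 5) ⊗ (y ⊗ z ⊝ 1#) ⊗ u)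
          ≈⟨ trans (⊕-congˡ (⊗-zeroˡ _)) (⊕-identityʳ _) ⟩
        y ↑ 5 ⊝ int (+ 11) ⊕ z ↑ 5
          ≈⟨ quintic ⟩
        V ⟪ x ↑ 3 ⟫ ∎
        where
        open ≈-Reasoning
        X≈ : X ≈ u ⊝ 1#
        X≈ = solve 2 (λ y z → y :- con (+ 1) :+ z := (y :+ z) :- con (+ 1)) refl y z
        in-u : ∀ {t} → t ≈ u ⊝ 1# → t ↑ 5 ⊕ int (+ 5) ⊗ t ↑ 4 ⊕ int (+ 15) ⊗ t ↑ 3 ⊕ int (+ 25) ⊗ t ↑ 2 ⊕ int (+ 25) ⊗ t
          ≈ u ↑ 5 ⊕ int (+ 5) ⊗ u ↑ 3 ⊕ int (+ 5) ⊗ u ⊝ int (+ 11)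
        in-u e = trans (⊕-cong (⊕-cong (⊕-cong (⊕-cong (↑-congˡ 5 e) (⊗-congˡ (↑-congˡ 4 e))) (⊗-congˡ (↑-congˡ 3 e))) (⊗-congˡ (↑-congˡ 2 e))) (⊗-congˡ e))
          (solve 1 (λ u → let X = u :- con (+ 1) in X :^ 5 :+ con (+ 5) :* X :^ 4 :+ con (+ 15) :* X :^ 3 :+ con (+ 25) :* X :^ 2 :+ con (+ 25) :* X
               := u :^ 5 :+ con (+ 5) :* u :^ 3 :+ con (+ 5) :* u :- con (+ 11)) refl u)

      v : Carrier
      v = x ↑ 3

      private
        U₅ : ∀ {f a b c e} → f ≈ int (ℤ.- + 5) ⊗ a ⊕ int (ℤ.- + 15) ⊗ b ⊕ int (ℤ.- + 25) ⊗ c ⊕ int (ℤ.- + 25) ⊗ e →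
          U f ≈ int (ℤ.- + 5) ⊗ U a ⊕ int (ℤ.- + 15) ⊗ U b ⊕ int (ℤ.- + 25) ⊗ U c ⊕ int (ℤ.- + 25) ⊗ U e
        U₅ e = trans (U-cong e) (U₂ (ℤ.- + 25) (U₂ (ℤ.- + 25) (U₂ (ℤ.- + 15) (U-int (ℤ.- + 5) _) refl) refl) refl)

      -- `poly-X` makes X a root of a monic quintic whose constant term lies in the image of V and
      -- therefore leaves U as the factor `v`.
      U-X-step : ∀ a → U (X ↑ (5 + a)) ≈ v ⊗ U (X ↑ a) ⊕ (int (ℤ.- + 5) ⊗ U (X ↑ (4 + a)) ⊕ int (ℤ.- + 15) ⊗ U (X ↑ (3 + a)) ⊕ int (ℤ.- + 25) ⊗ U (X ↑ (2 + a)) ⊕ int (ℤ.- + 25) ⊗ U (X ↑ (1 + a)))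
      U-X-step a = begin
        U (X ↑ (5 + a))
          ≈⟨ U-cong (solve 2 (λ t m → t :* (t :* (t :* (t :* (t :* m))))
               := (t :^ 5 :+ con (+ 5) :* t :^ 4 :+ con (+ 15) :* t :^ 3 :+ con (+ 25) :* t :^ 2 :+ con (+ 25) :* t) :* m
                 :+ (con (ℤ.- + 5) :* (t :* (t :* (t :* (t :* m)))) :+ con (ℤ.- + 15) :* (t :* (t :* (t :* m))) :+ con (ℤ.- + 25) :* (t :* (t :* m)) :+ con (ℤ.- + 25) :* (t :* m))) refl
               X (X ↑ a)) ⟩
        U (tx ⊗ X ↑ a ⊕ (int (ℤ.- + 5) ⊗ X ↑ (4 + a) ⊕ int (ℤ.- + 15) ⊗ X ↑ (3 + a) ⊕ int (ℤ.- + 25) ⊗ X ↑ (2 + a) ⊕ int (ℤ.- + 25) ⊗ X ↑ (1 + a)))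
          ≈⟨ U-⊕ _ _ ⟩
        U (tx ⊗ X ↑ a) ⊕ U (int (ℤ.- + 5) ⊗ X ↑ (4 + a) ⊕ int (ℤ.- + 15) ⊗ X ↑ (3 + a) ⊕ int (ℤ.- + 25) ⊗ X ↑ (2 + a) ⊕ int (ℤ.- + 25) ⊗ X ↑ (1 + a))
          ≈⟨ ⊕-cong (trans (U-cong (⊗-congʳ poly-X)) (U-⊗ v (X ↑ a))) (U₅ refl) ⟩
        v ⊗ U (X ↑ a) ⊕ (int (ℤ.- + 5) ⊗ U (X ↑ (4 + a)) ⊕ int (ℤ.- + 15) ⊗ U (X ↑ (3 + a)) ⊕ int (ℤ.- + 25) ⊗ U (X ↑ (2 + a)) ⊕ int (ℤ.- + 25) ⊗ U (X ↑ (1 + a))) ∎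
        where
        open ≈-Reasoning
        tx = X ↑ 5 ⊕ int (+ 5) ⊗ X ↑ 4 ⊕ int (+ 15) ⊗ X ↑ 3 ⊕ int (+ 25) ⊗ X ↑ 2 ⊕ int (+ 25) ⊗ X

      private
        X-step : ∀ a {p₀ p₁ p₂ p₃ p₄} → U (X ↑ a) ≈ p₀ → U (X ↑ (1 + a)) ≈ p₁ → U (X ↑ (2 + a)) ≈ p₂ → U (X ↑ (3 + a)) ≈ p₃ → U (X ↑ (4 + a)) ≈ p₄ →
          U (X ↑ (5 + a)) ≈ v ⊗ p₀ ⊕ (int (ℤ.- + 5) ⊗ p₄ ⊕ int (ℤ.- + 15) ⊗ p₃ ⊕ int (ℤ.- + 25) ⊗ p₂ ⊕ int (ℤ.- + 25) ⊗ p₁)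
        X-step a e₀ e₁ e₂ e₃ e₄ = trans (U-X-step a) (⊕-cong (⊗-congˡ e₀) (⊕-cong (⊕-cong (⊕-cong (⊗-congˡ e₄) (⊗-congˡ e₃)) (⊗-congˡ e₂)) (⊗-congˡ e₁)))

        P₁ : U (X ↑ 1) ≈ int (ℤ.- + 1)
        P₁ = trans (U-cong (⊗-identityʳ X)) U-X¹

        P₅ : U (X ↑ 5) ≈ v
        P₅ = trans (X-step 0 U-1 P₁ U-X² U-X³ U-X⁴) (solve 1 (λ v → v :* con (+ 1)
          :+ (con (ℤ.- + 5) :* con (ℤ.- + 5) :+ con (ℤ.- + 15) :* con (+ 5) :+ con (ℤ.- + 25) :* con (ℤ.- + 1) :+ con (ℤ.- + 25) :* con (ℤ.- + 1)) := v) refl v)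

        P₆ : U (X ↑ 6) ≈ int (ℤ.- + 6) ⊗ v ⊕ int (ℤ.- + 25)
        P₆ = trans (X-step 1 P₁ U-X² U-X³ U-X⁴ P₅) (solve 1 (λ v → v :* con (ℤ.- + 1)
          :+ (con (ℤ.- + 5) :* v :+ con (ℤ.- + 15) :* con (ℤ.- + 5) :+ con (ℤ.- + 25) :* con (+ 5) :+ con (ℤ.- + 25) :* con (ℤ.- + 1)) := con (ℤ.- + 6) :* v :+ con (ℤ.- + 25)) refl v)

        P₇ : U (X ↑ 7) ≈ int (+ 14) ⊗ v ⊕ int (+ 125)
        P₇ = trans (X-step 2 U-X² U-X³ U-X⁴ P₅ P₆) (solve 1 (λ v → v :* con (ℤ.- + 1)
          :+ (con (ℤ.- + 5) :* (con (ℤ.- + 6) :* v :+ con (ℤ.- + 25)) :+ con (ℤ.- + 15) :* v :+ con (ℤ.- + 25) :* con (ℤ.- + 5) :+ con (ℤ.- + 25) :* con (+ 5)) := con (+ 14) :* v :+ con (+ 125)) refl v)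

        P₈ : U (X ↑ 8) ≈ int (ℤ.- + 125)
        P₈ = trans (X-step 3 U-X³ U-X⁴ P₅ P₆ P₇) (solve 1 (λ v → v :* con (+ 5)
          :+ (con (ℤ.- + 5) :* (con (+ 14) :* v :+ con (+ 125)) :+ con (ℤ.- + 15) :* (con (ℤ.- + 6) :* v :+ con (ℤ.- + 25)) :+ con (ℤ.- + 25) :* v :+ con (ℤ.- + 25) :* con (ℤ.- + 5))
          := con (ℤ.- + 125)) refl v)

        P₉ : U (X ↑ 9) ≈ int (ℤ.- + 90) ⊗ v ⊕ int (ℤ.- + 625)
        P₉ = trans (X-step 4 U-X⁴ P₅ P₆ P₇ P₈) (solve 1 (λ v → v :* con (ℤ.- + 5)
          :+ (con (ℤ.- + 5) :* con (ℤ.- + 125) :+ con (ℤ.- + 15) :* (con (+ 14) :* v :+ con (+ 125)) :+ con (ℤ.- + 25) :* (con (ℤ.- + 6) :* v :+ con (ℤ.- + 25)) :+ con (ℤ.- + 25) :* v)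
          := con (ℤ.- + 90) :* v :+ con (ℤ.- + 625)) refl v)

        P₁₀ : U (X ↑ 10) ≈ v ↑ 2 ⊕ int (+ 250) ⊗ v ⊕ int (+ 2500)
        P₁₀ = trans (X-step 5 P₅ P₆ P₇ P₈ P₉) (solve 1 (λ v → v :* v
          :+ (con (ℤ.- + 5) :* (con (ℤ.- + 90) :* v :+ con (ℤ.- + 625)) :+ con (ℤ.- + 15) :* con (ℤ.- + 125) :+ con (ℤ.- + 25) :* (con (+ 14) :* v :+ con (+ 125))
            :+ con (ℤ.- + 25) :* (con (ℤ.- + 6) :* v :+ con (ℤ.- + 25)))
          := v :^ 2 :+ con (+ 250) :* v :+ con (+ 2500)) refl v)

      -- γ is forced by γ s = s⁶ + 10 s³ + 5: it is s⁵ + 10 s² + 5/s with s = 5σ and 1/σ = x. The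
      -- point is that x satisfies the same sextic with V γ in place of γ.
      γ s : Carrier
      γ = int (+ 3125) ⊗ σ ↑ 5 ⊕ int (+ 250) ⊗ σ ↑ 2 ⊕ x
      s = int (+ 5) ⊗ σ

      private
        A B : Carrier
        A = V ⟪ σ ⟫
        B = V ⟪ x ⟫

        B⊗A : B ⊗ A ≈ 1#
        B⊗A = trans (sym (V.⟪⟫-⊗ x σ)) (trans (V.⟪⟫-cong x⊗σ) V.⟪⟫-1)

      x-X : x ≈ X ↑ 2 ⊗ A
      x-X = begin
        H ↑ 2 ⊗ G⁻¹ ↑ 2                                ≈⟨ ⊗-congʳ (↑-congˡ 2 H-dissected) ⟩
        (X ⊗ V ⟪ G ⟫) ↑ 2 ⊗ G⁻¹ ↑ 2                    ≈⟨ solve 3 (λ x a b → (x :* a) :^ 2 :* b := x :^ 2 :* (a :^ 2 :* b)) refl X (V ⟪ G ⟫) (G⁻¹ ↑ 2) ⟩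
        X ↑ 2 ⊗ (V ⟪ G ⟫ ↑ 2 ⊗ G⁻¹ ↑ 2)                ≈⟨ ⊗-congˡ (trans (V.⟪⟫-⊗ _ _) (⊗-cong (V.⟪⟫-↑ G 2) (V.⟪⟫-↑ H⁻¹ 2))) ⟨
        X ↑ 2 ⊗ A ∎
        where open ≈-Reasoning

      V-γ : V ⟪ γ ⟫ ≈ int (+ 3125) ⊗ A ↑ 5 ⊕ int (+ 250) ⊗ A ↑ 2 ⊕ B
      V-γ = trans (V.⟪⟫-⊕ _ _) (⊕-congʳ (trans (V.⟪⟫-⊕ _ _) (⊕-cong (term (+ 3125) 5) (term (+ 250) 2))))
        where
        term : ∀ c n → V ⟪ int c ⊗ σ ↑ n ⟫ ≈ int c ⊗ A ↑ n
        term c n = trans (V.⟪⟫-⊗ _ _) (⊗-cong (V.⟪⟫-int c) (V.⟪⟫-↑ σ n))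

      sextic : V ⟪ γ ⟫ ⊗ x ≈ x ↑ 6 ⊕ int (+ 10) ⊗ x ↑ 3 ⊕ int (+ 5)
      sextic = begin
        V ⟪ γ ⟫ ⊗ x
          ≈⟨ ⊗-cong V-γ x-X ⟩
        (int (+ 3125) ⊗ A ↑ 5 ⊕ int (+ 250) ⊗ A ↑ 2 ⊕ B) ⊗ (X ↑ 2 ⊗ A)
          ≈⟨ solve 3 (λ A B X → (con (+ 3125) :* A :^ 5 :+ con (+ 250) :* A :^ 2 :+ B) :* (X :^ 2 :* A)
               := X :^ 2 :* (con (+ 3125) :* A :^ 6 :+ con (+ 250) :* A :^ 3 :* con (+ 1) :^ 3 :+ B :* A)) refl A B X ⟩
        X ↑ 2 ⊗ (int (+ 3125) ⊗ A ↑ 6 ⊕ int (+ 250) ⊗ A ↑ 3 ⊗ 1# ↑ 3 ⊕ B ⊗ A)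
          -- Powers of B A = 1 are inserted to make the expression homogeneous, so that A⁶ factors
          -- out.
          ≈⟨ ⊗-congˡ (⊕-cong (⊕-congˡ (⊗-congˡ (↑-congˡ 3 B⊗A))) one⁶) ⟨
        X ↑ 2 ⊗ (int (+ 3125) ⊗ A ↑ 6 ⊕ int (+ 250) ⊗ A ↑ 3 ⊗ (B ⊗ A) ↑ 3 ⊕ (B ⊗ A) ↑ 6)
          ≈⟨ solve 3 (λ A B X → X :^ 2 :* (con (+ 3125) :* A :^ 6 :+ con (+ 250) :* A :^ 3 :* (B :* A) :^ 3 :+ (B :* A) :^ 6)
               := A :^ 6 :* (X :^ 2 :* (con (+ 3125) :+ con (+ 250) :* (B :^ 3) :+ (B :^ 3) :^ 2))) refl A B X ⟩
        A ↑ 6 ⊗ (X ↑ 2 ⊗ (int (+ 3125) ⊕ int (+ 250) ⊗ B ↑ 3 ⊕ (B ↑ 3) ↑ 2))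
          ≈⟨ ⊗-congˡ (⊗-congˡ (⊕-cong (⊕-congˡ (⊗-congˡ B³)) (↑-congˡ 2 B³))) ⟩
        A ↑ 6 ⊗ (X ↑ 2 ⊗ (int (+ 3125) ⊕ int (+ 250) ⊗ tx ⊕ tx ↑ 2))
          -- The modular relation proper: with t = V(x³) written as a polynomial in X by `poly-X`,
          -- this identity turns the formula for V γ into the sextic for x.
          ≈⟨ ⊗-congˡ (solve 1 (λ X → let t = X :^ 5 :+ con (+ 5) :* X :^ 4 :+ con (+ 15) :* X :^ 3 :+ con (+ 25) :* X :^ 2 :+ con (+ 25) :* X in
               X :^ 2 :* (con (+ 3125) :+ con (+ 250) :* t :+ t :^ 2) := X :^ 12 :+ con (+ 10) :* X :^ 6 :* t :+ con (+ 5) :* t :^ 2) refl X) ⟩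
        A ↑ 6 ⊗ (X ↑ 12 ⊕ int (+ 10) ⊗ X ↑ 6 ⊗ tx ⊕ int (+ 5) ⊗ tx ↑ 2)
          ≈⟨ ⊗-congˡ (⊕-cong (⊕-congˡ (⊗-congˡ B³)) (⊗-congˡ (↑-congˡ 2 B³))) ⟨
        A ↑ 6 ⊗ (X ↑ 12 ⊕ int (+ 10) ⊗ X ↑ 6 ⊗ B ↑ 3 ⊕ int (+ 5) ⊗ (B ↑ 3) ↑ 2)
          ≈⟨ solve 3 (λ A B X → A :^ 6 :* (X :^ 12 :+ con (+ 10) :* X :^ 6 :* B :^ 3 :+ con (+ 5) :* (B :^ 3) :^ 2)
               := (X :^ 2 :* A) :^ 6 :+ con (+ 10) :* (X :^ 2 :* A) :^ 3 :* (B :* A) :^ 3 :+ con (+ 5) :* (B :* A) :^ 6) refl A B X ⟩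
        (X ↑ 2 ⊗ A) ↑ 6 ⊕ int (+ 10) ⊗ (X ↑ 2 ⊗ A) ↑ 3 ⊗ (B ⊗ A) ↑ 3 ⊕ int (+ 5) ⊗ (B ⊗ A) ↑ 6
          ≈⟨ ⊕-cong (⊕-cong (↑-congˡ 6 (sym x-X)) (⊗-cong (⊗-congˡ (↑-congˡ 3 (sym x-X))) (↑-congˡ 3 B⊗A))) (⊗-congˡ (↑-congˡ 6 B⊗A)) ⟩
        x ↑ 6 ⊕ int (+ 10) ⊗ x ↑ 3 ⊗ 1# ↑ 3 ⊕ int (+ 5) ⊗ 1# ↑ 6
          ≈⟨ solve 1 (λ x → x :^ 6 :+ con (+ 10) :* x :^ 3 :* con (+ 1) :^ 3 :+ con (+ 5) :* con (+ 1) :^ 6 := x :^ 6 :+ con (+ 10) :* x :^ 3 :+ con (+ 5)) refl x ⟩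
        x ↑ 6 ⊕ int (+ 10) ⊗ x ↑ 3 ⊕ int (+ 5) ∎
        where
        open ≈-Reasoning
        tx = X ↑ 5 ⊕ int (+ 5) ⊗ X ↑ 4 ⊕ int (+ 15) ⊗ X ↑ 3 ⊕ int (+ 25) ⊗ X ↑ 2 ⊕ int (+ 25) ⊗ X
        one⁶ : (B ⊗ A) ↑ 6 ≈ B ⊗ A
        one⁶ = trans (↑-congˡ 6 B⊗A) (trans (solve 0 (con (+ 1) :^ 6 := con (+ 1)) refl) (sym B⊗A))
        B³ : B ↑ 3 ≈ tx
        B³ = trans (sym (V.⟪⟫-↑ x 3)) (sym poly-X)

      γ⊗s : γ ⊗ s ≈ s ↑ 6 ⊕ int (+ 10) ⊗ s ↑ 3 ⊕ int (+ 5)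
      γ⊗s = trans (solve 2 (λ x σ → (con (+ 3125) :* σ :^ 5 :+ con (+ 250) :* σ :^ 2 :+ x) :* (con (+ 5) :* σ)
          := (con (+ 5) :* σ) :^ 6 :+ con (+ 10) :* (con (+ 5) :* σ) :^ 3 :+ con (+ 5) :* (x :* σ)) refl x σ)
        (trans (⊕-congˡ (⊗-congˡ x⊗σ)) (⊕-congˡ (⊗-identityʳ _)))

      U-x : ∀ b {p} → U (X ↑ (2 * b)) ≈ p → U (x ↑ b) ≈ σ ↑ b ⊗ p
      U-x b {p} e = trans (U-cong (trans (↑-congˡ b x-X) (trans (↑-distrib-⊗ (X ↑ 2) A b) (trans (⊗-comm _ _)
        (⊗-cong (sym (V.⟪⟫-↑ σ b)) (↑-assocʳ X 2 b)))))) (trans (U-⊗ (σ ↑ b) _) (⊗-congˡ e))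

      -- The inverse of 5 is represented by an integer, so that integer coefficient vectors are
      -- closed under division by 5.
      module Hecke (⅕ : ℤ) (5⊗⅕ : int (+ 5) ⊗ int ⅕ ≈ 1#) where

        τ : Carrier
        τ = int ⅕ ⊗ x

        s⊗τ : s ⊗ τ ≈ 1#
        s⊗τ = trans (solve 4 (λ a b x σ → (a :* σ) :* (b :* x) := (a :* b) :* (x :* σ)) refl (int (+ 5)) (int ⅕) x σ)
          (trans (⊗-cong 5⊗⅕ x⊗σ) (⊗-identityʳ 1#))

        -- Dividing the sextic by x expresses V γ through s and τ = 1/s exactly as γ is expressed
        -- through x and σ = 1/x. By this symmetry one expansion later serves both summands of the
        -- trace.
        V-γ-s : V ⟪ γ ⟫ ≈ int (+ 3125) ⊗ τ ↑ 5 ⊕ int (+ 250) ⊗ τ ↑ 2 ⊕ s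
        V-γ-s = begin
          V ⟪ γ ⟫                                        ≈⟨ ⊗-identityʳ _ ⟨
          V ⟪ γ ⟫ ⊗ 1#                                   ≈⟨ ⊗-congˡ x⊗σ ⟨
          V ⟪ γ ⟫ ⊗ (x ⊗ σ)                              ≈⟨ ⊗-assoc _ _ _ ⟨
          V ⟪ γ ⟫ ⊗ x ⊗ σ                                ≈⟨ ⊗-congʳ sextic ⟩
          (x ↑ 6 ⊕ int (+ 10) ⊗ x ↑ 3 ⊕ int (+ 5)) ⊗ σ   ≈⟨ solve 2 (λ x σ → (x :^ 6 :+ con (+ 10) :* x :^ 3 :+ con (+ 5)) :* σ
                                                              := x :^ 5 :* (x :* σ) :+ con (+ 10) :* x :^ 2 :* (x :* σ) :+ con (+ 5) :* σ) refl x σ ⟩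
          x ↑ 5 ⊗ (x ⊗ σ) ⊕ int (+ 10) ⊗ x ↑ 2 ⊗ (x ⊗ σ) ⊕ s ≈⟨ ⊕-congʳ (⊕-cong (⊗-congˡ (one 5)) (⊗-congˡ (one 2))) ⟩
          x ↑ 5 ⊗ (int (+ 5) ⊗ int ⅕) ↑ 5 ⊕ int (+ 10) ⊗ x ↑ 2 ⊗ (int (+ 5) ⊗ int ⅕) ↑ 2 ⊕ s
            ≈⟨ solve 3 (λ x b s → x :^ 5 :* (con (+ 5) :* b) :^ 5 :+ con (+ 10) :* x :^ 2 :* (con (+ 5) :* b) :^ 2 :+ s
                 := con (+ 3125) :* (b :* x) :^ 5 :+ con (+ 250) :* (b :* x) :^ 2 :+ s) refl x (int ⅕) s ⟩
          int (+ 3125) ⊗ τ ↑ 5 ⊕ int (+ 250) ⊗ τ ↑ 2 ⊕ s ∎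
          where
          open ≈-Reasoning
          one : ∀ n → x ⊗ σ ≈ (int (+ 5) ⊗ int ⅕) ↑ n
          one n = trans x⊗σ (sym (trans (↑-congˡ n 5⊗⅕) (1↑ n)))

        -- S c j is the sum of the (j − c)-th powers of the six roots X of X⁶ + 10 X³ − γ X + 5,
        -- namely s and the five conjugates of x(q^{1/5}).
        S : ℕ → ℕ → Carrier
        S c j = int (+ 5) ⊗ U (x ↑ j ⊗ σ ↑ c) ⊕ s ↑ j ⊗ τ ↑ c

        S-shift : ∀ c j → S (suc c) (suc j) ≈ S c j
        S-shift c j = ⊕-cong (⊗-congˡ (U-cong (shift x⊗σ))) (shift s⊗τ)
          where
          shift : ∀ {a b} → a ⊗ b ≈ 1# → a ↑ suc j ⊗ b ↑ suc c ≈ a ↑ j ⊗ b ↑ c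
          shift {a} {b} e = trans (solve 4 (λ a b m n → (a :* m) :* (b :* n) := (a :* b) :* (m :* n)) refl a b (a ↑ j) (b ↑ c))
            (trans (⊗-congʳ e) (⊗-identityˡ _))

        S-step : ∀ c j → S c (6 + j) ≈ int (ℤ.- + 10) ⊗ S c (3 + j) ⊕ int (ℤ.- + 5) ⊗ S c j ⊕ γ ⊗ S c (1 + j)
        S-step c j = begin
          int (+ 5) ⊗ U (x ↑ (6 + j) ⊗ σ ↑ c) ⊕ s ↑ (6 + j) ⊗ τ ↑ c
            ≈⟨ ⊕-cong (⊗-congˡ U-part) (root-step (sym γ⊗s) (τ ↑ c)) ⟩
          int (+ 5) ⊗ (int (ℤ.- + 10) ⊗ U (x ↑ (3 + j) ⊗ σ ↑ c) ⊕ int (ℤ.- + 5) ⊗ U (x ↑ j ⊗ σ ↑ c) ⊕ γ ⊗ U (x ↑ (1 + j) ⊗ σ ↑ c))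
            ⊕ (int (ℤ.- + 10) ⊗ (s ↑ (3 + j) ⊗ τ ↑ c) ⊕ int (ℤ.- + 5) ⊗ (s ↑ j ⊗ τ ↑ c) ⊕ γ ⊗ (s ↑ (1 + j) ⊗ τ ↑ c))
            ≈⟨ solve 7 (λ a b c a′ b′ c′ g → con (+ 5) :* (con (ℤ.- + 10) :* a :+ con (ℤ.- + 5) :* b :+ g :* c) :+ (con (ℤ.- + 10) :* a′ :+ con (ℤ.- + 5) :* b′ :+ g :* c′)
                 := con (ℤ.- + 10) :* (con (+ 5) :* a :+ a′) :+ con (ℤ.- + 5) :* (con (+ 5) :* b :+ b′) :+ g :* (con (+ 5) :* c :+ c′)) refl
                 (U (x ↑ (3 + j) ⊗ σ ↑ c)) (U (x ↑ j ⊗ σ ↑ c)) (U (x ↑ (1 + j) ⊗ σ ↑ c)) (s ↑ (3 + j) ⊗ τ ↑ c) (s ↑ j ⊗ τ ↑ c) (s ↑ (1 + j) ⊗ τ ↑ c) γ ⟩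
          int (ℤ.- + 10) ⊗ S c (3 + j) ⊕ int (ℤ.- + 5) ⊗ S c j ⊕ γ ⊗ S c (1 + j) ∎
          where
          open ≈-Reasoning
          root-step : ∀ {a g} → a ↑ 6 ⊕ int (+ 10) ⊗ a ↑ 3 ⊕ int (+ 5) ≈ g ⊗ a → ∀ t →
            a ↑ (6 + j) ⊗ t ≈ int (ℤ.- + 10) ⊗ (a ↑ (3 + j) ⊗ t) ⊕ int (ℤ.- + 5) ⊗ (a ↑ j ⊗ t) ⊕ g ⊗ (a ↑ (1 + j) ⊗ t)
          root-step {a} {g} e t = trans
            (solve 3 (λ a m t → (a :* (a :* (a :* (a :* (a :* (a :* m)))))) :* t
              := con (ℤ.- + 10) :* ((a :* (a :* (a :* m))) :* t) :+ con (ℤ.- + 5) :* (m :* t) :+ (a :^ 6 :+ con (+ 10) :* a :^ 3 :+ con (+ 5)) :* (m :* t)) refl a (a ↑ j) t)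
            (⊕-congˡ (trans (⊗-congʳ e) (solve 4 (λ g a m t → (g :* a) :* (m :* t) := g :* ((a :* m) :* t)) refl g a (a ↑ j) t)))
          U-part : U (x ↑ (6 + j) ⊗ σ ↑ c) ≈ int (ℤ.- + 10) ⊗ U (x ↑ (3 + j) ⊗ σ ↑ c) ⊕ int (ℤ.- + 5) ⊗ U (x ↑ j ⊗ σ ↑ c) ⊕ γ ⊗ U (x ↑ (1 + j) ⊗ σ ↑ c)
          U-part = trans (U-cong (root-step (sym sextic) (σ ↑ c))) (trans (U-⊕ _ _) (⊕-cong (U₂ (ℤ.- + 5) (U-int (ℤ.- + 10) _) refl) (U-⊗ γ _)))

        private
          S₀ : ∀ b {p r} → U (X ↑ (2 * b)) ≈ p → int (+ 5) ⊗ (σ ↑ b ⊗ p) ⊕ s ↑ b ≈ r → S 0 b ≈ r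
          S₀ b e e′ = trans (⊕-cong (⊗-congˡ (trans (U-cong (⊗-identityʳ _)) (U-x b e))) (⊗-identityʳ _)) e′

          σv : ∀ n → σ ↑ (3 + n) ⊗ v ≈ σ ↑ n
          σv n = trans (solve 3 (λ σ m x → (σ :* (σ :* (σ :* m))) :* x :^ 3 := (x :* σ) :^ 3 :* m) refl σ (σ ↑ n) x)
            (trans (⊗-congʳ (↑-congˡ 3 x⊗σ)) (solve 1 (λ m → con (+ 1) :^ 3 :* m := m) refl (σ ↑ n)))

        -- Newton's identities for X⁶ + 10 X³ - γX + 5 predict the initial values 6, 0, 0, -30, 0,
        -- 5γ; here they come out of the computed U (X^(2j)).
        S-0 : S 0 0 ≈ int (+ 6)
        S-0 = S₀ 0 U-1 (solve 0 (con (+ 5) :* (con (+ 1) :* con (+ 1)) :+ con (+ 1) := con (+ 6)) refl)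

        S-1 : S 0 1 ≈ int (+ 0)
        S-1 = S₀ 1 U-X² (solve 1 (λ σ → con (+ 5) :* (σ :^ 1 :* con (ℤ.- + 1)) :+ (con (+ 5) :* σ) :^ 1 := con (+ 0)) refl σ)

        S-2 : S 0 2 ≈ int (+ 0)
        S-2 = S₀ 2 U-X⁴ (solve 1 (λ σ → con (+ 5) :* (σ :^ 2 :* con (ℤ.- + 5)) :+ (con (+ 5) :* σ) :^ 2 := con (+ 0)) refl σ)

        S-3 : S 0 3 ≈ int (ℤ.- + 30)
        S-3 = S₀ 3 P₆ (trans (solve 2 (λ σ v → con (+ 5) :* (σ :^ 3 :* (con (ℤ.- + 6) :* v :+ con (ℤ.- + 25))) :+ (con (+ 5) :* σ) :^ 3
            := con (ℤ.- + 30) :* (σ :^ 3 :* v)) refl σ v) (trans (⊗-congˡ (σv 0)) (⊗-identityʳ _)))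

        S-4 : S 0 4 ≈ int (+ 0)
        S-4 = S₀ 4 P₈ (solve 1 (λ σ → con (+ 5) :* (σ :^ 4 :* con (ℤ.- + 125)) :+ (con (+ 5) :* σ) :^ 4 := con (+ 0)) refl σ)

        S-5 : S 0 5 ≈ int (+ 5) ⊗ γ
        S-5 = S₀ 5 P₁₀ (trans (solve 2 (λ σ v → con (+ 5) :* (σ :^ 5 :* (v :^ 2 :+ con (+ 250) :* v :+ con (+ 2500))) :+ (con (+ 5) :* σ) :^ 5
            := con (+ 5) :* (con (+ 3125) :* σ :^ 5 :+ con (+ 250) :* (σ :^ 5 :* v) :+ (σ :^ 5 :* v) :* v)) refl σ v)
          (⊗-congˡ (⊕-cong (⊕-congˡ (⊗-congˡ (σv 2))) (trans (⊗-congʳ (σv 2))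
            (trans (solve 2 (λ σ x → σ :^ 2 :* x :^ 3 := (x :* σ) :^ 2 :* x) refl σ x) (trans (⊗-congʳ (↑-congˡ 2 x⊗σ)) (solve 1 (λ x → con (+ 1) :^ 2 :* x := x) refl x)))))))

        eval : ∀ {n} → Vec ℤ n → Carrier
        eval [] = 0#
        eval (c ∷ cs) = int c ⊕ γ ⊗ eval cs

        -- The length of the coefficient vector bounds the degree in γ and, modulo p, leaves
        -- finitely many possibilities.
        Poly : ℕ → Carrier → Set
        Poly n f = ∃ λ (cs : Vec ℤ n) → f ≈ eval cs

        Poly-cong : ∀ {n f g} → f ≈ g → Poly n f → Poly n g
        Poly-cong e (cs , e′) = cs , trans (sym e) e′

        Poly-⊕ : ∀ {n f g} → Poly n f → Poly n g → Poly n (f ⊕ g)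
        Poly-⊕ (cs , e) (ds , e′) = add cs ds , trans (⊕-cong e e′) (sym (eval-add cs ds))
          where
          add : ∀ {n} → Vec ℤ n → Vec ℤ n → Vec ℤ n
          add [] [] = []
          add (c ∷ cs) (k ∷ ks) = c ℤ.+ k ∷ add cs ks
          eval-add : ∀ {n} (cs ds : Vec ℤ n) → eval (add cs ds) ≈ eval cs ⊕ eval ds
          eval-add [] [] = sym (⊕-identityˡ 0#)
          eval-add (c ∷ cs) (k ∷ ks) = trans (⊕-cong (int-homo-+ c k) (⊗-congˡ (eval-add cs ks)))
            (solve 5 (λ c k g a b → c :+ k :+ g :* (a :+ b) := (c :+ g :* a) :+ (k :+ g :* b)) refl (int c) (int k) γ (eval cs) (eval ks))

        Poly-int : ∀ {n f} a → Poly n f → Poly n (int a ⊗ f)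
        Poly-int a (cs , e) = scale cs , trans (⊗-congˡ e) (sym (eval-scale cs))
          where
          scale : ∀ {n} → Vec ℤ n → Vec ℤ n
          scale [] = []
          scale (c ∷ cs) = a ℤ.* c ∷ scale cs
          eval-scale : ∀ {n} (cs : Vec ℤ n) → eval (scale cs) ≈ int a ⊗ eval cs
          eval-scale [] = sym (⊗-zeroʳ _)
          eval-scale (c ∷ cs) = trans (⊕-cong (int-homo-* a c) (⊗-congˡ (eval-scale cs)))
            (solve 4 (λ a c g e → a :* c :+ g :* (a :* e) := a :* (c :+ g :* e)) refl (int a) (int c) γ (eval cs))

        Poly-γ : ∀ {n f} → Poly n f → Poly (suc n) (γ ⊗ f)
        Poly-γ (cs , e) = + 0 ∷ cs , trans (⊗-congˡ e) (sym (⊕-identityˡ _))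

        Poly-const : ∀ n c → Poly (suc n) (int c)
        Poly-const n c = c ∷ zeros n , sym (trans (⊕-congˡ (trans (⊗-congˡ (eval-zeros n)) (⊗-zeroʳ γ))) (⊕-identityʳ _))
          where
          zeros : ∀ n → Vec ℤ n
          zeros zero = []
          zeros (suc n) = + 0 ∷ zeros n
          eval-zeros : ∀ n → eval (zeros n) ≈ 0#
          eval-zeros zero = refl
          eval-zeros (suc n) = trans (⊕-identityˡ _) (trans (⊗-congˡ (eval-zeros n)) (⊗-zeroʳ γ))

        private
          recurrence : ∀ {n} j → Poly n (S 0 (3 + j)) → Poly n (S 0 j) → Poly n (γ ⊗ S 0 (1 + j)) → Poly n (S 0 (6 + j))
          recurrence j a b c = Poly-cong (sym (S-step 0 j)) (Poly-⊕ (Poly-⊕ (Poly-int (ℤ.- + 10) a) (Poly-int (ℤ.- + 5) b)) c)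

        -- In the recurrence a factor γ accompanies a rise of the index by 5, so the j-th power sum
        -- has degree at most j/5.
        S-degree⁺ : ∀ m j → j < 5 + 5 * m → Poly (suc m) (S 0 j)
        S-degree⁺ m 0 _ = Poly-cong (sym S-0) (Poly-const m (+ 6))
        S-degree⁺ m 1 _ = Poly-cong (sym S-1) (Poly-const m (+ 0))
        S-degree⁺ m 2 _ = Poly-cong (sym S-2) (Poly-const m (+ 0))
        S-degree⁺ m 3 _ = Poly-cong (sym S-3) (Poly-const m (ℤ.- + 30))
        S-degree⁺ m 4 _ = Poly-cong (sym S-4) (Poly-const m (+ 0))
        S-degree⁺ zero (suc (suc (suc (suc (suc j))))) (s≤s (s≤s (s≤s (s≤s (s≤s ())))))
        S-degree⁺ (suc m) 5 _ = Poly-cong (sym S-5) (Poly-int (+ 5) (Poly-cong (⊗-identityʳ γ) (Poly-γ (Poly-const m (+ 1)))))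
        S-degree⁺ (suc m) (suc (suc (suc (suc (suc (suc j)))))) lt = recurrence j
          (S-degree⁺ (suc m) (suc (suc (suc j))) (ℕP.<-trans (ℕP.m<n+m (3 + j) {3} (s≤s z≤n)) lt))
          (S-degree⁺ (suc m) j (ℕP.<-trans (ℕP.m<n+m j {6} (s≤s z≤n)) lt))
          (Poly-γ (S-degree⁺ m (suc j) (ℕP.+-cancelˡ-< 5 _ _ (ℕP.<-≤-trans lt (ℕP.≤-reflexive (≡.cong (λ i → 5 + i) (ℕP.*-suc 5 m)))))))

        -- Negative powers arise by running the recurrence backwards: each step divides by the
        -- constant term 5 and raises the degree by at most one. Thus all exponents from -m to 5m +
        -- 4 have degree at most m.
        S-degree : ∀ n m j → n ≤ m → j < n + (5 + 5 * m) → Poly (suc m) (S n j)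
        S-degree zero m j _ lt = S-degree⁺ m j lt
        S-degree (suc n) m (suc j) n<m (s≤s lt) = Poly-cong (sym (S-shift n j)) (S-degree n m j (ℕP.<⇒≤ n<m) lt)
        -- The power sum of exponent -n-1 is solved for from those of exponents 5-n, 2-n and -n.
        S-degree (suc n) (suc m) zero (s≤s n≤m) _ = Poly-cong (begin
            int ⅕ ⊗ (int (ℤ.- + 1) ⊗ S n 5 ⊕ int (ℤ.- + 10) ⊗ S n 2 ⊕ γ ⊗ S n 0)
              ≈⟨ ⊗-congˡ (⊕-cong (⊕-cong (⊗-congˡ (sym (S-shift n 5))) (⊗-congˡ (sym (S-shift n 2)))) (⊗-congˡ (sym (S-shift n 0)))) ⟩
            int ⅕ ⊗ (int (ℤ.- + 1) ⊗ S (suc n) 6 ⊕ int (ℤ.- + 10) ⊗ S (suc n) 3 ⊕ γ ⊗ S (suc n) 1)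
              ≈⟨ ⊗-congˡ (⊕-congʳ (⊕-congʳ (⊗-congˡ (S-step (suc n) 0)))) ⟩
            int ⅕ ⊗ (int (ℤ.- + 1) ⊗ (int (ℤ.- + 10) ⊗ S (suc n) 3 ⊕ int (ℤ.- + 5) ⊗ S (suc n) 0 ⊕ γ ⊗ S (suc n) 1) ⊕ int (ℤ.- + 10) ⊗ S (suc n) 3 ⊕ γ ⊗ S (suc n) 1)
              ≈⟨ solve 5 (λ a t z o g → a :* (con (ℤ.- + 1) :* (con (ℤ.- + 10) :* t :+ con (ℤ.- + 5) :* z :+ g :* o) :+ con (ℤ.- + 10) :* t :+ g :* o) := (con (+ 5) :* a) :* z) refl
                   (int ⅕) (S (suc n) 3) (S (suc n) 0) (S (suc n) 1) γ ⟩
            (int (+ 5) ⊗ int ⅕) ⊗ S (suc n) 0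
              ≈⟨ trans (⊗-congʳ 5⊗⅕) (⊗-identityˡ _) ⟩
            S (suc n) 0 ∎)
          (Poly-int ⅕ (Poly-⊕ (Poly-⊕
            (Poly-int (ℤ.- + 1) (S-degree n (suc m) 5 n≤sm (ℕP.<-≤-trans (ℕP.m<m+n 5 {5 + 5 * m} (s≤s z≤n)) (ℕP.≤-trans (ℕP.≤-reflexive (≡.cong (λ i → 5 + i) (≡.sym (ℕP.*-suc 5 m)))) (ℕP.m≤n+m _ n)))))
            (Poly-int (ℤ.- + 10) (S-degree n (suc m) 2 n≤sm (ℕP.<-≤-trans (s≤s (s≤s (s≤s z≤n))) (ℕP.m≤n+m _ n)))))
            (Poly-γ (S-degree n m 0 n≤m (ℕP.<-≤-trans (s≤s z≤n) (ℕP.m≤n+m _ n))))))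
          where
          open ≈-Reasoning
          n≤sm = ℕP.m≤n⇒m≤1+n n≤m

        -- The two inequalities say that K is the integer part of ρ/4.
        module Weight (K ρ : ℕ) (4K≤ρ : 4 * K ≤ ρ) (ρ≤4K+3 : ρ ≤ 3 + 4 * K) where

          private
            -- In use, f is an expression in x and σ, and f′ the same expression in s and τ, so that
            -- 5 U f + f′ is its trace over the six roots.
            Good : Carrier → Carrier → Set
            Good f f′ = Poly (suc K) (int (+ 5) ⊗ U f ⊕ f′)

            Good-cong : ∀ {f g f′ g′} → f ≈ g → f′ ≈ g′ → Good f f′ → Good g g′
            Good-cong e e′ = Poly-cong (⊕-cong (⊗-congˡ (U-cong e)) e′)

            Good-⊕ : ∀ {f g f′ g′} → Good f f′ → Good g g′ → Good (f ⊕ g) (f′ ⊕ g′)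
            Good-⊕ {f} {g} {f′} {g′} p r = Poly-cong (trans
              (solve 4 (λ a b c e → (con (+ 5) :* a :+ b) :+ (con (+ 5) :* c :+ e) := con (+ 5) :* (a :+ c) :+ (b :+ e)) refl (U f) f′ (U g) g′)
              (⊕-congʳ (⊗-congˡ (sym (U-⊕ f g))))) (Poly-⊕ p r)

            Good-int : ∀ {f f′} c → Good f f′ → Good (int c ⊗ f) (int c ⊗ f′)
            Good-int {f} {f′} c p = Poly-cong (trans
              (solve 3 (λ c a b → c :* (con (+ 5) :* a :+ b) := con (+ 5) :* (c :* a) :+ c :* b) refl (int c) (U f) f′)
              (⊕-congʳ (⊗-congˡ (sym (U-int c f))))) (Poly-int c p)

          -- Each factor γ = 3125σ⁵ + 250σ² + x changes the exponent of x by -5, -2 or +1. The first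
          -- bound keeps j from falling below zero during k such factors, and the second keeps the
          -- top exponent within the range of `S-degree`.
          good-power : ∀ k j → 5 * k ≤ j → j + k < K + (5 + 5 * K) → Good (x ↑ j ⊗ σ ↑ K ⊗ γ ↑ k) (s ↑ j ⊗ τ ↑ K ⊗ V ⟪ γ ⟫ ↑ k)
          good-power zero j _ lt = Good-cong (sym (⊗-identityʳ _)) (sym (⊗-identityʳ _))
            (S-degree K K j ℕP.≤-refl (ℕP.≤-<-trans (ℕP.≤-reflexive (≡.sym (ℕP.+-identityʳ j))) lt))
          good-power (suc k) j 5k≤j lt = ≡.subst (λ j → Good (x ↑ j ⊗ σ ↑ K ⊗ γ ↑ suc k) (s ↑ j ⊗ τ ↑ K ⊗ V ⟪ γ ⟫ ↑ suc k)) (ℕP.m+[n∸m]≡n 5≤j)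
            (Good-cong (sym (expand x⊗σ refl)) (sym (expand s⊗τ V-γ-s))
              (Good-⊕ (Good-⊕ (Good-int (+ 3125) (good-power k i 5k≤i (ℕP.<-trans (ℕP.m<n+m (i + k) {6} (s≤s z≤n)) lt′)))
                              (Good-int (+ 250) (good-power k (3 + i) (ℕP.≤-trans 5k≤i (ℕP.m≤n+m i 3)) (ℕP.<-trans (ℕP.m<n+m (3 + i + k) {3} (s≤s z≤n)) lt′))))
                      (good-power k (6 + i) (ℕP.≤-trans 5k≤i (ℕP.m≤n+m i 6)) lt′)))
            where
            5≤j : 5 ≤ j
            5≤j = ℕP.≤-trans (ℕP.≤-trans (ℕP.m≤m+n 5 (5 * k)) (ℕP.≤-reflexive (≡.sym (ℕP.*-suc 5 k)))) 5k≤j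
            i = j ∸ 5
            5+i≡j : 5 + i ≡ j
            5+i≡j = ℕP.m+[n∸m]≡n 5≤j
            5k≤i : 5 * k ≤ i
            5k≤i = ℕP.+-cancelˡ-≤ 5 _ _ (ℕP.≤-trans (ℕP.≤-reflexive (≡.sym (ℕP.*-suc 5 k))) (ℕP.≤-trans 5k≤j (ℕP.≤-reflexive (≡.sym 5+i≡j))))
            lt′ : 6 + i + k < K + (5 + 5 * K)
            lt′ = ℕP.≤-<-trans (ℕP.≤-reflexive (≡.trans (≡.sym (ℕP.+-suc (5 + i) k)) (≡.cong (_+ suc k) 5+i≡j))) lt
            expand : ∀ {a b g} → a ⊗ b ≈ 1# → g ≈ int (+ 3125) ⊗ b ↑ 5 ⊕ int (+ 250) ⊗ b ↑ 2 ⊕ a → a ↑ (5 + i) ⊗ b ↑ K ⊗ g ↑ suc k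
              ≈ int (+ 3125) ⊗ (a ↑ i ⊗ b ↑ K ⊗ g ↑ k) ⊕ int (+ 250) ⊗ (a ↑ (3 + i) ⊗ b ↑ K ⊗ g ↑ k) ⊕ a ↑ (6 + i) ⊗ b ↑ K ⊗ g ↑ k
            expand {a} {b} {g} e e′ = trans (⊗-congˡ (⊗-congʳ e′)) (trans
              (solve 5 (λ a b m n h → (a :* (a :* (a :* (a :* (a :* m))))) :* n :* ((con (+ 3125) :* b :^ 5 :+ con (+ 250) :* b :^ 2 :+ a) :* h)
                := con (+ 3125) :* ((a :* b) :^ 5 :* (m :* n :* h)) :+ con (+ 250) :* ((a :* b) :^ 2 :* ((a :* (a :* (a :* m))) :* n :* h)) :+ (a :* (a :* (a :* (a :* (a :* (a :* m)))))) :* n :* h) refl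
                a b (a ↑ i) (b ↑ K) (g ↑ k))
              (⊕-congʳ (⊕-cong (⊗-congˡ (drop 5)) (⊗-congˡ (drop 2)))))
              where
              drop : ∀ n {t} → (a ⊗ b) ↑ n ⊗ t ≈ t
              drop n = trans (⊗-congʳ (trans (↑-congˡ n e) (1↑ n))) (⊗-identityˡ _)

          F : Carrier
          F = H ↑ (2 * ρ)

          5^ρ : Carrier
          5^ρ = int (+ 5) ↑ ρ

          -- Five times U + 5^(ρ-1) V, the Hecke operator at 5 in weight ρ; the scaling keeps the
          -- exponent natural when ρ = 0.
          T′ : Carrier → Carrier
          T′ f = int (+ 5) ⊗ U f ⊕ 5^ρ ⊗ V ⟪ f ⟫

          T′-cong : ∀ {f g} → f ≈ g → T′ f ≈ T′ g
          T′-cong e = ⊕-cong (⊗-congˡ (U-cong e)) (⊗-congˡ (V.⟪⟫-cong e))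

          T′-⊕ : ∀ f g → T′ (f ⊕ g) ≈ T′ f ⊕ T′ g
          T′-⊕ f g = trans (⊕-cong (⊗-congˡ (U-⊕ f g)) (⊗-congˡ (V.⟪⟫-⊕ f g)))
            (solve 6 (λ a b c e f g → a :* (c :+ e) :+ b :* (f :+ g) := (a :* c :+ b :* f) :+ (a :* e :+ b :* g)) refl (int (+ 5)) 5^ρ (U f) (U g) (V ⟪ f ⟫) (V ⟪ g ⟫))

          T′-int : ∀ c f → T′ (int c ⊗ f) ≈ int c ⊗ T′ f
          T′-int c f = trans (⊕-cong (⊗-congˡ (U-int c f)) (⊗-congˡ (trans (V.⟪⟫-⊗ _ f) (⊗-congʳ (V.⟪⟫-int c)))))
            (solve 5 (λ a b c e f → a :* (c :* e) :+ b :* (c :* f) := c :* (a :* e :+ b :* f)) refl (int (+ 5)) 5^ρ (int c) (U f) (V ⟪ f ⟫))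

          Span : Carrier → Set
          Span f = ∃ λ g → Poly (suc K) g × f ≈ F ⊗ g

          Span-⊕ : ∀ {f g} → Span f → Span g → Span (f ⊕ g)
          Span-⊕ (f′ , p , e) (g′ , r , e′) = f′ ⊕ g′ , Poly-⊕ p r , trans (⊕-cong e e′) (sym (⊗-distribˡ F f′ g′))

          Span-int : ∀ {f} c → Span f → Span (int c ⊗ f)
          Span-int c (g , p , e) = int c ⊗ g , Poly-int c p , trans (⊗-congˡ e) (solve 3 (λ c F g → c :* (F :* g) := F :* (c :* g)) refl (int c) F g)

          Span-cong : ∀ {f g} → f ≈ g → Span f → Span g
          Span-cong e (h , p , e′) = h , p , trans (sym e) e′

          -- F = V(F) x^ρ and V(F) = F σ^ρ pull F out of both summands, and 5^ρ turns σ^ρ into s^ρ;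
          -- what remains is the trace of x^ρ γ^k.
          T′-basis : ∀ k → k ≤ K → Span (T′ (F ⊗ γ ↑ k))
          T′-basis k k≤K = _ , good-power k (ρ + K) 5k≤ bound , (begin
            int (+ 5) ⊗ U (F ⊗ γ ↑ k) ⊕ 5^ρ ⊗ V ⟪ F ⊗ γ ↑ k ⟫
              ≈⟨ ⊕-cong (⊗-congˡ (trans (U-cong F-split) (U-⊗ F (x ↑ ρ ⊗ γ ↑ k)))) V-side ⟩
            int (+ 5) ⊗ (F ⊗ U (x ↑ ρ ⊗ γ ↑ k)) ⊕ F ⊗ (s ↑ ρ ⊗ V ⟪ γ ⟫ ↑ k)
              ≈⟨ solve 3 (λ F a b → con (+ 5) :* (F :* a) :+ F :* b := F :* (con (+ 5) :* a :+ b)) refl F (U (x ↑ ρ ⊗ γ ↑ k)) (s ↑ ρ ⊗ V ⟪ γ ⟫ ↑ k) ⟩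
            F ⊗ (int (+ 5) ⊗ U (x ↑ ρ ⊗ γ ↑ k) ⊕ s ↑ ρ ⊗ V ⟪ γ ⟫ ↑ k)
              ≈⟨ ⊗-congˡ (⊕-cong (⊗-congˡ (U-cong (⊗-congʳ (shift x⊗σ)))) (⊗-congʳ (shift s⊗τ))) ⟨
            F ⊗ (int (+ 5) ⊗ U (x ↑ (ρ + K) ⊗ σ ↑ K ⊗ γ ↑ k) ⊕ s ↑ (ρ + K) ⊗ τ ↑ K ⊗ V ⟪ γ ⟫ ↑ k) ∎)
            where
            open ≈-Reasoning
            -- The K spare powers of σ let the exponent of the root descend to -K; at k = K the
            -- requirement is exactly 4K ≤ ρ. The next bound uses ρ ≤ 4K + 3 at the upper end.
            5k≤ : 5 * k ≤ ρ + K
            5k≤ = ℕP.≤-trans (ℕP.*-monoʳ-≤ 5 k≤K) (ℕP.≤-trans (ℕP.≤-reflexive (ℕP.+-comm K (4 * K))) (ℕP.+-monoˡ-≤ K 4K≤ρ))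
            bound : ρ + K + k < K + (5 + 5 * K)
            bound = ℕP.<-≤-trans (s≤s (ℕP.+-mono-≤ (ℕP.+-monoˡ-≤ K ρ≤4K+3) k≤K))
              (ℕP.≤-trans (ℕP.n≤1+n _) (ℕP.≤-reflexive (ℕ-solve 1 (λ K → ν 1 ∔ (ν 1 ∔ ((ν 3 ∔ ν 4 ∙ K) ∔ K ∔ K)) ≐ K ∔ (ν 5 ∔ ν 5 ∙ K)) ≡.refl K)))
            shift : ∀ {a b} → a ⊗ b ≈ 1# → a ↑ (ρ + K) ⊗ b ↑ K ≈ a ↑ ρ
            shift {a} {b} e = trans (⊗-congʳ (↑-homo-⊗ a ρ K)) (trans (⊗-assoc _ _ _) (trans (⊗-congˡ (unit-↑ K e)) (⊗-identityʳ _)))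
            V-F : V ⟪ F ⟫ ≈ G ↑ (2 * ρ)
            V-F = V.⟪⟫-↑ H (2 * ρ)
            square : ∀ {a b c} → a ⊗ b ≈ 1# → a ↑ (2 * ρ) ⊗ (c ↑ 2 ⊗ b ↑ 2) ↑ ρ ≈ c ↑ (2 * ρ)
            square {a} {b} {c} e = trans (⊗-congʳ (sym (↑-assocʳ a 2 ρ))) (trans (sym (↑-distrib-⊗ (a ↑ 2) (c ↑ 2 ⊗ b ↑ 2) ρ))
              (trans (↑-congˡ ρ (trans (solve 3 (λ a b c → a :^ 2 :* (c :^ 2 :* b :^ 2) := (a :* b) :^ 2 :* c :^ 2) refl a b c)
                (trans (⊗-congʳ (trans (↑-congˡ 2 e) (1↑ 2))) (⊗-identityˡ _)))) (↑-assocʳ c 2 ρ)))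
            F-split : F ⊗ γ ↑ k ≈ V ⟪ F ⟫ ⊗ (x ↑ ρ ⊗ γ ↑ k)
            F-split = trans (⊗-congʳ (sym (trans (⊗-congʳ V-F) (square G⊗G⁻¹)))) (⊗-assoc _ _ _)
            V-side : 5^ρ ⊗ V ⟪ F ⊗ γ ↑ k ⟫ ≈ F ⊗ (s ↑ ρ ⊗ V ⟪ γ ⟫ ↑ k)
            V-side = begin
              5^ρ ⊗ V ⟪ F ⊗ γ ↑ k ⟫                           ≈⟨ ⊗-congˡ (trans (V.⟪⟫-⊗ F _) (⊗-cong (trans V-F (sym (square H⊗H⁻¹))) (V.⟪⟫-↑ γ k))) ⟩
              5^ρ ⊗ (F ⊗ σ ↑ ρ ⊗ V ⟪ γ ⟫ ↑ k)                 ≈⟨ solve 4 (λ a F b g → a :* (F :* b :* g) := F :* ((a :* b) :* g)) refl 5^ρ F (σ ↑ ρ) (V ⟪ γ ⟫ ↑ k) ⟩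
              F ⊗ ((5^ρ ⊗ σ ↑ ρ) ⊗ V ⟪ γ ⟫ ↑ k)               ≈⟨ ⊗-congˡ (⊗-congʳ (↑-distrib-⊗ (int (+ 5)) σ ρ)) ⟨
              F ⊗ (s ↑ ρ ⊗ V ⟪ γ ⟫ ↑ k) ∎

          T′-Span : ∀ {f} → Span f → Span (T′ f)
          T′-Span {f} (g , (cs , g≈) , f≈) = Span-cong (T′-cong (sym (trans f≈ (trans (⊗-congˡ g≈) (⊗-congʳ (sym (⊗-identityʳ F)))))))
            (go 0 cs (ℕP.≤-reflexive (ℕP.+-identityʳ (suc K))))
            where
            zero-Span : Span (T′ 0#)
            zero-Span = Span-cong (trans (sym (T′-int (+ 0) F)) (T′-cong (⊗-zeroˡ F))) (Span-int (+ 0) (Span-cong (T′-cong (⊗-identityʳ F)) (T′-basis 0 z≤n)))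
            go : ∀ {n} k (cs : Vec ℤ n) → n + k ≤ suc K → Span (T′ (F ⊗ γ ↑ k ⊗ eval cs))
            go k [] _ = Span-cong (T′-cong (sym (⊗-zeroʳ _))) zero-Span
            go {suc n} k (c ∷ cs) (s≤s n+k≤K) = Span-cong (trans (⊕-congʳ (sym (T′-int c _))) (trans (sym (T′-⊕ _ _))
                (T′-cong (solve 5 (λ c F p g e → c :* (F :* p) :+ F :* (g :* p) :* e := F :* p :* (c :+ g :* e)) refl (int c) F (γ ↑ k) γ (eval cs)))))
              (Span-⊕ (Span-int c (T′-basis k (ℕP.≤-trans (ℕP.m≤n+m k n) n+k≤K))) (go (suc k) cs (ℕP.≤-trans (ℕP.≤-reflexive (ℕP.+-suc n k)) (s≤s n+k≤K))))

          -- t k is the result of applying the Hecke operator T(5^{k−1}), up to scaling, to F.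
          t : ℕ → Carrier
          t 0 = 0#
          t 1 = F
          t (suc (suc k)) = T′ (t (suc k)) ⊝ int (+ 5) ⊗ 5^ρ ⊗ t k

          5↑-int : ∀ n → ∃ λ c → int (+ 5) ↑ n ≈ int c
          5↑-int zero = + 1 , refl
          5↑-int (suc n) = + 5 ℤ.* proj₁ (5↑-int n) , trans (⊗-congˡ (proj₂ (5↑-int n))) (sym (int-homo-* (+ 5) (proj₁ (5↑-int n))))

          5^ρ-int = 5↑-int ρ

          t-Span : ∀ k → Span (t k)
          t-Span 0 = int (+ 0) , Poly-const K (+ 0) , sym (⊗-zeroʳ F)
          t-Span 1 = int (+ 1) , Poly-const K (+ 1) , sym (⊗-identityʳ F)
          t-Span (suc (suc k)) = Span-cong (⊕-congˡ (trans (⊗-cong (trans (int-homo-* (ℤ.- + 5) (proj₁ 5^ρ-int)) (⊗-congˡ (sym (proj₂ 5^ρ-int)))) refl)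
              (solve 2 (λ a b → con (ℤ.- + 5) :* a :* b := :- (con (+ 5) :* a :* b)) refl 5^ρ (t k))))
            (Span-⊕ (T′-Span (t-Span (suc k))) (Span-int (ℤ.- + 5 ℤ.* proj₁ 5^ρ-int) (t-Span k)))

          -- A repetition descends along the recurrence, where the unit 5^(ρ+1) is cancelled, until
          -- it reaches `t 0`, which is zero.
          backtrack : ∀ i j → t i ≈ t (i + j) → t (suc i) ≈ t (suc i + j) → t j ≈ 0#
          backtrack zero j e _ = sym e
          backtrack (suc i) j e e′ = backtrack i j (unit-cancel unit (begin
              c ⊗ t i                                              ≈⟨ solve 2 (λ a b → b := a :- (a :- b)) refl (T′ (t (suc i))) (c ⊗ t i) ⟩
              T′ (t (suc i)) ⊝ t (suc (suc i))                     ≈⟨ ⊕-cong (T′-cong e) (⊖-cong e′) ⟩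
              T′ (t (suc i + j)) ⊝ t (suc (suc i) + j)             ≈⟨ solve 2 (λ a b → a :- (a :- b) := b) refl (T′ (t (suc (i + j)))) (c ⊗ t (i + j)) ⟩
              c ⊗ t (i + j) ∎)) e
            where
            open ≈-Reasoning
            c = int (+ 5) ⊗ 5^ρ
            unit : c ⊗ (int ⅕ ⊗ int ⅕ ↑ ρ) ≈ 1#
            unit = unit-↑ (suc ρ) 5⊗⅕

          U↑ : ℕ → Carrier → Carrier
          U↑ zero f = f
          U↑ (suc n) f = U (U↑ n f)

          private
            U-V : ∀ f → U (V ⟪ f ⟫) ≈ f
            U-V f = trans (U-cong (sym (⊗-identityʳ _))) (trans (U-⊗ f 1#) (trans (⊗-congˡ U-1) (⊗-identityʳ f)))

          -- Induction with U V = id: 5U turns t (k+1) into T′ (t (k+1)) minus its V part, and turns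
          -- the V term into the second term of the recurrence.
          U↑-t : ∀ k → int (+ 5) ↑ k ⊗ U↑ k F ≈ t (suc k) ⊝ 5^ρ ⊗ V ⟪ t k ⟫
          U↑-t zero = trans (⊗-identityˡ F) (sym (trans (⊕-congˡ (⊖-cong (trans (⊗-congˡ V.⟪⟫-0) (⊗-zeroʳ _))))
            (solve 1 (λ F → F :- con (+ 0) := F) refl F)))
          U↑-t (suc k) = begin
            int (+ 5) ⊗ int (+ 5) ↑ k ⊗ U (U↑ k F)
              ≈⟨ solve 3 (λ a b u → a :* b :* u := a :* (b :* u)) refl (int (+ 5)) (int (+ 5) ↑ k) (U (U↑ k F)) ⟩
            int (+ 5) ⊗ (int (+ 5) ↑ k ⊗ U (U↑ k F))
              ≈⟨ ⊗-congˡ (trans (⊗-congʳ (5↑ k)) (trans (sym (U-int (proj₁ (5↑-int k)) _)) (U-cong (⊗-congʳ (sym (5↑ k)))))) ⟩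
            int (+ 5) ⊗ U (int (+ 5) ↑ k ⊗ U↑ k F)
              ≈⟨ ⊗-congˡ (U-cong (U↑-t k)) ⟩
            int (+ 5) ⊗ U (t (suc k) ⊝ 5^ρ ⊗ V ⟪ t k ⟫)
              ≈⟨ ⊗-congˡ (trans (U-⊕ _ _) (⊕-congˡ U-second)) ⟩
            int (+ 5) ⊗ (U (t (suc k)) ⊝ 5^ρ ⊗ t k)
              ≈⟨ solve 5 (λ f u p a v → f :* (u :- p :* a) := f :* u :+ p :* v :- f :* p :* a :- p :* v) refl (int (+ 5)) (U (t (suc k))) 5^ρ (t k) (V ⟪ t (suc k) ⟫) ⟩
            t (suc (suc k)) ⊝ 5^ρ ⊗ V ⟪ t (suc k) ⟫ ∎
            where
            open ≈-Reasoning
            5↑ : ∀ n → int (+ 5) ↑ n ≈ int (proj₁ (5↑-int n))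
            5↑ n = proj₂ (5↑-int n)
            U-second : U (⊖ (5^ρ ⊗ V ⟪ t k ⟫)) ≈ ⊖ (5^ρ ⊗ t k)
            U-second = begin
              U (⊖ (5^ρ ⊗ V ⟪ t k ⟫))                          ≈⟨ U-cong (⊖-cong (⊗-congʳ (proj₂ 5^ρ-int))) ⟩
              U (⊖ (int (proj₁ 5^ρ-int) ⊗ V ⟪ t k ⟫))          ≈⟨ U-cong (solve 2 (λ a b → :- (a :* b) := con (ℤ.- + 1) :* (a :* b)) refl _ _) ⟩
              U (int (ℤ.- + 1) ⊗ (int (proj₁ 5^ρ-int) ⊗ V ⟪ t k ⟫)) ≈⟨ trans (U-int (ℤ.- + 1) _) (⊗-congˡ (trans (U-int (proj₁ 5^ρ-int) _) (⊗-cong (sym (proj₂ 5^ρ-int)) (U-V (t k))))) ⟩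
              int (ℤ.- + 1) ⊗ (5^ρ ⊗ t k)                       ≈⟨ solve 2 (λ a b → con (ℤ.- + 1) :* (a :* b) := :- (a :* b)) refl 5^ρ (t k) ⟩
              ⊖ (5^ρ ⊗ t k) ∎

          -- Once t (N+1) is zero, `U↑-t` leaves a multiple of V (t N), and its scalars are
          -- themselves in the image of V.
          U↑-supported : ∀ N → t (suc N) ≈ 0# → ∃ λ g → U↑ N F ≈ V ⟪ g ⟫
          U↑-supported N tN = int ⅕ ↑ N ⊗ (⊖ (5^ρ ⊗ t N)) , unit-cancel (unit-↑ N 5⊗⅕) (begin
            int (+ 5) ↑ N ⊗ U↑ N F                                ≈⟨ U↑-t N ⟩
            t (suc N) ⊝ 5^ρ ⊗ V ⟪ t N ⟫                           ≈⟨ trans (⊕-congʳ tN) (⊕-identityˡ _) ⟩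
            ⊖ (5^ρ ⊗ V ⟪ t N ⟫)                                   ≈⟨ ⊖-cong (⊗-congʳ (trans (V.⟪⟫-↑ _ ρ) (↑-congˡ ρ (V.⟪⟫-int (+ 5))))) ⟨
            ⊖ (V ⟪ 5^ρ ⟫ ⊗ V ⟪ t N ⟫)                             ≈⟨ trans (V.⟪⟫-⊖ _) (⊖-cong (V.⟪⟫-⊗ _ _)) ⟨
            V ⟪ ⊖ (5^ρ ⊗ t N) ⟫                                   ≈⟨ trans (sym (⊗-assoc _ _ _)) (trans (⊗-congʳ (unit-↑ N 5⊗⅕)) (⊗-identityˡ _)) ⟨
            int (+ 5) ↑ N ⊗ (int ⅕ ↑ N ⊗ V ⟪ ⊖ (5^ρ ⊗ t N) ⟫)     ≈⟨ ⊗-congˡ (trans (V.⟪⟫-⊗ _ _) (⊗-congʳ (trans (V.⟪⟫-↑ _ N) (↑-congˡ N (V.⟪⟫-int ⅕))))) ⟨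
            int (+ 5) ↑ N ⊗ V ⟪ int ⅕ ↑ N ⊗ (⊖ (5^ρ ⊗ t N)) ⟫ ∎)
            where open ≈-Reasoning

          module Periodicity (p : ℕ) .{{_ : NonZero p}} (p≈0 : int (+ p) ≈ 0#) where

            private
              residue : ℤ → Fin p
              residue c = fromℕ< (ℤ÷.n%ℕd<d c p)

              residue-≈ : ∀ c k → residue c ≡ residue k → int c ≈ int k
              residue-≈ c k e = trans (reduce c) (trans (reflexive (≡.cong (λ r → int (+ r))
                  (≡.trans (≡.sym (FinP.toℕ-fromℕ< (ℤ÷.n%ℕd<d c p))) (≡.trans (≡.cong toℕ e) (FinP.toℕ-fromℕ< (ℤ÷.n%ℕd<d k p))))))
                (sym (reduce k)))
                where
                reduce : ∀ c → int c ≈ int (+ (c ℤ÷.%ℕ p))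
                reduce c = trans (reflexive (≡.cong int (ℤ÷.a≡a%ℕn+[a/ℕn]*n c p))) (trans (int-homo-+ (+ (c ℤ÷.%ℕ p)) ((c ℤ÷./ℕ p) ℤ.* + p))
                  (trans (⊕-congˡ (trans (int-homo-* (c ℤ÷./ℕ p) (+ p)) (trans (⊗-congˡ p≈0) (⊗-zeroʳ _)))) (⊕-identityʳ _)))

              code : ∀ {n} → Vec ℤ n → Fin (p ^ n)
              code cs = funToFin (λ i → residue (lookup cs i))

              eval-cong : ∀ {n} (cs ks : Vec ℤ n) → (∀ i → residue (lookup cs i) ≡ residue (lookup ks i)) → eval cs ≈ eval ks
              eval-cong [] [] _ = refl
              eval-cong (c ∷ cs) (k ∷ ks) e = ⊕-cong (residue-≈ c k (e Fin.zero)) (⊗-congˡ (eval-cong cs ks (λ i → e (Fin.suc i))))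

              coefficients : ℕ → Vec ℤ (suc K)
              coefficients k = proj₁ (proj₁ (proj₂ (t-Span k)))

              t-≈ : ∀ i j → code (coefficients i) ≡ code (coefficients j) → t i ≈ t j
              t-≈ i j e = trans (expand i) (trans (⊗-congˡ (eval-cong (coefficients i) (coefficients j)
                (λ l → ≡.trans (≡.sym (decode i l)) (≡.trans (≡.cong (λ f → finToFun f l) e) (decode j l))))) (sym (expand j)))
                where
                decode : ∀ k l → finToFun (code (coefficients k)) l ≡ residue (lookup (coefficients k) l)
                decode k = FinP.finToFun-funToFin (λ l → residue (lookup (coefficients k) l))
                expand : ∀ k → t k ≈ F ⊗ eval (coefficients k)
                expand k = trans (proj₂ (proj₂ (t-Span k))) (⊗-congˡ (proj₂ (proj₁ (proj₂ (t-Span k)))))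

              states : ℕ
              states = p ^ suc K * p ^ suc K

              -- Two consecutive terms, as the recurrence has order two.
              state : ℕ → Fin states
              state k = combine (code (coefficients k)) (code (coefficients (suc k)))

            t-vanishes : ∃ λ N → t (suc N) ≈ 0#
            t-vanishes with FinP.pigeonhole {states} {suc states} ℕP.≤-refl (λ i → state (toℕ i))
            ... | i , j , i<j , e = N , backtrack (toℕ i) (suc N)
                (≡.subst (λ l → t (toℕ i) ≈ t l) j≡ (t-≈ (toℕ i) (toℕ j) (proj₁ codes)))
                (≡.subst (λ l → t (suc (toℕ i)) ≈ t (suc l)) j≡ (t-≈ (suc (toℕ i)) (suc (toℕ j)) (proj₂ codes)))
              where
              codes = FinP.combine-injective (code (coefficients (toℕ i))) (code (coefficients (suc (toℕ i)))) (code (coefficients (toℕ j))) (code (coefficients (suc (toℕ j)))) e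
              -- The period j - i is positive and is written N + 1.
              N = toℕ j ∸ suc (toℕ i)
              j≡ : toℕ j ≡ toℕ i + suc N
              j≡ = ≡.trans (≡.sym (ℕP.m+[n∸m]≡n i<j)) (≡.sym (ℕP.+-suc (toℕ i) N))

            eventually-supported : ∃ λ N → ∃ λ g → U↑ N F ≈ V ⟪ g ⟫
            eventually-supported = proj₁ t-vanishes , U↑-supported (proj₁ t-vanishes) (proj₂ t-vanishes)

-- Binomial coefficients and the Frobenius map in characteristic p.

prime[5] : Prime 5
prime[5] = from-yes (Primality.prime? 5)

private
  prime∤! : ∀ {p} → Prime p → ∀ k → k < p → ¬ (p ∣ k ℕ.!)
  prime∤! pp zero k<p p∣1 = ℕP.<⇒≢ (ℕ.nonTrivial⇒n>1 _ {{Primality.prime⇒nonTrivial pp}}) (≡.sym (∣.∣1⇒≡1 p∣1))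
  prime∤! pp (suc k) k<p p∣ with Primality.euclidsLemma (suc k) (k ℕ.!) pp p∣
  ... | inj₁ p∣sk = ℕP.<⇒≱ k<p (∣.∣⇒≤ p∣sk)
  ... | inj₂ p∣k! = prime∤! pp k (ℕP.<-trans (ℕP.n<1+n k) k<p) p∣k!

-- p divides p! = C(p,k) k! (p-k)!, but neither of the two smaller factorials.
prime∣choose : ∀ {p} → Prime p → ∀ k → 0 < k → k < p → p ∣ (p Comb.C k)
prime∣choose {p} pp k 0<k k<p with Primality.euclidsLemma (p Comb.C k) (k ℕ.! * (p ∸ k) ℕ.!) pp p∣product
  where
  instance _ = ℕP._!*_!≢0 k (p ∸ k)
  p∣p! : ∀ n → 0 < n → n ∣ n ℕ.!
  p∣p! (suc n) _ = ∣.m∣m*n (n ℕ.!)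
  p∣product : p ∣ (p Comb.C k) * (k ℕ.! * (p ∸ k) ℕ.!)
  p∣product = ≡.subst (p ∣_) (≡.sym (≡.trans (≡.cong (_* (k ℕ.! * (p ∸ k) ℕ.!)) (Comb.nCk≡n!/k![n-k]! (ℕP.<⇒≤ k<p))) (÷.m/n*n≡m (Comb.k![n∸k]!∣n! (ℕP.<⇒≤ k<p)))))
    (p∣p! p (ℕP.<-trans 0<k k<p))
... | inj₁ p∣C = p∣C
... | inj₂ p∣k![p∸k]! with Primality.euclidsLemma (k ℕ.!) ((p ∸ k) ℕ.!) pp p∣k![p∸k]!
...   | inj₁ p∣k! = contradiction p∣k! (prime∤! pp k k<p)
...   | inj₂ p∣p∸k! = contradiction p∣p∸k! (prime∤! pp (p ∸ k) (ℕP.∸-monoʳ-< 0<k (ℕP.<⇒≤ k<p)))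

module Characteristic (R : CommutativeRing 0ℓ 0ℓ) where
  open RingKit R

  module At (p : ℕ) (pp : Prime p) (p≈0 : int (+ p) ≈ 0#) where
    private
      module Sum = Algebra.Properties.Semiring.Sum semiring
      module M = Algebra.Properties.Semiring.Mult semiring

      ×≈int : ∀ n x → n M.× x ≈ int (+ n) ⊗ x
      ×≈int zero x = sym (⊗-zeroˡ x)
      ×≈int (suc n) x = trans (⊕-cong (sym (⊗-identityˡ x)) (×≈int n x)) (trans (sym (⊗-distribʳ x _ _)) (⊗-congʳ (sym (int-homo-+ (+ 1) (+ n)))))

      ×-zero : ∀ n x → p ∣ n → n M.× x ≈ 0#
      ×-zero n x (divides k ≡.refl) = trans (×≈int n x) (trans (⊗-congʳ (trans (reflexive (≡.cong int (ℤP.pos-* k p))) (trans (int-homo-* (+ k) (+ p))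
        (trans (⊗-congˡ p≈0) (⊗-zeroʳ _))))) (⊗-zeroˡ x))

    freshman : ∀ x y → (x ⊕ y) ↑ p ≈ x ↑ p ⊕ y ↑ p
    freshman = go p pp ≡.refl
      where
      go : ∀ n → Prime n → n ≡ p → ∀ x y → (x ⊕ y) ↑ n ≈ x ↑ n ⊕ y ↑ n
      go 0 pr = contradiction pr Primality.¬prime[0]
      go 1 pr = contradiction pr Primality.¬prime[1]
      go n@(suc (suc m)) pr ≡.refl x y = begin
        (x ⊕ y) ↑ n
          ≈⟨ B.theorem n x y ⟩
        term Fin.zero ⊕ Sum.sum (λ i → term (Fin.suc i))
          ≈⟨ ⊕-cong first (trans (Sum.sum-init-last (λ i → term (Fin.suc i))) (⊕-cong middle last)) ⟩
        y ↑ n ⊕ (0# ⊕ x ↑ n)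
          ≈⟨ solve 2 (λ x y → y :+ (con (+ 0) :+ x) := x :+ y) refl (x ↑ n) (y ↑ n) ⟩
        x ↑ n ⊕ y ↑ n ∎
        where
        open ≈-Reasoning
        module B = Algebra.Properties.CommutativeSemiring.Binomial commutativeSemiring
        term = B.binomialTerm x y n
        first : term Fin.zero ≈ y ↑ n
        first = trans (⊕-identityʳ _) (⊗-identityˡ _)
        last : term (Fin.suc (fromℕ (suc m))) ≈ x ↑ n
        last = trans (reflexive (≡.cong (λ k → (n Comb.C k) M.× (x ↑ k ⊗ y ↑ (n ∸ k))) (≡.cong suc (FinP.toℕ-fromℕ (suc m)))))
          (trans (reflexive (≡.cong₂ (λ c e → c M.× (x ↑ n ⊗ y ↑ e)) (Comb.nCn≡1 n) (ℕP.n∸n≡0 n))) (trans (⊕-identityʳ _) (⊗-identityʳ _)))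
        middle : Sum.sum (λ (i : Fin (suc m)) → term (Fin.suc (inject₁ i))) ≈ 0#
        middle = trans (Sum.sum-cong-≋ {suc m} (λ i → ×-zero _ (x ↑ suc (toℕ (inject₁ i)) ⊗ y ↑ (n ∸ suc (toℕ (inject₁ i)))) (prime∣choose pr (suc (toℕ (inject₁ i))) (s≤s z≤n)
            (s≤s (≡.subst (_< suc m) (≡.sym (FinP.toℕ-inject₁ i)) (FinP.toℕ<n i))))))
          (Sum.sum-replicate-zero (suc m))

    freshman-power : ∀ t x y → (x ⊕ y) ↑ (p ^ t) ≈ x ↑ (p ^ t) ⊕ y ↑ (p ^ t)
    freshman-power zero x y = trans (⊗-identityʳ _) (sym (⊕-cong (⊗-identityʳ x) (⊗-identityʳ y)))
    freshman-power (suc t) x y = begin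
      (x ⊕ y) ↑ (p * p ^ t)                       ≈⟨ ↑-assocʳ _ p (p ^ t) ⟨
      ((x ⊕ y) ↑ p) ↑ (p ^ t)                     ≈⟨ ↑-congˡ (p ^ t) (freshman x y) ⟩
      (x ↑ p ⊕ y ↑ p) ↑ (p ^ t)                   ≈⟨ freshman-power t _ _ ⟩
      (x ↑ p) ↑ (p ^ t) ⊕ (y ↑ p) ↑ (p ^ t)       ≈⟨ ⊕-cong (↑-assocʳ x p (p ^ t)) (↑-assocʳ y p (p ^ t)) ⟩
      x ↑ (p * p ^ t) ⊕ y ↑ (p * p ^ t) ∎
      where open ≈-Reasoning

    -- Obtained from additivity for (x - y) + y, so the sign (-1)^(p^t) never has to be discussed,
    -- whatever the parity of p.
    freshman-⊝ : ∀ t x y → (x ⊝ y) ↑ (p ^ t) ≈ x ↑ (p ^ t) ⊝ y ↑ (p ^ t)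
    freshman-⊝ t x y = begin
      (x ⊝ y) ↑ (p ^ t)                                     ≈⟨ solve 2 (λ a b → a := a :+ b :- b) refl _ (y ↑ (p ^ t)) ⟩
      (x ⊝ y) ↑ (p ^ t) ⊕ y ↑ (p ^ t) ⊝ y ↑ (p ^ t)         ≈⟨ ⊕-congʳ (freshman-power t _ _) ⟨
      (x ⊝ y ⊕ y) ↑ (p ^ t) ⊝ y ↑ (p ^ t)                   ≈⟨ ⊕-congʳ (↑-congˡ (p ^ t) (solve 2 (λ x y → x :- y :+ y := x) refl x y)) ⟩
      x ↑ (p ^ t) ⊝ y ↑ (p ^ t) ∎
      where open ≈-Reasoning

module IntegerSeries (K : CommutativeRing 0ℓ 0ℓ) where
  private module K = RingKit K
  open PowerSeries K

  int-constant : ∀ c → 𝕊.int (+ c) ≋ constant (K.int (+ c))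
  int-constant zero = λ { zero → K.refl ; (suc n) → K.refl }
  int-constant (suc c) = 𝕊.trans (𝕊.int-homo-+ (+ 1) (+ c)) (𝕊.trans (𝕊.⊕-congˡ {𝕊.1#} (int-constant c))
    (λ { zero → K.sym (K.int-homo-+ (+ 1) (+ c)) ; (suc n) → K.⊕-identityˡ _ }))

  int-series≈0 : ∀ c → K.int (+ c) K.≈ K.0# → 𝕊.int (+ c) ≋ 𝕊.0#
  int-series≈0 c c≈0 n = K.trans (int-constant c n) (go n)
    where
    go : ∀ n → constant (K.int (+ c)) n K.≈ K.0#
    go zero = c≈0
    go (suc n) = K.refl

module Frobenius (K : CommutativeRing 0ℓ 0ℓ) (p : ℕ) (pp : Prime p) (p≈0 : RingKit._≈_ K (RingKit.int K (+ p)) (RingKit.0# K)) where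
  private module K = RingKit K
  open PowerSeries K hiding (module 𝕊)
  open SeriesMaps K
  open EulerProduct K
  open RingKit seriesRing

  open Characteristic.At seriesRing p pp (IntegerSeries.int-series≈0 K p p≈0)

  private
    p^t-pos : ∀ t → ∃ λ m → p ^ t ≡ suc m
    p^t-pos t = ℕ.pred (p ^ t) , ≡.sym (ℕP.suc-pred (p ^ t) {{ℕP.m^n≢0 p t {{Primality.prime⇒nonZero pp}}}})

  Q-frobenius : ∀ t n → Q n ↑ (p ^ t) ≋ dil (p ^ t) (Q n)
  Q-frobenius t zero = trans (1↑ (p ^ t)) (sym (dil-1 (p ^ t)))
  Q-frobenius t (suc n) = begin
    (Q n ⊗ factor (suc n)) ↑ (p ^ t)                        ≈⟨ ↑-distrib-⊗ (Q n) (factor (suc n)) (p ^ t) ⟩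
    Q n ↑ (p ^ t) ⊗ factor (suc n) ↑ (p ^ t)                ≈⟨ ⊗-cong (Q-frobenius t n) (trans (freshman-⊝ t 1# (q ↑ suc n)) (⊕-cong (1↑ (p ^ t)) (⊖-cong q-side))) ⟩
    dil (p ^ t) (Q n) ⊗ (1# ⊝ dil (p ^ t) (q ↑ suc n))      ≈⟨ ⊗-congˡ {dil (p ^ t) (Q n)} (trans (Hom.⟪⟫-⊝ (dilHom (p ^ t)) 1# (q ↑ suc n)) (⊕-congʳ (dil-1 (p ^ t)))) ⟨
    dil (p ^ t) (Q n) ⊗ dil (p ^ t) (factor (suc n))        ≈⟨ dil-⊗ (p ^ t) (Q n) (factor (suc n)) ⟨
    dil (p ^ t) (Q n ⊗ factor (suc n)) ∎
    where
    open ≈-Reasoning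
    q-side : (q ↑ suc n) ↑ (p ^ t) ≋ dil (p ^ t) (q ↑ suc n)
    q-side = ≡.subst (λ m → (q ↑ suc n) ↑ m ≋ dil m (q ↑ suc n)) (≡.sym (proj₂ (p^t-pos t)))
      (sym (trans (Hom.⟪⟫-↑ (dilHom (suc m)) q (suc n)) (trans (↑-congˡ (suc n) (dil-q m)) (trans (↑-assocʳ q (suc m) (suc n))
        (trans (reflexive (≡.cong (q ↑_) (ℕP.*-comm (suc m) (suc n)))) (sym (↑-assocʳ q (suc n) (suc m))))))))
      where m = proj₁ (p^t-pos t)

  E-frobenius : ∀ t → E ↑ (p ^ t) ≋ dil (p ^ t) E
  E-frobenius t = ≋[]⇒≋ λ N → ≋[]-trans (≋[]-↑ (p ^ t) (E≋ N)) (≋[]-trans (≋⇒≋[] (Q-frobenius t N))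
    (≡.subst (λ m → dil m (Q N) ≋[ N ] dil m E) (≡.sym (proj₂ (p^t-pos t))) (dil-≋[] (proj₁ (p^t-pos t)) (≋[]-sym (E≋ N)))))
    where
    E≋ : ∀ N → E ≋[ N ] Q N
    E≋ N = ≋[]-weaken (ℕP.n≤1+n N) (≋[]-sym (Q≋[]E N))

  -- `D (p ^ t)` times E is E(q^(p^t)), which Frobenius identifies with E · E^r; one factor E is
  -- then removed by its inverse `D 0`.
  D≋E↑ : ∀ t r → p ^ t ≡ suc r → D (p ^ t) ≋ E ↑ r
  D≋E↑ t r e = begin
    D (p ^ t)                        ≡⟨ ≡.cong D e ⟩
    D (suc r)                        ≈⟨ ⊗-identityʳ (D (suc r)) ⟨
    D (suc r) ⊗ 1#                   ≈⟨ ⊗-congˡ {D (suc r)} (trans (⊗-comm E (D 0)) D0⊗E) ⟨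
    D (suc r) ⊗ (E ⊗ D 0)            ≈⟨ ⊗-assoc (D (suc r)) E (D 0) ⟨
    D (suc r) ⊗ E ⊗ D 0              ≈⟨ ⊗-congʳ {D 0} (trans (D⊗E r) (sym (≡.subst (λ m → E ↑ m ≋ dil m E) e (E-frobenius t)))) ⟩
    E ⊗ E ↑ r ⊗ D 0                  ≈⟨ solve 3 (λ e f g → e :* f :* g := (g :* e) :* f) refl E (E ↑ r) (D 0) ⟩
    D 0 ⊗ E ⊗ E ↑ r                  ≈⟨ trans (⊗-congʳ {E ↑ r} D0⊗E) (⊗-identityˡ (E ↑ r)) ⟩
    E ↑ r ∎
    where open ≈-Reasoning

-- The series η and the data it supplies to the Hecke argument.

module UnitQuotients (R : CommutativeRing 0ℓ 0ℓ) where
  open RingKit R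

  module By {b i : Carrier} (b⊗i : b ⊗ i ≈ 1#) where

    quotient-dissected : ∀ {h a c} → h ≈ a ⊝ b ⊕ c → h ≈ (a ⊗ i ⊝ 1# ⊕ c ⊗ i) ⊗ b
    quotient-dissected {h} {a} {c} e = begin
      h                                             ≈⟨ e ⟩
      a ⊝ b ⊕ c                                     ≈⟨ solve 3 (λ a b c → a :- b :+ c := a :* con (+ 1) :- b :+ c :* con (+ 1)) refl a b c ⟩
      a ⊗ 1# ⊝ b ⊕ c ⊗ 1#                           ≈⟨ ⊕-cong (⊕-congʳ (⊗-congˡ b⊗i)) (⊗-congˡ b⊗i) ⟨
      a ⊗ (b ⊗ i) ⊝ b ⊕ c ⊗ (b ⊗ i)                 ≈⟨ solve 4 (λ a b c i → a :* (b :* i) :- b :+ c :* (b :* i) := (a :* i :- con (+ 1) :+ c :* i) :* b) refl a b c i ⟩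
      (a ⊗ i ⊝ 1# ⊕ c ⊗ i) ⊗ b ∎
      where open ≈-Reasoning

    quotient-product : ∀ {a c} → a ⊗ c ≈ ⊖ (b ⊗ b) → (a ⊗ i) ⊗ (c ⊗ i) ≈ ⊖ 1#
    quotient-product {a} {c} e = begin
      (a ⊗ i) ⊗ (c ⊗ i)                             ≈⟨ solve 3 (λ a b i → (a :* i) :* (b :* i) := (a :* b) :* (i :* i)) refl a c i ⟩
      (a ⊗ c) ⊗ (i ⊗ i)                             ≈⟨ ⊗-congʳ e ⟩
      (⊖ (b ⊗ b)) ⊗ (i ⊗ i)                         ≈⟨ solve 2 (λ b i → (:- (b :* b)) :* (i :* i) := :- ((b :* i) :* (b :* i))) refl b i ⟩
      ⊖ ((b ⊗ i) ⊗ (b ⊗ i))                         ≈⟨ ⊖-cong (trans (⊗-cong b⊗i b⊗i) (⊗-identityˡ 1#)) ⟩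
      ⊖ 1# ∎
      where open ≈-Reasoning

    quotient-quintic : ∀ {a c g} → (a ↑ 5 ⊝ int (+ 11) ⊗ b ↑ 5 ⊕ c ↑ 5) ⊗ b ≈ g ↑ 6 →
      (a ⊗ i) ↑ 5 ⊝ int (+ 11) ⊕ (c ⊗ i) ↑ 5 ≈ (g ↑ 2 ⊗ i ↑ 2) ↑ 3
    quotient-quintic {a} {c} {g} e = begin
      (a ⊗ i) ↑ 5 ⊝ int (+ 11) ⊕ (c ⊗ i) ↑ 5
        ≈⟨ solve 3 (λ a c i → (a :* i) :^ 5 :- con (+ 11) :+ (c :* i) :^ 5 := ((a :* i) :^ 5 :- con (+ 11) :* con (+ 1) :^ 5 :+ (c :* i) :^ 5) :* con (+ 1)) refl a c i ⟩
      ((a ⊗ i) ↑ 5 ⊝ int (+ 11) ⊗ 1# ↑ 5 ⊕ (c ⊗ i) ↑ 5) ⊗ 1#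
        ≈⟨ ⊗-cong (⊕-congʳ (⊕-congˡ (⊖-cong (⊗-congˡ (↑-congˡ 5 b⊗i))))) b⊗i ⟨
      ((a ⊗ i) ↑ 5 ⊝ int (+ 11) ⊗ (b ⊗ i) ↑ 5 ⊕ (c ⊗ i) ↑ 5) ⊗ (b ⊗ i)
        ≈⟨ solve 4 (λ a b c i → ((a :* i) :^ 5 :- con (+ 11) :* (b :* i) :^ 5 :+ (c :* i) :^ 5) :* (b :* i)
             := ((a :^ 5 :- con (+ 11) :* b :^ 5 :+ c :^ 5) :* b) :* i :^ 6) refl a b c i ⟩
      ((a ↑ 5 ⊝ int (+ 11) ⊗ b ↑ 5 ⊕ c ↑ 5) ⊗ b) ⊗ i ↑ 6
        ≈⟨ ⊗-congʳ e ⟩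
      g ↑ 6 ⊗ i ↑ 6
        ≈⟨ solve 2 (λ g i → g :^ 6 :* i :^ 6 := (g :^ 2 :* i :^ 2) :^ 3) refl g i ⟩
      (g ↑ 2 ⊗ i ↑ 2) ↑ 3 ∎
      where open ≈-Reasoning

module UnitProducts (R : CommutativeRing 0ℓ 0ℓ) where
  open RingKit R

  unit-⊗ : ∀ {a a′ b b′} → a ⊗ a′ ≈ 1# → b′ ⊗ b ≈ 1# → (a ⊗ b) ⊗ (a′ ⊗ b′) ≈ 1#
  unit-⊗ {a} {a′} {b} {b′} e e′ = trans (solve 4 (λ a b c e → a :* b :* (c :* e) := (a :* c) :* (e :* b)) refl a b a′ b′)
    (trans (⊗-cong e e′) (⊗-identityˡ 1#))

  split-power : ∀ {a b c h m} j → (b ⊗ c ≈ h) → (a ↑ j ≈ m) → ((a ⊗ b) ⊗ c) ↑ j ≈ h ↑ j ⊗ m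
  split-power {a} {b} {c} {h} {m} j e e′ = trans (↑-congˡ j (solve 3 (λ a b c → (a :* b) :* c := (b :* c) :* a) refl a b c))
    (trans (↑-distrib-⊗ (b ⊗ c) a j) (⊗-cong (↑-congˡ j e) e′))

module PowerRelation (R S : CommutativeRing 0ℓ 0ℓ) (ι : Hom R S) where
  open RingKit S
  private
    module R = RingKit R
    module I = Hom ι

  image-dissected : ∀ {h a b c} → h R.≈ a R.⊝ b R.⊕ c → ι ⟪ h ⟫ ≈ ι ⟪ a ⟫ ⊝ ι ⟪ b ⟫ ⊕ ι ⟪ c ⟫
  image-dissected e = trans (I.⟪⟫-cong e) (trans (I.⟪⟫-⊕ _ _) (⊕-congʳ (I.⟪⟫-⊝ _ _)))

  image-product : ∀ {a b c} → a R.⊗ c R.≈ R.⊖ (b R.⊗ b) → ι ⟪ a ⟫ ⊗ ι ⟪ c ⟫ ≈ ⊖ (ι ⟪ b ⟫ ⊗ ι ⟪ b ⟫)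
  image-product e = trans (sym (I.⟪⟫-⊗ _ _)) (trans (I.⟪⟫-cong e) (trans (I.⟪⟫-⊖ _) (⊖-cong (I.⟪⟫-⊗ _ _))))

  image-quintic : ∀ {a b c g} → (a R.↑ 5 R.⊝ R.int (+ 11) R.⊗ b R.↑ 5 R.⊕ c R.↑ 5) R.⊗ b R.≈ g R.↑ 6 →
    (ι ⟪ a ⟫ ↑ 5 ⊝ int (+ 11) ⊗ ι ⟪ b ⟫ ↑ 5 ⊕ ι ⟪ c ⟫ ↑ 5) ⊗ ι ⟪ b ⟫ ≈ ι ⟪ g ⟫ ↑ 6
  image-quintic {a} {b} {c} {g} e = begin
    (ι ⟪ a ⟫ ↑ 5 ⊝ int (+ 11) ⊗ ι ⟪ b ⟫ ↑ 5 ⊕ ι ⟪ c ⟫ ↑ 5) ⊗ ι ⟪ b ⟫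
      ≈⟨ ⊗-congʳ (⊕-cong (⊕-cong (I.⟪⟫-↑ a 5) (⊖-cong (trans (I.⟪⟫-⊗ _ _) (⊗-cong (I.⟪⟫-int (+ 11)) (I.⟪⟫-↑ b 5))))) (I.⟪⟫-↑ c 5)) ⟨
    (ι ⟪ a R.↑ 5 ⟫ ⊝ ι ⟪ R.int (+ 11) R.⊗ b R.↑ 5 ⟫ ⊕ ι ⟪ c R.↑ 5 ⟫) ⊗ ι ⟪ b ⟫
      ≈⟨ trans (I.⟪⟫-⊗ _ _) (⊗-congʳ (trans (I.⟪⟫-⊕ _ _) (⊕-congʳ (I.⟪⟫-⊝ _ _)))) ⟨
    ι ⟪ (a R.↑ 5 R.⊝ R.int (+ 11) R.⊗ b R.↑ 5 R.⊕ c R.↑ 5) R.⊗ b ⟫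
      ≈⟨ I.⟪⟫-cong e ⟩
    ι ⟪ g R.↑ 6 ⟫
      ≈⟨ I.⟪⟫-↑ g 6 ⟩
    ι ⟪ g ⟫ ↑ 6 ∎
    where open ≈-Reasoning

module Eta (K : CommutativeRing 0ℓ 0ℓ) where
  open PowerSeries K using (Series; _≋_; seriesRing; q; q↑⊗-+)
  open SeriesMaps K

  module Into (L : CommutativeRing 0ℓ 0ℓ) (ιHom : Hom seriesRing L) where
    private module 𝕃 = RingKit L

    ι : Series → 𝕃.Carrier
    ι f = ιHom ⟪ f ⟫

    module At
      (t⁻¹ : 𝕃.Carrier) (t⊗t⁻¹ : ι q 𝕃.⊗ t⁻¹ 𝕃.≈ 𝕃.1#)
      (V : Hom L L) (V-ι : ∀ f → V ⟪ ι f ⟫ 𝕃.≈ ι (dil 5 f))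
      (U : 𝕃.Carrier → 𝕃.Carrier)
      (U-cong : ∀ {f g} → f 𝕃.≈ g → U f 𝕃.≈ U g)
      (U-⊕ : ∀ f g → U (f 𝕃.⊕ g) 𝕃.≈ U f 𝕃.⊕ U g)
      (U-⊗ : ∀ f g → U (V ⟪ f ⟫ 𝕃.⊗ g) 𝕃.≈ f 𝕃.⊗ U g)
      (U-ι : ∀ f → U (ι f) 𝕃.≈ ι (section 5 f))
      (ι-injective : ∀ {f g} → ι f 𝕃.≈ ι g → f ≋ g)
      (ι-support : ∀ f g → ι f 𝕃.≈ V ⟪ g ⟫ → ∀ n → ¬ (5 ∣ n) → RingKit._≈_ K (f n) (RingKit.0# K)) where
      private module K = RingKit K
      open EulerProduct K
      open Pentagonal K using (e₀; e₂; E-dissected)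
      open EulerFacts K
      open IntegerSeries K
      open RingKit seriesRing
      private
        module I = Hom ιHom
        module V = Hom V

      -- Passing to η(24z) makes all exponents integral. The classes of 1, 0 and 4 modulo 5 start at
      -- q, q^25 = q^(1+24) and q^49 = q^(1+48).
      η η₀ η₂ η₅ η₂₅ : Series
      η   = q ⊗ dil 24 E
      η₀  = q ⊗ dil 120 e₀
      η₂  = q ↑ 49 ⊗ dil 120 e₂
      η₅  = q ↑ 5 ⊗ dil 120 E
      η₂₅ = q ↑ 25 ⊗ dil 120 (dil 5 E)

      private
        dil-monomial : ∀ k j f → dil (suc k) (q ↑ j ⊗ f) ≋ q ↑ (suc k * j) ⊗ dil (suc k) f
        dil-monomial k j f = trans (dil-⊗ (suc k) (q ↑ j) f) (⊗-congʳ {dil (suc k) f}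
          (trans (Hom.⟪⟫-↑ (dilHom (suc k)) q j) (trans (↑-congˡ j (dil-q k)) (↑-assocʳ q (suc k) j))))

        q¹ : ∀ f → q ↑ 1 ⊗ f ≋ q ⊗ f
        q¹ f = ⊗-congʳ {f} (⊗-identityʳ q)

      dil5-η : dil 5 η ≋ η₅
      dil5-η = trans (dil-cong 5 (sym (q¹ (dil 24 E)))) (trans (dil-monomial 4 1 (dil 24 E)) (⊗-congˡ {q ↑ 5} (dil-dil 4 23 E)))

      dil5-η₅ : dil 5 η₅ ≋ η₂₅
      dil5-η₅ = trans (dil-monomial 4 5 (dil 120 E)) (⊗-congˡ {q ↑ 25} (trans (dil-dil 4 119 E) (sym (dil-dil 119 4 E))))

      η-dissected : η ≋ η₀ ⊝ η₂₅ ⊕ η₂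
      η-dissected = begin
        q ⊗ dil 24 E
          ≈⟨ ⊗-congˡ {q} (dil-cong 24 E-dissected) ⟩
        q ⊗ dil 24 (dil 5 e₀ ⊝ q ⊗ dil 5 (dil 5 E) ⊕ q ↑ 2 ⊗ dil 5 e₂)
          ≈⟨ ⊗-congˡ {q} (trans (dil-⊕ 24 (dil 5 e₀ ⊝ q ⊗ dil 5 (dil 5 E)) (q ↑ 2 ⊗ dil 5 e₂)) (⊕-cong (trans (Hom.⟪⟫-⊝ (dilHom 24) (dil 5 e₀) (q ⊗ dil 5 (dil 5 E)))
               (⊕-cong (dil-dil 23 4 e₀) (⊖-cong (trans (dil-cong 24 (sym (q¹ (dil 5 (dil 5 E))))) (trans (dil-monomial 23 1 (dil 5 (dil 5 E))) (⊗-congˡ {q ↑ 24} (dil-dil 23 4 (dil 5 E))))))))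
               (trans (dil-monomial 23 2 (dil 5 e₂)) (⊗-congˡ {q ↑ 48} (dil-dil 23 4 e₂))))) ⟩
        q ⊗ (dil 120 e₀ ⊝ q ↑ 24 ⊗ dil 120 (dil 5 E) ⊕ q ↑ 48 ⊗ dil 120 e₂)
          ≈⟨ solve 6 (λ q a x b y c → q :* (a :- x :* b :+ y :* c) := q :* a :- (q :* x) :* b :+ (q :* y) :* c) refl
               q (dil 120 e₀) (q ↑ 24) (dil 120 (dil 5 E)) (q ↑ 48) (dil 120 e₂) ⟩
        η₀ ⊝ η₂₅ ⊕ η₂ ∎
        where open ≈-Reasoning

      η₀⊗η₂ : η₀ ⊗ η₂ ≋ ⊖ (η₂₅ ⊗ η₂₅)
      η₀⊗η₂ = begin
        (q ⊗ dil 120 e₀) ⊗ (q ↑ 49 ⊗ dil 120 e₂)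
          ≈⟨ solve 4 (λ q a x b → (q :* a) :* (x :* b) := (q :* x) :* (a :* b)) refl q (dil 120 e₀) (q ↑ 49) (dil 120 e₂) ⟩
        q ↑ 50 ⊗ (dil 120 e₀ ⊗ dil 120 e₂)
          ≈⟨ ⊗-cong (↑-homo-⊗ q 25 25) (trans (sym (dil-⊗ 120 e₀ e₂)) (trans (dil-cong 120 e₀⊗e₂) (trans (Hom.⟪⟫-⊖ (dilHom 120) (dil 5 E ⊗ dil 5 E)) (⊖-cong (dil-⊗ 120 (dil 5 E) (dil 5 E)))))) ⟩
        q ↑ 25 ⊗ q ↑ 25 ⊗ (⊖ (dil 120 (dil 5 E) ⊗ dil 120 (dil 5 E)))
          ≈⟨ solve 2 (λ q b → q :* q :* (:- (b :* b)) := :- ((q :* b) :* (q :* b))) refl (q ↑ 25) (dil 120 (dil 5 E)) ⟩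
        ⊖ (η₂₅ ⊗ η₂₅) ∎
        where open ≈-Reasoning

      η-quintic : (η₀ ↑ 5 ⊝ int (+ 11) ⊗ η₂₅ ↑ 5 ⊕ η₂ ↑ 5) ⊗ η₂₅ ≋ η₅ ↑ 6
      η-quintic = begin
        ((q ⊗ a) ↑ 5 ⊝ l ⊗ (q ↑ 25 ⊗ g) ↑ 5 ⊕ (q ↑ 49 ⊗ b) ↑ 5) ⊗ (q ↑ 25 ⊗ g)
          ≈⟨ ⊗-congʳ {q ↑ 25 ⊗ g} (⊕-cong (⊕-cong (↑-distrib-⊗ q a 5) (⊖-cong (⊗-congˡ {l} (pow 25 120 g ≡.refl)))) (pow 49 240 b ≡.refl)) ⟩
        (q ↑ 5 ⊗ a ↑ 5 ⊝ l ⊗ (q ↑ 5 ⊗ q ↑ 120 ⊗ g ↑ 5) ⊕ q ↑ 5 ⊗ q ↑ 240 ⊗ b ↑ 5) ⊗ (q ↑ 25 ⊗ g)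
          ≈⟨ solve 9 (λ x a l y g z b w h → (x :* a :- l :* (x :* y :* g) :+ x :* z :* b) :* (w :* h) := (x :* w) :* ((a :- l :* (y :* g) :+ z :* b) :* h)) refl
               (q ↑ 5) (a ↑ 5) l (q ↑ 120) (g ↑ 5) (q ↑ 240) (b ↑ 5) (q ↑ 25) g ⟩
        (q ↑ 5 ⊗ q ↑ 25) ⊗ ((a ↑ 5 ⊝ l ⊗ (q ↑ 120 ⊗ g ↑ 5) ⊕ q ↑ 240 ⊗ b ↑ 5) ⊗ g)
          ≈⟨ ⊗-cong (sym (trans (↑-assocʳ q 5 6) (↑-homo-⊗ q 5 25))) dilated ⟩
        (q ↑ 5) ↑ 6 ⊗ dil 120 E ↑ 6
          ≈⟨ ↑-distrib-⊗ (q ↑ 5) (dil 120 E) 6 ⟨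
        η₅ ↑ 6 ∎
        where
        open ≈-Reasoning
        module D = Hom (dilHom 120)
        a = dil 120 e₀
        b = dil 120 e₂
        g = dil 120 (dil 5 E)
        l = int (+ 11)
        pow : ∀ i j f → i * 5 ≡ 5 + j → (q ↑ i ⊗ f) ↑ 5 ≋ q ↑ 5 ⊗ q ↑ j ⊗ f ↑ 5
        pow i j f e = trans (↑-distrib-⊗ (q ↑ i) f 5) (⊗-congʳ {f ↑ 5} (trans (↑-assocʳ q i 5) (trans (reflexive (≡.cong (q ↑_) e)) (↑-homo-⊗ q 5 j))))
        dilated : (a ↑ 5 ⊝ l ⊗ (q ↑ 120 ⊗ g ↑ 5) ⊕ q ↑ 240 ⊗ b ↑ 5) ⊗ g ≋ dil 120 E ↑ 6
        dilated = begin
          (a ↑ 5 ⊝ l ⊗ (q ↑ 120 ⊗ g ↑ 5) ⊕ q ↑ 240 ⊗ b ↑ 5) ⊗ g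
            ≈⟨ ⊗-congʳ {g} (⊕-cong (⊕-cong (D.⟪⟫-↑ e₀ 5) (⊖-cong (trans (D.⟪⟫-⊗ l (q ⊗ dil 5 E ↑ 5)) (⊗-cong (D.⟪⟫-int (+ 11))
                 (trans (D.⟪⟫-⊗ q (dil 5 E ↑ 5)) (⊗-cong (dil-q 119) (D.⟪⟫-↑ (dil 5 E) 5)))))))
                 (trans (D.⟪⟫-⊗ (q ↑ 2) (e₂ ↑ 5)) (⊗-cong (trans (D.⟪⟫-↑ q 2) (trans (↑-congˡ 2 (dil-q 119)) (↑-assocʳ q 120 2))) (D.⟪⟫-↑ e₂ 5)))) ⟨
          (dil 120 (e₀ ↑ 5) ⊝ dil 120 (l ⊗ (q ⊗ dil 5 E ↑ 5)) ⊕ dil 120 (q ↑ 2 ⊗ e₂ ↑ 5)) ⊗ g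
            ≈⟨ trans (D.⟪⟫-⊗ (e₀ ↑ 5 ⊝ l ⊗ (q ⊗ dil 5 E ↑ 5) ⊕ q ↑ 2 ⊗ e₂ ↑ 5) (dil 5 E)) (⊗-congʳ {g} (trans
                 (D.⟪⟫-⊕ (e₀ ↑ 5 ⊝ l ⊗ (q ⊗ dil 5 E ↑ 5)) (q ↑ 2 ⊗ e₂ ↑ 5))
                 (⊕-congʳ {dil 120 (q ↑ 2 ⊗ e₂ ↑ 5)} (D.⟪⟫-⊝ (e₀ ↑ 5) (l ⊗ (q ⊗ dil 5 E ↑ 5)))))) ⟨
          dil 120 ((e₀ ↑ 5 ⊝ l ⊗ (q ⊗ dil 5 E ↑ 5) ⊕ q ↑ 2 ⊗ e₂ ↑ 5) ⊗ dil 5 E)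
            ≈⟨ D.⟪⟫-cong quintic ⟩
          dil 120 (E ↑ 6)
            ≈⟨ D.⟪⟫-↑ E 6 ⟩
          dil 120 E ↑ 6 ∎

      H H⁻¹ H₂₅⁻¹ y z : 𝕃.Carrier
      H = ι η
      H⁻¹ = t⁻¹ 𝕃.⊗ ι (dil 24 (D 0))
      H₂₅⁻¹ = V ⟪ V ⟪ H⁻¹ ⟫ ⟫
      y = ι η₀ 𝕃.⊗ H₂₅⁻¹
      z = ι η₂ 𝕃.⊗ H₂₅⁻¹

      H⊗H⁻¹ : H 𝕃.⊗ H⁻¹ 𝕃.≈ 𝕃.1#
      H⊗H⁻¹ = 𝕃.trans (𝕃.⊗-congʳ {H⁻¹} (I.⟪⟫-⊗ q (dil 24 E))) (UnitProducts.unit-⊗ L t⊗t⁻¹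
        (𝕃.trans (𝕃.sym (I.⟪⟫-⊗ (dil 24 (D 0)) (dil 24 E))) (𝕃.trans (I.⟪⟫-cong
          (trans (sym (dil-⊗ 24 (D 0) E)) (trans (dil-cong 24 D0⊗E) (dil-1 24)))) I.⟪⟫-1)))

      V-H : V ⟪ H ⟫ 𝕃.≈ ι η₅
      V-H = 𝕃.trans (V-ι η) (I.⟪⟫-cong dil5-η)

      VV-H : V ⟪ V ⟪ H ⟫ ⟫ 𝕃.≈ ι η₂₅
      VV-H = 𝕃.trans (V.⟪⟫-cong V-H) (𝕃.trans (V-ι η₅) (I.⟪⟫-cong dil5-η₅))

      η₂₅⊗ : ι η₂₅ 𝕃.⊗ H₂₅⁻¹ 𝕃.≈ 𝕃.1#
      η₂₅⊗ = 𝕃.trans (𝕃.⊗-congʳ (𝕃.sym VV-H)) (𝕃.trans (𝕃.sym (V.⟪⟫-⊗ (V ⟪ H ⟫) (V ⟪ H⁻¹ ⟫)))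
        (𝕃.trans (V.⟪⟫-cong (𝕃.trans (𝕃.sym (V.⟪⟫-⊗ H H⁻¹)) (𝕃.trans (V.⟪⟫-cong H⊗H⁻¹) V.⟪⟫-1))) V.⟪⟫-1))

      open UnitQuotients.By L {ι η₂₅} {H₂₅⁻¹} η₂₅⊗
      open PowerRelation seriesRing L ιHom

      H-dissected : H 𝕃.≈ (y 𝕃.⊝ 𝕃.1# 𝕃.⊕ z) 𝕃.⊗ V ⟪ V ⟪ H ⟫ ⟫
      H-dissected = 𝕃.trans (quotient-dissected {H} {ι η₀} {ι η₂} (image-dissected {η} {η₀} {η₂₅} {η₂} η-dissected)) (𝕃.⊗-congˡ {y 𝕃.⊝ 𝕃.1# 𝕃.⊕ z} (𝕃.sym VV-H))

      y⊗z : y 𝕃.⊗ z 𝕃.≈ 𝕃.⊖ 𝕃.1#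
      y⊗z = quotient-product {ι η₀} {ι η₂} (image-product {η₀} {η₂₅} {η₂} η₀⊗η₂)

      y-quintic : y 𝕃.↑ 5 𝕃.⊝ 𝕃.int (+ 11) 𝕃.⊕ z 𝕃.↑ 5 𝕃.≈ V ⟪ (H 𝕃.↑ 2 𝕃.⊗ V ⟪ H⁻¹ ⟫ 𝕃.↑ 2) 𝕃.↑ 3 ⟫
      y-quintic = 𝕃.trans (quotient-quintic {ι η₀} {ι η₂} {V ⟪ H ⟫} (𝕃.trans (image-quintic {η₀} {η₂₅} {η₂} {η₅} η-quintic) (𝕃.↑-congˡ 6 {ι η₅} {V ⟪ H ⟫} (𝕃.sym V-H))))
        (𝕃.sym (𝕃.trans (V.⟪⟫-↑ (H 𝕃.↑ 2 𝕃.⊗ V ⟪ H⁻¹ ⟫ 𝕃.↑ 2) 3) (𝕃.↑-congˡ 3 (𝕃.trans (V.⟪⟫-⊗ (H 𝕃.↑ 2) (V ⟪ H⁻¹ ⟫ 𝕃.↑ 2))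
          (𝕃.⊗-cong (V.⟪⟫-↑ H 2) (V.⟪⟫-↑ (V ⟪ H⁻¹ ⟫) 2))))))

      U-1 : U 𝕃.1# 𝕃.≈ 𝕃.1#
      U-1 = 𝕃.trans (U-cong (𝕃.sym I.⟪⟫-1)) (𝕃.trans (U-ι 1#) (𝕃.trans (I.⟪⟫-cong (trans (λ n → sym (dil-1 5) (n * 5)) (section-dil 4 1#))) I.⟪⟫-1))

      -- All exponents of the j-th power lie in the class of ej modulo 5, which U annihilates; y and
      -- z use e = 1 and e = 49.
      U-class : ∀ e f g j → ¬ (5 ∣ e * j) → U ((ι (q ↑ e ⊗ dil 5 f) 𝕃.⊗ V ⟪ g ⟫) 𝕃.↑ j) 𝕃.≈ 𝕃.0#
      U-class e f g j 5∤ = begin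
        U ((ι (q ↑ e ⊗ dil 5 f) 𝕃.⊗ V ⟪ g ⟫) 𝕃.↑ j)
          ≈⟨ U-cong step ⟩
        U (V ⟪ (ι f 𝕃.⊗ g) 𝕃.↑ j ⟫ 𝕃.⊗ ι (q ↑ (e * j)))
          ≈⟨ U-⊗ ((ι f 𝕃.⊗ g) 𝕃.↑ j) (ι (q ↑ (e * j))) ⟩
        (ι f 𝕃.⊗ g) 𝕃.↑ j 𝕃.⊗ U (ι (q ↑ (e * j)))
          ≈⟨ 𝕃.⊗-congˡ (𝕃.trans (U-ι (q ↑ (e * j))) (𝕃.trans (I.⟪⟫-cong (section-q↑ 5 (e * j) 5∤)) I.⟪⟫-0)) ⟩
        (ι f 𝕃.⊗ g) 𝕃.↑ j 𝕃.⊗ 𝕃.0#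
          ≈⟨ 𝕃.⊗-zeroʳ _ ⟩
        𝕃.0# ∎
        where
        open 𝕃.≈-Reasoning
        step : (ι (q ↑ e ⊗ dil 5 f) 𝕃.⊗ V ⟪ g ⟫) 𝕃.↑ j 𝕃.≈ V ⟪ (ι f 𝕃.⊗ g) 𝕃.↑ j ⟫ 𝕃.⊗ ι (q ↑ (e * j))
        step = 𝕃.trans (𝕃.↑-congˡ j (𝕃.⊗-congʳ {V ⟪ g ⟫} (I.⟪⟫-⊗ (q ↑ e) (dil 5 f)))) (𝕃.trans
          (UnitProducts.split-power L j (𝕃.sym (𝕃.trans (V.⟪⟫-⊗ (ι f) g) (𝕃.⊗-congʳ {V ⟪ g ⟫} (V-ι f))))
            (𝕃.trans (𝕃.sym (I.⟪⟫-↑ (q ↑ e) j)) (I.⟪⟫-cong (↑-assocʳ q e j))))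
          (𝕃.⊗-congʳ {ι (q ↑ (e * j))} (𝕃.sym (V.⟪⟫-↑ (ι f 𝕃.⊗ g) j))))

      private
        1-4 : ∀ {e} → ¬ (5 ∣ e * 1) → ¬ (5 ∣ e * 2) → ¬ (5 ∣ e * 3) → ¬ (5 ∣ e * 4) → ∀ i → 1 ≤ i → i ≤ 4 → ¬ (5 ∣ e * i)
        1-4 a b c f 1 _ _ = a
        1-4 a b c f 2 _ _ = b
        1-4 a b c f 3 _ _ = c
        1-4 a b c f 4 _ _ = f
        1-4 a b c f (suc (suc (suc (suc (suc i))))) _ (s≤s (s≤s (s≤s (s≤s ()))))

      U-y : ∀ i → 1 ≤ i → i ≤ 4 → U (y 𝕃.↑ i) 𝕃.≈ 𝕃.0#
      U-y i 1≤i i≤4 = 𝕃.trans (U-cong (𝕃.↑-congˡ i (𝕃.⊗-congʳ (I.⟪⟫-cong (trans (sym (q¹ (dil 120 e₀))) (⊗-congˡ {q ↑ 1} (sym (dil-dil 4 23 e₀))))))))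
        (U-class 1 (dil 24 e₀) (V ⟪ H⁻¹ ⟫) i (1-4 {1} (from-no (5 ∣? 1)) (from-no (5 ∣? 2)) (from-no (5 ∣? 3)) (from-no (5 ∣? 4)) i 1≤i i≤4))

      U-z : ∀ i → 1 ≤ i → i ≤ 4 → U (z 𝕃.↑ i) 𝕃.≈ 𝕃.0#
      U-z i 1≤i i≤4 = 𝕃.trans (U-cong (𝕃.↑-congˡ i (𝕃.⊗-congʳ (I.⟪⟫-cong (⊗-congˡ {q ↑ 49} (sym (dil-dil 4 23 e₂)))))))
        (U-class 49 (dil 24 e₂) (V ⟪ H⁻¹ ⟫) i (1-4 {49} (from-no (5 ∣? 49)) (from-no (5 ∣? 98)) (from-no (5 ∣? 147)) (from-no (5 ∣? 196)) i 1≤i i≤4))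

      open TraceOperator.At L V U U-cong U-⊕ U-⊗ U-1 H H⁻¹ y z H⊗H⁻¹ y⊗z H-dissected U-y U-z public
        using (U-H⁴; module Quintic)
      open Quintic y-quintic public using (module Hecke)

      η-frobenius : ∀ {p} → Prime p → K.int (+ p) K.≈ K.0# → η ↑ p ≋ dil p η
      η-frobenius {zero} pp = contradiction pp Primality.¬prime[0]
      η-frobenius {suc m} pp p≈0 = begin
        (q ⊗ dil 24 E) ↑ suc m                    ≈⟨ ↑-distrib-⊗ q (dil 24 E) (suc m) ⟩
        q ↑ suc m ⊗ dil 24 E ↑ suc m              ≈⟨ ⊗-cong (sym (dil-q m)) (trans (sym (Hom.⟪⟫-↑ (dilHom 24) E (suc m)))
                                                       (trans (dil-cong 24 E↑p) (trans (dil-dil 23 m E) (trans commute (sym (dil-dil m 23 E)))))) ⟩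
        dil (suc m) q ⊗ dil (suc m) (dil 24 E)    ≈⟨ dil-⊗ (suc m) q (dil 24 E) ⟨
        dil (suc m) η ∎
        where
        open ≈-Reasoning
        E↑p : E ↑ suc m ≋ dil (suc m) E
        E↑p = ≡.subst (λ k → E ↑ k ≋ dil k E) (ℕP.*-identityʳ (suc m)) (Frobenius.E-frobenius K (suc m) pp p≈0 1)
        commute : dil (24 * suc m) E ≋ dil (suc m * 24) E
        commute = ≡.subst (λ k → dil (24 * suc m) E ≋ dil k E) (ℕP.*-comm 24 (suc m)) (refl {dil (24 * suc m) E})

      -- Modulo 5, η^(4+5w) is η⁴ times a series in q⁵, and `U-H⁴` then contributes the factor -5.
      section-η : K.int (+ 5) K.≈ K.0# → ∀ w → section 5 (η ↑ (4 + 5 * w)) ≋ 0#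
      section-η 5≈0 w = ι-injective (begin
        ι (section 5 (η ↑ (4 + 5 * w)))                      ≈⟨ U-ι (η ↑ (4 + 5 * w)) ⟨
        U (ι (η ↑ (4 + 5 * w)))                              ≈⟨ U-cong (𝕃.trans (I.⟪⟫-cong split) (I.⟪⟫-⊗ (η ↑ 4) (dil 5 (η ↑ w)))) ⟩
        U (ι (η ↑ 4) 𝕃.⊗ ι (dil 5 (η ↑ w)))                  ≈⟨ U-cong (𝕃.⊗-cong (I.⟪⟫-↑ η 4) (𝕃.sym (V-ι (η ↑ w)))) ⟩
        U (H 𝕃.↑ 4 𝕃.⊗ V ⟪ ι (η ↑ w) ⟫)                      ≈⟨ U-H⁴ (ι (η ↑ w)) ⟩
        𝕃.int (ℤ.- + 5) 𝕃.⊗ (V ⟪ H ⟫ 𝕃.↑ 4 𝕃.⊗ ι (η ↑ w))    ≈⟨ 𝕃.⊗-congʳ (𝕃.trans (𝕃.⊖-cong (int≈0 5 5≈0)) (𝕃.trans (𝕃.sym (𝕃.⊕-identityˡ (𝕃.⊖ 𝕃.0#))) (𝕃.⊖-inverseʳ 𝕃.0#))) ⟩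
        𝕃.0# 𝕃.⊗ (V ⟪ H ⟫ 𝕃.↑ 4 𝕃.⊗ ι (η ↑ w))               ≈⟨ 𝕃.⊗-zeroˡ _ ⟩
        𝕃.0#                                                 ≈⟨ I.⟪⟫-0 ⟨
        ι 0# ∎)
        where
        open 𝕃.≈-Reasoning
        int≈0 : ∀ c → K.int (+ c) K.≈ K.0# → 𝕃.int (+ c) 𝕃.≈ 𝕃.0#
        int≈0 c e = 𝕃.trans (𝕃.sym (I.⟪⟫-int (+ c))) (𝕃.trans (I.⟪⟫-cong (int-series≈0 c e)) I.⟪⟫-0)
        split : η ↑ (4 + 5 * w) ≋ η ↑ 4 ⊗ dil 5 (η ↑ w)
        split = trans (↑-homo-⊗ η 4 (5 * w)) (⊗-congˡ {η ↑ 4} (trans (sym (↑-assocʳ η 5 w)) (trans (↑-congˡ w (η-frobenius prime[5] 5≈0)) (sym (Hom.⟪⟫-↑ (dilHom 5) η w)))))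

      section↑ : ℕ → Series → Series
      section↑ N f n = f (n * 5 ^ N)

      -- The Bézout equation makes ⅕ an inverse of 5 in characteristic p, and N-fold application of
      -- U reads off the coefficients at multiples of 5^N. That the result lies in the image of V is
      -- the vanishing claimed.
      η-supported : ∀ p → Prime p → K.int (+ p) K.≈ K.0# → ∀ ⅕ k → + 5 ℤ.* ⅕ ≡ + 1 ℤ.+ k ℤ.* + p → ∀ ρ →
        ∃ λ N → ∀ n → ¬ (5 ∣ n) → (η ↑ (2 * ρ)) (n * 5 ^ N) K.≈ K.0#
      η-supported p pp p≈0 ⅕ k 5⅕≡1 ρ = N , ι-support (section↑ N (η ↑ (2 * ρ))) (proj₁ (proj₂ supported)) (𝕃.trans (𝕃.sym (U↑-ι N)) (proj₂ (proj₂ supported)))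
        where
        p≈0ᴸ : 𝕃.int (+ p) 𝕃.≈ 𝕃.0#
        p≈0ᴸ = 𝕃.trans (𝕃.sym (I.⟪⟫-int (+ p))) (𝕃.trans (I.⟪⟫-cong (int-series≈0 p p≈0)) I.⟪⟫-0)
        unit : 𝕃.int (+ 5) 𝕃.⊗ 𝕃.int ⅕ 𝕃.≈ 𝕃.1#
        unit = 𝕃.trans (𝕃.sym (𝕃.int-homo-* (+ 5) ⅕)) (𝕃.trans (𝕃.reflexive (≡.cong 𝕃.int 5⅕≡1)) (𝕃.trans (𝕃.int-homo-+ (+ 1) (k ℤ.* + p))
          (𝕃.trans (𝕃.⊕-congˡ (𝕃.trans (𝕃.int-homo-* k (+ p)) (𝕃.trans (𝕃.⊗-congˡ p≈0ᴸ) (𝕃.⊗-zeroʳ _)))) (𝕃.⊕-identityʳ 𝕃.1#))))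
        open Hecke ⅕ unit using (module Weight)
        open Weight (ρ ÷./ 4) ρ
          (ℕP.≤-trans (ℕP.≤-reflexive (ℕP.*-comm 4 (ρ ÷./ 4))) (÷.m/n*n≤m ρ 4))
          (ℕP.≤-trans (ℕP.≤-reflexive (÷.m≡m%n+[m/n]*n ρ 4)) (ℕP.+-mono-≤ (ℕP.≤-pred (÷.m%n<n ρ 4)) (ℕP.≤-reflexive (ℕP.*-comm (ρ ÷./ 4) 4))))
          using (U↑; module Periodicity)
        supported = Periodicity.eventually-supported p {{Primality.prime⇒nonZero pp}} p≈0ᴸ
        N = proj₁ supported
        U↑-ι : ∀ N → U↑ N (H 𝕃.↑ (2 * ρ)) 𝕃.≈ ι (section↑ N (η ↑ (2 * ρ)))
        U↑-ι zero = 𝕃.trans (𝕃.sym (I.⟪⟫-↑ η (2 * ρ))) (I.⟪⟫-cong (λ n → K.reflexive (≡.cong (η ↑ (2 * ρ)) (≡.sym (ℕP.*-identityʳ n)))))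
        U↑-ι (suc N) = 𝕃.trans (U-cong (U↑-ι N)) (𝕃.trans (U-ι (section↑ N (η ↑ (2 * ρ)))) (I.⟪⟫-cong (λ n → K.reflexive (≡.cong (η ↑ (2 * ρ)) (ℕP.*-assoc n 5 (5 ^ N))))))

module LaurentEta (K : CommutativeRing 0ℓ 0ℓ) where
  private module K = RingKit K
  open PowerSeries K using (Series; _≋_; seriesRing; q; q↑⊗-+)
  open SeriesMaps K
  open LaurentSeries K
  open RingKit seriesRing
  private
    module 𝕃 = RingKit localisation

    V = dilᶠHom 4

    V-ι : ∀ f → V ⟪ ι f ⟫ 𝕃.≈ ι (dil 5 f)
    V-ι f = cross (⊗-congˡ {dil 5 f} (sym (dil-1 5)))

    ι-injective : ∀ {f g} → ι f 𝕃.≈ ι g → f ≋ g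
    ι-injective {f} {g} (cross e) = trans (sym (⊗-identityʳ f)) (trans e (⊗-identityʳ g))

    dil-∤ : ∀ f n → ¬ (5 ∣ n) → dil 5 f n K.≈ K.0#
    dil-∤ f n 5∤n = ≡.subst (λ i → dil 5 f i K.≈ K.0#) (≡.trans (ℕP.+-comm (n ÷./ 5 * 5) (n ÷.% 5)) (≡.sym (÷.m≡m%n+[m/n]*n n 5)))
      (dil-residue 4 f (n ÷./ 5) (n ÷.% 5) (ℕP.n≢0⇒n>0 (λ r≡0 → 5∤n (∣.m%n≡0⇒n∣m n 5 r≡0))) (÷.m%n<n n 5))

    -- Clearing the pole of V g multiplies f by a power of q⁵, which preserves residue classes
    -- modulo 5.
    ι-support : ∀ f g → ι f 𝕃.≈ V ⟪ g ⟫ → ∀ n → ¬ (5 ∣ n) → f n K.≈ K.0#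
    ι-support f g (cross e) n 5∤n = K.trans (K.sym (q↑⊗-+ (5 * exponent g) f n)) (K.trans (eq (5 * exponent g + n))
      (dil-∤ (num g) (5 * exponent g + n) (λ 5∣ → 5∤n (∣.∣m+n∣m⇒∣n 5∣ (∣.m∣m*n (exponent g))))))
      where
      eq : q ↑ (5 * exponent g) ⊗ f ≋ dil 5 (num g)
      eq = trans (⊗-congʳ {f} (sym (dilᶠ-exponent 4 g))) (trans (⊗-comm (dil 5 (den g)) f) (trans e (⊗-identityʳ (dil 5 (num g)))))

  open Eta.Into.At K localisation ιHom t⁻¹ t⊗t⁻¹ V V-ι U U-cong U-⊕ U-⊗ U-ι ι-injective ι-support public
    using (η; η-frobenius; section-η; η-supported)

-- The ring ℤ/p and the choice of the progression.

module Quotient (R : CommutativeRing 0ℓ 0ℓ) where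
  open RingKit R

  module By (n : Carrier) where
    private
      _≈ₙ_ : Carrier → Carrier → Set
      x ≈ₙ y = ∃ λ k → x ≈ y ⊕ k ⊗ n

      lift : ∀ {x y} → x ≈ y → x ≈ₙ y
      lift {x} {y} e = 0# , trans e (solve 2 (λ y n → y := y :+ con (+ 0) :* n) refl y n)

      symₙ : ∀ {x y} → x ≈ₙ y → y ≈ₙ x
      symₙ {x} {y} (k , e) = ⊖ k , trans (solve 3 (λ y k n → y := (y :+ k :* n) :+ (:- k) :* n) refl y k n) (⊕-congʳ (sym e))

      transₙ : ∀ {x y z} → x ≈ₙ y → y ≈ₙ z → x ≈ₙ z
      transₙ {x} {y} {z} (k , e) (l , e′) = l ⊕ k , trans e (trans (⊕-congʳ e′) (solve 4 (λ z k l n → z :+ l :* n :+ k :* n := z :+ (l :+ k) :* n) refl z k l n))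

      ⊕-congₙ : ∀ {x y u v} → x ≈ₙ y → u ≈ₙ v → (x ⊕ u) ≈ₙ (y ⊕ v)
      ⊕-congₙ {x} {y} {u} {v} (k , e) (l , e′) = k ⊕ l , trans (⊕-cong e e′)
        (solve 5 (λ y v k l n → (y :+ k :* n) :+ (v :+ l :* n) := (y :+ v) :+ (k :+ l) :* n) refl y v k l n)

      ⊗-congₙ : ∀ {x y u v} → x ≈ₙ y → u ≈ₙ v → (x ⊗ u) ≈ₙ (y ⊗ v)
      ⊗-congₙ {x} {y} {u} {v} (k , e) (l , e′) = y ⊗ l ⊕ k ⊗ v ⊕ k ⊗ l ⊗ n , trans (⊗-cong e e′)
        (solve 5 (λ y v k l n → (y :+ k :* n) :* (v :+ l :* n) := y :* v :+ (y :* l :+ k :* v :+ k :* l :* n) :* n) refl y v k l n)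

    -- The carrier stays that of R and only the equality is coarser; its witness is the cofactor
    -- from which divisibility is read off at the end.
    quotient : CommutativeRing 0ℓ 0ℓ
    quotient = record
      { Carrier = Carrier ; _≈_ = _≈ₙ_ ; _+_ = _⊕_ ; _*_ = _⊗_ ; -_ = ⊖_ ; 0# = 0# ; 1# = 1#
      ; isCommutativeRing = record
        { isRing = record
          { +-isAbelianGroup = record
            { isGroup = record
              { isMonoid = record
                { isSemigroup = record
                  { isMagma = record
                    { isEquivalence = record { refl = lift refl ; sym = symₙ ; trans = transₙ }
                    ; ∙-cong = ⊕-congₙ }
                  ; assoc = λ x y z → lift (⊕-assoc x y z) }
                ; identity = (λ x → lift (⊕-identityˡ x)) , (λ x → lift (⊕-identityʳ x)) }
              ; inverse = (λ x → lift (⊖-inverseˡ x)) , (λ x → lift (⊖-inverseʳ x))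
              ; ⁻¹-cong = λ {x} {y} (k , e) → ⊖ k , trans (⊖-cong e) (solve 3 (λ y k n → :- (y :+ k :* n) := :- y :+ (:- k) :* n) refl y k n) }
            ; comm = λ x y → lift (⊕-comm x y) }
          ; *-cong = ⊗-congₙ
          ; *-assoc = λ x y z → lift (⊗-assoc x y z)
          ; *-identity = (λ x → lift (⊗-identityˡ x)) , (λ x → lift (⊗-identityʳ x))
          ; distrib = (λ x y z → lift (⊗-distribˡ x y z)) , (λ x y z → lift (⊗-distribʳ x y z)) }
        ; *-comm = λ x y → lift (⊗-comm x y) } }

    projection : Hom R quotient
    projection = record
      { ⟪_⟫ = λ x → x ; ⟪⟫-cong = lift ; ⟪⟫-⊕ = λ _ _ → lift refl ; ⟪⟫-⊗ = λ _ _ → lift refl ; ⟪⟫-1 = lift refl }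

    n≈0 : n ≈ₙ 0#
    n≈0 = 1# , sym (trans (⊕-identityˡ _) (⊗-identityˡ n))

private
  -- g = (25^{N+1} − 1) / 24
  geometric : ∀ N → ∃ λ g → 1 + 24 * g ≡ 25 * (5 ^ N * 5 ^ N)
  geometric zero = 1 , ≡.refl
  geometric (suc N) with geometric N
  ... | g , e = 1 + 25 * g , ≡.trans (ℕ-solve 1 (λ g → ν 1 ∔ ν 24 ∙ (ν 1 ∔ ν 25 ∙ g) ≐ ν 25 ∙ (ν 1 ∔ ν 24 ∙ g)) ≡.refl g)
    (≡.trans (≡.cong (25 *_) e) (ℕ-solve 1 (λ P → ν 25 ∙ (ν 25 ∙ (P ∙ P)) ≐ ν 25 ∙ ((ν 5 ∙ P) ∙ (ν 5 ∙ P))) ≡.refl (5 ^ N)))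

  inverse-5 : ∀ {p} → Prime p → ¬ (p ≡ 5) → ∃ λ ⅕ → ∃ λ k → + 5 ℤ.* ⅕ ≡ + 1 ℤ.+ k ℤ.* + p
  inverse-5 {p} pp p≢5 with Coprimality.coprime-Bézout {5} {p} (λ (k∣5 , k∣p) → coprime k∣5 k∣p)
    where
    coprime : ∀ {k} → k ∣ 5 → k ∣ p → k ≡ 1
    coprime k∣5 k∣p with Primality.prime⇒irreducible prime[5] k∣5
    ... | inj₁ k≡1 = k≡1
    ... | inj₂ ≡.refl with Primality.prime⇒irreducible pp k∣p
    ...   | inj₁ ()
    ...   | inj₂ 5≡p = contradiction (≡.sym 5≡p) p≢5
  ... | Bézout.+- x y e = + x , + y , ≡.trans (≡.sym (ℤP.pos-* 5 x)) (≡.trans (≡.cong +_ (≡.trans (ℕP.*-comm 5 x) (≡.sym e)))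
    (≡.cong (λ i → + 1 ℤ.+ i) (ℤP.pos-* y p)))
  ... | Bézout.-+ x y e = ℤ.- + x , ℤ.- + y , (begin
    + 5 ℤ.* (ℤ.- + x)                             ≡⟨ ℤ-solve 2 (λ x n → con (+ 5) :* (:- x) := con (+ 1) :- (con (+ 1) :+ x :* con (+ 5))) ≡.refl (+ x) (+ 0) ⟩
    + 1 ℤ.- (+ 1 ℤ.+ + x ℤ.* + 5)                 ≡⟨ ≡.cong (λ i → + 1 ℤ.- i) (≡.trans (≡.cong (λ i → + 1 ℤ.+ i) (≡.sym (ℤP.pos-* x 5))) (≡.trans (≡.cong +_ e) (ℤP.pos-* y p))) ⟩
    + 1 ℤ.- + y ℤ.* + p                           ≡⟨ ≡.cong (λ i → + 1 ℤ.+ i) (ℤP.neg-distribˡ-* (+ y) (+ p)) ⟩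
    + 1 ℤ.+ (ℤ.- + y) ℤ.* + p ∎)
    where
    open ≡.≡-Reasoning
    open RingKit ℤP.+-*-commutativeRing using (con; _:+_; _:*_; _:-_; :-_; _:=_) renaming (solve to ℤ-solve)

-- With n = 5^{N+1} m + B, 24 n + r = 5^N (25 · 5^N r + 24 + 120 m).
module Arithmetic {p : ℕ} (pp : Prime p) (p≢5 : ¬ (p ≡ 5)) (r N : ℕ) where
  private
    P = 5 ^ N
    g = proj₁ (geometric N)

  -- Chosen so that r + 24 · `offset` = r (1 + 24g) + 24 · 5^N = 5^N (25 · 5^N r + 24), with a
  -- bracket prime to 5.
  offset : ℕ
  offset = r * g + P

  -- The factor p comes from passing to the p-th power of η^r; the bracket is grouped so that its
  -- residue 4 modulo 5 is visible.
  cofactor : ℕ → ℕ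
  cofactor m = p * (5 * (5 * P * r + 24 * m + 4) + 4)

  5∤cofactor : ∀ m → ¬ (5 ∣ cofactor m)
  5∤cofactor m 5∣ with Primality.euclidsLemma p _ prime[5] 5∣
  5∤cofactor m 5∣ | inj₁ 5∣p with Primality.prime⇒irreducible pp 5∣p
  ...   | inj₂ 5≡p = p≢5 (≡.sym 5≡p)
  5∤cofactor m 5∣ | inj₂ 5∣′ = from-no (5 ∣? 4) (∣.∣m+n∣m⇒∣n 5∣′ (∣.m∣m*n (5 * P * r + 24 * m + 4)))

  index : ∀ m → (r + (5 ^ suc N * m + offset) * 24) * p ≡ cofactor m * 5 ^ N
  index m = ≡.trans
    (ℕ-solve 5 (λ r P m g p → (r ∔ (ν 5 ∙ P ∙ m ∔ (r ∙ g ∔ P)) ∙ ν 24) ∙ p ≐ (r ∙ (ν 1 ∔ ν 24 ∙ g) ∔ ν 120 ∙ P ∙ m ∔ ν 24 ∙ P) ∙ p) ≡.refl r P m g p)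
    (≡.trans (≡.cong (λ i → (r * i + 120 * P * m + 24 * P) * p) (proj₂ (geometric N)))
      (ℕ-solve 4 (λ r P m p → (r ∙ (ν 25 ∙ (P ∙ P)) ∔ ν 120 ∙ P ∙ m ∔ ν 24 ∙ P) ∙ p ≐ p ∙ (ν 5 ∙ (ν 5 ∙ P ∙ r ∔ ν 24 ∙ m ∔ ν 4) ∔ ν 4) ∙ P) ≡.refl r P m p))

module Progression (K : CommutativeRing 0ℓ 0ℓ) where
  private module 𝔽 = RingKit K

  module At (p : ℕ) (pp : Prime p) (p≈0 : 𝔽.int (+ p) 𝔽.≈ 𝔽.0#) (t r : ℕ) (p^t≡ : p ^ t ≡ suc r) where
    open PowerSeries K using (seriesRing; q; q↑⊗-+; _≋_)
    open SeriesMaps K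
    open EulerProduct K
    open RingKit seriesRing
    open LaurentEta K

    η↑ : (η ↑ r) ≋ q ↑ r ⊗ dil 24 (E ↑ r)
    η↑ = trans (↑-distrib-⊗ q (dil 24 E) r) (⊗-congˡ {q ↑ r} (sym (Hom.⟪⟫-↑ (dilHom 24) E r)))

    D≈η : ∀ n → D (p ^ t) n 𝔽.≈ (η ↑ r) (r + n * 24)
    D≈η n = 𝔽.trans (Frobenius.D≋E↑ K p pp p≈0 t r p^t≡ n) (𝔽.sym (𝔽.trans (η↑ (r + n * 24))
      (𝔽.trans (q↑⊗-+ r (dil 24 (E ↑ r)) (n * 24)) (dil-multiple 23 (E ↑ r) n))))

    -- By Frobenius η^(pr) is η^r with q replaced by q^p, so the same coefficient reappears at p
    -- times the exponent.
    D≈η^p : ∀ n → D (p ^ t) n 𝔽.≈ (η ↑ (p * r)) ((r + n * 24) * p)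
    D≈η^p n = 𝔽.trans (D≈η n) (𝔽.sym (𝔽.trans (η↑-p ((r + n * 24) * p)) (dil-p (r + n * 24))))
      where
      η↑-p : η ↑ (p * r) ≋ dil p (η ↑ r)
      η↑-p = trans (sym (↑-assocʳ η p r)) (trans (↑-congˡ r (η-frobenius pp p≈0)) (sym (Hom.⟪⟫-↑ (dilHom p) η r)))
      p≡ : suc (ℕ.pred p) ≡ p
      p≡ = ℕP.suc-pred p {{Primality.prime⇒nonZero pp}}
      dil-p : ∀ k → dil p (η ↑ r) (k * p) 𝔽.≈ (η ↑ r) k
      dil-p k = ≡.subst (λ m → dil m (η ↑ r) (k * m) 𝔽.≈ (η ↑ r) k) p≡ (dil-multiple (ℕ.pred p) (η ↑ r) k)

    vanishing-5 : p ≡ 5 → ∀ w → r ≡ 4 + 5 * w → ∀ n k → r + n * 24 ≡ k * 5 → D (p ^ t) n 𝔽.≈ 𝔽.0#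
    vanishing-5 p≡5 w r≡ n k e = 𝔽.trans (D≈η n) (at-multiple r r≡ (r + n * 24) e)
      where
      at-multiple : ∀ r → r ≡ 4 + 5 * w → ∀ i → i ≡ k * 5 → (η ↑ r) i 𝔽.≈ 𝔽.0#
      at-multiple _ ≡.refl _ ≡.refl = section-η (≡.subst (λ c → 𝔽.int (+ c) 𝔽.≈ 𝔽.0#) p≡5 p≈0) w k

    vanishing-≢5 : ¬ (p ≡ 5) → ∀ ρ → p * r ≡ 2 * ρ →
      ∃ λ N → ∀ n j → (r + n * 24) * p ≡ j * 5 ^ N → ¬ (5 ∣ j) → D (p ^ t) n 𝔽.≈ 𝔽.0#
    vanishing-≢5 p≢5 ρ pr≡2ρ = N , λ n j e 5∤j → 𝔽.trans (D≈η^p n) (at-multiple (p * r) pr≡2ρ ((r + n * 24) * p) j e 5∤j)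
      where
      unit = inverse-5 pp p≢5
      supported : ∃ λ N → ∀ n → ¬ (5 ∣ n) → (η ↑ (2 * ρ)) (n * 5 ^ N) 𝔽.≈ 𝔽.0#
      supported = η-supported p pp p≈0 (proj₁ unit) (proj₁ (proj₂ unit)) (proj₂ (proj₂ unit)) ρ
      N = proj₁ supported
      at-multiple : ∀ e → e ≡ 2 * ρ → ∀ i j → i ≡ j * 5 ^ N → ¬ (5 ∣ j) → (η ↑ e) i 𝔽.≈ 𝔽.0#
      at-multiple _ ≡.refl _ j ≡.refl 5∤j = proj₂ supported j 5∤j

-- From vanishing in ℤ/p to divisibility, and the family of progressions.

private
  int-ℤ : ∀ n → RingKit.int ℤP.+-*-commutativeRing (+ n) ≡ + n
  int-ℤ zero = ≡.refl
  int-ℤ (suc zero) = ≡.refl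
  int-ℤ (suc (suc n)) = ≡.trans (RingKit.int-homo-+ ℤP.+-*-commutativeRing (+ 1) (+ suc n)) (≡.cong (λ i → + 1 ℤ.+ i) (int-ℤ (suc n)))

module Mod (p : ℕ) where
  open Quotient.By ℤP.+-*-commutativeRing (+ p) using (quotient; projection; n≈0) public
  module 𝔽 = RingKit quotient
  private module ℤ𝕂 = RingKit ℤP.+-*-commutativeRing

  int-id : ∀ n → 𝔽.int (+ n) 𝔽.≈ + n
  int-id n = 𝔽.trans {𝔽.int (+ n)} {ℤ𝕂.int (+ n)} {+ n} (𝔽.sym {ℤ𝕂.int (+ n)} {𝔽.int (+ n)} (Hom.⟪⟫-int projection (+ n))) (𝔽.reflexive (int-ℤ n))

  p≈0 : 𝔽.int (+ p) 𝔽.≈ 𝔽.0#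
  p≈0 = 𝔽.trans {𝔽.int (+ p)} {+ p} {𝔽.0#} (int-id p) n≈0

  ≈0⇒∣ : ∀ n → 𝔽.int (+ n) 𝔽.≈ 𝔽.0# → p ∣ n
  ≈0⇒∣ n e with 𝔽.trans {+ n} {𝔽.int (+ n)} {𝔽.0#} (𝔽.sym {𝔽.int (+ n)} {+ n} (int-id n)) e
  ... | k , eq = divides ℤ.∣ k ∣ (≡.trans (≡.cong ℤ.∣_∣ (≡.trans eq (ℤP.+-identityˡ (k ℤ.* + p)))) (ℤP.abs-* k (+ p)))

private
  even-or-odd : ∀ n → ∃ λ k → (n ≡ 2 * k) ⊎ (n ≡ 1 + 2 * k)
  even-or-odd zero = 0 , inj₁ ≡.refl
  even-or-odd (suc n) with even-or-odd n
  ... | k , inj₁ e = k , inj₂ (≡.cong suc e)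
  ... | k , inj₂ e = suc k , inj₁ (≡.trans (≡.cong suc e) (≡.sym (ℕP.*-suc 2 k)))

  odd-power : ∀ {p k} → p ≡ 1 + 2 * k → ∀ t → ∃ λ l → p ^ t ≡ 1 + 2 * l
  odd-power e zero = 0 , ≡.refl
  odd-power {p} {k} e (suc t) with odd-power {p} {k} e t
  ... | l , e′ = k + l + 2 * (k * l) , ≡.trans (≡.cong₂ _*_ e e′)
    (ℕ-solve 2 (λ k l → (ν 1 ∔ ν 2 ∙ k) ∙ (ν 1 ∔ ν 2 ∙ l) ≐ ν 1 ∔ ν 2 ∙ (k ∔ l ∔ ν 2 ∙ (k ∙ l))) ≡.refl k l)

  -- For odd p already r = p^t - 1 is even; for p = 2 the factor p supplies the evenness.
  even-p*r : ∀ p t r → p ^ t ≡ suc r → ∃ λ ρ → p * r ≡ 2 * ρ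
  even-p*r p t r e with even-or-odd p
  ... | k , inj₁ p≡ = k * r , ≡.trans (≡.cong (_* r) p≡) (ℕP.*-assoc 2 k r)
  ... | k , inj₂ p≡ with odd-power {p} {k} p≡ t
  ...   | l , e′ = p * l , ≡.trans (≡.cong (p *_) (ℕP.suc-injective (≡.trans (≡.sym e) e′)))
    (ℕ-solve 2 (λ p l → p ∙ (ν 2 ∙ l) ≐ ν 2 ∙ (p ∙ l)) ≡.refl p l)

  -- Uniqueness of the power of 2 in an integer, decided by parity one factor at a time.
  2^-odd-part : ∀ i j n → 2 ^ i ≡ 2 ^ j * (1 + 2 * n) → i ≡ j
  2^-odd-part zero zero n _ = ≡.refl
  2^-odd-part zero (suc j) n e = contradiction (∣.∣1⇒≡1 {2} (≡.subst (2 ∣_) (≡.sym e) (∣.∣-trans (∣.m∣m*n (2 ^ j)) (∣.m∣m*n (1 + 2 * n))))) λ ()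
  2^-odd-part (suc i) zero n e = contradiction (∣.∣1⇒≡1 {2} (∣.∣m+n∣m⇒∣n (≡.subst (2 ∣_) (≡.trans e (≡.trans (ℕP.*-identityˡ (1 + 2 * n)) (ℕP.+-comm 1 (2 * n)))) (∣.m∣m*n (2 ^ i))) (∣.m∣m*n n))) λ ()
  2^-odd-part (suc i) (suc j) n e = ≡.cong suc (2^-odd-part i j n (ℕP.*-cancelˡ-≡ (2 ^ i) (2 ^ j * (1 + 2 * n)) 2 (≡.trans e (ℕP.*-assoc 2 (2 ^ j) (1 + 2 * n)))))

single-progression : ∀ p t → Prime p → t ≥ 1 → ∃ λ A → ∃ λ B → (1 ≤ A) × (∀ n → p ∣ d (p ^ t) (A * n + B))
single-progression p (suc t) pp _ with p ℕ.≟ 5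
-- Here r = 5^(t+1) - 1 = 4 + 5w, and r + 24(5n + 4) = 5(20 + w + 24n): the residue 4 is what makes
-- the exponent of η a multiple of 5.
... | yes ≡.refl = 5 , 4 , s≤s z≤n , λ n → ≈0⇒∣ _ (vanishing-5 ≡.refl w ≡.refl (5 * n + 4) (20 + w + 24 * n)
    (ℕ-solve 2 (λ w n → (ν 4 ∔ ν 5 ∙ w) ∔ (ν 5 ∙ n ∔ ν 4) ∙ ν 24 ≐ (ν 20 ∔ w ∔ ν 24 ∙ n) ∙ ν 5) ≡.refl w n))
  where
  open Mod 5
  w = ℕ.pred (5 ^ t)
  5^t≡ : 5 ^ t ≡ suc w
  5^t≡ = ≡.sym (ℕP.suc-pred (5 ^ t) {{ℕP.m^n≢0 5 t}})
  open Progression.At quotient 5 pp p≈0 (suc t) (4 + 5 * w) (≡.trans (≡.cong (λ i → 5 * i) 5^t≡) (ℕP.*-suc 5 w))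
... | no p≢5 = 5 ^ suc N , offset , ℕP.m^n>0 5 (suc N) , λ n → ≈0⇒∣ _ (proj₂ found (5 ^ suc N * n + offset) (cofactor n) (index n) (5∤cofactor n))
  where
  open Mod p
  r = ℕ.pred (p ^ suc t)
  r≡ : p ^ suc t ≡ suc r
  r≡ = ≡.sym (ℕP.suc-pred (p ^ suc t) {{ℕP.m^n≢0 p (suc t) {{Primality.prime⇒nonZero pp}}}})
  even = even-p*r p (suc t) r r≡
  found = Progression.At.vanishing-≢5 quotient p pp p≈0 (suc t) r r≡ p≢5 (proj₁ even) (proj₂ even)
  N = proj₁ found
  open Arithmetic pp p≢5 r N

theorem1p3 : ∀ (p t : ℕ) → Prime p → t ≥ 1 →
    Σ (ℕ → ℕ × ℕ) λ F →
    (∀ i → 1 ≤ proj₁ (F i))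
    × (∀ i j → ¬ (i ≡ j) → ¬ (F i ⊆AP F j))
    × (∀ i n → p ∣ d (p ^ t) (proj₁ (F i) * n + proj₂ (F i)))
theorem1p3 p t pp t≥1 with single-progression p t pp t≥1
... | A , B , A≥1 , p∣ = F , (λ i → ℕP.*-mono-≤ A≥1 (ℕP.m^n>0 2 (suc i))) , non-nested , λ i n → ≡.subst (λ k → p ∣ d (p ^ t) k) (≡.sym (inside i n)) (p∣ _)
  where
  F : ℕ → ℕ × ℕ
  F i = A * 2 ^ suc i , A * 2 ^ i + B

  inside : ∀ i n → A * 2 ^ suc i * n + (A * 2 ^ i + B) ≡ A * (2 ^ suc i * n + 2 ^ i) + B
  inside i n = ℕ-solve 4 (λ A P n B → A ∙ (ν 2 ∙ P) ∙ n ∔ (A ∙ P ∔ B) ≐ A ∙ (ν 2 ∙ P ∙ n ∔ P) ∔ B) ≡.refl A (2 ^ i) n B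

  -- The first term of F i lies in F j only if 2^i = 2^j (2n + 1).
  non-nested : ∀ i j → ¬ (i ≡ j) → ¬ (F i ⊆AP F j)
  non-nested i j i≢j Fi⊆Fj with Fi⊆Fj 0
  ... | n , e = i≢j (2^-odd-part i j n (ℕP.*-cancelˡ-≡ (2 ^ i) (2 ^ j * (1 + 2 * n)) A {{ℕ.>-nonZero A≥1}} (ℕP.+-cancelʳ-≡ B _ _ (begin
    A * 2 ^ i + B                                  ≡⟨ ≡.cong (_+ (A * 2 ^ i + B)) (ℕP.*-zeroʳ (A * 2 ^ suc i)) ⟨
    A * 2 ^ suc i * 0 + (A * 2 ^ i + B)            ≡⟨ e ⟩
    A * 2 ^ suc j * n + (A * 2 ^ j + B)            ≡⟨ ℕ-solve 4 (λ A P n B → A ∙ (ν 2 ∙ P) ∙ n ∔ (A ∙ P ∔ B) ≐ A ∙ (P ∙ (ν 1 ∔ ν 2 ∙ n)) ∔ B) ≡.refl A (2 ^ j) n B ⟩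
    A * (2 ^ j * (1 + 2 * n)) + B ∎))))
    where open ≡.≡-Reasoning
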